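{- There exists a fixed string automatic structure of bounded degree and linear growth (i.e., normalized growth function in $O(n)$) whose $\Sigma_1$-theory is $\mathsf{PSPACE}$-complete.
   Context: A structure (finite relational signature) is string automatic if it is isomorphic to $(L,(R_r)_r)/{\equiv}$ where $L\subseteq\Gamma^*$ is regular and the relations $R_r\subseteq L^{m_r}$ and the congruence $\equiv$ are recognized by synchronous multi-tape finite automata (reading the padded convolution of strings letter by letter). The Gaifman graph has an edge between $a,b$ iff they occur together in a tuple of some relation; $S(n,a)$ is the set of elements at distance $\le n$ from $a$. Bounded degree: some constant bounds the number of neighbours of every node; growth function $g(n)=\max_a|S(n,a)|$, normalized $g'(n)=\max\{n,g(n)\}$. $\Sigma_n$ and $\Pi_n$ formulas: quantifier-free formulas are $\Sigma_0$ and $\Pi_0$; if $\varphi$ is $\Sigma_n$ then $\forall x_1\cdots\forall x_k\,\varphi$ is $\Pi_{n+1}$; if $\varphi$ is $\Pi_n$ then $\exists x_1\cdots\exists x_k\,\varphi$ is $\Sigma_{n+1}$. The $\Sigma_n$-theory of $\mathcal{A}$ is the set of closed $\Sigma_n$-formulas true in $\mathcal{A}$. -}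

module Defs where

open import Data.Nat using (ℕ; zero; suc; _+_; _*_; _^_; _≤_; _⊔_)
open import Data.Fin using (Fin; toℕ) renaming (zero to fz; suc to fs)
open import Data.Bool using (Bool; true; false; if_then_else_)
open import Data.Maybe using (Maybe; just; nothing)
open import Data.List using (List; []; _∷_; length; _++_)
open import Data.Vec as V using (Vec; lookup)
open import Data.Product using (Σ; ∃; _×_; _,_; proj₁)
open import Data.Sum using (_⊎_)
open import Data.List.Relation.Unary.All using (All)
open import Data.List.Relation.Unary.AllPairs using (AllPairs)
open import Relation.Nullary using (¬_)
open import Relation.Binary.PropositionalEquality using (_≡_)
open import Relation.Binary.Structures using (IsEquivalence)
open import Function.Bundles using (_⇔_)

record DFA (A : Set) : Set where
  field
    nQ    : ℕ
    start : Fin nQ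
    δ     : Fin nQ → A → Fin nQ
    final : Fin nQ → Bool

runDFA : ∀ {A} (M : DFA A) → Fin (DFA.nQ M) → List A → Fin (DFA.nQ M)
runDFA M q []       = q
runDFA M q (a ∷ as) = runDFA M (DFA.δ M q a) as

Accepts : ∀ {A} → DFA A → List A → Set
Accepts M w = DFA.final M (runDFA M (DFA.start M) w) ≡ true

head? : ∀ {A : Set} → List A → Maybe A
head? []      = nothing
head? (x ∷ _) = just x

tail' : ∀ {A : Set} → List A → List A
tail' []       = []
tail' (_ ∷ xs) = xs

maxLen : ∀ {A : Set} {m} → Vec (List A) m → ℕ
maxLen = V.foldr′ (λ w n → length w ⊔ n) 0

convN : ∀ {A : Set} {m} → ℕ → Vec (List A) m → List (Vec (Maybe A) m)
convN zero    ws = []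
convN (suc n) ws = V.map head? ws ∷ convN n (V.map tail' ws)

-- padded convolution of m strings (padding symbol = nothing)
conv : ∀ {A : Set} {m} → Vec (List A) m → List (Vec (Maybe A) m)
conv ws = convN (maxLen ws) ws

record Signature : Set where
  field
    nrel  : ℕ
    arity : Fin nrel → ℕ
open Signature public

record Structure (σ : Signature) : Set₁ where
  field
    Carrier : Set
    _≈_     : Carrier → Carrier → Set
    Rel     : (r : Fin (nrel σ)) → Vec Carrier (arity σ r) → Set

module _ {σ : Signature} (𝒜 : Structure σ) where
  open Structure 𝒜

  Occurs : ∀ {m} → Carrier → Vec Carrier m → Set
  Occurs a v = ∃ λ i → lookup v i ≈ a

  Adj : Carrier → Carrier → Set
  Adj a b = ¬ (a ≈ b) × Σ (Fin (nrel σ)) λ r →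
            Σ (Vec Carrier (arity σ r)) λ v → Rel r v × Occurs a v × Occurs b v

  Within : ℕ → Carrier → Carrier → Set
  Within zero    a b = a ≈ b
  Within (suc n) a b = a ≈ b ⊎ ∃ λ c → Adj a c × Within n c b

  AtMost : (Carrier → Set) → ℕ → Set
  AtMost P d = (xs : List Carrier) → AllPairs (λ x y → ¬ (x ≈ y)) xs → All P xs → length xs ≤ d

  BoundedDegree : Set
  BoundedDegree = ∃ λ d → ∀ a → AtMost (Adj a) d

  GrowthAtMost : ℕ → ℕ → Set
  GrowthAtMost n b = ∀ a → AtMost (Within n a) b

  -- g'(n) = max(n, g(n)) ∈ O(n)
  LinearGrowth : Set
  LinearGrowth = ∃ λ c → ∃ λ n₀ → ∀ n → n₀ ≤ n → n ≤ c * n × GrowthAtMost n (c * n)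

data QF (σ : Signature) (k : ℕ) : Set where
  eq  : Fin k → Fin k → QF σ k
  rel : (r : Fin (nrel σ)) → Vec (Fin k) (arity σ r) → QF σ k
  neg : QF σ k → QF σ k
  and : QF σ k → QF σ k → QF σ k
  or  : QF σ k → QF σ k → QF σ k

Σ₁Sentence : Signature → Set
Σ₁Sentence σ = Σ ℕ (QF σ)

module _ {σ : Signature} (𝒜 : Structure σ) where
  open Structure 𝒜

  ⟦_⟧ : ∀ {k} → QF σ k → (Fin k → Carrier) → Set
  ⟦ eq i j  ⟧ ρ = ρ i ≈ ρ j
  ⟦ rel r v ⟧ ρ = Rel r (V.map ρ v)
  ⟦ neg φ   ⟧ ρ = ¬ ⟦ φ ⟧ ρ
  ⟦ and φ ψ ⟧ ρ = ⟦ φ ⟧ ρ × ⟦ ψ ⟧ ρ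
  ⟦ or φ ψ  ⟧ ρ = ⟦ φ ⟧ ρ ⊎ ⟦ ψ ⟧ ρ

  Holds : Σ₁Sentence σ → Set
  Holds (k , φ) = ∃ λ (ρ : Fin k → Carrier) → ⟦ φ ⟧ ρ

unary : ℕ → List Bool
unary zero    = false ∷ []
unary (suc n) = true ∷ unary n

encVars : ∀ {k m} → Vec (Fin k) m → List Bool
encVars V.[]       = []
encVars (i V.∷ is) = unary (toℕ i) ++ encVars is

encQF : ∀ {σ k} → QF σ k → List Bool
encQF (eq i j)  = false ∷ false ∷ false ∷ (unary (toℕ i) ++ unary (toℕ j))
encQF (rel r v) = false ∷ false ∷ true ∷ (unary (toℕ r) ++ encVars v)
encQF (neg φ)   = false ∷ true ∷ false ∷ encQF φ
encQF (and φ ψ) = false ∷ true ∷ true ∷ (encQF φ ++ encQF ψ)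
encQF (or φ ψ)  = true ∷ false ∷ false ∷ (encQF φ ++ encQF ψ)

encSentence : ∀ {σ} → Σ₁Sentence σ → List Bool
encSentence (k , φ) = unary k ++ encQF φ

Language : Set₁
Language = List Bool → Set

Σ₁Theory : ∀ {σ} → Structure σ → Language
Σ₁Theory {σ} 𝒜 w = Σ (Σ₁Sentence σ) λ s → encSentence s ≡ w × Holds 𝒜 s

-- Deterministic single-tape Turing machines (two-way infinite tape).
-- Tape alphabet Fin (3 + nΓ): fz = blank, fs fz = bit 0, fs (fs fz) = bit 1.

data Move : Set where
  left right stay : Move

record TM : Set where
  field
    nQ        : ℕ
    nΓ        : ℕ
    start     : Fin nQ
    halting   : Fin nQ → Bool
    accepting : Fin nQ → Bool
    δ         : Fin nQ → Fin (3 + nΓ) → Fin nQ × Fin (3 + nΓ) × Move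

module _ (M : TM) where
  open TM M

  Sym : Set
  Sym = Fin (3 + nΓ)

  blank : Sym
  blank = fz

  bitSym : Bool → Sym
  bitSym false = fs fz
  bitSym true  = fs (fs fz)

  record Config : Set where
    constructor cfg
    field
      state : Fin nQ
      lft   : List Sym   -- cells left of the head, nearest first
      hd    : Sym
      rgt   : List Sym   -- cells right of the head, nearest first

  initCfg : List Bool → Config
  initCfg []      = cfg start [] blank []
  initCfg (b ∷ w) = cfg start [] (bitSym b) (Data.List.map bitSym w)

  moveHead : Fin nQ → Sym → Move → List Sym → List Sym → Config
  moveHead q s left  []       r = cfg q [] blank (s ∷ r)
  moveHead q s left  (x ∷ l)  r = cfg q l x (s ∷ r)
  moveHead q s right l []       = cfg q (s ∷ l) blank []
  moveHead q s right l (x ∷ r)  = cfg q (s ∷ l) x r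
  moveHead q s stay  l r        = cfg q l s r

  step : Config → Config
  step (cfg q l h r) with δ q h
  ... | (q' , s , mv) = if halting q then cfg q l h r else moveHead q' s mv l r

  run : List Bool → ℕ → Config
  run w zero    = initCfg w
  run w (suc t) = step (run w t)

  halted : Config → Set
  halted c = halting (Config.state c) ≡ true

  accepted : Config → Set
  accepted c = accepting (Config.state c) ≡ true

  space : Config → ℕ
  space c = length (Config.lft c) + suc (length (Config.rgt c))

  bitsPrefix : List Sym → List Bool
  bitsPrefix []                   = []
  bitsPrefix (fz ∷ _)             = []
  bitsPrefix (fs fz ∷ ss)         = false ∷ bitsPrefix ss
  bitsPrefix (fs (fs fz) ∷ ss)    = true ∷ bitsPrefix ss
  bitsPrefix (fs (fs (fs _)) ∷ _) = []

  output : Config → List Bool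
  output c = bitsPrefix (Config.hd c ∷ Config.rgt c)

polyBound : ℕ → ℕ → ℕ
polyBound c n = c * suc n ^ c

InPSPACE : Language → Set
InPSPACE L = Σ TM λ M → ∃ λ c → ∀ w → ∃ λ t →
    halted M (run M w t)
  × (∀ t' → t' ≤ t → space M (run M w t') ≤ polyBound c (length w))
  × (accepted M (run M w t) ⇔ L w)

PolyTimeComputable : (List Bool → List Bool) → Set
PolyTimeComputable f = Σ TM λ M → ∃ λ c → ∀ w → ∃ λ t →
    t ≤ polyBound c (length w)
  × halted M (run M w t)
  × output M (run M w t) ≡ f w

PSPACEHard : Language → Set₁
PSPACEHard T = (L : Language) → InPSPACE L →
  ∃ λ (f : List Bool → List Bool) → PolyTimeComputable f × (∀ w → L w ⇔ T (f w))

PSPACEComplete : Language → Set₁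
PSPACEComplete T = InPSPACE T × PSPACEHard T

record AutomaticPresentation (σ : Signature) : Set where
  field
    γ    : ℕ
    dom  : DFA (Fin γ)
    rels : (r : Fin (nrel σ)) → DFA (Vec (Maybe (Fin γ)) (arity σ r))
    eqv  : DFA (Vec (Maybe (Fin γ)) 2)

module _ {σ : Signature} (P : AutomaticPresentation σ) where
  open AutomaticPresentation P

  Elem : Set
  Elem = Σ (List (Fin γ)) (Accepts dom)

  EqP : Elem → Elem → Set
  EqP x y = Accepts eqv (conv (proj₁ x V.∷ proj₁ y V.∷ V.[]))

  RelP : (r : Fin (nrel σ)) → Vec Elem (arity σ r) → Set
  RelP r v = Accepts (rels r) (conv (V.map proj₁ v))

  IsValidPresentation : Set
  IsValidPresentation = IsEquivalence EqP
    × (∀ r (u v : Vec Elem (arity σ r)) → (∀ i → EqP (lookup u i) (lookup v i)) → RelP r u → RelP r v)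

  presented : Structure σ
  presented = record { Carrier = Elem ; _≈_ = EqP ; Rel = RelP }

{-# OPTIONS --safe #-}
-- Elements are strings with two tracks, and every relation is contained in the graph of the rotation of the second
-- track by one place.  The Gaifman graph is then a union of paths and cycles, which gives bounded degree and linear
-- growth.  After p rotations one scan of the string compares each letter with the letter p places further on.
--
-- Hardness: the body of the string is the history of a space-bounded Turing machine, written as rows of equal length N.
-- A Σ₁-sentence about a walk x₀, x₁, … reads the first row letter by letter, compares successive rows at x_N, and makes the
-- schedule of rewriting rules periodic at x_P.  So a fixed structure and a sentence of polynomial length suffice.
--
-- Membership: witnesses for a Σ₁-sentence are guessed letter by letter while the automata of all atoms run in parallel.
-- This is reachability in a graph of exponential size, decided in polynomial space by Savitch's recursion, which is
-- unfolded into a depth-first evaluation of an alternating pattern of digits.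
--
-- All machines are stack programs with while loops, compiled into single-tape Turing machines.
module Submission where

-- The structure must not depend on the machine, yet every polynomial-space machine has its own
-- states, alphabet and transitions. So cells are spelled in bits, and the key of each letter
-- carries the bits that the rule under trial expects and writes at this place: the fixed automata
-- compare bits only, and the machine enters through the sentence. A letter has room for one rule,
-- so a row tries one rule, the rules take turns, and a step of the machine may cost a whole round.
-- A history may have exponentially many rows; the sentence spells out one round, and equality of
-- keys at distance P carries the schedule on. Bounded degree leaves nothing to guess beyond x₀:
-- each later element of the walk is determined by it. Hence the whole history, its schedule and the
-- roles of its cells lie in x₀. On the membership side the search takes exponential time, so
-- running time cannot bound its space. Each round of the search loop, however, starts from a store
-- of polynomial height and takes polynomial time, and the space bound is renewed round by round.

-- Finite types as retracts of standard finite sets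

module FiniteTypes where

  open import Data.Nat using (ℕ; zero; suc; _+_; _*_)
  open import Data.Fin using (Fin; splitAt; join; combine; remQuot) renaming (zero to fz; suc to fs)
  open import Data.Fin.Properties using (splitAt-join; remQuot-combine)
  open import Data.Bool using (Bool; true; false)
  open import Data.Maybe as Maybe using (Maybe; just; nothing)
  open import Data.Unit using (⊤; tt)
  open import Data.Product using (_×_; _,_)
  import Data.Product as Product
  open import Data.Sum as Sum using (_⊎_; inj₁; inj₂)
  open import Data.Vec using (Vec; []; _∷_)
  open import Relation.Binary.PropositionalEquality
  open import Function using (_∘_)

  -- A retract of a standard finite set suffices throughout: codes outside the image of enc are harmless.
  record Finite (A : Set) : Set where
    field
      size    : ℕ
      enc     : A → Fin size
      dec     : Fin size → A
      dec-enc : ∀ a → dec (enc a) ≡ a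

  open Finite public

  enc-injective : ∀ {A} (F : Finite A) {a b} → enc F a ≡ enc F b → a ≡ b
  enc-injective F {a} {b} e = trans (sym (dec-enc F a)) (trans (cong (dec F) e) (dec-enc F b))

  finFin : ∀ n → Finite (Fin n)
  finFin n = record { size = n ; enc = λ i → i ; dec = λ i → i ; dec-enc = λ _ → refl }

  abstract

    retract : ∀ {A B : Set} → Finite B → (f : A → B) (g : B → A) → (∀ a → g (f a) ≡ a) → Finite A
    retract F f g gf = record
      { size    = size F
      ; enc     = enc F ∘ f
      ; dec     = g ∘ dec F
      ; dec-enc = λ a → trans (cong g (dec-enc F (f a))) (gf a)
      }

    fin⊤ : Finite ⊤
    fin⊤ = retract (finFin 1) (λ _ → fz) (λ _ → tt) (λ _ → refl)

    fin⊎ : ∀ {A B} → Finite A → Finite B → Finite (A ⊎ B)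
    fin⊎ F G = record
      { size    = size F + size G
      ; enc     = λ x → join (size F) (size G) (Sum.map (enc F) (enc G) x)
      ; dec     = λ i → Sum.map (dec F) (dec G) (splitAt (size F) i)
      ; dec-enc = λ x → trans (cong (Sum.map (dec F) (dec G)) (splitAt-join (size F) (size G) (Sum.map (enc F) (enc G) x))) (back x)
      }
      where
      back : ∀ x → Sum.map (dec F) (dec G) (Sum.map (enc F) (enc G) x) ≡ x
      back (inj₁ a) = cong inj₁ (dec-enc F a)
      back (inj₂ b) = cong inj₂ (dec-enc G b)

    fin× : ∀ {A B} → Finite A → Finite B → Finite (A × B)
    fin× F G = record
      { size    = size F * size G
      ; enc     = λ (a , b) → combine (enc F a) (enc G b)
      ; dec     = λ i → Product.map (dec F) (dec G) (remQuot {size F} (size G) i)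
      ; dec-enc = λ (a , b) → trans (cong (Product.map (dec F) (dec G)) (remQuot-combine (enc F a) (enc G b)))
                                    (cong₂ _,_ (dec-enc F a) (dec-enc G b))
      }

    finMaybe : ∀ {A} → Finite A → Finite (Maybe A)
    finMaybe F = retract (fin⊎ fin⊤ F) (Maybe.maybe inj₂ (inj₁ tt)) Sum.[ (λ _ → nothing) , just ]
      λ { nothing → refl ; (just _) → refl }

    finBool : Finite Bool
    finBool = retract (finFin 2) (λ { false → fz ; true → fs fz }) (λ { fz → false ; (fs _) → true })
      λ { false → refl ; true → refl }

    finVec : ∀ {A} → Finite A → ∀ n → Finite (Vec A n)
    finVec F zero    = retract fin⊤ (λ _ → tt) (λ _ → []) λ { [] → refl }
    finVec F (suc n) = retract (fin× F (finVec F n)) (λ { (x ∷ xs) → x , xs }) (λ (x , xs) → x ∷ xs) λ { (_ ∷ _) → refl }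

-- Stack programs, their running time and polynomial bounds

module StackPrograms where

  open import Defs using (head?; tail'; polyBound)
  open FiniteTypes
  open import Data.Nat using (ℕ; suc; _+_; _*_; _^_; _≤_; z≤n; s≤s)
  open import Data.Nat.Properties
  open import Data.Fin using (Fin)
  open import Data.Fin.Properties using () renaming (_≟_ to _≟F_)
  open import Data.Bool using (Bool; true; false; if_then_else_)
  open import Data.Maybe using (Maybe; just; nothing; is-just)
  open import Data.List using (List; []; _∷_; length; foldl; _ʳ++_)
  open import Data.Vec as V using (Vec; lookup; updateAt)
  open import Data.Vec.Properties using (lookup∘updateAt; lookup∘updateAt′; lookup∘update; lookup∘update′; lookup-map; []≔-lookup; []≔-idempotent; []≔-commutes; updateAt-cong-local; updateAt-id; updateAt-updateAt)
  open import Data.Product using (∃; _×_; _,_)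
  open import Data.Unit using (⊤; tt)
  open import Data.Empty using (⊥)
  open import Function using (_∘_)
  open import Relation.Nullary using (yes; no)
  open import Relation.Binary.PropositionalEquality

  Poly : (ℕ → ℕ) → Set
  Poly f = ∃ λ c → ∀ n → f n ≤ polyBound c n

  poly-const : ∀ k → Poly (λ _ → k)
  poly-const k = k , λ n → ≤-trans (≤-reflexive (sym (*-identityʳ k))) (*-monoʳ-≤ k (m^n>0 (suc n) k))

  poly-id : Poly (λ n → n)
  poly-id = 1 , λ n → ≤-trans (n≤1+n n) (≤-reflexive (sym (trans (+-identityʳ _) (*-identityʳ (suc n)))))

  poly-+ : ∀ {f g} → Poly f → Poly g → Poly (λ n → f n + g n)
  poly-+ (c , p) (d , q) = c + d , λ n → ≤-trans (+-mono-≤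
      (≤-trans (p n) (*-monoʳ-≤ c (^-monoʳ-≤ (suc n) (m≤m+n c d))))
      (≤-trans (q n) (*-monoʳ-≤ d (^-monoʳ-≤ (suc n) (m≤n+m d c)))))
    (≤-reflexive (sym (*-distribʳ-+ (suc n ^ (c + d)) c d)))

  -- `polyBound` uses one number as factor and as exponent. The product needs factor c * d and
  -- exponent c + d, and c + d + c * d dominates both.
  poly-* : ∀ {f g} → Poly f → Poly g → Poly (λ n → f n * g n)
  poly-* {f} {g} (c , p) (d , q) = e , λ n → ≤-trans (*-mono-≤ (p n) (q n)) (≤-trans (≤-reflexive (rearrange n))
      (*-mono-≤ (m≤n+m (c * d) (c + d)) (^-monoʳ-≤ (suc n) (m≤m+n (c + d) (c * d)))))
    where
    e = c + d + c * d
    rearrange : ∀ n → polyBound c n * polyBound d n ≡ c * d * suc n ^ (c + d)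
    rearrange n = trans ([m*n]*[o*p]≡[m*o]*[n*p] c (suc n ^ c) d (suc n ^ d)) (cong (c * d *_) (sym (^-distribˡ-+-* (suc n) c d)))

  module Language (k : ℕ) (S : Set) where

    Tops Store : Set
    Tops  = Vec (Maybe S) (suc k)
    Store = Vec (List S) (suc k)

    data Action : Set where
      none : Action
      push : Fin (suc k) → S → Action
      pop  : Fin (suc k) → Action

    tops : Store → Tops
    tops = V.map head?

    perform : Action → Store → Store
    perform none       σ = σ
    perform (push i s) σ = updateAt σ i (s ∷_)
    perform (pop i)    σ = updateAt σ i tail'

    infixr 5 _⨾_

    data Prog : Set where
      act   : (Tops → Action) → Prog
      _⨾_   : Prog → Prog → Prog
      ifte  : (Tops → Bool) → Prog → Prog → Prog
      while : (Tops → Bool) → Prog → Prog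

    -- `Ok` is demanded of the store after every elementary action, so with `Height≤ s` a derivation
    -- records a space bound along the whole run. Because of `weaken` the last index is an upper
    -- bound on the time.
    data Exec (Ok : Store → Set) : Prog → Store → Store → ℕ → Set where
      act    : ∀ {f σ} → Ok (perform (f (tops σ)) σ) → Exec Ok (act f) σ (perform (f (tops σ)) σ) 1
      _⨾_    : ∀ {p q σ σ′ σ″ t t′} → Exec Ok p σ σ′ t → Exec Ok q σ′ σ″ t′ → Exec Ok (p ⨾ q) σ σ″ (t + t′)
      then′  : ∀ {b p q σ σ′ t} → b (tops σ) ≡ true → Exec Ok p σ σ′ t → Exec Ok (ifte b p q) σ σ′ (suc t)
      else′  : ∀ {b p q σ σ′ t} → b (tops σ) ≡ false → Exec Ok q σ σ′ t → Exec Ok (ifte b p q) σ σ′ (suc t)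
      stop   : ∀ {b p σ} → b (tops σ) ≡ false → Exec Ok (while b p) σ σ 1
      loop   : ∀ {b p σ σ′ σ″ t t′} → b (tops σ) ≡ true → Exec Ok p σ σ′ t → Exec Ok (while b p) σ′ σ″ t′ →
               Exec Ok (while b p) σ σ″ (suc (t + t′))
      weaken : ∀ {p σ σ′ t t′} → t ≤ t′ → Exec Ok p σ σ′ t → Exec Ok p σ σ′ t′

    Exec-ok : ∀ {Ok p σ σ′ t} → Exec Ok p σ σ′ t → Ok σ → Ok σ′
    Exec-ok (act o) _       = o
    Exec-ok (x ⨾ y) o       = Exec-ok y (Exec-ok x o)
    Exec-ok (then′ _ x) o   = Exec-ok x o
    Exec-ok (else′ _ x) o   = Exec-ok x o
    Exec-ok (stop _) o      = o
    Exec-ok (loop _ x y) o  = Exec-ok y (Exec-ok x o)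
    Exec-ok (weaken _ x) o  = Exec-ok x o

    infix 4 _⊢_⇒_within_
    _⊢_⇒_within_ : Prog → Store → Store → ℕ → Set
    p ⊢ σ ⇒ σ′ within (t) = Exec (λ _ → ⊤) p σ σ′ t

    record Height≤ (h : ℕ) (σ : Store) : Set where
      constructor height
      field at : ∀ j → length (lookup σ j) ≤ h

    perform-height : ∀ a {h σ} → Height≤ h σ → Height≤ (suc h) (perform a σ)
    perform-height a {h} {σ} (height hσ) = height (go a)
      where
      tail-length : ∀ (xs : List S) → length (tail' xs) ≤ length xs
      tail-length []       = z≤n
      tail-length (_ ∷ xs) = n≤1+n _
      go : ∀ a j → length (lookup (perform a σ) j) ≤ suc h
      go none j = m≤n⇒m≤1+n (hσ j)
      go (push i s) j with j ≟F i
      ... | yes refl rewrite lookup∘updateAt j {s ∷_} σ = s≤s (hσ j)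
      ... | no j≢i rewrite lookup∘updateAt′ j i {s ∷_} j≢i σ = m≤n⇒m≤1+n (hσ j)
      go (pop i) j with j ≟F i
      ... | yes refl rewrite lookup∘updateAt j {tail'} σ = m≤n⇒m≤1+n (≤-trans (tail-length (lookup σ j)) (hσ j))
      ... | no j≢i rewrite lookup∘updateAt′ j i {tail'} j≢i σ = m≤n⇒m≤1+n (hσ j)

    height-mono : ∀ {a b σ} → a ≤ b → Height≤ a σ → Height≤ b σ
    height-mono a≤b (height hσ) = height λ j → ≤-trans (hσ j) a≤b

    height-grows : ∀ {p σ σ′ t h} → p ⊢ σ ⇒ σ′ within (t) → Height≤ h σ → Height≤ (h + t) σ′
    height-grows {h = h} (act {f} {σ} _) hσ rewrite +-comm h 1 = perform-height (f (tops σ)) hσ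
    height-grows {h = h} (_⨾_ {t = t} {t′} x y) hσ rewrite sym (+-assoc h t t′) = height-grows y (height-grows x hσ)
    height-grows {h = h} (then′ {t = t} _ x) hσ = height-mono (+-monoʳ-≤ h (n≤1+n t)) (height-grows x hσ)
    height-grows {h = h} (else′ {t = t} _ x) hσ = height-mono (+-monoʳ-≤ h (n≤1+n t)) (height-grows x hσ)
    height-grows {h = h} (stop _) hσ = height-mono (m≤m+n h 1) hσ
    height-grows {h = h} (loop {t = t} {t′} _ x y) hσ =
      height-mono (≤-trans (≤-reflexive (+-assoc h t t′)) (+-monoʳ-≤ h (n≤1+n (t + t′)))) (height-grows y (height-grows x hσ))
    height-grows {h = h} (weaken t≤t′ x) hσ = height-mono (+-monoʳ-≤ h t≤t′) (height-grows x hσ)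

    -- A step lengthens a stack by at most one symbol, so time bounds space.
    bounded : ∀ {p σ σ′ t h s} → p ⊢ σ ⇒ σ′ within (t) → Height≤ h σ → h + t ≤ s → Exec (Height≤ s) p σ σ′ t
    bounded {h = h} x@(act _) hσ le = act (height-mono le (height-grows x hσ))
    bounded {h = h} (_⨾_ {t = t} {t′} x y) hσ le =
      bounded x hσ (≤-trans (+-monoʳ-≤ h (m≤m+n t t′)) le)
      ⨾ bounded y (height-grows x hσ) (≤-trans (≤-reflexive (+-assoc h t t′)) le)
    bounded {h = h} (then′ {t = t} e x) hσ le = then′ e (bounded x hσ (≤-trans (+-monoʳ-≤ h (n≤1+n t)) le))
    bounded {h = h} (else′ {t = t} e x) hσ le = else′ e (bounded x hσ (≤-trans (+-monoʳ-≤ h (n≤1+n t)) le))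
    bounded (stop e) hσ le = stop e
    bounded {h = h} (loop {t = t} {t′} e x y) hσ le =
      loop e (bounded x hσ (≤-trans (+-monoʳ-≤ h (m≤n⇒m≤1+n (m≤m+n t t′))) le))
             (bounded y (height-grows x hσ) (≤-trans (≤-reflexive (+-assoc h t t′)) (≤-trans (+-monoʳ-≤ h (n≤1+n (t + t′))) le)))
    bounded {h = h} (weaken t≤t′ x) hσ le = weaken t≤t′ (bounded x hσ (≤-trans (+-monoʳ-≤ h t≤t′) le))

    nonempty : Fin (suc k) → Tops → Bool
    nonempty i v = is-just (lookup v i)

    -- Executions in which no loop is iterated more than B times, so that cost p B bounds the running time.
    cost : Prog → ℕ → ℕ
    cost (act _)      B = 1
    cost (p ⨾ q)      B = cost p B + cost q B
    cost (ifte _ p q) B = suc (cost p B + cost q B)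
    cost (while _ p)  B = suc (B * suc (cost p B))

    cost-poly : ∀ p {f} → Poly f → Poly (λ n → cost p (f n))
    cost-poly (act _)      P = poly-const 1
    cost-poly (p ⨾ q)      P = poly-+ (cost-poly p P) (cost-poly q P)
    cost-poly (ifte _ p q) P = poly-+ (poly-const 1) (poly-+ (cost-poly p P) (cost-poly q P))
    cost-poly (while _ p)  P = poly-+ (poly-const 1) (poly-* P (poly-+ (poly-const 1) (cost-poly p P)))

    module Loops (B : ℕ) where

      infix 4 _⊢_⇒_

      data _⊢_⇒_ : Prog → Store → Store → Set
      data Loop (b : Tops → Bool) (p : Prog) : ℕ → Store → Store → Set

      data _⊢_⇒_ where
        act   : ∀ {f σ} → act f ⊢ σ ⇒ perform (f (tops σ)) σ
        _⨾_   : ∀ {p q σ σ′ σ″} → p ⊢ σ ⇒ σ′ → q ⊢ σ′ ⇒ σ″ → p ⨾ q ⊢ σ ⇒ σ″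
        then′ : ∀ {b p q σ σ′} → b (tops σ) ≡ true → p ⊢ σ ⇒ σ′ → ifte b p q ⊢ σ ⇒ σ′
        else′ : ∀ {b p q σ σ′} → b (tops σ) ≡ false → q ⊢ σ ⇒ σ′ → ifte b p q ⊢ σ ⇒ σ′
        while : ∀ {b p σ σ′ n} → n ≤ B → Loop b p n σ σ′ → while b p ⊢ σ ⇒ σ′

      data Loop b p where
        stop : ∀ {σ} → b (tops σ) ≡ false → Loop b p 0 σ σ
        more : ∀ {n σ σ′ σ″} → b (tops σ) ≡ true → p ⊢ σ ⇒ σ′ → Loop b p n σ′ σ″ → Loop b p (suc n) σ σ″

      timed : ∀ {p σ σ′} → p ⊢ σ ⇒ σ′ → p ⊢ σ ⇒ σ′ within (cost p B)
      timed-loop : ∀ {b p n σ σ′} → Loop b p n σ σ′ → while b p ⊢ σ ⇒ σ′ within (suc (n * suc (cost p B)))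
      timed act         = act tt
      timed (x ⨾ y)     = timed x ⨾ timed y
      timed {ifte b p q} (then′ e x) = weaken (s≤s (m≤m+n (cost p B) (cost q B))) (then′ e (timed x))
      timed {ifte b p q} (else′ e x) = weaken (s≤s (m≤n+m (cost q B) (cost p B))) (else′ e (timed x))
      timed {while b p} (while n≤B l) = weaken (s≤s (*-monoˡ-≤ (suc (cost p B)) n≤B)) (timed-loop l)
      timed-loop (stop e) = stop e
      timed-loop {p = p} (more {n} e x l) = weaken (≤-reflexive (cong suc (+-suc (cost p B) (n * suc (cost p B))))) (loop e (timed x) (timed-loop l))

      result : Prog → Store → Store
      result (act f)      σ = perform (f (tops σ)) σ
      result (p ⨾ q)      σ = result q (result p σ)
      result (ifte b p q) σ = if b (tops σ) then result p σ else result q σ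
      result (while _ _)  σ = σ

      -- Where evaluation meets no `while`, this reduces to a product of unit types, which is solved
      -- as an implicit argument.
      Straight : Prog → Store → Set
      Straight (act _)      σ = ⊤
      Straight (p ⨾ q)      σ = Straight p σ × Straight q (result p σ)
      Straight (ifte b p q) σ = if b (tops σ) then Straight p σ else Straight q σ
      Straight (while _ _)  σ = ⊥

      -- Such a derivation written out by constructors names every intermediate store, and these terms grow fast.
      acts : ∀ {p σ} {_ : Straight p σ} → p ⊢ σ ⇒ result p σ
      acts {act _}              = act
      acts {p ⨾ q} {σ} {a , b}  = acts {p} {σ} {a} ⨾ acts {q} {_} {b}
      acts {ifte b p q} {σ} {s} = branch (b (tops σ)) refl s
        where
        branch : ∀ c → b (tops σ) ≡ c → (if c then Straight p σ else Straight q σ) → ifte b p q ⊢ σ ⇒ (if c then result p σ else result q σ)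
        branch true  e s = then′ e (acts {p} {σ} {s})
        branch false e s = else′ e (acts {q} {σ} {s})

      cast : ∀ {p σ σ′ σ″} → σ′ ≡ σ″ → p ⊢ σ ⇒ σ′ → p ⊢ σ ⇒ σ″
      cast refl x = x

      -- Naming an intermediate store keeps the type checker from unfolding long chains of actions.
      via : ∀ {p q σ σ″} σ′ → p ⊢ σ ⇒ σ′ → q ⊢ σ′ ⇒ σ″ → p ⨾ q ⊢ σ ⇒ σ″
      via _ x y = x ⨾ y

      Loop-cast : ∀ {b p n σ σ′ σ″} → σ′ ≡ σ″ → Loop b p n σ σ′ → Loop b p n σ σ″
      Loop-cast refl x = x

      -- A loop that pops one symbol per round is a left fold over the stack; `I` describes the
      -- stores at the head of the loop by what is left on the stack and what has been accumulated.
      drain : ∀ {A : Set} i {body} (I : List S → A → Store) (g : A → S → A) →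
              (∀ xs a → lookup (tops (I xs a)) i ≡ head? xs) →
              (∀ x xs a → body ⊢ I (x ∷ xs) a ⇒ I xs (g a x)) →
              ∀ xs a → length xs ≤ B → while (nonempty i) body ⊢ I xs a ⇒ I [] (foldl g a xs)
      drain i {body} I g tp bd xs a le = while le (go xs a)
        where
        go : ∀ xs a → Loop (nonempty i) body (length xs) (I xs a) (I [] (foldl g a xs))
        go []       a = stop (cong is-just (tp [] a))
        go (x ∷ xs) a = more (cong is-just (tp (x ∷ xs) a)) (bd x xs a) (go xs (g a x))

  -- reading an empty stack yields the default symbol
  module Basics (k : ℕ) {S : Set} (default : S) where

    open Language k S

    sym? : Maybe S → S
    sym? (just x) = x
    sym? nothing  = default

    put : Fin (suc k) → S → Prog
    put i x = act (λ _ → push i x)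

    copy : Fin (suc k) → Fin (suc k) → Prog
    copy i j = act (λ v → push j (sym? (lookup v i)))

    del : Fin (suc k) → Prog
    del i = act (λ _ → pop i)

    idle : Prog
    idle = act (λ _ → none)

    mv : Fin (suc k) → Fin (suc k) → Prog
    mv i j = while (nonempty i) (copy i j ⨾ del i)

    clear : Fin (suc k) → Prog
    clear i = while (nonempty i) (del i)

    module Moves (B : ℕ) where

      open Loops B

      mv-run : ∀ i j → i ≢ j → ∀ σ → length (lookup σ i) ≤ B →
               mv i j ⊢ σ ⇒ V.updateAt (V.updateAt σ j (lookup σ i ʳ++_)) i (λ _ → [])
      mv-run i j i≢j σ le = cast end (subst (λ τ → mv i j ⊢ τ ⇒ I [] (lookup σ i ʳ++ lookup σ j)) start
          (drain i I (λ a x → x ∷ a) top-I step (lookup σ i) (lookup σ j) le))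
        where
        I : List S → List S → Store
        I xs ys = (σ V.[ j ]≔ ys) V.[ i ]≔ xs
        at-i : ∀ xs ys → lookup (I xs ys) i ≡ xs
        at-i xs ys = lookup∘update i (σ V.[ j ]≔ ys) xs
        top-I : ∀ xs ys → lookup (tops (I xs ys)) i ≡ head? xs
        top-I xs ys = trans (lookup-map i head? (I xs ys)) (cong head? (at-i xs ys))
        start : I (lookup σ i) (lookup σ j) ≡ σ
        start = trans (cong (V._[ i ]≔ lookup σ i) ([]≔-lookup σ j)) ([]≔-lookup σ i)
        upd : ∀ {f : List S → List S} {x} → ∀ l (τ : Store) → f (lookup τ l) ≡ x → V.updateAt τ l f ≡ τ V.[ l ]≔ x
        upd l τ e = updateAt-cong-local l τ e
        end : I [] (lookup σ i ʳ++ lookup σ j) ≡ V.updateAt (V.updateAt σ j (lookup σ i ʳ++_)) i (λ _ → [])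
        end = cong (V._[ i ]≔ []) (sym (upd j σ refl))
        step : ∀ x xs ys → copy i j ⨾ del i ⊢ I (x ∷ xs) ys ⇒ I xs (x ∷ ys)
        step x xs ys = cast (trans
            (cong (λ z → V.updateAt (V.updateAt (I (x ∷ xs) ys) j (sym? z ∷_)) i tail') (top-I (x ∷ xs) ys))
            (trans (cong (λ τ → V.updateAt τ i tail') (trans (upd j (I (x ∷ xs) ys) (cong (x ∷_) (trans (lookup∘update′ (i≢j ∘ sym) (σ V.[ j ]≔ ys) (x ∷ xs)) (lookup∘update j σ ys))))
                (trans ([]≔-commutes (σ V.[ j ]≔ ys) i j i≢j) (cong (V._[ i ]≔ (x ∷ xs)) ([]≔-idempotent σ j)))))
              (trans (upd i (I (x ∷ xs) (x ∷ ys)) (cong tail' (at-i (x ∷ xs) (x ∷ ys)))) ([]≔-idempotent (σ V.[ j ]≔ (x ∷ ys)) i))))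
          (act ⨾ act)

      clear-run : ∀ i σ → length (lookup σ i) ≤ B → clear i ⊢ σ ⇒ V.updateAt σ i (λ _ → [])
      clear-run i σ le = while le (go σ (lookup σ i) refl)
        where
        go : ∀ σ xs → lookup σ i ≡ xs → Loop (nonempty i) (del i) (length xs) σ (V.updateAt σ i (λ _ → []))
        go σ [] e = Loop-cast (sym (trans (updateAt-cong-local i σ (sym e)) (updateAt-id i σ))) (stop (cong is-just (trans (lookup-map i head? σ) (cong head? e))))
        go σ (x ∷ xs) e = more (cong is-just (trans (lookup-map i head? σ) (cong head? e))) act
          (Loop-cast (updateAt-updateAt i σ) (go (V.updateAt σ i tail') xs (trans (lookup∘updateAt i σ) (cong tail' e))))

-- Compiling stack programs into single-tape Turing machines

module Compilation where

  open import Defs hiding (QF; eq; rel; neg; and; or)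
  open FiniteTypes
  open StackPrograms
  open import Data.Nat using (ℕ; zero; suc; _+_; _*_; _≤_; z≤n; s≤s)
  open import Data.Nat.Properties
  open import Data.Fin using (Fin) renaming (zero to fz; suc to fs)
  open import Data.Fin.Properties using () renaming (_≟_ to _≟F_)
  open import Data.Bool using (Bool; true; false; if_then_else_)
  open import Data.Maybe using (Maybe; just; nothing)
  open import Data.List using (List; []; _∷_; length; map)
  open import Data.List.Properties using (length-map)
  open import Data.List.Relation.Unary.All using (All; []; _∷_)
  open import Data.Vec as V using (Vec; lookup; _[_]≔_; replicate)
  open import Data.Vec.Properties using (lookup∘update; lookup∘update′; lookup-replicate; lookup∘updateAt; lookup∘updateAt′; tabulate∘lookup; tabulate-cong; lookup-map)
  open import Data.Product using (∃; ∃₂; _×_; _,_; proj₁; proj₂)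
  open import Data.Sum using (_⊎_; inj₁; inj₂)
  open import Data.Unit using (⊤; tt)
  open import Function using (_∘_)
  open import Relation.Nullary using (yes; no)
  open import Relation.Binary.PropositionalEquality

  step-δ : ∀ M q l h r {q′ s mv} → TM.δ M q h ≡ (q′ , s , mv) → TM.halting M q ≡ false →
           step M (cfg q l h r) ≡ moveHead M q′ s mv l r
  step-δ M q l h r e nh with TM.δ M q h | e
  ... | _ | refl rewrite nh = refl

  module Paths (M : TM) where

    data Path (B : ℕ) : Config M → ℕ → Config M → Set where
      here  : ∀ {c} → space M c ≤ B → Path B c 0 c
      there : ∀ {c c′ t} → space M c ≤ B → Path B (step M c) t c′ → Path B c (suc t) c′

    Path-cast : ∀ {B c c′ t t′} → t ≡ t′ → Path B c t c′ → Path B c t′ c′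
    Path-cast refl p = p

    infixr 5 _▹_
    _▹_ : ∀ {B c c′ c″ t t′} → Path B c t c′ → Path B c′ t′ c″ → Path B c (t + t′) c″
    here _    ▹ q = q
    there s p ▹ q = there s (p ▹ q)

    Path-run : ∀ {B w c t} n → Path B (run M w n) t c →
               run M w (t + n) ≡ c × (∀ t′ → t′ ≤ t → space M (run M w (t′ + n)) ≤ B)
    Path-run n (here s) = refl , λ { .0 z≤n → s }
    Path-run {B} {w} {c} {suc t} n (there s p) with Path-run (suc n) p
    ... | e , sp = trans (cong (run M w) (sym (+-suc t n))) e ,
      λ { zero _ → s ; (suc t′) (s≤s le) → subst (λ m → space M (run M w m) ≤ B) (+-suc t′ n) (sp t′ le) }

  module Compiler (k : ℕ) {S : Set} (finS : Finite S) (bit : Bool → S) (unbit : S → Bool) where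

    open Language k S

    Lab : Prog → Set
    Lab (act _)      = ⊤
    Lab (p ⨾ q)      = Lab p ⊎ Lab q
    Lab (ifte _ p q) = Maybe (Lab p ⊎ Lab q)
    Lab (while _ p)  = Maybe (Lab p)

    finLab : ∀ p → Finite (Lab p)
    finLab (act _)      = fin⊤
    finLab (p ⨾ q)      = fin⊎ (finLab p) (finLab q)
    finLab (ifte _ p q) = finMaybe (fin⊎ (finLab p) (finLab q))
    finLab (while _ p)  = finMaybe (finLab p)

    entry : ∀ p → Lab p
    entry (act _)      = tt
    entry (p ⨾ _)      = inj₁ (entry p)
    entry (ifte _ _ _) = nothing
    entry (while _ _)  = nothing

    -- Continuation style: `e` embeds the labels of p into those of the surrounding program and `x`
    -- is where control goes after p, so one definition serves p in every context.
    code : ∀ {X : Set} p → (Lab p → X) → X → Lab p → Tops → Action × X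
    code (act f)      e x tt              v = f v , x
    code (p ⨾ q)      e x (inj₁ l)        v = code p (e ∘ inj₁) (e (inj₂ (entry q))) l v
    code (p ⨾ q)      e x (inj₂ l)        v = code q (e ∘ inj₂) x l v
    code (ifte b p q) e x nothing         v = none , (if b v then e (just (inj₁ (entry p))) else e (just (inj₂ (entry q))))
    code (ifte b p q) e x (just (inj₁ l)) v = code p (e ∘ just ∘ inj₁) x l v
    code (ifte b p q) e x (just (inj₂ l)) v = code q (e ∘ just ∘ inj₂) x l v
    code (while b p)  e x nothing         v = none , (if b v then e (just (entry p)) else x)
    code (while b p)  e x (just l)        v = code p (e ∘ just) (e nothing) l v

    module _ (prog : Prog) (acc : Tops → Bool) where

      X : Set
      X = Maybe (Lab prog)

      -- A push sweeps right carrying the displaced symbol (`pushing`) and returns (`ret`). A pop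
      -- walks to the first empty cell (`popR`) and shifts the track on its way back (`popL`). At
      -- the end `convR` and `convL` turn track 0 into raw output bits.
      data Q : Set where
        boot    : Q
        home    : X → Q
        pushing : Fin (suc k) → S → X → Q
        ret     : X → Q
        popR    : Fin (suc k) → X → Q
        popL    : Fin (suc k) → Maybe S → X → Q
        convR   : Bool → Q
        convL   : Bool → Q
        done    : Bool → Q

      private
        finX : Finite X
        finX = finMaybe (finLab prog)
        finI : Finite (Fin (suc k))
        finI = finFin (suc k)

        Sum : Set
        Sum = ⊤ ⊎ X ⊎ (Fin (suc k) × S × X) ⊎ X ⊎ (Fin (suc k) × X) ⊎ (Fin (suc k) × Maybe S × X) ⊎ Bool ⊎ Bool ⊎ Bool

        finSum : Finite Sum
        finSum = fin⊎ fin⊤ (fin⊎ finX (fin⊎ (fin× finI (fin× finS finX)) (fin⊎ finX (fin⊎ (fin× finI finX)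
                 (fin⊎ (fin× finI (fin× (finMaybe finS) finX)) (fin⊎ finBool (fin⊎ finBool finBool)))))))

        to : Q → Sum
        to boot            = inj₁ tt
        to (home x)        = inj₂ (inj₁ x)
        to (pushing i s x) = inj₂ (inj₂ (inj₁ (i , s , x)))
        to (ret x)         = inj₂ (inj₂ (inj₂ (inj₁ x)))
        to (popR i x)      = inj₂ (inj₂ (inj₂ (inj₂ (inj₁ (i , x)))))
        to (popL i c x)    = inj₂ (inj₂ (inj₂ (inj₂ (inj₂ (inj₁ (i , c , x))))))
        to (convR b)       = inj₂ (inj₂ (inj₂ (inj₂ (inj₂ (inj₂ (inj₁ b))))))
        to (convL b)       = inj₂ (inj₂ (inj₂ (inj₂ (inj₂ (inj₂ (inj₂ (inj₁ b)))))))
        to (done b)        = inj₂ (inj₂ (inj₂ (inj₂ (inj₂ (inj₂ (inj₂ (inj₂ b)))))))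

        from : Sum → Q
        from (inj₁ _) = boot
        from (inj₂ (inj₁ x)) = home x
        from (inj₂ (inj₂ (inj₁ (i , s , x)))) = pushing i s x
        from (inj₂ (inj₂ (inj₂ (inj₁ x)))) = ret x
        from (inj₂ (inj₂ (inj₂ (inj₂ (inj₁ (i , x)))))) = popR i x
        from (inj₂ (inj₂ (inj₂ (inj₂ (inj₂ (inj₁ (i , c , x))))))) = popL i c x
        from (inj₂ (inj₂ (inj₂ (inj₂ (inj₂ (inj₂ (inj₁ b))))))) = convR b
        from (inj₂ (inj₂ (inj₂ (inj₂ (inj₂ (inj₂ (inj₂ (inj₁ b)))))))) = convL b
        from (inj₂ (inj₂ (inj₂ (inj₂ (inj₂ (inj₂ (inj₂ (inj₂ b)))))))) = done b

        from-to : ∀ q → from (to q) ≡ q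
        from-to boot            = refl
        from-to (home x)        = refl
        from-to (pushing i s x) = refl
        from-to (ret x)         = refl
        from-to (popR i x)      = refl
        from-to (popL i c x)    = refl
        from-to (convR b)       = refl
        from-to (convL b)       = refl
        from-to (done b)        = refl

      finQ : Finite Q
      finQ = retract finSum to from from-to

      -- The flag marks the leftmost cell, which holds the tops of all stacks.
      Cell : Set
      Cell = Bool × Tops

      finCell : Finite Cell
      finCell = fin× finBool (finVec (finMaybe finS) (suc k))

      module Table (n : ℕ) (encS : Cell → Fin (3 + n)) where

        TSym : Set
        TSym = Fin (3 + n)

        raw : Maybe S → TSym
        raw nothing  = fz
        raw (just s) = if unbit s then fs (fs fz) else fs fz

        Out : Set
        Out = Q × TSym × Move

        launch : Action × X → Cell → Out
        launch (none , x)     c = home x , encS c , stay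
        launch (push i s , x) c = pushing i s x , encS c , stay
        launch (pop i , x)    c = popR i x , encS c , stay

        pushT : Fin (suc k) → S → X → Cell → Maybe S → Out
        pushT i s x (h , v) nothing   = ret x , encS (h , v [ i ]≔ just s) , stay
        pushT i s x (h , v) (just s′) = pushing i s′ x , encS (h , v [ i ]≔ just s) , right

        popRT : Fin (suc k) → X → Cell → Maybe S → Out
        popRT i x c nothing  = popL i nothing x , encS c , stay
        popRT i x c (just _) = popR i x , encS c , right

        convRT : Bool → Cell → Maybe S → Out
        convRT b c nothing  = convL b , encS c , stay
        convRT b c (just _) = convR b , encS c , right

        trans′ : Q → Cell → Out
        trans′ boot            (h , v)     = home (just (entry prog)) , encS (true , v) , stay
        trans′ (home nothing)  (h , v)     = convR (acc v) , encS (h , v) , stay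
        trans′ (home (just l)) (h , v)     = launch (code prog just nothing l v) (h , v)
        trans′ (pushing i s x) (h , v)     = pushT i s x (h , v) (lookup v i)
        trans′ (ret x)         (true , v)  = home x , encS (true , v) , stay
        trans′ (ret x)         (false , v) = ret x , encS (false , v) , left
        trans′ (popR i x)      (h , v)     = popRT i x (h , v) (lookup v i)
        trans′ (popL i c x)    (true , v)  = home x , encS (true , v [ i ]≔ c) , stay
        trans′ (popL i c x)    (false , v) = popL i (lookup v i) x , encS (false , v [ i ]≔ c) , left
        trans′ (convR b)       (h , v)     = convRT b (h , v) (lookup v fz)
        trans′ (convL b)       (true , v)  = done b , raw (lookup v fz) , stay
        trans′ (convL b)       (false , v) = convL b , raw (lookup v fz) , left
        trans′ (done b)        c           = done b , encS c , stay

      isDone : Q → Bool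
      isDone (done _) = true
      isDone _        = false

      isAcc : Q → Bool
      isAcc (done b) = b
      isAcc _        = false

      -- The simulation argument sees the Turing machine only through this interface.
      record Impl : Set where
        field
          tm         : TM
          encQ       : Q → Fin (TM.nQ tm)
          encS       : Cell → Sym tm
          decS       : Sym tm → Cell
          decS-encS  : ∀ c → decS (encS c) ≡ c
          decS-blank : decS (blank tm) ≡ (false , replicate (suc k) nothing)
          decS-bit   : ∀ b → decS (bitSym tm b) ≡ (false , just (bit b) V.∷ replicate k nothing)
          start-boot : TM.start tm ≡ encQ boot
          halting-Q  : ∀ q → TM.halting tm (encQ q) ≡ isDone q
          accept-Q   : ∀ q → TM.accepting tm (encQ q) ≡ isAcc q
        open Table (TM.nΓ tm) encS public
        go : Out → List TSym → List TSym → Config tm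
        go (q , s , mv) l r = moveHead tm (encQ q) s mv l r
        field
          step≡ : ∀ q l h r → isDone q ≡ false → step tm (cfg (encQ q) l h r) ≡ go (trans′ q (decS h)) l r

      impl : Impl
      impl = record
        { tm         = machine
        ; encQ       = enc finQ
        ; encS       = encS
        ; decS       = decS
        ; decS-encS  = dec-enc finCell
        ; decS-blank = refl
        ; decS-bit   = λ { true → refl ; false → refl }
        ; start-boot = refl
        ; halting-Q  = λ q → cong isDone (dec-enc finQ q)
        ; accept-Q   = λ q → cong isAcc (dec-enc finQ q)
        ; step≡      = λ q l h r nd → step-δ machine _ l h r
                         (cong (λ q → let o = trans′ q (decS h) in enc finQ (proj₁ o) , proj₂ o) (dec-enc finQ q))
                         (trans (cong isDone (dec-enc finQ q)) nd)
        }
        where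
        encS : Cell → Fin (3 + size finCell)
        encS c = fs (fs (fs (enc finCell c)))
        open Table (size finCell) encS
        -- Raw input symbols are read as cells that carry a bit on track 0.
        decS : TSym → Cell
        decS fz               = false , replicate (suc k) nothing
        decS (fs fz)          = false , just (bit false) V.∷ replicate k nothing
        decS (fs (fs fz))     = false , just (bit true) V.∷ replicate k nothing
        decS (fs (fs (fs c))) = dec finCell c
        machine : TM
        machine = record
          { nQ        = size finQ
          ; nΓ        = size finCell
          ; start     = enc finQ boot
          ; halting   = isDone ∘ dec finQ
          ; accepting = isAcc ∘ dec finQ
          ; δ         = λ q s → let o = trans′ (dec finQ q) (decS s) in enc finQ (proj₁ o) , proj₂ o
          }

      module Sim (I : Impl) where

        open Impl I
        open Paths tm

        conf : Q → List TSym → TSym → List TSym → Config tm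
        conf q l h r = cfg (encQ q) l h r

        one : ∀ {B} q {l h r c} → isDone q ≡ false → length l + suc (length r) ≤ B → space tm c ≤ B →
              go (trans′ q (decS h)) l r ≡ c → Path B (conf q l h r) 1 c
        one {B} q {l} {h} {r} {c} nd s s′ e = there s (subst (λ c′ → Path B c′ 0 c) (sym (trans (step≡ q l h r nd) e)) (here s′))

        -- Any number of empty cells may follow the stack, since the length of the tape is set by
        -- the tallest stack.
        data Track : List (Maybe S) → List S → Set where
          nil  : ∀ {ms} → All (_≡ nothing) ms → Track ms []
          cons : ∀ {x ms xs} → Track ms xs → Track (just x ∷ ms) (x ∷ xs)

        flag : TSym → Bool
        flag c = proj₁ (decS c)

        tr : Fin (suc k) → TSym → Maybe S
        tr j c = lookup (proj₂ (decS c)) j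

        track : Fin (suc k) → List TSym → List (Maybe S)
        track j = map (tr j)

        Inner : List TSym → Set
        Inner = All (λ c → flag c ≡ false)

        Track-head : ∀ {m ms xs} → Track (m ∷ ms) xs → m ≡ head? xs
        Track-head (nil (e ∷ _)) = e
        Track-head (cons _)      = refl

        Track-tail : ∀ {m ms xs} → Track (m ∷ ms) xs → Track ms (tail' xs)
        Track-tail (nil (_ ∷ a)) = nil a
        Track-tail (cons t)      = t

        Track-∷ : ∀ {m ms xs} → m ≡ head? xs → Track ms (tail' xs) → Track (m ∷ ms) xs
        Track-∷ {xs = []}     refl (nil a) = nil (refl ∷ a)
        Track-∷ {xs = x ∷ xs} refl t       = cons t

        Track-lift : ∀ {m m′ ms ms′ xs} → m′ ≡ m → (∀ {ys} → Track ms ys → Track ms′ ys) → Track (m ∷ ms) xs → Track (m′ ∷ ms′) xs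
        Track-lift refl f t = Track-∷ (Track-head t) (f (Track-tail t))

        -- A move right may leave the cells visited so far. The fresh blank decodes to an unmarked
        -- cell that is empty on all tracks, so every track still holds the same stack.
        advance : ∀ q s l r B → Inner r → length l + suc (length r) ≤ B → suc (suc (length l)) ≤ B →
          ∃₂ λ h₁ r₁ → moveHead tm q s right l r ≡ cfg q (s ∷ l) h₁ r₁
            × (∀ j {ys} → Track (track j r) ys → Track (track j (h₁ ∷ r₁)) ys)
            × flag h₁ ≡ false × Inner r₁ × suc (length l) + suc (length r₁) ≤ B
        advance q s l [] B _ le le′ = fz , [] , refl ,
          (λ { j (nil []) → nil (trans (cong (λ z → lookup (proj₂ z) j) decS-blank) (lookup-replicate j nothing) ∷ []) }) , cong proj₁ decS-blank , [] ,
          ≤-trans (≤-reflexive (trans (+-suc (suc (length l)) 0) (cong (suc ∘ suc) (+-identityʳ _)))) le′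
        advance q s l (x ∷ r) B (e ∷ a) le le′ = x , r , refl , (λ j t → t) , e , a ,
          ≤-trans (≤-reflexive (sym (+-suc (length l) (suc (length r))))) le

        tr-set : ∀ i h v x → tr i (encS (h , v [ i ]≔ x)) ≡ x
        tr-set i h v x = trans (cong (λ z → lookup (proj₂ z) i) (decS-encS (h , v [ i ]≔ x))) (lookup∘update i v x)

        tr-set′ : ∀ i j h v x → j ≢ i → tr j (encS (h , v [ i ]≔ x)) ≡ lookup v j
        tr-set′ i j h v x ne = trans (cong (λ z → lookup (proj₂ z) j) (decS-encS (h , v [ i ]≔ x))) (lookup∘update′ ne v x)

        flag-set : ∀ h v → flag (encS (h , v)) ≡ h
        flag-set h v = cong proj₁ (decS-encS (h , v))

        2+ : ∀ l x → l + suc (suc x) ≡ suc (l + suc x)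
        2+ l x = +-suc l (suc x)

        room : ∀ {l x B} → l + suc (suc x) ≤ B → suc (suc l) ≤ B
        room {l} {x} le = ≤-trans (≤-trans (s≤s (s≤s (m≤m+n l x))) (≤-reflexive (sym (trans (+-suc l (suc x)) (cong suc (+-suc l x)))))) le

        -- Each cell takes the symbol that is carried and hands on its own. One step out and one
        -- step back per symbol, and one step for the turn, give `suc (length xs * 2)`.
        pushSweep : ∀ {B} i s x l h r xs → Track (track i (h ∷ r)) xs → Inner r →
          length l + suc (length r) ≤ B → length l + suc (length xs) ≤ B →
          ∃₂ λ h′ r′ → Path B (conf (pushing i s x) l h r) (suc (length xs * 2)) (conf (ret x) l h′ r′)
            × Track (track i (h′ ∷ r′)) (s ∷ xs)
            × (∀ j → j ≢ i → ∀ {ys} → Track (track j (h ∷ r)) ys → Track (track j (h′ ∷ r′)) ys)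
            × flag h′ ≡ flag h × Inner r′ × length l + suc (length r′) ≤ B
        pushSweep {B} i s x l h r [] t a le le′ =
          encS (flag h , proj₂ (decS h) [ i ]≔ just s) , r ,
          one (pushing i s x) refl le le (cong (λ z → go (pushT i s x (decS h) z) l r) (Track-head t)) ,
          subst (λ z → Track (z ∷ track i r) (s ∷ [])) (sym (tr-set i _ _ (just s))) (cons (Track-tail t)) ,
          (λ j ne → Track-lift (tr-set′ i j _ _ _ ne) (λ u → u)) ,
          flag-set _ _ , a , le
        pushSweep {B} i s x l h r (y ∷ xs) t a le le′ with advance (encQ (pushing i y x)) (encS (flag h , proj₂ (decS h) [ i ]≔ just s)) l r B a le (room le′)
        ... | h₁ , r₁ , eq₁ , tr₁ , f₁ , a₁ , le₁
          with pushSweep {B} i y x (encS (flag h , proj₂ (decS h) [ i ]≔ just s) ∷ l) h₁ r₁ xs (tr₁ i (Track-tail t)) a₁ le₁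
                 (≤-trans (≤-reflexive (sym (+-suc (length l) _))) le′)
        ... | h₂ , r₂ , p , t₂ , o₂ , f₂ , a₂ , le₂ =
          h′ , encS (decS h₂) ∷ r₂ ,
          Path-cast (cong suc (+-comm (suc (length xs * 2)) 1))
            (one (pushing i s x) refl le le₁ (trans (cong (λ z → go (pushT i s x (decS h) z) l r) (Track-head t)) eq₁)
             ▹ p ▹ one (ret x) refl le₂ le₃ back) ,
          subst (λ z → Track (z ∷ _) _) (sym (tr-set i _ _ (just s))) (cons (subst (λ z → Track (z ∷ track i r₂) (y ∷ xs)) (sym (tr-same i)) t₂)) ,
          (λ j ne → Track-lift (tr-set′ i j _ _ _ ne) (λ u → subst (λ z → Track (z ∷ track j r₂) _) (sym (tr-same j)) (o₂ j ne (tr₁ j u)))) ,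
          flag-set _ _ , trans (cong proj₁ (decS-encS (decS h₂))) (trans f₂ f₁) ∷ a₂ , le₃
          where
          h′ = encS (flag h , proj₂ (decS h) [ i ]≔ just s)
          tr-same : ∀ j → tr j (encS (decS h₂)) ≡ tr j h₂
          tr-same j = cong (λ z → lookup (proj₂ z) j) (decS-encS (decS h₂))
          le₃ : length l + suc (suc (length r₂)) ≤ B
          le₃ = ≤-trans (≤-reflexive (2+ (length l) (length r₂))) le₂
          dec₂ : decS h₂ ≡ (false , proj₂ (decS h₂))
          dec₂ = cong (_, proj₂ (decS h₂)) (trans f₂ f₁)
          back : go (trans′ (ret x) (decS h₂)) (h′ ∷ l) r₂ ≡ conf (ret x) l h′ (encS (decS h₂) ∷ r₂)
          back = subst (λ d → go (trans′ (ret x) d) (h′ ∷ l) r₂ ≡ conf (ret x) l h′ (encS d ∷ r₂)) (sym dec₂) refl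

        -- The sweep is followed until one step before the end: the first cell still shows its old
        -- symbol and `c` is held in the state. At the marked cell this last write goes together
        -- with entering `home`, elsewhere with a further step to the left.
        popSweep : ∀ {B} i x l h r xs → Track (track i (h ∷ r)) xs → Inner r →
          length l + suc (length r) ≤ B → length l + suc (length xs) ≤ B →
          ∃₂ λ c r′ → ∃ λ h′ → Path B (conf (popR i x) l h r) (suc (length xs * 2)) (conf (popL i c x) l h′ r′)
            × decS h′ ≡ decS h
            × Track (c ∷ track i r′) (tail' xs)
            × (∀ j → j ≢ i → ∀ {ys} → Track (track j (h ∷ r)) ys → Track (tr j h ∷ track j r′) ys)
            × Inner r′ × length l + suc (length r′) ≤ B
        popSweep {B} i x l h r [] t a le le′ =
          nothing , r , encS (decS h) ,
          one (popR i x) refl le le (cong (λ z → go (popRT i x (decS h) z) l r) (Track-head t)) ,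
          decS-encS _ , Track-∷ refl (Track-tail t) , (λ j ne u → u) , a , le
        popSweep {B} i x l h r (y ∷ xs) t a le le′ with advance (encQ (popR i x)) (encS (decS h)) l r B a le (room le′)
        ... | h₁ , r₁ , eq₁ , tr₁ , f₁ , a₁ , le₁
          with popSweep {B} i x (encS (decS h) ∷ l) h₁ r₁ xs (tr₁ i (Track-tail t)) a₁ le₁
                 (≤-trans (≤-reflexive (sym (+-suc (length l) _))) le′)
        ... | c , r₂ , h₂ , p , d₂ , t₂ , o₂ , a₂ , le₂ =
          tr i h₁ , h₃ ∷ r₂ , encS (decS h) ,
          Path-cast (cong suc (+-comm (suc (length xs * 2)) 1))
            (one (popR i x) refl le le₁ (trans (cong (λ z → go (popRT i x (decS h) z) l r) (Track-head t)) eq₁)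
             ▹ p ▹ one (popL i c x) refl le₂ le₃ back) ,
          decS-encS _ ,
          Track-∷ (Track-head (tr₁ i (Track-tail t))) (subst (λ z → Track (z ∷ track i r₂) (tail' xs)) (sym (tr-set i _ _ c)) t₂) ,
          (λ j ne → Track-lift refl (λ u → subst (λ z → Track (z ∷ track j r₂) _) (sym (tr-set′ i j _ _ _ ne)) (o₂ j ne (tr₁ j u)))) ,
          flag-set _ _ ∷ a₂ , le₃
          where
          h₃ = encS (false , proj₂ (decS h₁) [ i ]≔ c)
          le₃ : length l + suc (suc (length r₂)) ≤ B
          le₃ = ≤-trans (≤-reflexive (2+ (length l) (length r₂))) le₂
          dec₂ : decS h₂ ≡ (false , proj₂ (decS h₁))
          dec₂ = trans d₂ (cong (_, proj₂ (decS h₁)) f₁)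
          back : go (trans′ (popL i c x) (decS h₂)) (encS (decS h) ∷ l) r₂ ≡ conf (popL i (tr i h₁) x) l (encS (decS h)) (h₃ ∷ r₂)
          back = subst (λ d → go (trans′ (popL i c x) d) (encS (decS h) ∷ l) r₂ ≡ conf (popL i (tr i h₁) x) l (encS (decS h)) (h₃ ∷ r₂)) (sym dec₂) refl

        raw-bits : List S → List Bool
        raw-bits = map unbit

        bits-raw : ∀ m (r : List TSym) xs → m ≡ head? xs → (∀ y ys → xs ≡ y ∷ ys → bitsPrefix tm r ≡ raw-bits ys) →
                   bitsPrefix tm (raw m ∷ r) ≡ raw-bits xs
        bits-raw nothing  r []       e f = refl
        bits-raw (just s) r (x ∷ xs) refl f with unbit s
        ... | true  = cong (true ∷_) (f x xs refl)
        ... | false = cong (false ∷_) (f x xs refl)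

        convSweep : ∀ {B} b l h r xs → Track (track fz (h ∷ r)) xs → Inner r →
          length l + suc (length r) ≤ B → length l + suc (length xs) ≤ B →
          ∃₂ λ h′ r′ → Path B (conf (convR b) l h r) (suc (length xs * 2)) (conf (convL b) l h′ r′)
            × decS h′ ≡ decS h
            × bitsPrefix tm (raw (tr fz h) ∷ r′) ≡ raw-bits xs
            × length l + suc (length r′) ≤ B
        convSweep {B} b l h r [] t a le le′ =
          encS (decS h) , r ,
          one (convR b) refl le le (cong (λ z → go (convRT b (decS h) z) l r) (Track-head t)) ,
          decS-encS _ , bits-raw _ r [] (Track-head t) (λ _ _ ()) , le
        convSweep {B} b l h r (y ∷ xs) t a le le′ with advance (encQ (convR b)) (encS (decS h)) l r B a le (room le′)
        ... | h₁ , r₁ , eq₁ , tr₁ , f₁ , a₁ , le₁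
          with convSweep {B} b (encS (decS h) ∷ l) h₁ r₁ xs (tr₁ fz (Track-tail t)) a₁ le₁
                 (≤-trans (≤-reflexive (sym (+-suc (length l) _))) le′)
        ... | h₂ , r₂ , p , d₂ , b₂ , le₂ =
          encS (decS h) , raw (tr fz h₁) ∷ r₂ ,
          Path-cast (cong suc (+-comm (suc (length xs * 2)) 1))
            (one (convR b) refl le le₁ (trans (cong (λ z → go (convRT b (decS h) z) l r) (Track-head t)) eq₁)
             ▹ p ▹ one (convL b) refl le₂ le₃ back) ,
          decS-encS _ , bits-raw _ _ (y ∷ xs) (Track-head t) (λ { _ _ refl → b₂ }) , le₃
          where
          le₃ : length l + suc (suc (length r₂)) ≤ B
          le₃ = ≤-trans (≤-reflexive (2+ (length l) (length r₂))) le₂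
          dec₂ : decS h₂ ≡ (false , proj₂ (decS h₁))
          dec₂ = trans d₂ (cong (_, proj₂ (decS h₁)) f₁)
          back : go (trans′ (convL b) (decS h₂)) (encS (decS h) ∷ l) r₂ ≡ conf (convL b) l (encS (decS h)) (raw (tr fz h₁) ∷ r₂)
          back = subst (λ d → go (trans′ (convL b) d) (encS (decS h) ∷ l) r₂ ≡ conf (convL b) l (encS (decS h)) (raw (tr fz h₁) ∷ r₂)) (sym dec₂) refl

        -- Between two actions the head rests on the marked leftmost cell, where the tops of all
        -- stacks are visible at once.
        record Home (x : X) (σ : Store) (B : ℕ) (c : Config tm) : Set where
          constructor at-home
          field
            {hd}   : TSym
            {rgt}  : List TSym
            shape  : c ≡ conf (home x) [] hd rgt
            marked : flag hd ≡ true
            inner  : Inner rgt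
            tracks : ∀ j → Track (track j (hd ∷ rgt)) (lookup σ j)
            fits   : suc (length rgt) ≤ B

        vec-ext : ∀ {A : Set} {n} (u v : Vec A n) → (∀ j → lookup u j ≡ lookup v j) → u ≡ v
        vec-ext u v e = trans (sym (tabulate∘lookup u)) (trans (tabulate-cong e) (tabulate∘lookup v))

        decS-home : ∀ {h r σ} → flag h ≡ true → (∀ j → Track (track j (h ∷ r)) (lookup σ j)) → decS h ≡ (true , tops σ)
        decS-home {h} {r} {σ} f t = cong₂ _,_ f (vec-ext _ _ (λ j → trans (Track-head (t j)) (sym (lookup-map j head? σ))))

        tr-enc : ∀ j h → tr j (encS (decS h)) ≡ tr j h
        tr-enc j h = cong (λ z → lookup (proj₂ z) j) (decS-encS (decS h))

        stay-home : ∀ {x σ B q c} → isDone q ≡ false → ∀ h r → c ≡ conf q [] h r → flag h ≡ true → Inner r →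
          (∀ j → Track (track j (h ∷ r)) (lookup σ j)) → suc (length r) ≤ B →
          trans′ q (true , tops σ) ≡ (home x , encS (true , tops σ) , stay) → ∃ λ c′ → Path B c 1 c′ × Home x σ B c′
        stay-home {σ = σ} {q = q} nd h r refl f a t le e = _ ,
          one q nd le le (trans (cong (λ d → go (trans′ q d) [] r) d≡) (cong (λ o → go o [] r) e)) ,
          at-home refl (flag-set _ _) a (λ j → subst (λ z → Track (z ∷ track j r) _) (sym (trans (cong (tr j ∘ encS) (sym d≡)) (tr-enc j h))) (t j)) le
          where d≡ = decS-home f t

        Track-update : ∀ (F : List S → List S) σ i cs → Track (track i cs) (F (lookup σ i)) →
          (∀ j → j ≢ i → Track (track j cs) (lookup σ j)) → ∀ j → Track (track j cs) (lookup (V.updateAt σ i F) j)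
        Track-update F σ i cs u v j with j ≟F i
        ... | yes refl = subst (Track (track j cs)) (sym (lookup∘updateAt j σ)) u
        ... | no ne    = subst (Track (track j cs)) (sym (lookup∘updateAt′ j i ne σ)) (v j ne)

        -- Besides the way out and back over a stack of height at most s there are three steps: the
        -- launch, the turn and the entry into `home`.
        act-sim : ∀ s l σ {c} a x → Height≤ s σ → Height≤ s (perform a σ) → code prog just nothing l (tops σ) ≡ (a , x) →
          Home (just l) σ (suc s) c → ∃₂ λ c′ t → Path (suc s) c t c′ × t ≤ 3 + s * 2 × Home x (perform a σ) (suc s) c′
        act-sim s l σ none x hσ hσ′ e H = let open Home H ; (c′ , p , H′) = stay-home refl hd rgt shape marked inner tracks fits (cong (λ o → launch o (true , tops σ)) e) in
          c′ , 1 , p , s≤s z≤n , H′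
        act-sim s l σ (push i y) x (height hσ) hσ′ e (at-home {hd} {rgt} refl f a t le) =
          let d≡ = decS-home f t
              h₁ = encS (true , tops σ)
              tr₁ = λ j → trans (cong (tr j ∘ encS) (sym d≡)) (tr-enc j hd)
              (h₂ , r₂ , p , ti , tj , f₂ , a₂ , le₂) = pushSweep i y x [] h₁ rgt (lookup σ i)
                 (subst (λ z → Track (z ∷ track i rgt) _) (sym (tr₁ i)) (t i)) a le (s≤s (hσ i))
              f₃ = trans f₂ (flag-set _ _)
              trk : ∀ j → Track (track j (h₂ ∷ r₂)) (lookup (perform (push i y) σ) j)
              trk = Track-update (y ∷_) σ i (h₂ ∷ r₂) ti (λ j ne → tj j ne (subst (λ z → Track (z ∷ track j rgt) _) (sym (tr₁ j)) (t j)))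
              (c′ , p′ , H′) = stay-home {x = x} refl h₂ r₂ refl f₃ a₂ trk le₂ refl
          in c′ , _ , one (home (just l)) refl le le (trans (cong (λ d → go (trans′ (home (just l)) d) [] rgt) d≡)
                       (cong (λ o → go (launch o (true , tops σ)) [] rgt) e)) ▹ p ▹ p′ ,
             ≤-trans (≤-reflexive (cong suc (+-comm (suc (length (lookup σ i) * 2)) 1))) (s≤s (s≤s (s≤s (*-monoˡ-≤ 2 (hσ i))))) , H′
        act-sim s l σ (pop i) x (height hσ) hσ′ e (at-home {hd} {rgt} refl f a t le) =
          let d≡ = decS-home f t
              h₁ = encS (true , tops σ)
              tr₁ = λ j → trans (cong (tr j ∘ encS) (sym d≡)) (tr-enc j hd)
              (c , r₂ , h₂ , p , d₂ , ti , tj , a₂ , le₂) = popSweep i x [] h₁ rgt (lookup σ i)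
                 (subst (λ z → Track (z ∷ track i rgt) _) (sym (tr₁ i)) (t i)) a le (s≤s (hσ i))
              d₃ : decS h₂ ≡ (true , tops σ)
              d₃ = trans d₂ (decS-encS _)
              h₃ = encS (true , tops σ [ i ]≔ c)
              trk : ∀ j → Track (track j (h₃ ∷ r₂)) (lookup (perform (pop i) σ) j)
              trk = Track-update tail' σ i (h₃ ∷ r₂) (subst (λ z → Track (z ∷ track i r₂) _) (sym (tr-set i _ _ c)) ti)
                       (λ j ne → subst (λ z → Track (z ∷ track j r₂) _) (sym (tr-set′ i j _ _ _ ne))
                         (subst (λ z → Track (z ∷ track j r₂) _) (cong (λ z → lookup (proj₂ z) j) (decS-encS (true , tops σ)))
                           (tj j ne (subst (λ z → Track (z ∷ track j rgt) _) (sym (tr₁ j)) (t j)))))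
          in _ , _ , one (home (just l)) refl le le (trans (cong (λ d → go (trans′ (home (just l)) d) [] rgt) d≡)
                       (cong (λ o → go (launch o (true , tops σ)) [] rgt) e)) ▹ p
                     ▹ one (popL i c x) refl le₂ le₂ (cong (λ d → go (trans′ (popL i c x) d) [] r₂) d₃) ,
             ≤-trans (≤-reflexive (cong suc (+-comm (suc (length (lookup σ i) * 2)) 1))) (s≤s (s≤s (s≤s (*-monoˡ-≤ 2 (hσ i))))) ,
             at-home refl (flag-set _ _) a₂ trk le₂

        -- p sits inside `prog` with labels embedded by `e` and exit `x`. The transition table is
        -- built once for `prog`; this hypothesis is what allows induction on its subprograms.
        Agree : ∀ p → (Lab p → X) → X → Set
        Agree p e x = ∀ l → ∃ λ l′ → e l ≡ just l′ × (∀ v → code prog just nothing l′ v ≡ code p e x l v)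

        record Reaches (s : ℕ) (c : Config tm) (x : X) (σ : Store) (t : ℕ) : Set where
          constructor reaches
          field
            {cfg′} : Config tm
            {time} : ℕ
            path  : Path (suc s) c time cfg′
            spent : time ≤ t * (3 + s * 2)
            arrived : Home x σ (suc s) cfg′

        label-sim : ∀ {s} p {e x} l {σ c a y} → Agree p e x → Height≤ s σ → Height≤ s (perform a σ) → code p e x l (tops σ) ≡ (a , y) →
          Home (e l) σ (suc s) c → Reaches s c y (perform a σ) 1
        label-sim {s} p l {σ} {c} {a} {y} ag hσ hσ′ eq H with ag l
        ... | l′ , e≡ , cd = let (c′ , t , p , le , H′) = act-sim s l′ σ a y hσ hσ′ (trans (cd (tops σ)) eq) (subst (λ z → Home z σ (suc s) c) e≡ H)
                             in reaches p (≤-trans le (≤-reflexive (sym (+-identityʳ _)))) H′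

        join-sim : ∀ {s c x σ y σ′ t t′} → Reaches s c x σ t → (∀ {c′} → Home x σ (suc s) c′ → Reaches s c′ y σ′ t′) →
          Reaches s c y σ′ (t + t′)
        join-sim {s} {t = t} {t′} (reaches p₁ le₁ H₁) f with f H₁
        ... | reaches p₂ le₂ H₂ = reaches (p₁ ▹ p₂) (≤-trans (+-mono-≤ le₁ le₂) (≤-reflexive (sym (*-distribʳ-+ (3 + s * 2) t t′)))) H₂

        exec-sim : ∀ {s} p {e x σ σ′ t c} → Exec (Height≤ s) p σ σ′ t → Height≤ s σ → Agree p e x →
          Home (e (entry p)) σ (suc s) c → Reaches s c x σ′ t
        exec-sim (act f) (act o) hσ ag H = label-sim (act f) tt ag hσ o refl H
        exec-sim (p ⨾ q) (u ⨾ v) hσ ag H =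
          join-sim (exec-sim p u hσ (ag ∘ inj₁) H) (exec-sim q v (Exec-ok u hσ) (ag ∘ inj₂))
        exec-sim (ifte b p q) {e} (then′ eq u) hσ ag H =
          join-sim (label-sim (ifte b p q) nothing ag hσ hσ (cong (λ z → none , (if z then e (just (inj₁ (entry p))) else e (just (inj₂ (entry q))))) eq) H)
            (exec-sim p u hσ (ag ∘ just ∘ inj₁))
        exec-sim (ifte b p q) {e} (else′ eq u) hσ ag H =
          join-sim (label-sim (ifte b p q) nothing ag hσ hσ (cong (λ z → none , (if z then e (just (inj₁ (entry p))) else e (just (inj₂ (entry q))))) eq) H)
            (exec-sim q u hσ (ag ∘ just ∘ inj₂))
        exec-sim (while b p) {e} {x} (stop eq) hσ ag H =
          label-sim (while b p) nothing ag hσ hσ (cong (λ z → none , (if z then e (just (entry p)) else x)) eq) H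
        exec-sim (while b p) {e} {x} (loop eq u v) hσ ag H =
          join-sim (label-sim (while b p) nothing ag hσ hσ (cong (λ z → none , (if z then e (just (entry p)) else x)) eq) H)
            (λ H′ → join-sim (exec-sim p u hσ (ag ∘ just) H′) (exec-sim (while b p) v (Exec-ok u hσ) ag))
        exec-sim {s} p (weaken le u) hσ ag H with exec-sim p u hσ ag H
        ... | reaches p₁ le₁ H₁ = reaches p₁ (≤-trans le₁ (*-monoˡ-≤ (3 + s * 2) le)) H₁

        initStore : List Bool → Store
        initStore w = map bit w V.∷ replicate k []

        input-track : ∀ j w → Track (track j (map (bitSym tm) w)) (lookup (initStore w) j)
        input-track fz [] = nil []
        input-track fz (b ∷ w) = subst (λ z → Track (z ∷ track fz (map (bitSym tm) w)) _) (sym (cong (λ z → lookup (proj₂ z) fz) (decS-bit b))) (cons (input-track fz w))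
        input-track (fs j) w = subst (Track _) (sym (lookup-replicate j [])) (nil (blanks w))
          where
          blanks : ∀ w → All (_≡ nothing) (track (fs j) (map (bitSym tm) w))
          blanks []      = []
          blanks (b ∷ w) = trans (cong (λ z → lookup (proj₂ z) (fs j)) (decS-bit b)) (lookup-replicate j nothing) ∷ blanks w

        input-inner : ∀ w → Inner (map (bitSym tm) w)
        input-inner []      = []
        input-inner (b ∷ w) = cong proj₁ (decS-bit b) ∷ input-inner w

        init-shape : ∀ w → ∃₂ λ h r → initCfg tm w ≡ cfg (TM.start tm) [] h r × (∀ j → Track (track j (h ∷ r)) (lookup (initStore w) j))
          × Inner r × length r ≤ length w
        init-shape [] = _ , _ , refl , (λ { fz → nil (cong (λ z → lookup (proj₂ z) fz) decS-blank ∷ [])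
          ; (fs j) → subst (Track _) (sym (lookup-replicate j [])) (nil (trans (cong (λ z → lookup (proj₂ z) (fs j)) decS-blank) (lookup-replicate j nothing) ∷ [])) }) , [] , z≤n
        init-shape (b ∷ w) = _ , _ , refl , (λ j → input-track j (b ∷ w)) , input-inner w ,
          ≤-trans (≤-reflexive (length-map (bitSym tm) w)) (n≤1+n _)

        boot-sim : ∀ s w → length w ≤ s → ∃ λ c → Path (suc s) (initCfg tm w) 1 c × Home (just (entry prog)) (initStore w) (suc s) c
        boot-sim s w le with init-shape w
        ... | h , r , eq , trk , a , lr = conf (home (just (entry prog))) [] (encS (true , proj₂ (decS h))) r ,
          subst (λ c → Path (suc s) c 1 (conf (home (just (entry prog))) [] (encS (true , proj₂ (decS h))) r)) (sym (trans eq (cong (λ q → cfg q [] h r) start-boot))) (one boot refl (s≤s (≤-trans lr le)) (s≤s (≤-trans lr le)) refl) ,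
          at-home refl (flag-set _ _) a (λ j → subst (λ z → Track (z ∷ track j r) _) (sym (cong (λ z → lookup (proj₂ z) j) (decS-encS _))) (trk j))
            (s≤s (≤-trans lr le))

        finish-sim : ∀ s σ {c} → Height≤ s σ → Home nothing σ (suc s) c →
          ∃₂ λ c′ t → Path (suc s) c t c′ × t ≤ 3 + s * 2 × halted tm c′ × TM.accepting tm (Config.state c′) ≡ acc (tops σ)
            × output tm c′ ≡ map unbit (lookup σ fz)
        finish-sim s σ (height hσ) (at-home {hd} {rgt} refl f a t le) =
          let d≡ = decS-home f t
              h₁ = encS (true , tops σ)
              b = acc (tops σ)
              tr₁ = trans (cong (tr fz ∘ encS) (sym d≡)) (tr-enc fz hd)
              (h₂ , r₂ , p , d₂ , bp , le₂) = convSweep b [] h₁ rgt (lookup σ fz) (subst (λ z → Track (z ∷ track fz rgt) _) (sym tr₁) (t fz)) a le (s≤s (hσ fz))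
              d₃ : decS h₂ ≡ (true , tops σ)
              d₃ = trans d₂ (decS-encS _)
          in conf (done b) [] (raw (lookup (tops σ) fz)) r₂ , _ ,
             one (home nothing) refl le le (cong (λ d → go (trans′ (home nothing) d) [] rgt) d≡) ▹ p
             ▹ one (convL b) refl le₂ le₂ (cong (λ d → go (trans′ (convL b) d) [] r₂) d₃) ,
             ≤-trans (≤-reflexive (cong suc (+-comm (suc (length (lookup σ fz) * 2)) 1))) (s≤s (s≤s (s≤s (*-monoˡ-≤ 2 (hσ fz))))) ,
             halting-Q (done b) , accept-Q (done b) ,
             trans (cong (λ z → bitsPrefix tm (raw z ∷ r₂)) (sym (trans tr₁ (cong (λ z → lookup (proj₂ z) fz) d≡)))) bp

        -- The outer `suc` is the booting step; the conversion of the output costs as much as one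
        -- action, hence `suc t`. A stack of height s fits into s + 1 cells even during a sweep.
        simulate : ∀ {s w σ t} → Exec (Height≤ s) prog (initStore w) σ t → length w ≤ s →
          ∃ λ T → T ≤ suc (suc t * (3 + s * 2))
            × halted tm (run tm w T)
            × (∀ t′ → t′ ≤ T → space tm (run tm w t′) ≤ suc s)
            × TM.accepting tm (Config.state (run tm w T)) ≡ acc (tops σ)
            × output tm (run tm w T) ≡ map unbit (lookup σ fz)
        simulate {s} {w} {σ} {t} x le =
          let (c₀ , p₀ , H₀) = boot-sim s w le
              hσ = height (λ { fz → ≤-trans (≤-reflexive (length-map bit w)) le ; (fs j) → subst (λ l → length l ≤ s) (sym (lookup-replicate j [])) z≤n })
              (reaches {c₁} {t₁} p₁ le₁ H₁) = exec-sim {s} prog {just} {nothing} x hσ (λ l → l , refl , λ _ → refl) H₀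
              (c₂ , t₂ , p₂ , le₂ , h , ac , out) = finish-sim s σ (Exec-ok x hσ) H₁
              (e , sp) = Path-run {w = w} 0 (p₀ ▹ p₁ ▹ p₂)
              T = 1 + (t₁ + t₂)
              e′ = trans (cong (run tm w) (sym (+-identityʳ T))) e
          in T , s≤s (≤-trans (≤-reflexive (+-comm t₁ t₂)) (+-mono-≤ le₂ le₁)) ,
             subst (halted tm) (sym e′) h ,
             (λ t′ t′≤ → subst (λ z → space tm (run tm w z) ≤ suc s) (+-identityʳ t′) (sp t′ t′≤)) ,
             trans (cong (TM.accepting tm ∘ Config.state) e′) ac , trans (cong (output tm) e′) out

-- Automatic structures whose automata share their transition function

module Presentation where

  open import Defs
  open import Data.Nat using (ℕ; zero; suc; _≤_; _⊔_; z≤n; s≤s)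
  open import Data.Nat.Properties using (m≤m⊔n; m≤n⊔m; ≤-trans)
  open import Data.Fin using (Fin; toℕ) renaming (zero to fz; suc to fs)
  open import Data.Fin.Properties using (toℕ-injective)
  open import Data.Bool using (Bool; true; false; not; _∧_; _∨_)
  open import Data.Maybe using (Maybe; nothing)
  open import Data.List using (List; []; _∷_; length; _++_)
  open import Data.List.Properties using (++-assoc; ∷-injectiveʳ)
  open import Data.Vec using (Vec; []; _∷_)
  open import Data.Product using (_×_; _,_; proj₁)
  open import Data.Sum using (inj₁; inj₂)
  open import Data.Empty using (⊥-elim)
  open import Relation.Binary.PropositionalEquality

  nth : ∀ {A : Set} → ℕ → List A → Maybe A
  nth zero    u = head? u
  nth (suc n) u = nth n (tail' u)

  unary-injective : ∀ m n {r r′} → unary m ++ r ≡ unary n ++ r′ → m ≡ n × r ≡ r′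
  unary-injective zero    zero    refl = refl , refl
  unary-injective (suc m) (suc n) e    with unary-injective m n (∷-injectiveʳ e)
  ... | refl , e′ = refl , e′

  -- With one transition function for all relations, a pair of strings has a single state, from
  -- which `final` reads off the truth of every atom about the pair. By `δ-pad` this state does not
  -- change under further padding, so all pairs can be run to one common length.
  module Shared (γ nQ m : ℕ) (q₀ : Fin nQ) (δ : Fin nQ → Vec (Maybe (Fin γ)) 2 → Fin nQ)
                (final : Fin (suc m) → Fin nQ → Bool) (δ-pad : ∀ q → δ q (nothing ∷ nothing ∷ []) ≡ q) where

    σ : Signature
    σ = record { nrel = m ; arity = λ _ → 2 }

    automaton : Fin (suc m) → DFA (Vec (Maybe (Fin γ)) 2)
    automaton a = record { nQ = nQ ; start = q₀ ; δ = δ ; final = final a }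

    P : AutomaticPresentation σ
    P = record
      { γ    = γ
      ; dom  = record { nQ = 1 ; start = fz ; δ = λ q _ → q ; final = λ _ → true }
      ; rels = λ r → automaton (fs r)
      ; eqv  = automaton fz
      }

    𝒜 : Structure σ
    𝒜 = presented P

    stAt : ℕ → List (Fin γ) → List (Fin γ) → Fin nQ → Fin nQ
    stAt zero    u v q = q
    stAt (suc n) u v q = stAt n (tail' u) (tail' v) (δ q (head? u ∷ head? v ∷ []))

    stAt-suc : ∀ n u v q → stAt (suc n) u v q ≡ δ (stAt n u v q) (nth n u ∷ nth n v ∷ [])
    stAt-suc zero    u v q = refl
    stAt-suc (suc n) u v q = stAt-suc n (tail' u) (tail' v) (δ q (head? u ∷ head? v ∷ []))

    stAt-stable : ∀ n n′ u v q → length u ≤ n → length v ≤ n → length u ≤ n′ → length v ≤ n′ → stAt n u v q ≡ stAt n′ u v q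
    stAt-stable zero zero u v q a b c d = refl
    stAt-stable zero (suc n′) [] [] q a b c d = trans (stAt-stable zero n′ [] [] q z≤n z≤n z≤n z≤n) (cong (stAt n′ [] []) (sym (δ-pad q)))
    stAt-stable (suc n) zero [] [] q a b c d = trans (cong (stAt n [] []) (δ-pad q)) (stAt-stable n zero [] [] q z≤n z≤n z≤n z≤n)
    stAt-stable (suc n) (suc n′) u v q a b c d = stAt-stable n n′ (tail' u) (tail' v) _ (tl u a) (tl v b) (tl u c) (tl v d)
      where
      tl : ∀ {A : Set} {n} (u : List A) → length u ≤ suc n → length (tail' u) ≤ n
      tl []      _       = z≤n
      tl (_ ∷ u) (s≤s p) = p

    runDFA-convN : ∀ a n u v q → runDFA (automaton a) q (convN n (u ∷ v ∷ [])) ≡ stAt n u v q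
    runDFA-convN a zero    u v q = refl
    runDFA-convN a (suc n) u v q = runDFA-convN a n (tail' u) (tail' v) _

    accepts-stAt : ∀ a n u v → length u ≤ n → length v ≤ n → Accepts (automaton a) (conv (u ∷ v ∷ [])) ≡ (final a (stAt n u v q₀) ≡ true)
    accepts-stAt a n u v lu lv = cong (λ q → final a q ≡ true) (trans (runDFA-convN a (length u ⊔ (length v ⊔ 0)) u v q₀)
      (stAt-stable (length u ⊔ (length v ⊔ 0)) n u v q₀ (m≤m⊔n _ _) (≤-trans (m≤m⊔n _ 0) (m≤n⊔m (length u) _)) lu lv))

    ev : ∀ {k} → QF σ k → (Fin k → Fin k → Fin nQ) → Bool
    ev (eq i j)              q = final fz (q i j)
    ev (rel r (i ∷ j ∷ []))  q = final (fs r) (q i j)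
    ev (neg φ)               q = not (ev φ q)
    ev (and φ ψ)             q = ev φ q ∧ ev ψ q
    ev (or φ ψ)              q = ev φ q ∨ ev ψ q

    module _ {k} (ρ : Fin k → Elem P) (n : ℕ) (long : ∀ i → length (proj₁ (ρ i)) ≤ n) where

      states : Fin k → Fin k → Fin nQ
      states i j = stAt n (proj₁ (ρ i)) (proj₁ (ρ j)) q₀

      -- Both directions go together because negation exchanges them.
      ev-sound    : ∀ φ → ev φ states ≡ true → ⟦_⟧ 𝒜 φ ρ
      ev-complete : ∀ φ → ⟦_⟧ 𝒜 φ ρ → ev φ states ≡ true
      ev-sound (eq i j) e = subst (λ X → X) (sym (accepts-stAt fz n _ _ (long i) (long j))) e
      ev-sound (rel r (i ∷ j ∷ [])) e = subst (λ X → X) (sym (accepts-stAt (fs r) n _ _ (long i) (long j))) e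
      ev-sound (neg φ) e h with ev φ states | ev-complete φ h
      ev-sound (neg φ) () h | .true | refl
      ev-sound (and φ ψ) e with ev φ states in e₁ | ev ψ states in e₂
      ... | true | true = ev-sound φ e₁ , ev-sound ψ e₂
      ev-sound (or φ ψ) e with ev φ states in e₁ | ev ψ states in e₂
      ... | true  | _    = inj₁ (ev-sound φ e₁)
      ... | false | true = inj₂ (ev-sound ψ e₂)
      ev-complete (eq i j) h = subst (λ X → X) (accepts-stAt fz n _ _ (long i) (long j)) h
      ev-complete (rel r (i ∷ j ∷ [])) h = subst (λ X → X) (accepts-stAt (fs r) n _ _ (long i) (long j)) h
      ev-complete (neg φ) h with ev φ states in e
      ... | true  = ⊥-elim (h (ev-sound φ e))
      ... | false = refl
      ev-complete (and φ ψ) (h , h′) rewrite ev-complete φ h = ev-complete ψ h′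
      ev-complete (or φ ψ) (inj₁ h) rewrite ev-complete φ h = refl
      ev-complete (or φ ψ) (inj₂ h) with ev φ states
      ... | true  = refl
      ... | false = ev-complete ψ h

    -- The code is prefix-free. The arbitrary remainders make the induction pass through `and` and
    -- `or`, whose operands are merely concatenated.
    encQF-injective : ∀ {k} (φ ψ : QF σ k) {r r′} → encQF φ ++ r ≡ encQF ψ ++ r′ → φ ≡ ψ × r ≡ r′
    encQF-injective (eq i j) (eq i′ j′) {r} {r′} e
      with unary-injective (toℕ i) (toℕ i′) (trans (sym (++-assoc (unary (toℕ i)) _ r)) (trans (∷-injectiveʳ (∷-injectiveʳ (∷-injectiveʳ e))) (++-assoc (unary (toℕ i′)) _ r′)))
    ... | i≡ , e′ with unary-injective (toℕ j) (toℕ j′) e′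
    ... | j≡ , r≡ = cong₂ eq (toℕ-injective i≡) (toℕ-injective j≡) , r≡
    encQF-injective (rel a (i ∷ j ∷ [])) (rel a′ (i′ ∷ j′ ∷ [])) {r} {r′} e
      with unary-injective (toℕ a) (toℕ a′) (trans (sym (++-assoc (unary (toℕ a)) _ r)) (trans (∷-injectiveʳ (∷-injectiveʳ (∷-injectiveʳ e))) (++-assoc (unary (toℕ a′)) _ r′)))
    ... | a≡ , e₁ with unary-injective (toℕ i) (toℕ i′) (trans (sym (++-assoc (unary (toℕ i)) _ r)) (trans e₁ (++-assoc (unary (toℕ i′)) _ r′)))
    ... | i≡ , e₂ with unary-injective (toℕ j) (toℕ j′) (trans (sym (++-assoc (unary (toℕ j)) _ r)) (trans e₂ (++-assoc (unary (toℕ j′)) _ r′)))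
    ... | j≡ , r≡ with toℕ-injective a≡ | toℕ-injective i≡ | toℕ-injective j≡
    ... | refl | refl | refl = refl , r≡
    encQF-injective (neg φ) (neg ψ) e with encQF-injective φ ψ (∷-injectiveʳ (∷-injectiveʳ (∷-injectiveʳ e)))
    ... | refl , r≡ = refl , r≡
    encQF-injective (and φ ψ) (and φ′ ψ′) {r} {r′} e
      with encQF-injective φ φ′ (trans (sym (++-assoc (encQF φ) _ r)) (trans (∷-injectiveʳ (∷-injectiveʳ (∷-injectiveʳ e))) (++-assoc (encQF φ′) _ r′)))
    ... | refl , e′ with encQF-injective ψ ψ′ e′
    ... | refl , r≡ = refl , r≡
    encQF-injective (or φ ψ) (or φ′ ψ′) {r} {r′} e
      with encQF-injective φ φ′ (trans (sym (++-assoc (encQF φ) _ r)) (trans (∷-injectiveʳ (∷-injectiveʳ (∷-injectiveʳ e))) (++-assoc (encQF φ′) _ r′)))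
    ... | refl , e′ with encQF-injective ψ ψ′ e′
    ... | refl , r≡ = refl , r≡

    encSentence-injective : ∀ (s s′ : Σ₁Sentence σ) → encSentence s ≡ encSentence s′ → s ≡ s′
    encSentence-injective (k , φ) (k′ , ψ) e with unary-injective k k′ e
    ... | refl , e′ with encQF-injective φ ψ (cong (_++ []) e′)
    ... | refl , _ = refl

-- Satisfiability as reachability, and Savitch's recursion on digit patterns

module Savitch where

  open import Defs
  open FiniteTypes
  open Presentation
  open import Data.Nat using (ℕ; zero; suc; _+_; _*_; _∸_; _^_; _≤_; _<_; z≤n; s≤s)
  open import Data.Nat.Properties
  open import Data.Nat.Induction using (<-rec)
  open import Data.Fin using (Fin; toℕ; fromℕ; fromℕ<; inject₁; funToFin; finToFun) renaming (zero to fz; suc to fs)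
  open import Data.Fin.Properties using (toℕ<n; toℕ-fromℕ; toℕ-fromℕ<; toℕ-inject₁; toℕ-injective; pigeonhole; finToFun-funToFin) renaming (_≟_ to _≟F_)
  open import Data.Bool using (Bool; true; false; not; _∧_; _∨_; if_then_else_)
  open import Data.Bool.Properties using (∨-zeroʳ; ∧-identityʳ)
  open import Data.Maybe using (Maybe; just; nothing)
  open import Data.List using (List; []; _∷_; length; _++_; reverse; replicate; _ʳ++_; foldr; tabulate)
  open import Data.List.Properties using (length-++; length-reverse; length-replicate; length-tabulate; ʳ++-defn; reverse-involutive; ++-identityʳ; length-ʳ++; ++-assoc)
  open import Data.List.Relation.Binary.Pointwise using (Pointwise; []; _∷_)
  open import Data.List.Relation.Unary.All using (All; []; _∷_)
  open import Data.List.Relation.Unary.All.Properties using (replicate⁺)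
  open import Data.Vec as V using (Vec; []; _∷_)
  open import Data.Product using (∃; _×_; _,_; proj₁; proj₂)
  open import Data.Sum using (inj₁; inj₂)
  open import Data.Empty using (⊥-elim)
  open import Function using (_∘_)
  open import Relation.Nullary using (yes; no)
  open import Relation.Nullary.Decidable using (⌊_⌋)
  open import Relation.Binary.PropositionalEquality

  ∧-true : ∀ {a b} → a ∧ b ≡ true → a ≡ true × b ≡ true
  ∧-true {true} {true} _ = refl , refl

  true-∧ : ∀ {a b} → a ≡ true → b ≡ true → a ∧ b ≡ true
  true-∧ refl refl = refl

  module Walks {V : Set} (_⟶_ : V → V → Set) where

    data Walk : ℕ → V → V → Set where
      []  : ∀ {s} → Walk 0 s s
      _∷_ : ∀ {n s m t} → s ⟶ m → Walk n m t → Walk (suc n) s t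

    split : ∀ a {b s t} → Walk (a + b) s t → ∃ λ m → Walk a s m × Walk b m t
    split zero    w       = _ , [] , w
    split (suc a) (e ∷ w) with split a w
    ... | m , u , v = m , e ∷ u , v

    join : ∀ {a b s m t} → Walk a s m → Walk b m t → Walk (a + b) s t
    join []      w = w
    join (e ∷ u) w = e ∷ join u w

    node : ∀ {n s t} → Walk n s t → Fin (suc n) → V
    node {s = s} w       fz     = s
    node         (e ∷ w) (fs i) = node w i

    suffix : ∀ {n s t} (w : Walk n s t) i → ∃ λ n′ → n′ + toℕ i ≡ n × Walk n′ (node w i) t
    suffix {n} w fz = n , +-identityʳ n , w
    suffix (e ∷ w) (fs i) with suffix w i
    ... | n′ , n≡ , u = n′ , trans (+-suc n′ (toℕ i)) (cong suc n≡) , u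

    prefix : ∀ {n s t} (w : Walk n s t) i → Walk (toℕ i) s (node w i)
    prefix w       fz     = []
    prefix (e ∷ w) (fs i) = e ∷ prefix w i

    module _ {N : ℕ} (code : V → Fin N) (Good : V → Set) (closed : ∀ {s t} → s ⟶ t → Good t)
             (inj : ∀ {s t} → Good s → Good t → code s ≡ code t → s ≡ t) where

      node-good : ∀ {n s t} → Good s → (w : Walk n s t) → ∀ i → Good (node w i)
      node-good g w       fz     = g
      node-good g (e ∷ w) (fs i) = node-good (closed e) w i

      -- In a walk with more than N steps two nodes have the same code by the pigeonhole principle,
      -- and the segment between them is cut out. `Good` confines injectivity of the code to the
      -- nodes that occur, here the digit strings of the right length.
      shorten : ∀ {s t} → Good s → ∀ n → Walk n s t → ∃ λ n′ → n′ ≤ N × Walk n′ s t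
      shorten {s} {t} g = <-rec (λ n → Walk n s t → ∃ λ n′ → n′ ≤ N × Walk n′ s t) reduce
        where
        reduce : ∀ n → (∀ {n₁} → n₁ < n → Walk n₁ s t → ∃ λ n′ → n′ ≤ N × Walk n′ s t) → Walk n s t → ∃ λ n′ → n′ ≤ N × Walk n′ s t
        reduce n rec w with n ≤? N
        ... | yes n≤N = n , n≤N , w
        ... | no n≰N with pigeonhole (≤-trans (≰⇒> n≰N) (n≤1+n n)) (code ∘ node w)
        ... | i , j , i<j , same with suffix w j
        ... | n′ , n≡ , u = rec shorter (join (prefix w i) (subst (λ v → Walk n′ v t) (sym (inj (node-good g w i) (node-good g w j) same)) u))
          where
          shorter : toℕ i + n′ < n
          shorter = ≤-trans (s≤s (≤-reflexive (+-comm (toℕ i) n′))) (≤-trans (≤-reflexive (sym (+-suc n′ (toℕ i)))) (≤-trans (+-monoʳ-≤ n′ i<j) (≤-reflexive n≡)))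

  module Configurations (γ nQ m : ℕ) (q₀ : Fin nQ) (δ : Fin nQ → Vec (Maybe (Fin γ)) 2 → Fin nQ)
                (final : Fin (suc m) → Fin nQ → Bool) (δ-pad : ∀ q → δ q (nothing ∷ nothing ∷ []) ≡ q) where

    open Shared γ nQ m q₀ δ final δ-pad

    private
      F : Finite (Maybe (Fin γ) × Fin nQ)
      F = fin× (finMaybe (finFin γ)) (finFin nQ)

    nd : ℕ
    nd = suc (size F)

    -- A digit stands for a phase bit, for the next letter of a string, or for an automaton state.
    -- Digit zero is phase 0, a dummy letter, and the initial state.
    D : Set
    D = Fin nd

    digit : Maybe (Fin γ) → Fin nQ → D
    digit l q = fs (enc F (l , q))

    letterD : D → Maybe (Maybe (Fin γ))
    letterD fz     = nothing
    letterD (fs i) = just (proj₁ (dec F i))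

    stateD : D → Fin nQ
    stateD fz     = q₀
    stateD (fs i) = proj₂ (dec F i)

    phase : D → Bool
    phase fz     = false
    phase (fs _) = true

    letter-digit : ∀ l q → letterD (digit l q) ≡ just l
    letter-digit l q = cong (just ∘ proj₁) (dec-enc F (l , q))

    state-digit : ∀ l q → stateD (digit l q) ≡ q
    state-digit l q = cong proj₂ (dec-enc F (l , q))

    hd : List D → D
    hd []      = fz
    hd (x ∷ _) = x

    at : List D → ℕ → D
    at []       _       = fz
    at (x ∷ xs) zero    = x
    at (x ∷ xs) (suc n) = at xs n

    -- A dummy letter leaves the state alone, so the first edge, out of α, only guesses the first
    -- letters.
    δ̂ : Fin nQ → Maybe (Maybe (Fin γ)) → Maybe (Maybe (Fin γ)) → Fin nQ
    δ̂ q (just a) (just b) = δ q (a ∷ b ∷ [])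
    δ̂ q _        _        = q

    check : D → D → D → D → Bool
    check x y s t = ⌊ stateD t ≟F δ̂ (stateD s) (letterD x) (letterD y) ⌋

    -- A guessed string does not resume after its end, and the target of an edge holds no dummy.
    compat : Maybe (Maybe (Fin γ)) → Maybe (Maybe (Fin γ)) → Bool
    compat _              nothing         = false
    compat (just nothing) (just (just _)) = false
    compat _              _               = true

    mono : D → D → Bool
    mono x y = compat (letterD x) (letterD y)

    -- The states of the atoms are listed in the order in which the postfix evaluation meets them,
    -- that is, with the second operand first; `skip φ` passes over those of φ.
    skip : ∀ {k} → QF σ k → List D → List D
    skip (eq _ _)  S = tail' S
    skip (rel _ _) S = tail' S
    skip (neg φ)   S = skip φ S
    skip (and φ ψ) S = skip φ (skip ψ S)
    skip (or φ ψ)  S = skip φ (skip ψ S)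

    -- `f` transforms the state of an atom before it is judged. Taking for `f` the effect of the
    -- letters still to come, one can move the judgement backwards along a walk.
    valF : ∀ {k} → QF σ k → (Fin k → Fin k → Fin nQ → Fin nQ) → List D → Bool
    valF (eq i j)             f S = final fz (f i j (stateD (hd S)))
    valF (rel r (i ∷ j ∷ [])) f S = final (fs r) (f i j (stateD (hd S)))
    valF (neg φ)              f S = not (valF φ f S)
    valF (and φ ψ)            f S = valF φ f (skip ψ S) ∧ valF ψ f S
    valF (or φ ψ)             f S = valF φ f (skip ψ S) ∨ valF ψ f S

    val : ∀ {k} → QF σ k → List D → Bool
    val φ = valF φ (λ _ _ q → q)

    okc : ∀ {k} → QF σ k → List D → List D → List D → Bool
    okc (eq i j)             ls S T = check (at ls (toℕ i)) (at ls (toℕ j)) (hd S) (hd T)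
    okc (rel r (i ∷ j ∷ [])) ls S T = check (at ls (toℕ i)) (at ls (toℕ j)) (hd S) (hd T)
    okc (neg φ)              ls S T = okc φ ls S T
    okc (and φ ψ)            ls S T = okc φ ls (skip ψ S) (skip ψ T) ∧ okc ψ ls S T
    okc (or φ ψ)             ls S T = okc φ ls (skip ψ S) (skip ψ T) ∧ okc ψ ls S T

    lts : ℕ → List D → List D → List D
    lts zero    S ls = ls
    lts (suc n) S ls = lts n (tail' S) (hd S ∷ ls)

    dropD : ℕ → List D → List D
    dropD zero    S = S
    dropD (suc n) S = dropD n (tail' S)

    monos : ℕ → List D → List D → Bool → Bool
    monos zero    S T b = b
    monos (suc n) S T b = monos n (tail' S) (tail' T) (b ∧ mono (hd S) (hd T))

    -- An edge into phase 1 ends the guessing: φ must evaluate to true at S, unless S is in phase 1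
    -- already. An edge within phase 0 reads the letters held by S and guesses those of T.
    verdict : Bool → Bool → Bool → Bool → Bool → Bool
    verdict pS pT mo v o = if pT then pS ∨ v else not pS ∧ (mo ∧ o)

    checkE : ∀ {k} → QF σ k → List D → List D → Bool
    checkE {k} φ S T = verdict (phase (hd S)) (phase (hd T)) (monos k (tail' S) (tail' T) true)
      (val φ (dropD k (tail' S))) (okc φ (lts k (tail' S) []) (dropD k (tail' S)) (dropD k (tail' T)))

    Block : Set
    Block = List D × List D × List D

    -- Replays one decision of the search. A chosen digit extends the midpoint M, which is kept
    -- reversed. A zero selects the first half, so that the midpoint becomes the target; any other
    -- digit selects the second half, so that it becomes the source.
    place : Bool × D → Block → Block
    place (false , d)    (S , T , M) = S , T , d ∷ M
    place (true  , fz)   (S , T , M) = S , M ʳ++ [] , []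
    place (true  , fs _) (S , T , M) = M ʳ++ [] , T , []

    lower : D → D
    lower fz     = fz
    lower (fs d) = inject₁ d

    down : ℕ → D → (D → Bool) → Bool
    down zero    d f = f d
    down (suc n) d f = f d ∨ down n (lower d) f

    top : D
    top = fromℕ (size F)

    c₁ : D
    c₁ = digit nothing q₀

    module _ {k} (φ : QF σ k) (ℓ : ℕ) where

      -- Exactly 2 ^ d steps can always be required because ω carries a loop.
      α ω : List D
      α = replicate ℓ fz
      ω = digit nothing q₀ ∷ tail' α

      cur : List (Bool × D) → Block
      cur = foldr place (α , ω , [])

      leaf : Block → Bool
      leaf (S , T , _) = checkE φ S T

      -- kind false: existential digit; kind true: universal choice between the two halves of a walk
      dfs : List Bool → List (Bool × D) → Bool
      dfs []           p = leaf (cur p)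
      dfs (false ∷ ks) p = down (toℕ top) top (λ d → dfs ks ((false , d) ∷ p))
      -- The second half comes first: a universal digit then goes from `c₁` down to `fz`, and like
      -- an existential digit it ends at zero.
      dfs (true ∷ ks)  p = dfs ks ((true , c₁) ∷ p) ∧ dfs ks ((true , fz) ∷ p)

      kinds : ℕ → List Bool → List Bool
      kinds zero    ks = true ∷ ks
      kinds (suc n) ks = false ∷ kinds n ks

      pattern′ : ℕ → List Bool
      pattern′ zero    = []
      pattern′ (suc d) = kinds ℓ (pattern′ d)

      down-intro : ∀ n d f x → toℕ d ≡ n → toℕ x ≤ n → f x ≡ true → down n d f ≡ true
      down-intro zero    fz     f fz     _ _ e = e
      down-intro (suc n) (fs d) f x      d≡n x≤ e with m≤n⇒m<n∨m≡n x≤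
      ... | inj₁ (s≤s x≤n) rewrite down-intro n (inject₁ d) f x (trans (toℕ-inject₁ d) (suc-injective d≡n)) x≤n e = ∨-zeroʳ (f (fs d))
      ... | inj₂ x≡ with toℕ-injective (trans x≡ (sym d≡n))
      ... | refl rewrite e = refl

      down-elim : ∀ n d f → down n d f ≡ true → ∃ λ x → f x ≡ true
      down-elim zero    d f e = d , e
      down-elim (suc n) d f e with f d in e₀
      ... | true  = d , e₀
      ... | false = down-elim n (lower d) f e

      R : ℕ → List D → List D → Set
      R zero    S T = checkE φ S T ≡ true
      R (suc d) S T = ∃ λ m → length m ≡ ℓ × R d S m × R d m T

      mutual
        -- The decisions p matter only through the endpoints `cur p` that they encode; therefore
        -- induction on the depth suffices.
        dfs-elim : ∀ d p {S T} → cur p ≡ (S , T , []) → dfs (pattern′ d) p ≡ true → R d S T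
        dfs-elim zero    p c e = subst (λ b → leaf b ≡ true) c e
        dfs-elim (suc d) p c e = kinds-elim d ℓ p c (+-identityʳ ℓ) e

        kinds-elim : ∀ d n p {S T M} → cur p ≡ (S , T , M) → n + length M ≡ ℓ → dfs (kinds n (pattern′ d)) p ≡ true → R (suc d) S T
        kinds-elim d zero p {M = M} c len e with ∧-true e
        ... | e₁ , e₂ = M ʳ++ [] , trans (length-ʳ++ M) (trans (+-identityʳ _) len) ,
          dfs-elim d ((true , fz) ∷ p) (cong (place (true , fz)) c) e₂ , dfs-elim d ((true , c₁) ∷ p) (cong (place (true , c₁)) c) e₁
        kinds-elim d (suc n) p {M = M} c len e with down-elim (toℕ top) top (λ d′ → dfs (kinds n (pattern′ d)) ((false , d′) ∷ p)) e
        ... | x , e′ = kinds-elim d n ((false , x) ∷ p) (cong (place (false , x)) c) (trans (+-suc n (length M)) len) e′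

      mutual
        dfs-intro : ∀ d p {S T} → cur p ≡ (S , T , []) → R d S T → dfs (pattern′ d) p ≡ true
        dfs-intro zero    p c r = subst (λ b → leaf b ≡ true) (sym c) r
        dfs-intro (suc d) p c (m , len , r₁ , r₂) = kinds-intro d ℓ p m c len (sym refl) r₁ r₂

        -- The midpoint is split into the digits M chosen so far, reversed, and the digits `ds`
        -- still to be chosen.
        kinds-intro : ∀ d n p ds {S T M m} → cur p ≡ (S , T , M) → length ds ≡ n → M ʳ++ ds ≡ m →
                      R d S m → R d m T → dfs (kinds n (pattern′ d)) p ≡ true
        kinds-intro d zero p [] c len refl r₁ r₂ =
          true-∧ (dfs-intro d ((true , c₁) ∷ p) (cong (place (true , c₁)) c) r₂) (dfs-intro d ((true , fz) ∷ p) (cong (place (true , fz)) c) r₁)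
        kinds-intro d (suc n) p (x ∷ ds) c len m≡ r₁ r₂ =
          down-intro (toℕ top) top (λ d′ → dfs (kinds n (pattern′ d)) ((false , d′) ∷ p)) x refl (≤-trans (≤-pred (toℕ<n x)) (≤-reflexive (sym (toℕ-fromℕ (size F))))) (kinds-intro d n ((false , x) ∷ p) ds (cong (place (false , x)) c) (suc-injective len) m≡ r₁ r₂)

      Zero : List D → Set
      Zero = All (_≡ fz)

      zero-hd : ∀ {S} → Zero S → hd S ≡ fz
      zero-hd []      = refl
      zero-hd (e ∷ _) = e

      zero-tail : ∀ {S} → Zero S → Zero (tail' S)
      zero-tail []      = []
      zero-tail (_ ∷ z) = z

      zero-dropD : ∀ n {S} → Zero S → Zero (dropD n S)
      zero-dropD zero    z = z
      zero-dropD (suc n) z = zero-dropD n (zero-tail z)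

      zero-lts : ∀ n {S ls} → Zero S → Zero ls → Zero (lts n S ls)
      zero-lts zero    z z′ = z′
      zero-lts (suc n) z z′ = zero-lts n (zero-tail z) (zero-hd z ∷ z′)

      zero-at : ∀ {S} → Zero S → ∀ i → at S i ≡ fz
      zero-at []      i       = refl
      zero-at (e ∷ z) zero    = e
      zero-at (e ∷ z) (suc i) = zero-at z i

      Reads : QF σ k → (Fin k → Fin k → Fin nQ) → List D → Set
      Reads (eq i j)             q S = stateD (hd S) ≡ q i j
      Reads (rel r (i ∷ j ∷ [])) q S = stateD (hd S) ≡ q i j
      Reads (neg ψ)              q S = Reads ψ q S
      Reads (and ψ χ)            q S = Reads χ q S × Reads ψ q (skip χ S)
      Reads (or ψ χ)             q S = Reads χ q S × Reads ψ q (skip χ S)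

      reads-val : ∀ ψ {q S} f → Reads ψ q S → valF ψ f S ≡ ev ψ (λ i j → f i j (q i j))
      reads-val (eq i j)             f e = cong (final fz ∘ f i j) e
      reads-val (rel r (i ∷ j ∷ [])) f e = cong (final (fs r) ∘ f i j) e
      reads-val (neg ψ)              f e = cong not (reads-val ψ f e)
      reads-val (and ψ χ)            f (e , e′) = cong₂ _∧_ (reads-val ψ f e′) (reads-val χ f e)
      reads-val (or ψ χ)             f (e , e′) = cong₂ _∨_ (reads-val ψ f e′) (reads-val χ f e)

      zero-skip : ∀ (ψ : QF σ k) {S} → Zero S → Zero (skip ψ S)
      zero-skip (eq i j)  z = zero-tail z
      zero-skip (rel r v) z = zero-tail z
      zero-skip (neg ψ)   z = zero-skip ψ z
      zero-skip (and ψ χ) z = zero-skip ψ (zero-skip χ z)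
      zero-skip (or ψ χ)  z = zero-skip ψ (zero-skip χ z)

      zero-reads : ∀ ψ {S} → Zero S → Reads ψ (λ _ _ → q₀) S
      zero-reads (eq i j)             z = cong stateD (zero-hd z)
      zero-reads (rel r (i ∷ j ∷ [])) z = cong stateD (zero-hd z)
      zero-reads (neg ψ)              z = zero-reads ψ z
      zero-reads (and ψ χ)            z = zero-reads χ z , zero-reads ψ (zero-skip χ z)
      zero-reads (or ψ χ)             z = zero-reads χ z , zero-reads ψ (zero-skip χ z)

      valF-cong : ∀ ψ {f g} → (∀ i j q → f i j q ≡ g i j q) → ∀ S → valF {k} ψ f S ≡ valF ψ g S
      valF-cong (eq i j)             e S = cong (final fz) (e i j _)
      valF-cong (rel r (i ∷ j ∷ [])) e S = cong (final (fs r)) (e i j _)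
      valF-cong (neg ψ)              e S = cong not (valF-cong ψ e S)
      valF-cong (and ψ χ)            e S = cong₂ _∧_ (valF-cong ψ e _) (valF-cong χ e S)
      valF-cong (or ψ χ)             e S = cong₂ _∨_ (valF-cong ψ e _) (valF-cong χ e S)

      check-sound : ∀ x y s t → check x y s t ≡ true → stateD t ≡ δ̂ (stateD s) (letterD x) (letterD y)
      check-sound x y s t e with stateD t ≟F δ̂ (stateD s) (letterD x) (letterD y)
      ... | yes p = p

      check-complete : ∀ x y s t → stateD t ≡ δ̂ (stateD s) (letterD x) (letterD y) → check x y s t ≡ true
      check-complete x y s t e with stateD t ≟F δ̂ (stateD s) (letterD x) (letterD y)
      ... | yes p = refl
      ... | no np = ⊥-elim (np e)

      -- To judge T by the future `f` is to judge S by one letter followed by `f`. Quantification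
      -- over all `f` lets this be iterated along a walk.
      okc-sound : ∀ (ψ : QF σ k) ls S T → okc ψ ls S T ≡ true → ∀ (f : Fin k → Fin k → Fin nQ → Fin nQ) →
        valF ψ f T ≡ valF ψ (λ i j q → f i j (δ̂ q (letterD (at ls (toℕ i))) (letterD (at ls (toℕ j))))) S
      okc-sound (eq i j) ls S T o f = cong (final fz ∘ f i j) (check-sound (at ls (toℕ i)) (at ls (toℕ j)) (hd S) (hd T) o)
      okc-sound (rel r (i ∷ j ∷ [])) ls S T o f = cong (final (fs r) ∘ f i j) (check-sound (at ls (toℕ i)) (at ls (toℕ j)) (hd S) (hd T) o)
      okc-sound (neg ψ) ls S T o f = cong not (okc-sound ψ ls S T o f)
      okc-sound (and ψ χ) ls S T o f with ∧-true o
      ... | o₁ , o₂ = cong₂ _∧_ (okc-sound ψ ls _ _ o₁ f) (okc-sound χ ls S T o₂ f)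
      okc-sound (or ψ χ) ls S T o f with ∧-true o
      ... | o₁ , o₂ = cong₂ _∨_ (okc-sound ψ ls _ _ o₁ f) (okc-sound χ ls S T o₂ f)

      okc-complete : ∀ ψ ls {q q′} S T → Reads ψ q S → Reads ψ q′ T →
        (∀ i j → q′ i j ≡ δ̂ (q i j) (letterD (at ls (toℕ i))) (letterD (at ls (toℕ j)))) → okc ψ ls S T ≡ true
      okc-complete (eq i j) ls S T r r′ e = check-complete (at ls (toℕ i)) (at ls (toℕ j)) (hd S) (hd T)
        (trans r′ (trans (e i j) (cong (λ q → δ̂ q (letterD (at ls (toℕ i))) (letterD (at ls (toℕ j)))) (sym r))))
      okc-complete (rel a (i ∷ j ∷ [])) ls S T r r′ e = check-complete (at ls (toℕ i)) (at ls (toℕ j)) (hd S) (hd T)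
        (trans r′ (trans (e i j) (cong (λ q → δ̂ q (letterD (at ls (toℕ i))) (letterD (at ls (toℕ j)))) (sym r))))
      okc-complete (neg ψ) ls S T r r′ e = okc-complete ψ ls S T r r′ e
      okc-complete (and ψ χ) ls S T (r₁ , r₂) (s₁ , s₂) e = true-∧ (okc-complete ψ ls _ _ r₂ s₂ e) (okc-complete χ ls S T r₁ s₁ e)
      okc-complete (or ψ χ) ls S T (r₁ , r₂) (s₁ , s₂) e = true-∧ (okc-complete ψ ls _ _ r₂ s₂ e) (okc-complete χ ls S T r₁ s₁ e)

      Mono : D → D → Set
      Mono x y = mono x y ≡ true

      monos-sound : ∀ n S T {b xs ys} → monos n S T b ≡ true → Pointwise Mono xs ys → b ≡ true × Pointwise Mono (lts n S xs) (lts n T ys)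
      monos-sound zero    S T e p = e , p
      monos-sound (suc n) S T {b} {xs} {ys} e p with mono (hd S) (hd T) in eq₁
      ... | true with monos-sound n (tail' S) (tail' T) e (eq₁ ∷ p)
      ... | e₁ , p₁ = proj₁ (∧-true e₁) , p₁
      monos-sound (suc n) S T {b} {xs} {ys} e p | false with monos-sound n (tail' S) (tail' T) {xs = []} {ys = []} e []
      ... | e₁ , _ with proj₂ (∧-true {b} e₁)
      ... | ()

      monos-complete : ∀ n S T b xs ys → length xs ≡ length ys → Pointwise Mono (lts n S xs) (lts n T ys) → monos n S T b ≡ b
      monos-complete zero    S T b xs ys l p = refl
      monos-complete (suc n) S T b xs ys l p = trans (monos-complete n (tail' S) (tail' T) _ (hd S ∷ xs) (hd T ∷ ys) (cong suc l) p)
        (trans (cong (b ∧_) (keep n (tail' S) (tail' T) (hd S) (hd T) l p)) (∧-identityʳ b))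
        where
        pw-++ : ∀ {xs ys} → length xs ≡ length ys → ∀ {x y} n S T → Pointwise Mono (lts n S (x ∷ xs)) (lts n T (y ∷ ys)) → Pointwise Mono (x ∷ xs) (y ∷ ys)
        pw-++ l zero S T p = p
        pw-++ l (suc n) S T p with pw-++ (cong suc l) n (tail' S) (tail' T) p
        ... | _ ∷ q = q
        keep : ∀ n S T x y {xs ys} → length xs ≡ length ys → Pointwise Mono (lts n S (x ∷ xs)) (lts n T (y ∷ ys)) → mono x y ≡ true
        keep n S T x y l p with pw-++ l n S T p
        ... | m ∷ _ = m

      length-lts : ∀ n S ls → length (lts n S ls) ≡ n + length ls
      length-lts zero    S ls = refl
      length-lts (suc n) S ls = trans (length-lts n (tail' S) (hd S ∷ ls)) (+-suc n (length ls))

      pw-at : ∀ {xs ys} → Pointwise Mono xs ys → ∀ i → i < length xs → Mono (at xs i) (at ys i)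
      pw-at (m ∷ p) zero    _        = m
      pw-at (m ∷ p) (suc i) (s≤s i<) = pw-at p i i<

      L : List D → Fin k → Maybe (Maybe (Fin γ))
      L S i = letterD (at (lts k (tail' S) []) (toℕ i))

      monos-L : ∀ S T → monos k (tail' S) (tail' T) true ≡ true → ∀ i → compat (L S i) (L T i) ≡ true
      monos-L S T e i = pw-at (proj₂ (monos-sound k (tail' S) (tail' T) {xs = []} {ys = []} e [])) (toℕ i)
        (≤-trans (toℕ<n i) (≤-reflexive (sym (trans (length-lts k (tail' S) []) (+-identityʳ k)))))

      compat-letter : ∀ x y → compat x y ≡ true → ∃ λ a → y ≡ just a
      compat-letter x (just a) _ = a , refl
      compat-letter nothing nothing ()
      compat-letter (just nothing) nothing ()
      compat-letter (just (just _)) nothing ()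

      compat-end : ∀ y → compat (just nothing) y ≡ true → y ≡ just nothing
      compat-end (just nothing) _ = refl

      _⟶_ : List D → List D → Set
      S ⟶ T = length T ≡ ℓ × checkE φ S T ≡ true

      open Walks _⟶_

      Walk→R : ∀ d {S T} → Walk (2 ^ d) S T → R d S T
      Walk→R zero    ((_ , e) ∷ []) = e
      Walk→R (suc d) w with split (2 ^ d) w
      ... | m , u , v = m , target (m^n>0 2 d) u , Walk→R d u , Walk→R d (subst (λ n → Walk n m _) (+-identityʳ (2 ^ d)) v)
        where
        -- A walk of positive length ends in the target of an edge, and edges keep the length ℓ;
        -- this is what the midpoint needs.
        target : ∀ {n S T} → 0 < n → Walk n S T → length T ≡ ℓ
        target _ ((l , _) ∷ []) = l
        target _ (_ ∷ w@(_ ∷ _)) = target (s≤s z≤n) w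

      R→Walk : ∀ d {S T} → length T ≡ ℓ → R d S T → Walk (2 ^ d) S T
      R→Walk zero    l r = (l , r) ∷ []
      R→Walk (suc d) l (m , lm , r₁ , r₂) = join (R→Walk d lm r₁) (subst (λ n → Walk n m _) (sym (+-identityʳ (2 ^ d))) (R→Walk d l r₂))

      dig-code : List D → Fin (nd ^ ℓ)
      dig-code S = funToFin {ℓ} {nd} (λ i → at S (toℕ i))

      at-ext : ∀ S T → length S ≡ length T → (∀ i → i < length S → at S i ≡ at T i) → S ≡ T
      at-ext []      []      l f = refl
      at-ext (x ∷ S) (y ∷ T) l f = cong₂ _∷_ (f 0 (s≤s z≤n)) (at-ext S T (suc-injective l) (λ i i< → f (suc i) (s≤s i<)))

      dig-code-injective : ∀ {S T} → length S ≡ ℓ → length T ≡ ℓ → dig-code S ≡ dig-code T → S ≡ T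
      dig-code-injective {S} {T} lS lT e = at-ext S T (trans lS (sym lT)) λ i i< →
        let j = fromℕ< (≤-trans i< (≤-reflexive lS)) in
        subst (λ n → at S n ≡ at T n) (toℕ-fromℕ< _)
          (trans (sym (finToFun-funToFin (λ i → at S (toℕ i)) j)) (trans (cong (λ c → finToFun {nd} {ℓ} c j) e) (finToFun-funToFin (λ i → at T (toℕ i)) j)))

      ω-loop : length ω ≡ ℓ → ω ⟶ ω
      ω-loop l = l , refl

      extend : ∀ {n} d {S} → length ω ≡ ℓ → Walk n S ω → Walk (n + d) S ω
      extend zero    l []      = []
      extend (suc d) l []      = ω-loop l ∷ extend d l []
      extend d       l (e ∷ w) = e ∷ extend d l w

      glue : Maybe (Maybe (Fin γ)) → List (Fin γ) → List (Fin γ)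
      glue (just (just a)) u = a ∷ u
      glue (just nothing)  u = []
      glue nothing         u = u

      NoDummy : List D → Set
      NoDummy S = ∀ i → ∃ λ a → L S i ≡ just a

      -- The strings recovered from a configuration on, where `f i` is the letter guessed there. By
      -- `ended` a string is empty where padding was guessed; this is needed when a letter is put in
      -- front one step earlier.
      record Witness (f : Fin k → Maybe (Maybe (Fin γ))) (ok : (Fin k → Fin k → Fin nQ → Fin nQ) → Set) : Set where
        field
          word  : Fin k → List (Fin γ)
          bound : ℕ
          ended : ∀ i → f i ≡ just nothing → word i ≡ []
          short : ∀ i → length (word i) ≤ bound
          holds : ok (λ i j → stAt bound (word i) (word j))
      open Witness

      -- The letters guessed at S are not read when the next edge leads to phase 1, so empty strings
      -- witness the present states.
      final-step : ∀ {S} f → val φ (dropD k (tail' S)) ≡ true → Witness f (λ g → valF φ g (dropD k (tail' S)) ≡ true)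
      final-step f e = record { word = λ _ → [] ; bound = 0 ; ended = λ _ _ → refl ; short = λ _ → z≤n ; holds = e }

      -- The strings are recovered from the end of the walk: each edge within phase 0 puts the
      -- letters of its source in front.
      walk-sound : ∀ {n S} → Walk n S ω → phase (hd S) ≡ false → NoDummy S → Witness (L S) (λ g → valF φ g (dropD k (tail' S)) ≡ true)
      walk-sound [] () nd
      walk-sound {S = S} (_∷_ {m = T} (_ , e) w) p nd rewrite p with phase (hd T) in pT
      ... | true  = final-step {S} (L S) e
      ... | false with ∧-true e
      ... | mo , ok = record
        { word  = λ i → glue (L S i) (word W i)
        ; bound = suc (bound W)
        ; ended = λ i ei → cong (λ l → glue l (word W i)) ei
        ; short = λ i → glue-length (L S i) (short W i)
        ; holds = trans (sym (trans (okc-sound φ (lts k (tail' S) []) (dropD k (tail' S)) (dropD k (tail' T)) ok (λ i j → stAt (bound W) (word W i) (word W j)))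
                  (valF-cong φ (λ i j q → advance i j q (L S i) (L S j) (nd i) (nd j) refl refl) (dropD k (tail' S))))) (holds W)
        }
        where
        W = walk-sound w pT (λ i → compat-letter (L S i) (L T i) (monos-L S T mo i))
        glue-length : ∀ l {u b} → length u ≤ b → length (glue l u) ≤ suc b
        glue-length (just (just a)) le = s≤s le
        glue-length (just nothing)  le = z≤n
        glue-length nothing         le = m≤n⇒m≤1+n le
        tail-glue : ∀ i l → L S i ≡ l → (∃ λ a → l ≡ just a) → tail' (glue l (word W i)) ≡ word W i
        tail-glue i (just (just a)) _ _ = refl
        -- If padding is read at S, then `compat` forces padding at T, so the remaining string is
        -- empty and equals the tail of the empty string.
        tail-glue i (just nothing)  e _ = sym (ended W i (compat-end (L T i) (trans (cong (λ l → compat l (L T i)) (sym e)) (monos-L S T mo i))))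
        tail-glue i nothing         _ (_ , ())
        advance : ∀ i j q l l′ → (∃ λ a → l ≡ just a) → (∃ λ a → l′ ≡ just a) → L S i ≡ l → L S j ≡ l′ →
          stAt (bound W) (word W i) (word W j) (δ̂ q l l′) ≡ stAt (suc (bound W)) (glue l (word W i)) (glue l′ (word W j)) q
        advance i j q (just a) (just b) x y e e′
          rewrite tail-glue i (just a) e x | tail-glue j (just b) e′ y = cong (λ v → stAt (bound W) (word W i) (word W j) (δ q v)) (cong₂ (λ c d → c ∷ d ∷ []) (hd-glue a) (hd-glue b))
          where
          hd-glue : ∀ a {u} → a ≡ head? (glue (just a) u)
          hd-glue nothing  = refl
          hd-glue (just a) = refl
        advance i j q nothing _ (_ , ()) y e e′
        advance i j q (just a) nothing x (_ , ()) e e′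

      zero-α : Zero α
      zero-α = replicate⁺ ℓ refl

      α-reads : Reads φ (λ _ _ → q₀) (dropD k (tail' α))
      α-reads = zero-reads φ (zero-dropD k (zero-tail zero-α))

      α-dummy : ∀ i → L α i ≡ nothing
      α-dummy i = cong letterD (zero-at (zero-lts k (zero-tail zero-α) []) (toℕ i))

      -- The dummies of α contribute no letters and all its states are initial. The condition
      -- `ω ≢ α` excludes the empty walk.
      start-sound : ∀ {n} → Walk n α ω → ω ≢ α → Witness (λ _ → nothing) (λ g → ev φ (λ i j → g i j q₀) ≡ true)
      start-sound w ne = go w refl
        where
        finish : ∀ {f} → Witness f (λ g → valF φ g (dropD k (tail' α)) ≡ true) → Witness (λ _ → nothing) (λ g → ev φ (λ i j → g i j q₀) ≡ true)
        finish W = record { word = word W ; bound = bound W ; ended = λ _ () ; short = short W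
                          ; holds = trans (sym (reads-val φ _ α-reads)) (holds W) }
        go : ∀ {n S} → Walk n S ω → S ≡ α → Witness (λ _ → nothing) (λ g → ev φ (λ i j → g i j q₀) ≡ true)
        go [] e = ⊥-elim (ne e)
        go (_∷_ {m = T} (_ , e) w) refl rewrite zero-hd zero-α with phase (hd T) in pT
        ... | true  = finish (final-step {α} (λ _ → nothing) e)
        ... | false with ∧-true e
        ... | mo , ok = finish {λ _ → nothing} record { word = word W ; bound = bound W ; ended = λ i () ; short = short W
            ; holds = trans (sym (trans (okc-sound φ (lts k (tail' α) []) (dropD k (tail' α)) (dropD k (tail' T)) ok (λ i j → stAt (bound W) (word W i) (word W j)))
                  (valF-cong φ (λ i j q → cong (stAt (bound W) (word W i) (word W j)) (cong₂ (δ̂ q) (α-dummy i) (α-dummy j))) (dropD k (tail' α))))) (holds W) }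
          where
          W = walk-sound w pT (λ i → compat-letter (L α i) (L T i) (monos-L α T mo i))

      sound : ∀ {n} → Walk n α ω → ω ≢ α → Holds 𝒜 (k , φ)
      sound w ne = let W = start-sound w ne in (λ i → word W i , refl) , ev-sound (λ i → word W i , refl) (bound W) (short W) φ (holds W)

      pw-intro : ∀ xs ys → length xs ≡ length ys → (∀ i → i < length xs → Mono (at xs i) (at ys i)) → Pointwise Mono xs ys
      pw-intro []       []       l f = []
      pw-intro (x ∷ xs) (y ∷ ys) l f = f 0 (s≤s z≤n) ∷ pw-intro xs ys (suc-injective l) (λ i i< → f (suc i) (s≤s i<))

      flat : QF σ k → (Fin k → Fin k → Fin nQ) → List D
      flat (eq i j)             q = digit nothing (q i j) ∷ []
      flat (rel r (i ∷ j ∷ [])) q = digit nothing (q i j) ∷ []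
      flat (neg ψ)              q = flat ψ q
      flat (and ψ χ)            q = flat χ q ++ flat ψ q
      flat (or ψ χ)             q = flat χ q ++ flat ψ q

      natoms : QF σ k → ℕ
      natoms (eq i j)  = 1
      natoms (rel r v) = 1
      natoms (neg ψ)   = natoms ψ
      natoms (and ψ χ) = natoms χ + natoms ψ
      natoms (or ψ χ)  = natoms χ + natoms ψ

      length-flat : ∀ ψ q → length (flat ψ q) ≡ natoms ψ
      length-flat (eq i j)             q = refl
      length-flat (rel r (i ∷ j ∷ [])) q = refl
      length-flat (neg ψ)              q = length-flat ψ q
      length-flat (and ψ χ)            q = trans (length-++ (flat χ q)) (cong₂ _+_ (length-flat χ q) (length-flat ψ q))
      length-flat (or ψ χ)             q = trans (length-++ (flat χ q)) (cong₂ _+_ (length-flat χ q) (length-flat ψ q))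

      skip-flat : ∀ ψ q r → skip ψ (flat ψ q ++ r) ≡ r
      skip-flat (eq i j)             q r = refl
      skip-flat (rel a (i ∷ j ∷ [])) q r = refl
      skip-flat (neg ψ)              q r = skip-flat ψ q r
      skip-flat (and ψ χ)            q r = trans (cong (skip ψ) (trans (cong (skip χ) (++-assoc (flat χ q) _ r)) (skip-flat χ q _))) (skip-flat ψ q r)
      skip-flat (or ψ χ)             q r = trans (cong (skip ψ) (trans (cong (skip χ) (++-assoc (flat χ q) _ r)) (skip-flat χ q _))) (skip-flat ψ q r)

      flat-reads : ∀ ψ q r → Reads ψ q (flat ψ q ++ r)
      flat-reads (eq i j)             q r = state-digit nothing _
      flat-reads (rel a (i ∷ j ∷ [])) q r = state-digit nothing _
      flat-reads (neg ψ)              q r = flat-reads ψ q r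
      flat-reads (and ψ χ)            q r rewrite ++-assoc (flat χ q) (flat ψ q) r | skip-flat χ q (flat ψ q ++ r) = flat-reads χ q _ , flat-reads ψ q r
      flat-reads (or ψ χ)             q r rewrite ++-assoc (flat χ q) (flat ψ q) r | skip-flat χ q (flat ψ q ++ r) = flat-reads χ q _ , flat-reads ψ q r

      lts-++ : ∀ ys r acc → lts (length ys) (ys ++ r) acc ≡ ys ʳ++ acc
      lts-++ []       r acc = refl
      lts-++ (y ∷ ys) r acc = lts-++ ys r (y ∷ acc)

      dropD-++ : ∀ ys r → dropD (length ys) (ys ++ r) ≡ r
      dropD-++ []       r = refl
      dropD-++ (y ∷ ys) r = dropD-++ ys r

      at-tabulate : ∀ {n} (f : Fin n → D) i → at (tabulate f) (toℕ i) ≡ f i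
      at-tabulate f fz     = refl
      at-tabulate f (fs i) = at-tabulate (f ∘ fs) i

      nth-end : ∀ t (u : List (Fin γ)) → nth t u ≡ nothing → nth (suc t) u ≡ nothing
      nth-end zero    []      e = refl
      nth-end (suc t) u       e = nth-end t (tail' u) e

      max-length : ∀ {n} (u : Fin n → List (Fin γ)) → ∃ λ N → ∀ i → length (u i) ≤ N
      max-length {zero}  u = 0 , λ ()
      max-length {suc n} u with max-length (u ∘ fs)
      ... | N , le = length (u fz) + N , λ { fz → m≤m+n _ N ; (fs i) → ≤-trans (le i) (m≤n+m N _) }

      -- A configuration needs one digit for the phase, one per variable for the letters, and one
      -- per atom for the states; the rest is filled with zeros.
      module _ (fits : suc k + natoms φ ≤ ℓ) where

        α-length : length α ≡ ℓ
        α-length = length-replicate ℓ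

        α-cons : ∀ n → suc k + natoms φ ≤ n → replicate n fz ≡ fz {size F} ∷ tail' (replicate n fz)
        α-cons (suc n) _ = refl

        ω-length : length ω ≡ ℓ
        ω-length = trans (cong length (sym (α-cons ℓ fits))) α-length

        ω≢α : ω ≢ α
        ω≢α e with trans e (α-cons ℓ fits)
        ... | ()

        module _ (u : Fin k → List (Fin γ)) where

          qAt : ℕ → Fin k → Fin k → Fin nQ
          qAt t i j = stAt t (u i) (u j) q₀

          letters : ℕ → List D
          letters t = tabulate (λ i → digit (nth t (u i)) q₀)

          rest : ℕ → List D
          rest t = flat φ (qAt t) ++ replicate (ℓ ∸ (suc k + natoms φ)) fz

          -- The letters are stored in reverse because `lts` collects them on a stack and thereby
          -- reverses them again.
          config : ℕ → List D
          config t = fz ∷ (reverse (letters t) ++ rest t)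

          length-letters : ∀ t → length (reverse (letters t)) ≡ k
          length-letters t = trans (length-reverse (letters t)) (length-tabulate _)

          config-length : ∀ t → length (config t) ≡ ℓ
          config-length t = trans (cong suc (trans (length-++ (reverse (letters t))) (cong₂ _+_ (length-letters t)
            (trans (length-++ (flat φ (qAt t))) (cong₂ _+_ (length-flat φ (qAt t)) (length-replicate _))))))
            (trans (cong suc (sym (+-assoc k (natoms φ) _))) (m+[n∸m]≡n fits))

          lts-config : ∀ t → lts k (tail' (config t)) [] ≡ letters t
          lts-config t = trans (cong (λ n → lts n (tail' (config t)) []) (sym (length-letters t)))
            (trans (lts-++ (reverse (letters t)) (rest t) []) (trans (ʳ++-defn (reverse (letters t))) (trans (++-identityʳ _) (reverse-involutive (letters t)))))

          dropD-config : ∀ t → dropD k (tail' (config t)) ≡ rest t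
          dropD-config t = trans (cong (λ n → dropD n (tail' (config t))) (sym (length-letters t))) (dropD-++ (reverse (letters t)) (rest t))

          L-config : ∀ t i → L (config t) i ≡ just (nth t (u i))
          L-config t i = trans (cong (λ ls → letterD (at ls (toℕ i))) (lts-config t)) (trans (cong letterD (at-tabulate _ i)) (letter-digit _ q₀))

          config-reads : ∀ t → Reads φ (qAt t) (dropD k (tail' (config t)))
          config-reads t = subst (Reads φ (qAt t)) (sym (dropD-config t)) (flat-reads φ (qAt t) _)

          monos-intro : ∀ S T → (∀ i → compat (L S i) (L T i) ≡ true) → monos k (tail' S) (tail' T) true ≡ true
          monos-intro S T f = monos-complete k (tail' S) (tail' T) true [] [] refl
            (pw-intro _ _ (trans (length-lts k (tail' S) []) (sym (length-lts k (tail' T) [])))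
              λ i i< → let i<k = ≤-trans i< (≤-reflexive (trans (length-lts k (tail' S) []) (+-identityʳ k))) in
                subst (λ n → Mono (at (lts k (tail' S) []) n) (at (lts k (tail' T) []) n)) (toℕ-fromℕ< i<k) (f (fromℕ< i<k)))

          compat-step : ∀ t i → compat (just (nth t (u i))) (just (nth (suc t) (u i))) ≡ true
          compat-step t i with nth t (u i) in e
          ... | just _ = refl
          ... | nothing rewrite nth-end t (u i) e = refl

          config-step : ∀ t → config t ⟶ config (suc t)
          config-step t = config-length (suc t) , true-∧
            (monos-intro (config t) (config (suc t)) (λ i → trans (cong₂ compat (L-config t i) (L-config (suc t) i)) (compat-step t i)))
            (okc-complete φ (lts k (tail' (config t)) []) _ _ (config-reads t) (config-reads (suc t))
              λ i j → trans (stAt-suc t (u i) (u j) q₀) (sym (cong₂ (δ̂ (qAt t i j)) (L-config t i) (L-config t j))))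

          first-step : α ⟶ config 0
          first-step = config-length 0 , trans (cong (λ d → not (phase d) ∧ (monos k (tail' α) (tail' (config 0)) true
              ∧ okc φ (lts k (tail' α) []) (dropD k (tail' α)) (dropD k (tail' (config 0))))) (zero-hd zero-α)) (true-∧
            (monos-intro α (config 0) (λ i → cong₂ compat (α-dummy i) (L-config 0 i)))
            (okc-complete φ (lts k (tail' α) []) _ _ α-reads (config-reads 0) λ i j → sym (cong₂ (δ̂ q₀) (α-dummy i) (α-dummy j))))

          last-step : ∀ t → ev φ (qAt t) ≡ true → config t ⟶ ω
          last-step t e = ω-length , trans (reads-val φ (λ _ _ q → q) (config-reads t)) e

          configs : ∀ t n → ev φ (qAt (n + t)) ≡ true → Walk (suc n) (config t) ω
          configs t zero    e = last-step t e ∷ []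
          configs t (suc n) e = config-step t ∷ configs (suc t) n (subst (λ s → ev φ (qAt s) ≡ true) (sym (+-suc n t)) e)

        -- Estimating the base by nd ≤ 2 ^ nd avoids logarithms; the resulting depth is still linear
        -- in ℓ.
        enough : nd ^ ℓ ≤ 2 ^ (nd * ℓ)
        enough = ≤-trans (^-monoˡ-≤ ℓ (n≤2^n nd)) (≤-reflexive (^-*-assoc 2 nd ℓ))
          where
          n≤2^n : ∀ n → n ≤ 2 ^ n
          n≤2^n zero    = z≤n
          n≤2^n (suc n) = ≤-trans (+-mono-≤ (m^n>0 2 n) (n≤2^n n)) (≤-reflexive (cong (2 ^ n +_) (sym (+-identityʳ (2 ^ n)))))

        -- The walk spelled out by a satisfying assignment is shortened to at most `nd ^ ℓ` steps
        -- and then prolonged at ω to the exact power of two.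
        complete : Holds 𝒜 (k , φ) → Walk (2 ^ (nd * ℓ)) α ω
        complete (ρ , h) =
          let u = λ i → proj₁ (ρ i)
              (N , le) = max-length u
              w = first-step u ∷ configs u 0 N (subst (λ t → ev φ (qAt u t) ≡ true) (sym (+-identityʳ N)) (ev-complete ρ N le φ h))
              (n , n≤ , w′) = shorten dig-code (λ S → length S ≡ ℓ) proj₁ dig-code-injective α-length _ w
          in subst (λ n → Walk n α ω) (m+[n∸m]≡n (≤-trans n≤ enough)) (extend (2 ^ (nd * ℓ) ∸ n) ω-length w′)

        savitch-sound : dfs (pattern′ (nd * ℓ)) [] ≡ true → Holds 𝒜 (k , φ)
        savitch-sound e = sound (R→Walk (nd * ℓ) ω-length (dfs-elim (nd * ℓ) [] refl e)) ω≢α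

        savitch-complete : Holds 𝒜 (k , φ) → dfs (pattern′ (nd * ℓ)) [] ≡ true
        savitch-complete h = dfs-intro (nd * ℓ) [] refl (Walk→R (nd * ℓ) (complete h))

-- The store of the decider and the parser for sentences

module DeciderState where

  open import Defs using (QF; eq; rel; neg; and; or; unary; encQF; encVars; head?)
  open FiniteTypes
  open StackPrograms
  open Presentation
  open Savitch
  open import Data.Nat using (ℕ; zero; suc; _+_; _≤_; z≤n; s≤s)
  open import Data.Nat.Properties
  open import Data.Fin using (Fin; toℕ; #_) renaming (zero to fz; suc to fs)
  open import Data.Bool using (Bool; true; false; not; _∧_)
  open import Data.Bool.Properties using (∧-zeroʳ)
  open import Data.Maybe using (Maybe; just; nothing; is-just)
  open import Data.List using (List; []; _∷_; length; _++_; map; _ʳ++_)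
  open import Data.List.Properties using (++-assoc; ++-identityʳ; ∷-injectiveʳ)
  open import Data.Vec using (Vec; []; _∷_; lookup)
  open import Data.Product using (_×_; _,_; proj₂)
  open import Data.Sum using (_⊎_; inj₁; inj₂)
  open import Function using (_∘_)
  open import Relation.Binary.PropositionalEquality

  module Decider (γ nQ m : ℕ) (q₀ : Fin nQ) (δ : Fin nQ → Vec (Maybe (Fin γ)) 2 → Fin nQ)
                (final : Fin (suc m) → Fin nQ → Bool) (δ-pad : ∀ q → δ q (nothing ∷ nothing ∷ []) ≡ q) where

    open Shared γ nQ m q₀ δ final δ-pad using (σ; encQF-injective)
    open Configurations γ nQ m q₀ δ final δ-pad using (nd; D)

    -- `ent κ d a` is a decision on the search path: its kind, the current digit, and the truth
    -- value accumulated over the earlier digits. `vo v o` pairs the value of a subformula with the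
    -- check that its states were updated correctly.
    data Sy : Set where
      bit              : Bool → Sy
      one sep tneg tand tor : Sy
      atom             : Fin (suc m) → Sy
      dig              : D → Sy
      ent              : Bool → D → Bool → Sy
      kind             : Bool → Sy
      vo               : Bool → Bool → Sy

    finSy : Finite Sy
    finSy = retract (fin⊎ finBool (fin⊎ (finFin 5) (fin⊎ (finFin (suc m)) (fin⊎ (finFin nd) (fin⊎ (fin× finBool (fin× (finFin nd) finBool)) (fin⊎ finBool (fin× finBool finBool)))))))
      to from λ { (bit _) → refl ; one → refl ; sep → refl ; tneg → refl ; tand → refl ; tor → refl ; (atom _) → refl ; (dig _) → refl
                ; (ent _ _ _) → refl ; (kind _) → refl ; (vo _ _) → refl }
      where
      Sum : Set
      Sum = Bool ⊎ Fin 5 ⊎ Fin (suc m) ⊎ Fin nd ⊎ (Bool × Fin nd × Bool) ⊎ Bool ⊎ (Bool × Bool)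
      to : Sy → Sum
      to (bit b)     = inj₁ b
      to one         = inj₂ (inj₁ (# 0))
      to sep         = inj₂ (inj₁ (# 1))
      to tneg        = inj₂ (inj₁ (# 2))
      to tand        = inj₂ (inj₁ (# 3))
      to tor         = inj₂ (inj₁ (# 4))
      to (atom a)    = inj₂ (inj₂ (inj₁ a))
      to (dig d)     = inj₂ (inj₂ (inj₂ (inj₁ d)))
      to (ent κ d a) = inj₂ (inj₂ (inj₂ (inj₂ (inj₁ (κ , d , a)))))
      to (kind κ)    = inj₂ (inj₂ (inj₂ (inj₂ (inj₂ (inj₁ κ)))))
      to (vo v o)    = inj₂ (inj₂ (inj₂ (inj₂ (inj₂ (inj₂ (v , o))))))
      from : Sum → Sy
      from (inj₁ b) = bit b
      from (inj₂ (inj₁ fz)) = one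
      from (inj₂ (inj₁ (fs fz))) = sep
      from (inj₂ (inj₁ (fs (fs fz)))) = tneg
      from (inj₂ (inj₁ (fs (fs (fs fz))))) = tand
      from (inj₂ (inj₁ (fs (fs (fs (fs _)))))) = tor
      from (inj₂ (inj₂ (inj₁ a))) = atom a
      from (inj₂ (inj₂ (inj₂ (inj₁ d)))) = dig d
      from (inj₂ (inj₂ (inj₂ (inj₂ (inj₁ (κ , d , a)))))) = ent κ d a
      from (inj₂ (inj₂ (inj₂ (inj₂ (inj₂ (inj₁ κ)))))) = kind κ
      from (inj₂ (inj₂ (inj₂ (inj₂ (inj₂ (inj₂ (v , o))))))) = vo v o

    open Language 20 Sy public

    -- `tok` and `tk2` hold the formula and the part of it already read, `lc` the length ℓ, `ks` and
    -- `k2` the number of variables, `pend` the subformulas still expected, `bad` an error flag.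
    -- `rs` lists the kinds of the levels still to be entered, `path` the decisions made. `ss`,
    -- `ts`, `ms` are source, target and midpoint; `ls` and `l2` the letters; `xa` and `ya` the
    -- letters of an atom; `vs` the values; `md` the mode or the result of the search.
    record St : Set where
      field inp tok tk2 lc ks k2 pend bad rs path aux ss ts ms ls l2 vs rg md xa ya : List Sy
    open St public

    toVec : St → Store
    toVec s = inp s ∷ tok s ∷ tk2 s ∷ lc s ∷ ks s ∷ k2 s ∷ pend s ∷ bad s ∷ rs s ∷ path s ∷ aux s ∷ ss s ∷ ts s ∷ ms s ∷ ls s ∷ l2 s
              ∷ vs s ∷ rg s ∷ md s ∷ xa s ∷ ya s ∷ []

    inp# tok# tk2# lc# ks# k2# pend# bad# rs# path# aux# ss# ts# ms# ls# l2# vs# rg# md# xa# ya# : Fin 21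
    inp# = # 0
    tok# = # 1
    tk2# = # 2
    lc# = # 3
    ks# = # 4
    k2# = # 5
    pend# = # 6
    bad# = # 7
    rs# = # 8
    path# = # 9
    aux# = # 10
    ss# = # 11
    ts# = # 12
    ms# = # 13
    ls# = # 14
    l2# = # 15
    vs# = # 16
    rg# = # 17
    md# = # 18
    xa# = # 19
    ya# = # 20

    bits : List Bool → List Sy
    bits = map bit

    ones : ℕ → List Sy → List Sy
    ones zero    xs = xs
    ones (suc n) xs = one ∷ ones n xs

    ones-shift : ∀ n xs → ones n (one ∷ xs) ≡ one ∷ ones n xs
    ones-shift zero    xs = refl
    ones-shift (suc n) xs = cong (one ∷_) (ones-shift n xs)

    ones-ʳ++ : ∀ n xs ys → ones n xs ʳ++ ys ≡ xs ʳ++ ones n ys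
    ones-ʳ++ zero    xs ys = refl
    ones-ʳ++ (suc n) xs ys = trans (ones-ʳ++ n xs (one ∷ ys)) (cong (xs ʳ++_) (ones-shift n ys))

    ones-+ : ∀ a b xs → ones a (ones b xs) ≡ ones (a + b) xs
    ones-+ zero    b xs = refl
    ones-+ (suc a) b xs = cong (one ∷_) (ones-+ a b xs)

    length-ones : ∀ n → length (ones n []) ≡ n
    length-ones zero    = refl
    length-ones (suc n) = cong suc (length-ones n)

    open Basics 20 one public

    isBit : Bool → Maybe Sy → Bool
    isBit true  (just (bit true))  = true
    isBit false (just (bit false)) = true
    isBit _     _                  = false

    isF isT : Tops → Bool
    isF v = isBit false (lookup v inp#)
    isT v = isBit true (lookup v inp#)

    fail : Prog
    fail = put bad# one

    guard : Prog → Prog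
    guard p = ifte (nonempty bad#) idle p

    rd : Prog → Prog → Prog
    rd p q = ifte isF (del inp# ⨾ p) (ifte isT (del inp# ⨾ q) fail)

    -- Each 1 moves a unit from `ks` to `k2`, and the closing 0 is accepted only while `ks` is
    -- nonempty; this tests that the index is below the number of variables.
    index : Prog
    index = while (λ v → isT v ∧ nonempty ks# v) (del inp# ⨾ put tok# one ⨾ del ks# ⨾ put k2# one)
          ⨾ ifte (λ v → isF v ∧ nonempty ks# v) (del inp# ⨾ put tok# sep ⨾ mv k2# ks#) fail

    relation : ∀ n → (Fin n → Fin (suc m)) → Prog
    relation zero    e = fail
    relation (suc n) e = rd (put tok# (atom (e fz))) (relation n (e ∘ fs))

    -- The input is in prefix notation, so counting the subformulas still expected replaces a
    -- parsing stack.
    node : Prog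
    node = del pend# ⨾ rd (rd (rd (put tok# (atom fz) ⨾ index ⨾ guard index) (relation m fs ⨾ guard (index ⨾ guard index)))
                              (rd (put tok# tneg ⨾ put pend# one) (put tok# tand ⨾ put pend# one ⨾ put pend# one)))
                          (rd (rd (put tok# tor ⨾ put pend# one ⨾ put pend# one) fail) fail)

    working : Tops → Bool
    working v = nonempty pend# v ∧ not (nonempty bad# v)

    parse : Prog
    parse = while isT (del inp# ⨾ put ks# one)
          ⨾ ifte isF (del inp# ⨾ put pend# one) fail
          ⨾ while working node
          ⨾ ifte (nonempty inp#) fail idle

    -- Pushing the tokens as they are read turns prefix into postfix notation. The second operand
    -- comes out first, in agreement with `skip`.
    toks : ∀ {k} → QF σ k → List Sy → List Sy
    toks (eq i j)             tk = sep ∷ ones (toℕ j) (sep ∷ ones (toℕ i) (atom fz ∷ tk))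
    toks (rel r (i ∷ j ∷ [])) tk = sep ∷ ones (toℕ j) (sep ∷ ones (toℕ i) (atom (fs r) ∷ tk))
    toks (neg φ)              tk = toks φ (tneg ∷ tk)
    toks (and φ ψ)            tk = toks ψ (toks φ (tand ∷ tk))
    toks (or φ ψ)             tk = toks ψ (toks φ (tor ∷ tk))

    module Runs (B : ℕ) where

      open Loops B public
      open Moves B public

      P : St → ℕ → List Bool → List Sy → St
      P s k In tk = record s { inp = bits In ; tok = tk ; ks = ones k [] ; k2 = [] ; bad = [] }

      Failed : St → Set
      Failed s = is-just (head? (bad s)) ≡ true

      -- A failure carries the proof that the input has no prefix of the required kind, since
      -- malformed words have to be rejected.
      data Res (k : ℕ) (p : Prog) (s : St) (In : List Bool) (tk : List Sy) {X : Set} (encode : X → List Bool) (emit : X → List Sy → List Sy) : Set where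
        parsed : ∀ x rest → In ≡ encode x ++ rest → p ⊢ toVec (P s k In tk) ⇒ toVec (P s k rest (emit x tk)) → Res k p s In tk encode emit
        failed : ∀ s′ → (∀ x rest → In ≢ encode x ++ rest) → p ⊢ toVec (P s k In tk) ⇒ toVec s′ → Failed s′ → Res k p s In tk encode emit

      record IndexBad (s : St) (k′ c : ℕ) (tk : List Sy) (In : List Bool) : Set where
        field
          s′    : St
          n     : ℕ
          never : ∀ (i : Fin k′) rest → In ≢ unary (toℕ i) ++ rest
          n≤    : n ≤ k′
          run   : Loop (λ v → isT v ∧ nonempty ks# v) (del inp# ⨾ put tok# one ⨾ del ks# ⨾ put k2# one) n
                    (toVec (record s { inp = bits In ; tok = tk ; ks = ones k′ [] ; k2 = ones c [] ; bad = [] })) (toVec s′)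
          ends  : isF (tops (toVec s′)) ∧ nonempty ks# (tops (toVec s′)) ≡ false

      record IndexGood (s : St) (k′ c : ℕ) (tk : List Sy) (In : List Bool) : Set where
        field
          i     : Fin k′
          rest  : List Bool
          d     : ℕ
          In≡   : In ≡ unary (toℕ i) ++ rest
          left  : toℕ i + suc d ≡ k′
          run   : Loop (λ v → isT v ∧ nonempty ks# v) (del inp# ⨾ put tok# one ⨾ del ks# ⨾ put k2# one) (toℕ i)
                    (toVec (record s { inp = bits In ; tok = tk ; ks = ones k′ [] ; k2 = ones c [] ; bad = [] }))
                    (toVec (record s { inp = bits (false ∷ rest) ; tok = ones (toℕ i) tk ; ks = ones (suc d) [] ; k2 = ones (toℕ i + c) [] ; bad = [] }))

      index-loop : ∀ s k′ c tk In → IndexGood s k′ c tk In ⊎ IndexBad s k′ c tk In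
      index-loop s zero c tk In = inj₂ record { s′ = record s { inp = bits In ; tok = tk ; ks = [] ; k2 = ones c [] ; bad = [] }
        ; never = λ () ; n≤ = z≤n ; run = stop (∧-zeroʳ (isBit true (head? (bits In)))) ; ends = ∧-zeroʳ (isBit false (head? (bits In))) }
      index-loop s (suc k′) c tk [] = inj₂ record { never = λ { fz _ () ; (fs _) _ () } ; n≤ = z≤n ; run = stop refl ; ends = refl }
      index-loop s (suc k′) c tk (false ∷ In) = inj₁ record { i = fz ; rest = In ; d = k′ ; In≡ = refl ; left = refl ; run = stop refl }
      index-loop s (suc k′) c tk (true ∷ In) with index-loop s k′ (suc c) (one ∷ tk) In
      ... | inj₂ b = inj₂ record { never = λ { fz _ () ; (fs i) rest e → never i rest (∷-injectiveʳ e) } ; n≤ = s≤s n≤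
                                 ; run = more refl acts run ; ends = ends }
        where
        open IndexBad b
      ... | inj₁ g = inj₁ record { i = fs i ; rest = rest ; d = d ; In≡ = cong (true ∷_) In≡ ; left = cong suc left
          ; run = more refl acts
                    (Loop-cast (cong₂ (λ t n → toVec (record s { inp = bits (false ∷ rest) ; tok = t ; ks = ones (suc d) [] ; k2 = ones n [] ; bad = [] }))
                      (ones-shift (toℕ i) tk) (+-suc (toℕ i) c)) run) }
        where open IndexGood g

      index-run : ∀ s k tk In → k ≤ B → Res k index s In tk {Fin k} (unary ∘ toℕ) (λ i tk → sep ∷ ones (toℕ i) tk)
      index-run s k tk In k≤B with index-loop s k 0 tk In
      ... | inj₁ g = parsed i rest In≡ (while (≤-trans i≤k k≤B) run ⨾ then′ refl (act ⨾ act ⨾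
              cast (cong (λ l → toVec (P′ l)) (trans (ones-ʳ++ (toℕ i + 0) [] (ones (suc d) []))
                     (trans (ones-+ (toℕ i + 0) (suc d) []) (cong (λ n → ones n []) (trans (cong (_+ suc d) (+-identityʳ (toℕ i))) left)))))
                (mv-run k2# ks# (λ ()) (toVec (record (P s k rest (sep ∷ ones (toℕ i) tk)) { ks = ones (suc d) [] ; k2 = ones (toℕ i + 0) [] }))
                  (≤-trans (≤-reflexive (trans (length-ones (toℕ i + 0)) (+-identityʳ _))) (≤-trans i≤k k≤B)))))
        where
        open IndexGood g
        i≤k : toℕ i ≤ k
        i≤k = ≤-trans (m≤m+n (toℕ i) (suc d)) (≤-reflexive left)
        P′ : List Sy → St
        P′ l = record (P s k rest (sep ∷ ones (toℕ i) tk)) { ks = l }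
      ... | inj₂ b = failed (record s′ { bad = one ∷ bad s′ }) never (while (≤-trans n≤ k≤B) run ⨾ else′ ends act) refl
        where open IndexBad b

      relation-run : ∀ n e s k tk In → Res k (relation n e) s In tk {Fin n} (unary ∘ toℕ) (λ r tk → atom (e r) ∷ tk)
      relation-run zero e s k tk In = failed _ (λ ()) act refl
      relation-run (suc n) e s k tk [] = failed _ (λ { fz _ () ; (fs _) _ () }) (else′ refl (else′ refl act)) refl
      relation-run (suc n) e s k tk (false ∷ In) = parsed fz In refl acts
      relation-run (suc n) e s k tk (true ∷ In) with relation-run n (e ∘ fs) s k tk In
      ... | parsed r rest refl x = parsed (fs r) rest refl (else′ refl (then′ refl (act ⨾ x)))
      ... | failed s′ nv x f = failed s′ (λ { fz _ () ; (fs r) rest refl → nv r rest refl }) (else′ refl (then′ refl (act ⨾ x))) f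

      -- The last hypothesis makes the remainder after the first part unique, so a failure of the
      -- second reader rules out every way of reading the pair.
      seq-run : ∀ {k p q s In tk X Y} {encode : X → List Bool} {emit : X → List Sy → List Sy} {encode′ : Y → List Bool} {emit′ : Y → List Sy → List Sy} →
        Res k p s In tk encode emit → (∀ In tk → Res k q s In tk encode′ emit′) →
        (∀ x x′ {r r′} → encode x ++ r ≡ encode x′ ++ r′ → r ≡ r′) →
        Res k (p ⨾ guard q) s In tk {X × Y} (λ (x , y) → encode x ++ encode′ y) (λ (x , y) tk → emit′ y (emit x tk))
      seq-run {tk = tk} {encode = encode} {emit} {encode′} (parsed x rest refl e) f det with f rest (emit x tk)
      ... | parsed y rest′ refl e′ = parsed (x , y) rest′ (sym (++-assoc (encode x) (encode′ y) rest′)) (e ⨾ else′ refl e′)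
      ... | failed s′ nv e′ fl = failed s′ (λ (x′ , y) r eq′ → nv y r (det x x′ (trans eq′ (++-assoc (encode x′) (encode′ y) r)))) (e ⨾ else′ refl e′) fl
      seq-run {encode = encode} {encode′ = encode′} (failed s′ nv e fl) f det =
        failed s′ (λ (x , y) r eq′ → nv x (encode′ y ++ r) (trans eq′ (++-assoc (encode x) (encode′ y) r))) (e ⨾ then′ fl act) fl

      encAll : ∀ {k p} → Vec (QF σ k) p → List Bool
      encAll []       = []
      encAll (φ ∷ φs) = encQF φ ++ encAll φs

      toksAll : ∀ {k p} → Vec (QF σ k) p → List Sy → List Sy
      toksAll []       tk = tk
      toksAll (φ ∷ φs) tk = toksAll φs (toks φ tk)

      N : St → ℕ → List Bool → ℕ → List Sy → St
      N s k In p tk = record (P s k In tk) { pend = ones p [] }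

      data Nodes (s : St) (k : ℕ) (In : List Bool) (p : ℕ) (tk : List Sy) : Set where
        parsed : ∀ (φs : Vec (QF σ k) p) rest n → In ≡ encAll φs ++ rest → n ≤ length In →
                 Loop working node n (toVec (N s k In p tk)) (toVec (N s k rest 0 (toksAll φs tk))) → Nodes s k In p tk
        failed : ∀ s′ n → (∀ (φs : Vec (QF σ k) p) rest → In ≢ encAll φs ++ rest) → n ≤ suc (length In) →
                 Loop working node n (toVec (N s k In p tk)) (toVec s′) → Failed s′ → Nodes s k In p tk

      halt : ∀ s′ → Failed s′ → working (tops (toVec s′)) ≡ false
      halt s′ f = trans (cong (λ b → is-just (head? (pend s′)) ∧ not b) f) (∧-zeroʳ _)

      node-failed : ∀ {s k In p tk} s′ → node ⊢ toVec (N s k In (suc p) tk) ⇒ toVec s′ → Failed s′ →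
                    (∀ (φ : QF σ k) r → In ≢ encQF φ ++ r) → Nodes s k In (suc p) tk
      node-failed s′ x f nv = failed s′ 1 (λ { (φ ∷ φs) rest e → nv φ (encAll φs ++ rest) (trans e (++-assoc (encQF φ) (encAll φs) rest)) })
        (s≤s z≤n) (more refl x (stop (halt s′ f))) f

      suffix-≤ : ∀ (xs : List Bool) {ys n} → length (xs ++ ys) ≤ n → length ys ≤ n
      suffix-≤ []       le = le
      suffix-≤ (x ∷ xs) le = suffix-≤ xs (≤-trans (n≤1+n _) le)

      node-atom : ∀ {s k p tk} (φ : QF σ k) rest → node ⊢ toVec (N s k (encQF φ ++ rest) (suc p) tk) ⇒ toVec (N s k rest p (toks φ tk)) →
                  suc (length rest) ≤ length (encQF φ ++ rest) →
                  Nodes s k rest p (toks φ tk) → Nodes s k (encQF φ ++ rest) (suc p) tk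
      node-atom φ rest x le (parsed φs r n refl n≤ l) = parsed (φ ∷ φs) r (suc n) (sym (++-assoc (encQF φ) (encAll φs) r)) (≤-trans (s≤s n≤) le) (more refl x l)
      node-atom φ rest x le (failed s′ n nv n≤ l f) = failed s′ (suc n)
        (λ { (ψ ∷ φs) r e → nv φs r (proj₂ (encQF-injective φ ψ (trans e (++-assoc (encQF ψ) (encAll φs) r)))) }) (s≤s (≤-trans n≤ le)) (more refl x l) f

      unary-det : ∀ {k} (i j : Fin k) {r r′} → unary (toℕ i) ++ r ≡ unary (toℕ j) ++ r′ → r ≡ r′
      unary-det i j e = proj₂ (unary-injective (toℕ i) (toℕ j) e)

      -- Generalised to p formulas in succession, because a connective with two operands replaces
      -- one expected formula by two. The fuel `f` bounds the input, which does shrink.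
      nodes : ∀ f s k In p tk → length In ≤ f → k ≤ B → Nodes s k In p tk
      nodes f s k In zero tk le kB = parsed [] In 0 refl z≤n (stop refl)
      nodes f s k [] (suc p) tk le kB = node-failed _ acts refl λ { (eq _ _) r () ; (rel _ _) r () ; (neg _) r () ; (and _ _) r () ; (or _ _) r () }
      nodes f s k (true ∷ []) (suc p) tk le kB = node-failed _ acts refl
        λ { (eq _ _) r () ; (rel _ _) r () ; (neg _) r () ; (and _ _) r () ; (or _ _) r () }
      nodes f s k (true ∷ true ∷ In) (suc p) tk le kB = node-failed _ acts refl
        λ { (eq _ _) r () ; (rel _ _) r () ; (neg _) r () ; (and _ _) r () ; (or _ _) r () }
      nodes f s k (true ∷ false ∷ []) (suc p) tk le kB = node-failed _ acts refl
        λ { (eq _ _) r () ; (rel _ _) r () ; (neg _) r () ; (and _ _) r () ; (or _ _) r () }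
      nodes f s k (true ∷ false ∷ true ∷ In) (suc p) tk le kB = node-failed _ acts refl
        λ { (eq _ _) r () ; (rel _ _) r () ; (neg _) r () ; (and _ _) r () ; (or _ _) r () }
      nodes (suc f) s k (true ∷ false ∷ false ∷ In) (suc p) tk (s≤s le) kB
        with nodes f s k In (suc (suc p)) (tor ∷ tk) (≤-trans (n≤1+n _) (≤-trans (n≤1+n _) le)) kB
      ... | parsed (φ ∷ ψ ∷ φs) rest n refl n≤ l = parsed (or φ ψ ∷ φs) rest (suc n)
              (cong (λ x → true ∷ false ∷ false ∷ (x ++ rest)) (sym (++-assoc (encQF φ) (encQF ψ) (encAll φs))))
              (s≤s (≤-trans n≤ (≤-trans (n≤1+n _) (n≤1+n _))))
              (more refl acts l)
      ... | failed s′ n nv n≤ l fl = failed s′ (suc n)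
              (λ { (or φ ψ ∷ φs) r e → nv (φ ∷ ψ ∷ φs) r (trans (∷-injectiveʳ (∷-injectiveʳ (∷-injectiveʳ e))) (cong (_++ r) (++-assoc (encQF φ) (encQF ψ) (encAll φs))))
                 ; (eq _ _ ∷ _) r () ; (rel _ _ ∷ _) r () ; (neg _ ∷ _) r () ; (and _ _ ∷ _) r () })
              (s≤s (≤-trans n≤ (s≤s (≤-trans (n≤1+n _) (n≤1+n _)))))
              (more refl acts l) fl
      nodes f s k (false ∷ []) (suc p) tk le kB = node-failed _ acts refl
        λ { (eq _ _) r () ; (rel _ _) r () ; (neg _) r () ; (and _ _) r () ; (or _ _) r () }
      nodes f s k (false ∷ false ∷ []) (suc p) tk le kB = node-failed _ acts refl
        λ { (eq _ _) r () ; (rel _ _) r () ; (neg _) r () ; (and _ _) r () ; (or _ _) r () }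
      nodes f s k (false ∷ true ∷ []) (suc p) tk le kB = node-failed _ acts refl
        λ { (eq _ _) r () ; (rel _ _) r () ; (neg _) r () ; (and _ _) r () ; (or _ _) r () }
      nodes (suc f) s k (false ∷ true ∷ false ∷ In) (suc p) tk (s≤s le) kB
        with nodes f s k In (suc p) (tneg ∷ tk) (≤-trans (n≤1+n _) (≤-trans (n≤1+n _) le)) kB
      ... | parsed (φ ∷ φs) rest n refl n≤ l = parsed (neg φ ∷ φs) rest (suc n) refl (s≤s (≤-trans n≤ (≤-trans (n≤1+n _) (n≤1+n _))))
              (more refl acts l)
      ... | failed s′ n nv n≤ l fl = failed s′ (suc n)
              (λ { (neg φ ∷ φs) r e → nv (φ ∷ φs) r (∷-injectiveʳ (∷-injectiveʳ (∷-injectiveʳ e)))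
                 ; (eq _ _ ∷ _) r () ; (rel _ _ ∷ _) r () ; (or _ _ ∷ _) r () ; (and _ _ ∷ _) r () })
              (s≤s (≤-trans n≤ (s≤s (≤-trans (n≤1+n _) (n≤1+n _)))))
              (more refl acts l) fl
      nodes (suc f) s k (false ∷ true ∷ true ∷ In) (suc p) tk (s≤s le) kB
        with nodes f s k In (suc (suc p)) (tand ∷ tk) (≤-trans (n≤1+n _) (≤-trans (n≤1+n _) le)) kB
      ... | parsed (φ ∷ ψ ∷ φs) rest n refl n≤ l = parsed (and φ ψ ∷ φs) rest (suc n)
              (cong (λ x → false ∷ true ∷ true ∷ (x ++ rest)) (sym (++-assoc (encQF φ) (encQF ψ) (encAll φs))))
              (s≤s (≤-trans n≤ (≤-trans (n≤1+n _) (n≤1+n _))))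
              (more refl acts l)
      ... | failed s′ n nv n≤ l fl = failed s′ (suc n)
              (λ { (and φ ψ ∷ φs) r e → nv (φ ∷ ψ ∷ φs) r (trans (∷-injectiveʳ (∷-injectiveʳ (∷-injectiveʳ e))) (cong (_++ r) (++-assoc (encQF φ) (encQF ψ) (encAll φs))))
                 ; (eq _ _ ∷ _) r () ; (rel _ _ ∷ _) r () ; (neg _ ∷ _) r () ; (or _ _ ∷ _) r () })
              (s≤s (≤-trans n≤ (s≤s (≤-trans (n≤1+n _) (n≤1+n _)))))
              (more refl acts l) fl
      nodes (suc f) s k (false ∷ false ∷ false ∷ In) (suc p) tk (s≤s le) kB
        with seq-run (index-run (record s { pend = ones p [] }) k (atom fz ∷ tk) In kB) (λ In tk → index-run (record s { pend = ones p [] }) k tk In kB) unary-det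
      ... | failed s′ nv x fl = node-failed s′ (act ⨾ then′ refl (act ⨾ then′ refl (act ⨾ then′ refl (act ⨾ act ⨾ x)))) fl
              λ { (eq i j) r e → nv (i , j) r (∷-injectiveʳ (∷-injectiveʳ (∷-injectiveʳ e))) ; (rel _ _) r () ; (neg _) r () ; (and _ _) r () ; (or _ _) r () }
      ... | parsed (i , j) rest refl x = node-atom (eq i j) rest (act ⨾ then′ refl (act ⨾ then′ refl (act ⨾ then′ refl (act ⨾ act ⨾ x))))
              (s≤s (suffix-≤ (false ∷ false ∷ (unary (toℕ i) ++ unary (toℕ j))) ≤-refl))
              (nodes f s k rest p _ (suffix-≤ (false ∷ false ∷ (unary (toℕ i) ++ unary (toℕ j))) le) kB)
      nodes (suc f) s k (false ∷ false ∷ true ∷ In) (suc p) tk (s≤s le) kB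
        with seq-run (relation-run m fs (record s { pend = ones p [] }) k tk In)
               (λ In tk → seq-run (index-run (record s { pend = ones p [] }) k tk In kB) (λ In tk → index-run (record s { pend = ones p [] }) k tk In kB) unary-det) unary-det
      ... | failed s′ nv x fl = node-failed s′ (act ⨾ then′ refl (act ⨾ then′ refl (act ⨾ else′ refl (then′ refl (act ⨾ x))))) fl
              λ { (rel a (i ∷ j ∷ [])) r e → nv (a , i , j) r (trans (∷-injectiveʳ (∷-injectiveʳ (∷-injectiveʳ e)))
                                               (cong (λ z → (unary (toℕ a) ++ unary (toℕ i) ++ z) ++ r) (++-identityʳ (unary (toℕ j)))))
                ; (eq _ _) r () ; (neg _) r () ; (and _ _) r () ; (or _ _) r () }
      ... | parsed (a , i , j) rest e x =
        subst (λ I → Nodes s k (false ∷ false ∷ true ∷ I) (suc p) tk) (sym e′)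
          (node-atom (rel a (i ∷ j ∷ [])) rest (act ⨾ then′ refl (act ⨾ then′ refl (act ⨾ else′ refl (then′ refl (act ⨾ subst (λ I → relation m fs ⨾ guard (index ⨾ guard index) ⊢ toVec (P (record s { pend = ones p [] }) k I tk) ⇒ _) e′ x)))))
            (s≤s (suffix-≤ (false ∷ false ∷ word) ≤-refl))
            (nodes f s k rest p _ (suffix-≤ (false ∷ false ∷ word) (≤-trans (≤-reflexive (cong (λ I → suc (suc (length I))) (sym e′))) le)) kB))
        where
        word = unary (toℕ a) ++ encVars (i ∷ j ∷ [])
        e′ : In ≡ word ++ rest
        e′ = trans e (cong (λ z → (unary (toℕ a) ++ unary (toℕ i) ++ z) ++ rest) (sym (++-identityʳ (unary (toℕ j)))))

-- The programs of the decider and the postfix evaluation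

module DeciderPrograms where

  open import Defs using (QF; eq; rel; neg; and; or; encQF; head?; tail')
  open FiniteTypes
  open StackPrograms
  open Presentation
  open Savitch
  open DeciderState
  open import Data.Nat using (ℕ; zero; suc; _+_; _≤_; _<_; s≤s)
  open import Data.Nat.Properties
  open import Data.Fin using (Fin; toℕ) renaming (zero to fz; suc to fs)
  open import Data.Fin.Properties using (toℕ<n)
  open import Data.Bool using (Bool; true; false; not; _∧_; _∨_; if_then_else_)
  open import Data.Maybe using (Maybe; just; nothing)
  open import Data.List using (List; []; _∷_; length; map; _ʳ++_)
  open import Data.List.Properties using (length-map; length-++)
  open import Data.Vec using (Vec; []; _∷_; lookup)
  open import Data.Product using (∃₂; _×_; _,_)
  open import Relation.Binary.PropositionalEquality

  module Execution (γ nQ m : ℕ) (q₀ : Fin nQ) (δ : Fin nQ → Vec (Maybe (Fin γ)) 2 → Fin nQ)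
                (final : Fin (suc m) → Fin nQ → Bool) (δ-pad : ∀ q → δ q (nothing ∷ nothing ∷ []) ≡ q) where

    open Shared γ nQ m q₀ δ final δ-pad using (σ)
    open Configurations γ nQ m q₀ δ final δ-pad using (nd; D; phase; stateD; hd; at; check; mono; skip; val; okc; lower; top; c₁)
    open Decider γ nQ m q₀ δ final δ-pad

    dg : Maybe Sy → D
    dg (just (dig d)) = d
    dg _              = fz

    fst? snd? : Maybe Sy → Bool
    fst? (just (vo v _)) = v
    fst? _               = false
    snd? (just (vo _ o)) = o
    snd? _               = false

    isOne isSep isAtom isNeg : Maybe Sy → Bool
    isOne (just one) = true
    isOne _          = false
    isSep (just sep) = true
    isSep _          = false
    isAtom (just (atom _)) = true
    isAtom _               = false
    isNeg (just tneg) = true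
    isNeg _           = false

    final? : Maybe Sy → D → Bool
    final? (just (atom a)) d = final a (stateD d)
    final? _               d = false

    -- The checks are conjoined under `or` too: all states must be updated correctly, whatever the
    -- value of the formula.
    combine : Maybe Sy → Maybe Sy → Maybe Sy → Sy
    combine (just tand) (just (vo v o)) (just (vo v′ o′)) = vo (v ∧ v′) (o ∧ o′)
    combine _           (just (vo v o)) (just (vo v′ o′)) = vo (v ∨ v′) (o ∧ o′)
    combine _           _               _                 = one

    shift : Prog
    shift = copy tok# tk2# ⨾ del tok#

    -- A postfix evaluator. Indices fetch letters onto `xa`, an atom takes one state each from `ss`
    -- and `ts`, and connectives act on the top of `vs`. A single pass yields the value at S and the
    -- check of the edge from S to T.
    lookupP atomP negP binP tokStep : Prog
    lookupP = shift ⨾ while (λ v → isOne (lookup v tok#)) (copy tok# tk2# ⨾ del tok# ⨾ copy ls# l2# ⨾ del ls#)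
            ⨾ act (λ v → push xa# (dig (dg (lookup v ls#)))) ⨾ mv l2# ls#
    atomP = copy xa# ya# ⨾ del xa#
          ⨾ act (λ v → push vs# (vo (final? (lookup v tok#) (dg (lookup v ss#)))
                                    (check (dg (lookup v ya#)) (dg (lookup v xa#)) (dg (lookup v ss#)) (dg (lookup v ts#)))))
          ⨾ del xa# ⨾ del ya# ⨾ del ss# ⨾ del ts# ⨾ shift
    negP = act (λ v → push rg# (vo (not (fst? (lookup v vs#))) (snd? (lookup v vs#)))) ⨾ del vs# ⨾ copy rg# vs# ⨾ del rg# ⨾ shift
    binP = copy vs# rg# ⨾ del vs# ⨾ act (λ v → push rg# (combine (lookup v tok#) (lookup v rg#) (lookup v vs#)))
         ⨾ del vs# ⨾ copy rg# vs# ⨾ del rg# ⨾ del rg# ⨾ shift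
    tokStep = ifte (λ v → isSep (lookup v tok#)) lookupP (ifte (λ v → isAtom (lookup v tok#)) atomP (ifte (λ v → isNeg (lookup v tok#)) negP binP))

    letterStep letterP : Prog
    letterStep = put k2# one ⨾ del ks# ⨾ act (λ v → push ls# (dig (dg (lookup v ss#))))
               ⨾ act (λ v → push rg# (vo true (snd? (lookup v vs#) ∧ mono (dg (lookup v ss#)) (dg (lookup v ts#)))))
               ⨾ del vs# ⨾ copy rg# vs# ⨾ del rg# ⨾ del ss# ⨾ del ts#
    letterP = while (nonempty ks#) letterStep ⨾ mv k2# ks#

    verdict? : Maybe Sy → Maybe Sy → Bool
    verdict? (just (vo pS pT)) (just (vo v mo)) = if pT then pS ∨ v else not pS ∧ mo
    verdict? _                 _                = false

    verdictP checkP : Prog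
    verdictP = copy vs# rg# ⨾ del vs# ⨾ act (λ v → push rg# (vo (fst? (lookup v rg#)) (snd? (lookup v vs#) ∧ snd? (lookup v rg#)))) ⨾ del vs#
             ⨾ del md# ⨾ act (λ v → push md# (bit (verdict? (lookup v vs#) (lookup v rg#)))) ⨾ del vs# ⨾ del rg# ⨾ del rg#
    checkP = act (λ v → push vs# (vo (phase (dg (lookup v ss#))) (phase (dg (lookup v ts#))))) ⨾ del ss# ⨾ del ts# ⨾ put vs# (vo true true)
           ⨾ letterP ⨾ while (nonempty tok#) tokStep ⨾ mv tk2# tok# ⨾ verdictP
           ⨾ clear ss# ⨾ clear ts# ⨾ clear ms# ⨾ clear ls#

    -- Only decisions are stored along the search. A leaf rebuilds its two configurations from α and
    -- ω by replaying the path from the root, and erases them afterwards.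
    fillStep fillP scanStep leafP : Prog
    fillStep = put ss# (dig fz) ⨾ put ts# (dig fz) ⨾ put aux# one ⨾ del lc#
    fillP = while (nonempty lc#) fillStep ⨾ mv aux# lc# ⨾ del ts# ⨾ put ts# (dig c₁)

    isDigit isFirst : Maybe Sy → Bool
    isDigit (just (ent false _ _)) = true
    isDigit _                      = false
    isFirst (just (ent true (fs _) _)) = true
    isFirst _                          = false

    digitOf : Maybe Sy → D
    digitOf (just (ent _ d _)) = d
    digitOf _                  = fz

    scanStep = copy aux# path#
      ⨾ ifte (λ v → isDigit (lookup v aux#)) (act (λ v → push ms# (dig (digitOf (lookup v aux#)))))
          (ifte (λ v → isFirst (lookup v aux#)) (clear ss# ⨾ mv ms# ss#) (clear ts# ⨾ mv ms# ts#))
      ⨾ del aux#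
    leafP = fillP ⨾ mv path# aux# ⨾ while (nonempty aux#) scanStep ⨾ checkP

    start : Bool → D
    start true  = c₁
    start false = top

    next : Bool → D → D
    next true  d = fz
    next false d = lower d

    merge : Bool → Bool → Bool → Bool
    merge true  a v = a ∧ v
    merge false a v = a ∨ v

    enter : Maybe Sy → Sy
    -- The accumulator starts at κ itself: true is neutral for the universal kind, false for the
    -- existential one.
    enter (just (kind κ)) = ent κ (start κ) κ
    enter _               = one

    isLast : Maybe Sy → Bool
    isLast (just (ent _ fz _)) = true
    isLast _                   = false

    value : Maybe Sy → Bool
    value (just (bit b)) = b
    value _              = false

    advance : Maybe Sy → Maybe Sy → Sy
    advance (just (ent κ d a)) v = ent κ (next κ d) (merge κ a (value v))
    advance _                  _ = one

    result : Maybe Sy → Maybe Sy → Sy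
    result (just (ent κ d a)) v = bit (merge κ a (value v))
    result _                  _ = one

    kindOf : Maybe Sy → Sy
    kindOf (just (ent κ _ _)) = kind κ
    kindOf _                  = one

    -- `md` shows `one` while the search descends and the value of the subtree just finished while
    -- it ascends.
    upP dfsStep : Prog
    upP = ifte (λ v → isLast (lookup v path#))
            (act (λ v → push rg# (result (lookup v path#) (lookup v md#))) ⨾ del md# ⨾ copy rg# md# ⨾ del rg#
              ⨾ act (λ v → push rs# (kindOf (lookup v path#))) ⨾ del path#)
            (act (λ v → push rg# (advance (lookup v path#) (lookup v md#))) ⨾ del path# ⨾ copy rg# path# ⨾ del rg# ⨾ del md# ⨾ put md# one)
    dfsStep = ifte (λ v → isOne (lookup v md#))
                (ifte (nonempty rs#) (act (λ v → push path# (enter (lookup v rs#))) ⨾ del rs#) leafP)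
                upP

    searching : Tops → Bool
    searching v = isOne (lookup v md#) ∨ nonempty path# v

    measureP blockP setupP preludeP decide : Prog
    measureP = while (nonempty inp#) (put lc# one ⨾ copy inp# aux# ⨾ del inp#) ⨾ mv aux# inp#
    -- The universal kind is pushed first and so lies below the ℓ existential digits of its level.
    blockP = put rs# (kind true) ⨾ while (nonempty lc#) (put rs# (kind false) ⨾ put aux# one ⨾ del lc#) ⨾ mv aux# lc#

    repeatP : ℕ → Prog → Prog
    repeatP zero    p = idle
    repeatP (suc n) p = p ⨾ repeatP n p

    setupP = while (nonempty lc#) (put l2# one ⨾ put aux# one ⨾ del lc#) ⨾ mv aux# lc#
           ⨾ while (nonempty l2#) (repeatP nd blockP ⨾ del l2#) ⨾ put md# one
    preludeP = measureP ⨾ parse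
    decide = preludeP ⨾ ifte (nonempty bad#) idle (setupP ⨾ while searching dfsStep)

    accepting : Tops → Bool
    accepting v = isBit true (lookup v md#) ∧ not (nonempty bad# v)

    digs : List D → List Sy
    digs = map dig

    -- The tokens of φ as they lie on `tk2` once they have been read.
    revTok : ∀ {k} → QF σ k → List Sy → List Sy
    revTok (eq i j)             tk = atom fz ∷ ones (toℕ i) (sep ∷ ones (toℕ j) (sep ∷ tk))
    revTok (rel r (i ∷ j ∷ [])) tk = atom (fs r) ∷ ones (toℕ i) (sep ∷ ones (toℕ j) (sep ∷ tk))
    revTok (neg φ)              tk = tneg ∷ revTok φ tk
    revTok (and φ ψ)            tk = tand ∷ revTok φ (revTok ψ tk)
    revTok (or φ ψ)             tk = tor ∷ revTok φ (revTok ψ tk)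

    revTok-ʳ++ : ∀ {k} (φ : QF σ k) tk rest → revTok φ tk ʳ++ rest ≡ tk ʳ++ toks φ rest
    revTok-ʳ++ (eq i j) tk rest = trans (ones-ʳ++ (toℕ i) (sep ∷ ones (toℕ j) (sep ∷ tk)) (atom fz ∷ rest)) (ones-ʳ++ (toℕ j) (sep ∷ tk) _)
    revTok-ʳ++ (rel r (i ∷ j ∷ [])) tk rest = trans (ones-ʳ++ (toℕ i) (sep ∷ ones (toℕ j) (sep ∷ tk)) (atom (fs r) ∷ rest)) (ones-ʳ++ (toℕ j) (sep ∷ tk) _)
    revTok-ʳ++ (neg φ) tk rest = revTok-ʳ++ φ tk (tneg ∷ rest)
    revTok-ʳ++ (and φ ψ) tk rest = trans (revTok-ʳ++ φ (revTok ψ tk) (tand ∷ rest)) (revTok-ʳ++ ψ tk _)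
    revTok-ʳ++ (or φ ψ) tk rest = trans (revTok-ʳ++ φ (revTok ψ tk) (tor ∷ rest)) (revTok-ʳ++ ψ tk _)

    toksteps : ∀ {k} → QF σ k → ℕ → ℕ
    toksteps (eq i j)  n = 3 + n
    toksteps (rel r v) n = 3 + n
    toksteps (neg φ)   n = toksteps φ (suc n)
    toksteps (and φ ψ) n = toksteps ψ (toksteps φ (suc n))
    toksteps (or φ ψ)  n = toksteps ψ (toksteps φ (suc n))

    toksteps-≤ : ∀ {k} (φ : QF σ k) n → toksteps φ n ≤ length (encQF φ) + n
    toksteps-≤ (eq i j)  n = s≤s (s≤s (s≤s (m≤n+m n _)))
    toksteps-≤ (rel r v) n = s≤s (s≤s (s≤s (m≤n+m n _)))
    toksteps-≤ (neg φ)   n = ≤-trans (toksteps-≤ φ (suc n)) (≤-trans (≤-reflexive (+-suc _ n)) (s≤s (≤-trans (n≤1+n _) (n≤1+n _))))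
    toksteps-≤ (and φ ψ) n = ≤-trans (toksteps-≤ ψ _) (≤-trans (+-monoʳ-≤ (length (encQF ψ)) (toksteps-≤ φ (suc n)))
      (≤-trans (≤-reflexive (trans (sym (+-assoc (length (encQF ψ)) (length (encQF φ)) (suc n))) (trans (+-suc _ n)
        (cong (λ z → suc (z + n)) (trans (+-comm (length (encQF ψ)) _) (sym (length-++ (encQF φ)))))))) (s≤s (≤-trans (n≤1+n _) (n≤1+n _)))))
    toksteps-≤ (or φ ψ) n = ≤-trans (toksteps-≤ ψ _) (≤-trans (+-monoʳ-≤ (length (encQF ψ)) (toksteps-≤ φ (suc n)))
      (≤-trans (≤-reflexive (trans (sym (+-assoc (length (encQF ψ)) (length (encQF φ)) (suc n))) (trans (+-suc _ n)
        (cong (λ z → suc (z + n)) (trans (+-comm (length (encQF ψ)) _) (sym (length-++ (encQF φ)))))))) (s≤s (≤-trans (n≤1+n _) (n≤1+n _)))))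

    module _ (B : ℕ) where

      open Runs B

      map-ʳ++ : ∀ (xs ys : List D) → digs (xs ʳ++ ys) ≡ digs xs ʳ++ digs ys
      map-ʳ++ []       ys = refl
      map-ʳ++ (x ∷ xs) ys = map-ʳ++ xs (x ∷ ys)

      dg-digs : ∀ x → dg (head? (digs x)) ≡ hd x
      dg-digs []      = refl
      dg-digs (_ ∷ _) = refl

      tail-digs : ∀ x → tail' (digs x) ≡ digs (tail' x)
      tail-digs []      = refl
      tail-digs (_ ∷ _) = refl

      module Token (s : St) (L : List D) (len : length L ≤ B) where

        W : List Sy → List Sy → List D → List D → List Sy → St
        W t t2 S T v = record s { tok = t ; tk2 = t2 ; ss = digs S ; ts = digs T ; vs = v ; ls = digs L ; l2 = [] ; xa = [] ; ya = [] ; rg = [] }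

        Z : List Sy → List Sy → List Sy → List Sy → List Sy → List Sy → List Sy → List Sy → St
        Z t t2 S T v r x y = record s { tok = t ; tk2 = t2 ; ss = S ; ts = T ; vs = v ; ls = digs L ; l2 = [] ; rg = r ; xa = x ; ya = y }

        U : List Sy → List Sy → List D → List D → List Sy → List D → List D → List Sy → St
        U t t2 S T v x y z = record s { tok = t ; tk2 = t2 ; ss = digs S ; ts = digs T ; vs = v ; ls = digs x ; l2 = digs y ; xa = z ; ya = [] ; rg = [] }

        lookup-loop : ∀ i x y {t t2 S T v z} → i < length x → isOne (head? t) ≡ false → ∃₂ λ x′ y′ →
          Loop (λ v → isOne (lookup v tok#)) (copy tok# tk2# ⨾ del tok# ⨾ copy ls# l2# ⨾ del ls#) i
            (toVec (U (ones i t) t2 S T v x y z)) (toVec (U t (ones i t2) S T v x′ y′ z))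
          × hd x′ ≡ at x i × y′ ʳ++ x′ ≡ y ʳ++ x × length y′ ≡ i + length y
        lookup-loop zero (d ∷ x) y _ nt = d ∷ x , y , stop nt , refl , refl , refl
        lookup-loop (suc i) (d ∷ x) y {t} {t2} {S} {T} {v} {z} (s≤s i<) nt with lookup-loop i x (d ∷ y) {t} {one ∷ t2} {S} {T} {v} {z} i< nt
        ... | x′ , y′ , l , h , r , ln = x′ , y′ ,
          more refl acts (Loop-cast (cong (λ o → toVec (U t o S T v x′ y′ z)) (ones-shift i t2)) l) , h , r , trans ln (+-suc i (length y))

        lookup-run : ∀ i {t t2 S T v z} → i < length L → isOne (head? t) ≡ false →
          tokStep ⊢ toVec (U (sep ∷ ones i t) t2 S T v L [] z) ⇒ toVec (U t (ones i (sep ∷ t2)) S T v L [] (dig (at L i) ∷ z))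
        lookup-run i {t} {t2} {S} {T} {v} {z} i< nt with lookup-loop i L [] {t} {sep ∷ t2} {S} {T} {v} {z} i< nt
        ... | x′ , y′ , l , h , r , ln = then′ refl (acts ⨾ while (≤-trans (<⇒≤ i<) len) l ⨾ act ⨾
          cast (cong₂ (λ d x → toVec (record (U t (ones i (sep ∷ t2)) S T v L [] (dig d ∷ z)) { ls = x })) (trans (dg-digs x′) h)
                 (trans (sym (map-ʳ++ y′ x′)) (cong digs r)))
            (mv-run l2# ls# (λ ()) (toVec (U t (ones i (sep ∷ t2)) S T v x′ y′ (dig (dg (head? (digs x′))) ∷ z)))
              (≤-trans (≤-reflexive (trans (length-map dig y′) (trans ln (+-identityʳ i)))) (≤-trans (<⇒≤ i<) len))))

        atom-run : ∀ a x y {t t2 v} S T →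
          tokStep ⊢ toVec (U (atom a ∷ t) t2 S T v L [] (dig x ∷ dig y ∷ [])) ⇒
                    toVec (W t (atom a ∷ t2) (tail' S) (tail' T) (vo (final a (stateD (hd S))) (check x y (hd S) (hd T)) ∷ v))
        atom-run a x y {t} {t2} {v} S T = else′ refl (then′ refl (act ⨾ via (toVec (Z (atom a ∷ t) t2 (digs S) (digs T) v [] (dig y ∷ []) (dig x ∷ []))) act
          (via (toVec (Z (atom a ∷ t) t2 (digs S) (digs T) v′ [] (dig y ∷ []) (dig x ∷ []))) (cast (cong₂ (λ p q → toVec (Z (atom a ∷ t) t2 (digs S) (digs T) (vo (final a (stateD p)) (check x y p q) ∷ v) [] (dig y ∷ []) (dig x ∷ []))) (dg-digs S) (dg-digs T)) act)
          (act ⨾ via (toVec (Z (atom a ∷ t) t2 (digs S) (digs T) v′ [] [] [])) act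
          (act ⨾ via (toVec (W (atom a ∷ t) t2 (tail' S) (tail' T) v′)) (cast (cong₂ (λ p q → toVec (Z (atom a ∷ t) t2 p q v′ [] [] [])) (tail-digs S) (tail-digs T)) act)
          acts)))))
          where
          v′ = vo (final a (stateD (hd S))) (check x y (hd S) (hd T)) ∷ v

        neg-run : ∀ p q {S T v t t2} → tokStep ⊢ toVec (W (tneg ∷ t) t2 S T (vo p q ∷ v)) ⇒ toVec (W t (tneg ∷ t2) S T (vo (not p) q ∷ v))
        neg-run p q {S} {T} {v} {t} {t2} = else′ refl (else′ refl (then′ refl (act ⨾ via (toVec (Z (tneg ∷ t) t2 (digs S) (digs T) v (vo (not p) q ∷ []) [] [])) act
          (act ⨾ via (toVec (W (tneg ∷ t) t2 S T (vo (not p) q ∷ v))) act acts))))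

        bin-run : ∀ c p q p′ q′ {x y S T v t t2} → isSep (just c) ≡ false → isAtom (just c) ≡ false → isNeg (just c) ≡ false →
          combine (just c) (just (vo p q)) (just (vo p′ q′)) ≡ vo x y →
          tokStep ⊢ toVec (W (c ∷ t) t2 S T (vo p q ∷ vo p′ q′ ∷ v)) ⇒ toVec (W t (c ∷ t2) S T (vo x y ∷ v))
        bin-run c p q p′ q′ {x} {y} {S} {T} {v} {t} {t2} e₁ e₂ e₃ e₄ = else′ e₁ (else′ e₂ (else′ e₃
          (act ⨾ via (toVec (Z (c ∷ t) t2 (digs S) (digs T) (vo p′ q′ ∷ v) (vo p q ∷ []) [] [])) act
          (via (toVec (Z (c ∷ t) t2 (digs S) (digs T) (vo p′ q′ ∷ v) (vo x y ∷ vo p q ∷ []) [] []))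
             (cast (cong (λ w → toVec (Z (c ∷ t) t2 (digs S) (digs T) (vo p′ q′ ∷ v) (w ∷ vo p q ∷ []) [] [])) e₄) act)
          (act ⨾ via (toVec (Z (c ∷ t) t2 (digs S) (digs T) (vo x y ∷ v) (vo x y ∷ vo p q ∷ []) [] [])) act
          (act ⨾ via (toVec (W (c ∷ t) t2 S T (vo x y ∷ v))) act acts))))))

        walk-atom : ∀ a i j S T {v t2 t n τ} → i < length L → j < length L →
          Loop (nonempty tok#) tokStep n (toVec (W t (atom a ∷ ones i (sep ∷ ones j (sep ∷ t2))) (tail' S) (tail' T)
               (vo (final a (stateD (hd S))) (check (at L i) (at L j) (hd S) (hd T)) ∷ v))) τ →
          Loop (nonempty tok#) tokStep (3 + n) (toVec (W (sep ∷ ones j (sep ∷ ones i (atom a ∷ t))) t2 S T v)) τ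
        walk-atom a i j S T i< j< l = more refl (lookup-run j j< refl) (more refl (lookup-run i i< refl) (more refl (atom-run a (at L i) (at L j) S T) l))

        -- In continuation form: a run of the loop that starts after φ is extended to one that
        -- starts before it, so the operands of a connective chain without cutting loops.
        walk : ∀ {k} (φ : QF σ k) → length L ≡ k → ∀ {S T v t2 t n τ} →
          Loop (nonempty tok#) tokStep n (toVec (W t (revTok φ t2) (skip φ S) (skip φ T) (vo (val φ S) (okc φ L S T) ∷ v))) τ →
          Loop (nonempty tok#) tokStep (toksteps φ n) (toVec (W (toks φ t) t2 S T v)) τ
        walk (eq i j) refl {S} {T} l = walk-atom fz (toℕ i) (toℕ j) S T (toℕ<n i) (toℕ<n j) l
        walk (rel r (i ∷ j ∷ [])) refl {S} {T} l = walk-atom (fs r) (toℕ i) (toℕ j) S T (toℕ<n i) (toℕ<n j) l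
        walk (neg φ) e l = walk φ e (more refl (neg-run _ _) l)
        walk (and φ ψ) e l = walk ψ e (walk φ e (more refl (bin-run tand _ _ _ _ refl refl refl refl) l))
        walk (or φ ψ) e l = walk ψ e (walk φ e (more refl (bin-run tor _ _ _ _ refl refl refl refl) l))

-- Checking one edge at a leaf of the search

module DeciderLeaves where

  open import Defs using (QF; eq; rel; neg; and; or; unary; encQF; tail')
  open FiniteTypes
  open StackPrograms
  open Presentation
  open Savitch
  open DeciderState
  open import Data.Nat using (ℕ; zero; suc; _+_; _≤_; z≤n; s≤s)
  open import Data.Nat.Properties
  open import Data.Fin using (Fin; toℕ)
  open import Data.Bool using (Bool; true; _∧_)
  open import Data.Maybe using (Maybe; nothing)
  open import Data.List using (List; []; _∷_; length; _++_)
  open import Data.List.Properties using (++-identityʳ; length-map; length-++)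
  open import Data.Vec using (Vec; []; _∷_)
  open import Data.Product using (_×_; _,_)
  open import Relation.Binary.PropositionalEquality
  open DeciderPrograms

  module Search (γ nQ m : ℕ) (q₀ : Fin nQ) (δ : Fin nQ → Vec (Maybe (Fin γ)) 2 → Fin nQ)
                (final : Fin (suc m) → Fin nQ → Bool) (δ-pad : ∀ q → δ q (nothing ∷ nothing ∷ []) ≡ q) where

    open Shared γ nQ m q₀ δ final δ-pad using (σ)
    open Configurations γ nQ m q₀ δ final δ-pad using (D; phase; hd; mono; skip; val; okc; lts; dropD; monos; checkE; length-lts)
    open Decider γ nQ m q₀ δ final δ-pad
    open Execution γ nQ m q₀ δ final δ-pad

    length-revTok : ∀ {k} (φ : QF σ k) tk → length (revTok φ tk) ≤ length (encQF φ) + length tk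
    length-revTok φ tk = go φ tk
      where
      len-ones : ∀ n xs → length (ones n xs) ≡ n + length xs
      len-ones zero    xs = refl
      len-ones (suc n) xs = cong suc (len-ones n xs)
      len-unary : ∀ n (xs : List Bool) → length (unary n ++ xs) ≡ suc n + length xs
      len-unary zero    xs = refl
      len-unary (suc n) xs = cong suc (len-unary n xs)
      two : ∀ i j tk xs → length (ones i (sep ∷ ones j (sep ∷ tk))) ≤ length (unary i ++ unary j ++ xs) + length tk
      two i j tk xs = ≤-trans (≤-reflexive (trans (len-ones i _) (trans (+-suc i _) (cong (λ z → suc (i + z)) (trans (len-ones j _) (+-suc j _))))))
        (≤-trans (s≤s (+-monoʳ-≤ i (s≤s (+-monoˡ-≤ (length tk) (m≤m+n j (length xs))))))
          (≤-reflexive (sym (trans (cong (_+ length tk) (trans (len-unary i (unary j ++ xs)) (cong (suc i +_) (len-unary j xs)))) (cong suc (+-assoc i _ (length tk)))))))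
      step₂ : ∀ {k} (φ ψ : QF σ k) tk → length (revTok φ (revTok ψ tk)) ≤ length (encQF φ) + length (revTok ψ tk) →
              length (revTok ψ tk) ≤ length (encQF ψ) + length tk →
              length (revTok φ (revTok ψ tk)) ≤ length (encQF φ ++ encQF ψ) + length tk
      step₂ φ ψ tk a b = ≤-trans a (≤-trans (+-monoʳ-≤ (length (encQF φ)) b) (≤-reflexive (trans (sym (+-assoc (length (encQF φ)) _ _)) (cong (_+ length tk) (sym (length-++ (encQF φ)))))))
      go : ∀ {k} (φ : QF σ k) tk → length (revTok φ tk) ≤ length (encQF φ) + length tk
      go (eq i j) tk = s≤s (≤-trans (≤-trans (two (toℕ i) (toℕ j) tk []) (≤-reflexive (cong (λ z → length (unary (toℕ i) ++ z) + length tk) (++-identityʳ (unary (toℕ j)))))) (≤-trans (n≤1+n _) (n≤1+n _)))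
      go (rel r (i ∷ j ∷ [])) tk = s≤s (≤-trans (two (toℕ i) (toℕ j) tk []) (≤-trans (+-monoˡ-≤ (length tk) (≤-trans (m≤n+m _ (length (unary (toℕ r)))) (≤-reflexive (sym (length-++ (unary (toℕ r))))))) (≤-trans (n≤1+n _) (n≤1+n _))))
      go (neg φ) tk = s≤s (≤-trans (go φ tk) (≤-trans (n≤1+n _) (n≤1+n _)))
      go (and φ ψ) tk = s≤s (≤-trans (step₂ φ ψ tk (go φ _) (go ψ tk)) (≤-trans (n≤1+n _) (n≤1+n _)))
      go (or φ ψ) tk = s≤s (≤-trans (step₂ φ ψ tk (go φ _) (go ψ tk)) (≤-trans (n≤1+n _) (n≤1+n _)))

    length-tail : ∀ {A : Set} (S : List A) → length (tail' S) ≤ length S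
    length-tail []      = z≤n
    length-tail (_ ∷ S) = n≤1+n _

    length-skip : ∀ {k} (φ : QF σ k) S → length (skip φ S) ≤ length S
    length-skip (eq i j)  S = length-tail S
    length-skip (rel r v) S = length-tail S
    length-skip (neg φ)   S = length-skip φ S
    length-skip (and φ ψ) S = ≤-trans (length-skip φ _) (length-skip ψ S)
    length-skip (or φ ψ)  S = ≤-trans (length-skip φ _) (length-skip ψ S)

    length-dropD : ∀ n S → length (dropD n S) ≤ length S
    length-dropD zero    S = ≤-refl
    length-dropD (suc n) S = ≤-trans (length-dropD n (tail' S)) (length-tail S)

    Entry : Set
    Entry = Bool × D × Bool

    entS : Entry → Sy
    entS (κ , d , a) = ent κ d a

    strip : Entry → Bool × D
    strip (κ , d , _) = κ , d

    module _ (B : ℕ) where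

      open Runs B

      module Letters (s : St) (v : List Sy) where

        Y : ℕ → ℕ → List Sy → List Sy → List Sy → List Sy → List Sy → St
        Y n c l S T w r = record s { ks = ones n [] ; k2 = ones c [] ; ls = l ; vs = w ; ss = S ; ts = T ; rg = r }

        JJ : ℕ → ℕ → List D → List D → List D → Bool → St
        JJ n c l S T b = Y n c (digs l) (digs S) (digs T) (vo true b ∷ v) []

        letter-step : ∀ n c l S T b → letterStep ⊢ toVec (JJ (suc n) c l S T b) ⇒ toVec (JJ n (suc c) (hd S ∷ l) (tail' S) (tail' T) (b ∧ mono (hd S) (hd T)))
        letter-step n c l S T b = act ⨾ via (toVec (JJ n (suc c) l S T b)) act
          (via (toVec (JJ n (suc c) (hd S ∷ l) S T b)) (cast (cong (λ d → toVec (Y n (suc c) (dig d ∷ digs l) (digs S) (digs T) (vo true b ∷ v) [])) (dg-digs B S)) act)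
          (via (toVec (Y n (suc c) l′ (digs S) (digs T) (vo true b ∷ v) (vo true b′ ∷ [])))
             (cast (cong₂ (λ d e → toVec (Y n (suc c) l′ (digs S) (digs T) (vo true b ∷ v) (vo true (b ∧ mono d e) ∷ []))) (dg-digs B S) (dg-digs B T)) act)
          (act ⨾ via (toVec (Y n (suc c) l′ (digs S) (digs T) (vo true b′ ∷ v) (vo true b′ ∷ []))) act
          (act ⨾ (act ⨾ cast (cong₂ (λ p q → toVec (Y n (suc c) l′ p q (vo true b′ ∷ v) [])) (tail-digs B S) (tail-digs B T)) act)))))
          where
          l′ = digs (hd S ∷ l)
          b′ = b ∧ mono (hd S) (hd T)

        letters-loop : ∀ n c l S T b → Loop (nonempty ks#) letterStep n (toVec (JJ n c l S T b)) (toVec (JJ 0 (n + c) (lts n S l) (dropD n S) (dropD n T) (monos n S T b)))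
        letters-loop zero    c l S T b = stop refl
        letters-loop (suc n) c l S T b = more refl (letter-step n c l S T b)
          (Loop-cast (cong (λ c → toVec (JJ 0 c (lts n (tail' S) (hd S ∷ l)) (dropD n (tail' S)) (dropD n (tail' T)) (monos n (tail' S) (tail' T) (b ∧ mono (hd S) (hd T))))) (+-suc n c))
            (letters-loop n (suc c) (hd S ∷ l) (tail' S) (tail' T) (b ∧ mono (hd S) (hd T))))

        letters-run : ∀ n S T → n ≤ B → letterP ⊢ toVec (JJ n 0 [] S T true) ⇒ toVec (JJ n 0 (lts n S []) (dropD n S) (dropD n T) (monos n S T true))
        letters-run n S T n≤ = while n≤ (letters-loop n 0 [] S T true) ⨾
          cast (cong (λ x → toVec (record end { ks = x ; k2 = [] })) (trans (ones-ʳ++ (n + 0) [] []) (cong (λ n → ones n []) (+-identityʳ n))))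
            (mv-run k2# ks# (λ ()) (toVec end) (≤-trans (≤-reflexive (trans (length-ones (n + 0)) (+-identityʳ n))) n≤))
          where
          end = JJ 0 (n + 0) (lts n S []) (dropD n S) (dropD n T) (monos n S T true)

      module Check {k : ℕ} (φ : QF σ k) (s : St) (k≤ : k ≤ B) (φ≤ : length (encQF φ) ≤ B) where

        C : List Sy → List Sy → List Sy → List Sy → List Sy → List Sy → List Sy → List Sy → List Sy → St
        C t t2 S T M l v r d = record s { tok = t ; tk2 = t2 ; ks = ones k [] ; k2 = [] ; ss = S ; ts = T ; ms = M ; ls = l ; l2 = [] ; vs = v ; rg = r ; md = d ; xa = [] ; ya = [] }

        check-run : ∀ S T M → length S ≤ B → length T ≤ B → length M ≤ B →
          checkP ⊢ toVec (C (toks φ []) [] (digs S) (digs T) (digs M) [] [] [] (one ∷ [])) ⇒ toVec (C (toks φ []) [] [] [] [] [] [] [] (bit (checkE φ S T) ∷ []))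
        check-run S T M S≤ T≤ M≤ =
          via (toVec (C tk [] (digs S) (digs T) (digs M) [] (ph ∷ []) [] (one ∷ [])))
            (cast (cong₂ (λ x y → toVec (C tk [] (digs S) (digs T) (digs M) [] (vo (phase x) (phase y) ∷ []) [] (one ∷ []))) (dg-digs B S) (dg-digs B T)) act)
          (act ⨾ via (toVec (C tk [] (digs S₁) (digs T₁) (digs M) [] (ph ∷ []) [] (one ∷ [])))
            (cast (cong₂ (λ x y → toVec (C tk [] x y (digs M) [] (ph ∷ []) [] (one ∷ []))) (tail-digs B S) (tail-digs B T)) act)
          (via (toVec (C tk [] (digs S₁) (digs T₁) (digs M) [] (vo true true ∷ ph ∷ []) [] (one ∷ []))) act
          (via (toVec (C tk [] (digs S₂) (digs T₂) (digs M) (digs L) (vo true mo ∷ ph ∷ []) [] (one ∷ [])))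
            (Letters.letters-run (C tk [] [] [] (digs M) [] [] [] (one ∷ [])) (ph ∷ []) k S₁ T₁ k≤)
          (via (toVec (C [] (revTok φ []) (digs S₃) (digs T₃) (digs M) (digs L) (vo vl ok ∷ vo true mo ∷ ph ∷ []) [] (one ∷ [])))
            (while (≤-trans (≤-trans (toksteps-≤ φ 0) (≤-reflexive (+-identityʳ _))) φ≤)
              (Token.walk B (C [] [] [] [] (digs M) [] [] [] (one ∷ [])) L (≤-trans (≤-reflexive lenL) k≤) φ lenL (stop refl)))
          (via (toVec (C tk [] (digs S₃) (digs T₃) (digs M) (digs L) (vo vl ok ∷ vo true mo ∷ ph ∷ []) [] (one ∷ [])))
            (cast (cong (λ t → toVec (C t [] (digs S₃) (digs T₃) (digs M) (digs L) (vo vl ok ∷ vo true mo ∷ ph ∷ []) [] (one ∷ []))) (revTok-ʳ++ φ [] []))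
              (mv-run tk2# tok# (λ ()) (toVec (C [] (revTok φ []) (digs S₃) (digs T₃) (digs M) (digs L) (vo vl ok ∷ vo true mo ∷ ph ∷ []) [] (one ∷ [])))
                (≤-trans (≤-trans (length-revTok φ []) (≤-reflexive (+-identityʳ _))) φ≤)))
          (via (toVec (C tk [] (digs S₃) (digs T₃) (digs M) (digs L) [] [] (bit res ∷ []))) verdict-run
          (via (toVec (C tk [] [] (digs T₃) (digs M) (digs L) [] [] (bit res ∷ []))) (clear-run ss# _ (≤-trans (≤-reflexive (length-map dig S₃)) (small S S≤)))
          (via (toVec (C tk [] [] [] (digs M) (digs L) [] [] (bit res ∷ []))) (clear-run ts# _ (≤-trans (≤-reflexive (length-map dig T₃)) (small T T≤)))
          (via (toVec (C tk [] [] [] [] (digs L) [] [] (bit res ∷ []))) (clear-run ms# _ (≤-trans (≤-reflexive (length-map dig M)) M≤))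
            (clear-run ls# _ (≤-trans (≤-reflexive (trans (length-map dig L) lenL)) k≤)))))))))))
          where
          tk = toks φ []
          S₁ = tail' S
          T₁ = tail' T
          S₂ = dropD k S₁
          T₂ = dropD k T₁
          S₃ = skip φ S₂
          T₃ = skip φ T₂
          L = lts k S₁ []
          mo = monos k S₁ T₁ true
          vl = val φ S₂
          ok = okc φ L S₂ T₂
          ph = vo (phase (hd S)) (phase (hd T))
          res = checkE φ S T
          lenL : length L ≡ k
          lenL = trans (length-lts φ 0 k S₁ []) (+-identityʳ k)
          small : ∀ S → length S ≤ B → length (skip φ (dropD k (tail' S))) ≤ B
          small S le = ≤-trans (length-skip φ _) (≤-trans (length-dropD k _) (≤-trans (length-tail S) le))
          K : List Sy → List Sy → List Sy → St
          K = C tk [] (digs S₃) (digs T₃) (digs M) (digs L)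
          verdict-run : verdictP ⊢ toVec (K (vo vl ok ∷ vo true mo ∷ ph ∷ []) [] (one ∷ [])) ⇒ toVec (K [] [] (bit res ∷ []))
          verdict-run = act ⨾ via (toVec (K (vo true mo ∷ ph ∷ []) (vo vl ok ∷ []) (one ∷ []))) act
            (act ⨾ via (toVec (K (ph ∷ []) (vo vl (mo ∧ ok) ∷ vo vl ok ∷ []) (one ∷ []))) act
            (act ⨾ via (toVec (K (ph ∷ []) (vo vl (mo ∧ ok) ∷ vo vl ok ∷ []) (bit res ∷ []))) act
            acts))

-- Depth-first evaluation of the pattern in polynomial space

module DeciderSearch where

  open import Defs using (QF; encQF)
  open FiniteTypes
  open StackPrograms
  open Presentation
  open Savitch
  open DeciderState
  open import Data.Nat using (ℕ; zero; suc; _+_; _≤_; z≤n; s≤s)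
  open import Data.Nat.Properties
  open import Data.Fin using (Fin; toℕ) renaming (zero to fz; suc to fs)
  open import Data.Fin.Properties using (toℕ-inject₁)
  open import Data.Bool using (Bool; true; false; _∨_)
  open import Data.Bool.Properties using (∨-assoc)
  open import Data.Maybe using (Maybe; nothing)
  open import Data.List using (List; []; _∷_; length; map; _ʳ++_; replicate; reverse; foldl; foldr)
  open import Data.List.Properties using (++-identityʳ; length-map; length-ʳ++; length-replicate; reverse-foldl; ʳ++-defn; length-reverse; reverse-map; reverse-involutive)
  open import Data.Vec using (Vec; []; _∷_; lookup)
  open import Data.Product using (∃; _×_; _,_; proj₁; proj₂)
  open import Relation.Binary.PropositionalEquality
  open import Data.Vec.Relation.Unary.All using ([]; _∷_) renaming (All to AllV)
  open DeciderPrograms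
  open DeciderLeaves

  lookupAll : ∀ {A : Set} {P : A → Set} {n} {xs : Vec A n} → AllV P xs → ∀ j → P (lookup xs j)
  lookupAll (p ∷ _)  fz     = p
  lookupAll (_ ∷ ps) (fs j) = lookupAll ps j

  module Procedure (γ nQ m : ℕ) (q₀ : Fin nQ) (δ : Fin nQ → Vec (Maybe (Fin γ)) 2 → Fin nQ)
                (final : Fin (suc m) → Fin nQ → Bool) (δ-pad : ∀ q → δ q (nothing ∷ nothing ∷ []) ≡ q) where

    open Shared γ nQ m q₀ δ final δ-pad using (σ)
    open Configurations γ nQ m q₀ δ final δ-pad using (Block; place; lower; down; top; c₁; α; ω; cur; dfs; leaf)
    open Decider γ nQ m q₀ δ final δ-pad
    open Execution γ nQ m q₀ δ final δ-pad
    open Search γ nQ m q₀ δ final δ-pad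

    blank : St
    blank = record { inp = [] ; tok = [] ; tk2 = [] ; lc = [] ; ks = [] ; k2 = [] ; pend = [] ; bad = [] ; rs = [] ; path = [] ; aux = []
                   ; ss = [] ; ts = [] ; ms = [] ; ls = [] ; l2 = [] ; vs = [] ; rg = [] ; md = [] ; xa = [] ; ya = [] }

    module _ (B : ℕ) where

      open Runs B

      module Scan (s : St) where

        Sc : List Entry → List Sy → Block → St
        Sc es p (S , T , M) = record s { aux = map entS es ; path = p ; ss = digs S ; ts = digs T ; ms = digs M }

        -- The midpoint under construction is bounded together with the decisions still to be
        -- replayed; the sum does not grow when a digit passes from one to the other.
        Fits : List Entry → Block → Set
        Fits es (S , T , M) = length S ≤ B × length T ≤ B × length M + length es ≤ B

        scan-step : ∀ e es p b → Fits (e ∷ es) b → scanStep ⊢ toVec (Sc (e ∷ es) p b) ⇒ toVec (Sc es (entS e ∷ p) (place (strip e) b))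
        scan-step (false , d , a) es p (S , T , M) _ = act ⨾ then′ refl act ⨾ act
        scan-step (true , fz , a) es p (S , T , M) (S≤ , T≤ , M≤) =
          via (toVec (Sc (e ∷ es) (entS e ∷ p) (S , T , M))) act
          (via (toVec (Sc (e ∷ es) (entS e ∷ p) (S , M ʳ++ [] , []))) (else′ refl (else′ refl
            (via (toVec (Sc (e ∷ es) (entS e ∷ p) (S , [] , M))) (clear-run ts# _ (≤-trans (≤-reflexive (length-map dig T)) T≤))
              (cast (cong (λ x → toVec (record (Sc (e ∷ es) (entS e ∷ p) (S , [] , [])) { ts = x })) (sym (map-ʳ++ B M [])))
                (mv-run ms# ts# (λ ()) _ (≤-trans (≤-reflexive (length-map dig M)) (≤-trans (m≤m+n _ _) M≤)))))))
            act)
          where e = (true , fz , a)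
        scan-step (true , fs d , a) es p (S , T , M) (S≤ , T≤ , M≤) =
          via (toVec (Sc (e ∷ es) (entS e ∷ p) (S , T , M))) act
          (via (toVec (Sc (e ∷ es) (entS e ∷ p) (M ʳ++ [] , T , []))) (else′ refl (then′ refl
            (via (toVec (Sc (e ∷ es) (entS e ∷ p) ([] , T , M))) (clear-run ss# _ (≤-trans (≤-reflexive (length-map dig S)) S≤))
              (cast (cong (λ x → toVec (record (Sc (e ∷ es) (entS e ∷ p) ([] , T , [])) { ss = x })) (sym (map-ʳ++ B M [])))
                (mv-run ms# ss# (λ ()) _ (≤-trans (≤-reflexive (length-map dig M)) (≤-trans (m≤m+n _ _) M≤)))))))
            act)
          where e = (true , fs d , a)

        fits-step : ∀ e es b → Fits (e ∷ es) b → Fits es (place (strip e) b)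
        fits-step (false , d , a)   es (S , T , M) (S≤ , T≤ , M≤) = S≤ , T≤ , ≤-trans (≤-reflexive (sym (+-suc (length M) (length es)))) M≤
        fits-step (true , fz , a)   es (S , T , M) (S≤ , T≤ , M≤) = S≤ , ≤-trans (≤-reflexive (trans (length-ʳ++ M) (+-identityʳ _))) (≤-trans (m≤m+n _ _) M≤) , ≤-trans (≤-trans (n≤1+n _) (m≤n+m _ (length M))) M≤
        fits-step (true , fs d , a) es (S , T , M) (S≤ , T≤ , M≤) = ≤-trans (≤-reflexive (trans (length-ʳ++ M) (+-identityʳ _))) (≤-trans (m≤m+n _ _) M≤) , T≤ , ≤-trans (≤-trans (n≤1+n _) (m≤n+m _ (length M))) M≤

        after : Block → List Entry → Block
        after = foldl (λ b e → place (strip e) b)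

        scan-loop : ∀ es p b → Fits es b → Loop (nonempty aux#) scanStep (length es) (toVec (Sc es p b)) (toVec (Sc [] (map entS es ʳ++ p) (after b es)))
                    × Fits [] (after b es)
        scan-loop []       p b f = stop refl , f
        scan-loop (e ∷ es) p b f with scan-loop es (entS e ∷ p) (place (strip e) b) (fits-step e es b f)
        ... | l , f′ = more refl (scan-step e es p b f) l , f′

      module Leaf {k : ℕ} (φ : QF σ k) (ℓ : ℕ) (k≤ : k ≤ B) (φ≤ : length (encQF φ) ≤ B) (ℓ≤ : suc ℓ ≤ B) where

        H : List Sy → List Sy → List Sy → St
        H r p d = record blank { tok = toks φ [] ; lc = ones ℓ [] ; ks = ones k [] ; rs = r ; path = p ; md = d }

        F : St → ℕ → ℕ → ℕ → St
        F s n c a = record s { lc = ones n [] ; aux = ones c [] ; ss = digs (replicate a fz) ; ts = digs (replicate a fz) }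

        fill-loop : ∀ s n c a → Loop (nonempty lc#) fillStep n (toVec (F s n c a)) (toVec (F s 0 (n + c) (n + a)))
        fill-loop s zero    c a = stop refl
        fill-loop s (suc n) c a = more refl acts (Loop-cast (cong₂ (λ c a → toVec (F s 0 c a)) (+-suc n c) (+-suc n a)) (fill-loop s n (suc c) (suc a)))

        fill-run : ∀ s → fillP ⊢ toVec (record s { lc = ones ℓ [] ; aux = [] ; ss = [] ; ts = [] }) ⇒
                                 toVec (record s { lc = ones ℓ [] ; aux = [] ; ss = digs (α φ ℓ) ; ts = digs (ω φ ℓ) })
        fill-run s = via (toVec (F s 0 (ℓ + 0) (ℓ + 0))) (while (≤-trans (n≤1+n _) ℓ≤) (fill-loop s ℓ 0 0))
          (via (toVec (F s ℓ 0 ℓ))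
            (cast (cong₂ (λ l a → toVec (record (F s ℓ 0 a) { lc = l })) (trans (ones-ʳ++ (ℓ + 0) [] []) (cong (λ n → ones n []) (+-identityʳ ℓ))) (+-identityʳ ℓ))
              (mv-run aux# lc# (λ ()) _ (≤-trans (≤-reflexive (trans (length-ones (ℓ + 0)) (+-identityʳ ℓ))) (≤-trans (n≤1+n _) ℓ≤))))
          (act ⨾ cast (cong (λ t → toVec (record (F s ℓ 0 ℓ) { ts = dig c₁ ∷ t })) (tail-digs B (replicate ℓ fz))) act))

        length-α : length (α φ ℓ) ≤ B
        length-α = ≤-trans (≤-reflexive (length-replicate ℓ)) (≤-trans (n≤1+n _) ℓ≤)

        leaf-run : ∀ es → length es ≤ B →
          leafP ⊢ toVec (H [] (map entS es) (one ∷ [])) ⇒ toVec (H [] (map entS es) (bit (leaf φ ℓ (cur φ ℓ (map strip es))) ∷ []))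
        leaf-run es es≤ =
          via (toVec (record h { path = map entS es ; ss = digs (α φ ℓ) ; ts = digs (ω φ ℓ) })) (fill-run (H [] (map entS es) (one ∷ [])))
          (via (toVec (Scan.Sc h (reverse es) [] b₀))
            (cast (cong (λ x → toVec (record h { aux = x ; ss = digs (α φ ℓ) ; ts = digs (ω φ ℓ) })) (trans (ʳ++-defn (map entS es)) (trans (++-identityʳ _) (sym (reverse-map entS es)))))
              (mv-run path# aux# (λ ()) _ (≤-trans (≤-reflexive (length-map entS es)) es≤)))
          (via (toVec (Scan.Sc h [] (map entS es) b₁))
            (cast (cong₂ (λ p b → toVec (Scan.Sc h [] p b)) (trans (ʳ++-defn (map entS (reverse es))) (trans (++-identityʳ _) (trans (sym (reverse-map entS (reverse es))) (cong (map entS) (reverse-involutive es))))) fold≡)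
              (while (≤-trans (≤-reflexive (length-reverse es)) es≤) (proj₁ scanned)))
            (Check.check-run B φ (H [] (map entS es) []) k≤ φ≤ (proj₁ b₁) (proj₁ (proj₂ b₁)) (proj₂ (proj₂ b₁))
              (proj₁ fits) (proj₁ (proj₂ fits)) (≤-trans (m≤m+n _ 0) (proj₂ (proj₂ fits))))))
          where
          h = H [] [] (one ∷ [])
          b₀ : Block
          b₀ = α φ ℓ , ω φ ℓ , []
          b₁ = cur φ ℓ (map strip es)
          ω≤ : length (ω φ ℓ) ≤ B
          ω≤ = ≤-trans (s≤s (≤-trans (length-tail (α φ ℓ)) (≤-reflexive (length-replicate ℓ)))) ℓ≤
          scanned = Scan.scan-loop h (reverse es) [] b₀ (length-α , ω≤ , ≤-trans (≤-reflexive (length-reverse es)) es≤)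
          foldr-map : ∀ es → foldr (λ e b → place (strip e) b) b₀ es ≡ foldr place b₀ (map strip es)
          foldr-map []       = refl
          foldr-map (e ∷ es) = cong (place (strip e)) (foldr-map es)
          fold≡ : Scan.after h b₀ (reverse es) ≡ b₁
          fold≡ = trans (reverse-foldl (λ b e → place (strip e) b) b₀ es) (foldr-map es)
          fits : Scan.Fits h [] b₁
          fits = subst (Scan.Fits h []) fold≡ (proj₂ scanned)

        length-toks : length (toks φ []) ≤ B
        length-toks = ≤-trans (≤-reflexive (trans (cong length (sym (revTok-ʳ++ φ [] []))) (trans (length-ʳ++ (revTok φ [])) (+-identityʳ _))))
          (≤-trans (length-revTok φ []) (≤-trans (≤-reflexive (+-identityʳ _)) φ≤))

        module Dfs (K sp : ℕ) (K≤ : K ≤ B) (sp≤ : B + cost dfsStep B ≤ sp) where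

          H′ : List Bool → List Entry → Sy → Store
          H′ ks es x = toVec (H (map kind ks) (map entS es) (x ∷ []))

          H-height : ∀ ks es x → length es + length ks ≤ K → Height≤ B (H′ ks es x)
          H-height ks es x le = height (λ j → lookupAll heights j)
            where
            heights : AllV (λ l → length l ≤ B) (H′ ks es x)
            heights = z≤n ∷ length-toks ∷ z≤n ∷ ≤-trans (≤-reflexive (length-ones ℓ)) (≤-trans (n≤1+n _) ℓ≤) ∷ ≤-trans (≤-reflexive (length-ones k)) k≤ ∷ z≤n ∷ z≤n ∷ z≤n
              ∷ ≤-trans (≤-reflexive (length-map kind ks)) (≤-trans (m≤n+m _ (length es)) (≤-trans le K≤))
              ∷ ≤-trans (≤-reflexive (length-map entS es)) (≤-trans (m≤m+n _ (length ks)) (≤-trans le K≤))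
              ∷ z≤n ∷ z≤n ∷ z≤n ∷ z≤n ∷ z≤n ∷ z≤n ∷ z≤n ∷ z≤n ∷ ≤-trans (s≤s z≤n) ℓ≤ ∷ z≤n ∷ z≤n ∷ []

          -- The search takes exponentially many rounds, so times are not added up: every run of the
          -- loop from τ′ within the space bound extends to one from τ, for some time.
          Reach : Store → Store → Set
          Reach τ τ′ = ∀ {τ″} → (∃ λ t → Exec (Height≤ sp) (while searching dfsStep) τ′ τ″ t) → ∃ λ t → Exec (Height≤ sp) (while searching dfsStep) τ τ″ t

          -- At the head of each round all stacks have height at most B and the round is bounded by
          -- `cost dfsStep B`; so the space bound holds however many rounds there are.
          iter : ∀ ks es x {τ′} → length es + length ks ≤ K → searching (tops (H′ ks es x)) ≡ true → dfsStep ⊢ H′ ks es x ⇒ τ′ → Reach (H′ ks es x) τ′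
          iter ks es x le e r (t , u) = _ , loop e (bounded (timed r) (H-height ks es x le) sp≤) u

          search : ∀ ks es → length es + length ks ≤ K → Reach (H′ ks es one) (H′ ks es (bit (dfs φ ℓ ks (map strip es))))
          -- `acc` is the disjunction over the digits tried so far; associativity moves the value of
          -- each further digit into it.
          some : ∀ n d acc ks es → toℕ d ≡ n → length es + suc (length ks) ≤ K →
            Reach (H′ ks ((false , d , acc) ∷ es) one) (H′ (false ∷ ks) es (bit (acc ∨ down n d (λ d → dfs φ ℓ ks ((false , d) ∷ map strip es)))))

          search [] es le u = iter [] es one le refl (then′ refl (else′ refl (leaf-run es (≤-trans (m≤m+n _ 0) (≤-trans le K≤))))) u
          search (false ∷ ks) es le u = iter (false ∷ ks) es one le refl acts (some (toℕ top) top false ks es refl le u)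
          search (true ∷ ks) es le u =
            let le′ = ≤-trans (≤-reflexive (sym (+-suc (length es) (length ks)))) le in
            iter (true ∷ ks) es one le refl acts
              (search ks ((true , c₁ , true) ∷ es) le′
                (iter ks ((true , c₁ , true) ∷ es) _ le′ refl acts
                  (search ks ((true , fz , _) ∷ es) le′
                    (iter ks ((true , fz , _) ∷ es) _ le′ refl acts u))))

          some zero fz acc ks es refl le u =
            let le′ = ≤-trans (≤-reflexive (sym (+-suc (length es) (length ks)))) le in
            search ks ((false , fz , acc) ∷ es) le′
              (iter ks ((false , fz , acc) ∷ es) _ le′ refl acts u)
          some (suc n) (fs d) acc ks es e le u =
            let le′ = ≤-trans (≤-reflexive (sym (+-suc (length es) (length ks)))) le in
            search ks ((false , fs d , acc) ∷ es) le′
              (iter ks ((false , fs d , acc) ∷ es) _ le′ refl acts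
                (some n (lower (fs d)) _ ks es (trans (toℕ-inject₁ d) (suc-injective e)) le
                  (subst (λ b → ∃ λ t → Exec (Height≤ sp) (while searching dfsStep) (H′ (false ∷ ks) es (bit b)) _ t) (sym (∨-assoc acc _ _)) u)))

-- The theory lies in polynomial space

module DeciderTheorem where

  open import Defs using (QF; eq; rel; neg; and; or; unary; encQF; encSentence; head?; Holds; Σ₁Theory; InPSPACE)
  open FiniteTypes
  open StackPrograms
  open Presentation
  open Savitch
  open DeciderState
  open import Data.Nat using (ℕ; zero; suc; _+_; _*_; _≤_; z≤n; s≤s)
  open import Data.Nat.Properties
  open import Data.Fin using (Fin) renaming (zero to fz; suc to fs)
  open import Data.Bool using (Bool; true; false; not; _∧_)
  open import Data.Bool.Properties using (∧-zeroʳ)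
  open import Data.Maybe using (Maybe; just; nothing; is-just)
  open import Data.List using (List; []; _∷_; length; _++_; map; _ʳ++_; replicate; reverse)
  open import Data.List.Properties using (++-identityʳ; ∷-injectiveʳ; length-map; length-ʳ++; length-++; ʳ++-defn; reverse-involutive)
  open import Data.Vec as V using (Vec; []; _∷_)
  open import Data.Product using (∃; ∃₂; _×_; _,_; proj₁; proj₂)
  open import Data.Sum using (_⊎_; inj₁; inj₂)
  open import Data.Empty using (⊥-elim)
  open import Relation.Binary.PropositionalEquality
  open import Data.Vec.Relation.Unary.All using ([]; _∷_) renaming (All to AllV)
  open DeciderPrograms
  open DeciderLeaves
  open DeciderSearch
  open Compilation
  open import Function.Bundles using (_⇔_; mk⇔)

  module Membership (γ nQ m : ℕ) (q₀ : Fin nQ) (δ : Fin nQ → Vec (Maybe (Fin γ)) 2 → Fin nQ)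
                (final : Fin (suc m) → Fin nQ → Bool) (δ-pad : ∀ q → δ q (nothing ∷ nothing ∷ []) ≡ q) where

    open Shared γ nQ m q₀ δ final δ-pad using (σ; 𝒜; encQF-injective; encSentence-injective)
    open Configurations γ nQ m q₀ δ final δ-pad using (nd; dfs; kinds; pattern′; natoms; savitch-sound; savitch-complete)
    open Decider γ nQ m q₀ δ final δ-pad
    open Execution γ nQ m q₀ δ final δ-pad
    open Procedure γ nQ m q₀ δ final δ-pad

    module _ (B : ℕ) where

      open Runs B

      O : St → List Bool → ℕ → St
      O s In c = record s { inp = bits In ; ks = ones c [] }

      size-loop : ∀ s In c →
        (∃₂ λ k rest → In ≡ unary k ++ rest × Loop isT (del inp# ⨾ put ks# one) k (toVec (O s In c)) (toVec (O s (false ∷ rest) (k + c))))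
        ⊎ ((∀ k rest → In ≢ unary k ++ rest) × ∃ λ n → n ≤ length In × Loop isT (del inp# ⨾ put ks# one) n (toVec (O s In c)) (toVec (O s [] (n + c))))
      size-loop s [] c = inj₂ ((λ { zero _ () ; (suc _) _ () }) , 0 , z≤n , stop refl)
      size-loop s (false ∷ In) c = inj₁ (0 , In , refl , stop refl)
      size-loop s (true ∷ In) c with size-loop s In (suc c)
      ... | inj₁ (k , rest , refl , l) = inj₁ (suc k , rest , refl , more refl acts (Loop-cast (cong (λ n → toVec (O s (false ∷ rest) n)) (+-suc k c)) l))
      ... | inj₂ (nv , n , n≤ , l) = inj₂ ((λ { zero _ () ; (suc k) rest e → nv k rest (∷-injectiveʳ e) }) , suc n , s≤s n≤ ,
              more refl acts (Loop-cast (cong (λ n → toVec (O s [] n)) (+-suc n c)) l))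

      data Parse (w : List Bool) (s : St) : Set where
        valid   : ∀ k (φ : QF σ k) → w ≡ encSentence (k , φ) →
                  parse ⊢ toVec (record s { inp = bits w }) ⇒ toVec (record s { tok = toks φ [] ; ks = ones k [] }) → Parse w s
        invalid : ∀ s′ → (∀ k (φ : QF σ k) → w ≢ encSentence (k , φ)) → parse ⊢ toVec (record s { inp = bits w }) ⇒ toVec s′ → Failed s′ → Parse w s

      close : ∀ s′ → Failed s′ → ∃ λ s″ → ifte (nonempty inp#) fail idle ⊢ toVec s′ ⇒ toVec s″ × Failed s″
      close s′ f with is-just (head? (inp s′)) in e
      ... | true  = record s′ { bad = one ∷ bad s′ } , then′ e act , refl
      ... | false = s′ , else′ e act , f

      parse-run : ∀ w ℓ → suc (length w) ≤ B → Parse w (record blank { lc = ones ℓ [] })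
      parse-run w ℓ le with size-loop (record blank { lc = ones ℓ [] }) w 0
      ... | inj₂ (nv , n , n≤ , l) = invalid (record (O (record blank { lc = ones ℓ [] }) [] (n + 0)) { bad = one ∷ [] }) (λ k φ e → nv k (encQF φ) e)
              (while (≤-trans n≤ (≤-trans (n≤1+n _) le)) l ⨾ else′ refl act ⨾ while z≤n (stop refl) ⨾ else′ refl act) refl
      ... | inj₁ (k , rest , refl , l) = continue (nodes (length rest) s k rest 1 [] ≤-refl k≤)
        where
        s = record blank { lc = ones ℓ [] }
        len : length (unary k ++ rest) ≡ suc k + length rest
        len = go k
          where
          go : ∀ k → length (unary k ++ rest) ≡ suc k + length rest
          go zero    = refl
          go (suc k) = cong suc (go k)
        le′ : suc (suc (k + length rest)) ≤ B
        le′ = ≤-trans (s≤s (≤-reflexive (sym len))) le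
        k≤ : k ≤ B
        k≤ = ≤-trans (m≤m+n k _) (≤-trans (n≤1+n _) (≤-trans (n≤1+n _) le′))
        first : while isT (del inp# ⨾ put ks# one) ⊢ toVec (O s (unary k ++ rest) 0) ⇒ toVec (O s (false ∷ rest) k)
        first = cast (cong (λ n → toVec (O s (false ∷ rest) n)) (+-identityʳ k)) (while k≤ l)
        continue : Nodes s k rest 1 [] → Parse (unary k ++ rest) s
        continue (failed s′ n nv n≤ l f) with close s′ f
        ... | s″ , x , f′ = invalid s″ bad-word (via _ first (then′ refl acts ⨾ while (≤-trans n≤ (≤-trans (m≤n+m _ (suc k)) (≤-trans (≤-reflexive (+-suc (suc k) (length rest))) le′))) l ⨾ x)) f′
          where
          bad-word : ∀ k′ (φ : QF σ k′) → unary k ++ rest ≢ encSentence (k′ , φ)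
          bad-word k′ φ e with unary-injective k k′ e
          ... | refl , e′ = nv (φ ∷ []) [] (trans e′ (sym (trans (++-identityʳ _) (++-identityʳ _))))
        continue (parsed (φ ∷ []) [] n e n≤ l) = valid k φ (cong (unary k ++_) (trans e (trans (++-identityʳ _) (++-identityʳ _))))
          (via _ first (then′ refl acts ⨾ while (≤-trans n≤ (≤-trans (m≤n+m _ (suc (suc k))) le′)) l ⨾ else′ refl act))
        continue (parsed (φ ∷ []) (b ∷ r) n e n≤ l) = invalid (record (N s k (b ∷ r) 0 (toks φ [])) { bad = one ∷ [] }) bad-word
          (via _ first (then′ refl acts ⨾ while (≤-trans n≤ (≤-trans (m≤n+m _ (suc (suc k))) le′)) l ⨾ then′ refl act)) refl
          where
          bad-word : ∀ k′ (φ : QF σ k′) → unary k ++ rest ≢ encSentence (k′ , φ)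
          bad-word k′ ψ e′ with unary-injective k k′ e′
          ... | refl , e″ with encQF-injective φ ψ (trans (cong (_++ (b ∷ r)) (sym (++-identityʳ (encQF φ)))) (trans (sym e) (trans e″ (sym (++-identityʳ (encQF ψ))))))
          ... | ()

      measure-loop : ∀ In c a → Loop (nonempty inp#) (put lc# one ⨾ copy inp# aux# ⨾ del inp#) (length In)
        (toVec (record blank { inp = In ; lc = ones c [] ; aux = a })) (toVec (record blank { lc = ones (length In + c) [] ; aux = In ʳ++ a }))
      measure-loop []       c a = stop refl
      measure-loop (x ∷ In) c a = more refl acts
        (Loop-cast (cong (λ n → toVec (record blank { lc = ones n [] ; aux = In ʳ++ (x ∷ a) })) (+-suc (length In) c)) (measure-loop In (suc c) (x ∷ a)))

      measure-run : ∀ In → length In ≤ B → measureP ⊢ toVec (record blank { inp = In }) ⇒ toVec (record blank { inp = In ; lc = ones (length In) [] })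
      measure-run In le = via (toVec (record blank { lc = ones (length In + 0) [] ; aux = In ʳ++ [] })) (while le (measure-loop In 0 []))
        (cast (cong₂ (λ n i → toVec (record blank { inp = i ; lc = ones n [] })) (+-identityʳ (length In)) back)
          (mv-run aux# inp# (λ ()) _ (≤-trans (≤-reflexive (trans (length-ʳ++ In) (+-identityʳ _))) le)))
        where
        back : (In ʳ++ []) ʳ++ [] ≡ In
        back = trans (ʳ++-defn (In ʳ++ [])) (trans (++-identityʳ _) (trans (cong reverse (trans (ʳ++-defn In) (++-identityʳ _))) (reverse-involutive In)))

      module Setup {k : ℕ} (φ : QF σ k) (ℓ : ℕ) (ℓ≤ : ℓ ≤ B) where

        G : ℕ → ℕ → ℕ → List Sy → St
        G n a c r = record blank { tok = toks φ [] ; ks = ones k [] ; lc = ones n [] ; aux = ones a [] ; l2 = ones c [] ; rs = r }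

        restore : ∀ c r → mv aux# lc# ⊢ toVec (G 0 (ℓ + 0) c r) ⇒ toVec (G ℓ 0 c r)
        restore c r = cast (cong (λ l → toVec (record (G 0 0 c r) { lc = l })) (trans (ones-ʳ++ (ℓ + 0) [] []) (cong (λ n → ones n []) (+-identityʳ ℓ))))
          (mv-run aux# lc# (λ ()) (toVec (G 0 (ℓ + 0) c r)) (≤-trans (≤-reflexive (trans (length-ones (ℓ + 0)) (+-identityʳ ℓ))) ℓ≤))

        copy-loop : ∀ n a c r → Loop (nonempty lc#) (put l2# one ⨾ put aux# one ⨾ del lc#) n (toVec (G n a c r)) (toVec (G 0 (n + a) (n + c) r))
        copy-loop zero    a c r = stop refl
        copy-loop (suc n) a c r = more refl acts (Loop-cast (cong₂ (λ a c → toVec (G 0 a c r)) (+-suc n a) (+-suc n c)) (copy-loop n (suc a) (suc c) r))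

        kinds-loop : ∀ n a b c ks → Loop (nonempty lc#) (put rs# (kind false) ⨾ put aux# one ⨾ del lc#) n
          (toVec (G n a c (map kind (kinds φ ℓ b ks)))) (toVec (G 0 (n + a) c (map kind (kinds φ ℓ (n + b) ks))))
        kinds-loop zero    a b c ks = stop refl
        kinds-loop (suc n) a b c ks = more refl acts
          (Loop-cast (cong₂ (λ a b → toVec (G 0 a c (map kind (kinds φ ℓ b ks)))) (+-suc n a) (+-suc n b)) (kinds-loop n (suc a) (suc b) c ks))

        pat : ℕ → List Sy
        pat d = map kind (pattern′ φ ℓ d)

        block-run : ∀ c d → blockP ⊢ toVec (G ℓ 0 c (pat d)) ⇒ toVec (G ℓ 0 c (pat (suc d)))
        block-run c d = act ⨾ via (toVec (G 0 (ℓ + 0) c (pat (suc d))))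
          (cast (cong (λ b → toVec (G 0 (ℓ + 0) c (map kind (kinds φ ℓ b (pattern′ φ ℓ d))))) (+-identityʳ ℓ)) (while ℓ≤ (kinds-loop ℓ 0 0 c (pattern′ φ ℓ d))))
          (restore c (pat (suc d)))

        repeat-run : ∀ n c d → repeatP n blockP ⊢ toVec (G ℓ 0 c (pat d)) ⇒ toVec (G ℓ 0 c (pat (n + d)))
        repeat-run zero    c d = act
        repeat-run (suc n) c d = via _ (block-run c d) (cast (cong (λ e → toVec (G ℓ 0 c (pat e))) (+-suc n d)) (repeat-run n c (suc d)))

        outer-loop : ∀ j d → Loop (nonempty l2#) (repeatP nd blockP ⨾ del l2#) j (toVec (G ℓ 0 j (pat d))) (toVec (G ℓ 0 0 (pat (j * nd + d))))
        outer-loop zero    d = stop refl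
        outer-loop (suc j) d = more refl (via _ (repeat-run nd (suc j) d) act)
          (Loop-cast (cong (λ e → toVec (G ℓ 0 0 (pat e))) (trans (sym (+-assoc (j * nd) nd d)) (cong (_+ d) (+-comm (j * nd) nd)))) (outer-loop j (nd + d)))

        setup-run : setupP ⊢ toVec (G ℓ 0 0 []) ⇒ toVec (record (G ℓ 0 0 (pat (nd * ℓ))) { md = one ∷ [] })
        setup-run = via (toVec (G 0 (ℓ + 0) ℓ [])) (cast (cong (λ c → toVec (G 0 (ℓ + 0) c [])) (+-identityʳ ℓ)) (while ℓ≤ (copy-loop ℓ 0 0 [])))
          (via (toVec (G ℓ 0 ℓ [])) (restore ℓ [])
          (via (toVec (G ℓ 0 0 (pat (nd * ℓ)))) (cast (cong (λ e → toVec (G ℓ 0 0 (pat e))) (trans (+-identityʳ _) (*-comm ℓ nd))) (while ℓ≤ (outer-loop ℓ 0)))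
            act))

    length-pattern : ∀ {k} (φ : QF σ k) ℓ d → length (pattern′ φ ℓ d) ≡ d * suc ℓ
    length-pattern φ ℓ zero    = refl
    length-pattern φ ℓ (suc d) = trans (go ℓ) (cong (suc ℓ +_) (length-pattern φ ℓ d))
      where
      go : ∀ n → length (kinds φ ℓ n (pattern′ φ ℓ d)) ≡ suc n + length (pattern′ φ ℓ d)
      go zero    = refl
      go (suc n) = cong suc (go n)

    natoms-≤ : ∀ {k} (χ φ : QF σ k) ℓ → natoms χ ℓ φ ≤ length (encQF φ)
    natoms-≤ χ (eq i j)  ℓ = s≤s z≤n
    natoms-≤ χ (rel r v) ℓ = s≤s z≤n
    natoms-≤ χ (neg φ)   ℓ = ≤-trans (natoms-≤ χ φ ℓ) (≤-trans (n≤1+n _) (≤-trans (n≤1+n _) (n≤1+n _)))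
    natoms-≤ χ (and φ ψ) ℓ = ≤-trans (+-mono-≤ (natoms-≤ χ ψ ℓ) (natoms-≤ χ φ ℓ)) (≤-trans (≤-reflexive (trans (+-comm (length (encQF ψ)) _) (sym (length-++ (encQF φ))))) (≤-trans (n≤1+n _) (≤-trans (n≤1+n _) (n≤1+n _))))
    natoms-≤ χ (or φ ψ)  ℓ = ≤-trans (+-mono-≤ (natoms-≤ χ ψ ℓ) (natoms-≤ χ φ ℓ)) (≤-trans (≤-reflexive (trans (+-comm (length (encQF ψ)) _) (sym (length-++ (encQF φ))))) (≤-trans (n≤1+n _) (≤-trans (n≤1+n _) (n≤1+n _))))

    -- `bnd` covers nd * n levels of n + 1 decisions each, and the input. `spc` adds the time of the
    -- prelude, of the setup and of one round of the search, by which stacks can outgrow that bound.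
    bnd spc : ℕ → ℕ
    bnd n = nd * n * suc n + suc n
    spc n = bnd n + (cost preludeP (bnd n) + (cost setupP (bnd n) + cost dfsStep (bnd n)))

    decide-run : ∀ w → ∃₂ λ τ t → Exec (Height≤ (spc (length w))) decide (toVec (record blank { inp = bits w })) τ t
                      × (accepting (tops τ) ≡ true ⇔ Σ₁Theory 𝒜 w)
    decide-run w = finish (parse-run B w ℓ ℓ<)
      where
      ℓ = length w
      B = bnd ℓ
      ℓ< : suc ℓ ≤ B
      ℓ< = m≤n+m _ (nd * ℓ * suc ℓ)
      ℓ≤ : ℓ ≤ B
      ℓ≤ = ≤-trans (n≤1+n _) ℓ<
      s₀ = record blank { inp = bits w }
      s₁ = record blank { inp = bits w ; lc = ones ℓ [] }
      open Runs B
      Ok = Height≤ (spc ℓ)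
      lb : length (bits w) ≡ ℓ
      lb = length-map bit w
      h₀ : Height≤ B (toVec s₀)
      h₀ = height (λ { fz → ≤-trans (≤-reflexive lb) ℓ≤ ; (fs j) → lookupAll {P = λ (l : List Sy) → length l ≤ B} {xs = V.replicate 20 []} (none′ 20) j })
        where
        none′ : ∀ n → AllV (λ (l : List Sy) → length l ≤ B) (V.replicate n [])
        none′ zero    = []
        none′ (suc n) = z≤n ∷ none′ n
      measured : measureP ⊢ toVec s₀ ⇒ toVec s₁
      measured = cast (cong (λ n → toVec (record blank { inp = bits w ; lc = ones n [] })) lb) (measure-run B (bits w) (≤-trans (≤-reflexive lb) ℓ≤))
      pre : ∀ {τ} → parse ⊢ toVec s₁ ⇒ τ → Exec Ok preludeP (toVec s₀) τ (cost preludeP B)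
      pre x = bounded (timed (via (toVec s₁) measured x)) h₀ (+-monoʳ-≤ B (m≤m+n (cost preludeP B) _))
      Outcome : Set
      Outcome = ∃₂ λ τ t → Exec Ok decide (toVec s₀) τ t × (accepting (tops τ) ≡ true ⇔ Σ₁Theory 𝒜 w)
      ok₀ : Ok (toVec s₀)
      ok₀ = height-mono (m≤m+n B _) h₀
      finish : Parse B w (record blank { lc = ones ℓ [] }) → Outcome
      finish (invalid s′ nv x f) = toVec s′ , _ , pre x ⨾ then′ f (act (Exec-ok (pre x) ok₀)) ,
        mk⇔ (λ e → ⊥-elim (clash (trans (sym e) (trans (cong (λ b → isBit true (head? (md s′)) ∧ not b) f) (∧-zeroʳ _))))) (λ { ((k , φ) , e , _) → ⊥-elim (nv k φ (sym e)) })
        where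
        clash : true ≢ false
        clash ()
      finish (valid k φ e x) = H′ pk [] (bit r) , _ ,
          pre x ⨾ else′ refl (bounded (timed (setup-run)) (height-grows (timed (via (toVec s₁) measured x)) h₀)
            (≤-trans (≤-reflexive (+-assoc B (cost preludeP B) (cost setupP B))) (+-monoʳ-≤ B (+-monoʳ-≤ (cost preludeP B) (m≤m+n (cost setupP B) _)))) ⨾ proj₂ searched) ,
          mk⇔ (λ a → (k , φ) , sym e , savitch-sound φ ℓ fits (isTrue r a))
              (λ { (s , e′ , h) → trueIs r (savitch-complete φ ℓ fits (subst (Holds 𝒜) (encSentence-injective s (k , φ) (trans e′ e)) h)) })
        where
        len : ℓ ≡ suc k + length (encQF φ)
        len = trans (cong length e) (go k)
          where
          go : ∀ k → length (unary k ++ encQF φ) ≡ suc k + length (encQF φ)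
          go zero    = refl
          go (suc k) = cong suc (go k)
        -- The number of variables is written in unary and every atom takes at least one bit, so
        -- configurations as long as the input are long enough.
        fits : suc k + natoms φ ℓ φ ≤ ℓ
        fits = ≤-trans (+-monoʳ-≤ (suc k) (natoms-≤ φ φ ℓ)) (≤-reflexive (sym len))
        k≤ : k ≤ B
        k≤ = ≤-trans (≤-trans (n≤1+n k) (≤-trans (m≤m+n (suc k) _) (≤-reflexive (sym len)))) ℓ≤
        φ≤ : length (encQF φ) ≤ B
        φ≤ = ≤-trans (≤-trans (m≤n+m _ (suc k)) (≤-reflexive (sym len))) ℓ≤
        pk = pattern′ φ ℓ (nd * ℓ)
        r = dfs φ ℓ pk []
        open Setup B φ ℓ ℓ≤ using (setup-run)
        open Leaf B φ ℓ k≤ φ≤ ℓ<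
        open Dfs (nd * ℓ * suc ℓ) (spc ℓ) (m≤m+n _ (suc ℓ))
          (+-monoʳ-≤ B (≤-trans (m≤n+m (cost dfsStep B) (cost setupP B)) (m≤n+m _ (cost preludeP B))))
        searched : ∃ λ t → Exec Ok (while searching dfsStep) (H′ pk [] one) (H′ pk [] (bit r)) t
        searched = search pk [] (≤-reflexive (length-pattern φ ℓ (nd * ℓ))) (1 , stop refl)
        isTrue : ∀ b → isBit true (just (bit b)) ∧ true ≡ true → b ≡ true
        isTrue true _ = refl
        trueIs : ∀ b → b ≡ true → isBit true (just (bit b)) ∧ true ≡ true
        trueIs true _ = refl

    spc-poly : Poly (λ n → suc (spc n))
    spc-poly = poly-+ (poly-const 1) (poly-+ bnd-poly (poly-+ (cost-poly preludeP bnd-poly) (poly-+ (cost-poly setupP bnd-poly) (cost-poly dfsStep bnd-poly))))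
      where
      bnd-poly : Poly bnd
      bnd-poly = poly-+ (poly-* (poly-* (poly-const nd) poly-id) (poly-+ (poly-const 1) poly-id)) (poly-+ (poly-const 1) poly-id)

    unbit : Sy → Bool
    unbit (bit b) = b
    unbit _       = false

    theory∈PSPACE : InPSPACE (Σ₁Theory 𝒜)
    theory∈PSPACE = Compiler.Impl.tm machine , proj₁ spc-poly , λ w →
      let (τ , t , x , iff) = decide-run w
          (T , _ , h , sp , ac , _) = Compiler.Sim.simulate 20 finSy bit unbit decide accepting machine {s = spc (length w)} {w = w} x (fits w)
      in T , h , (λ t′ le → ≤-trans (sp t′ le) (proj₂ spc-poly (length w))) , subst (λ b → (b ≡ true) ⇔ Σ₁Theory 𝒜 w) (sym ac) iff
      where
      machine = Compiler.impl 20 finSy bit unbit decide accepting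
      fits : ∀ w → length w ≤ spc (length w)
      fits w = ≤-trans (≤-trans (n≤1+n _) (m≤n+m (suc (length w)) (nd * length w * suc (length w)))) (m≤m+n (bnd (length w)) _)

-- Structures inside the graph of a rotation: degree and growth

module Rotations where

  open import Defs hiding (step)
  open FiniteTypes
  open Presentation
  open import Data.Nat using (ℕ; zero; suc; _+_; _*_; _≤_; z≤n; s≤s; _⊔_)
  open import Data.Nat.Properties
  open import Data.Fin using (Fin; combine; remQuot) renaming (zero to fz; suc to fs)
  open import Data.Fin.Properties using (combine-remQuot; remQuot-combine) renaming (_≟_ to _≟F_)
  open import Data.Bool using (Bool; true; false; _∧_; if_then_else_)
  open import Data.Maybe using (Maybe; just; nothing)
  open import Data.Maybe.Properties using (≡-dec)
  open import Data.List using (List; []; _∷_; length; _++_; map; _∷ʳ_; foldl; reverse; applyUpTo; zipWith)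
  open import Data.List.Properties using (length-++; length-applyUpTo; ∷-injective; reverse-involutive; reverse-++; unfold-reverse; length-map)
  open import Data.List.Membership.Propositional using (_∈_)
  open import Data.List.Membership.Propositional.Properties using (∈-∃++; ∈-++⁺ˡ; ∈-++⁺ʳ; ∈-++⁻; ∈-applyUpTo⁺)
  open import Data.List.Relation.Unary.Any using (here; there)
  open import Data.List.Relation.Unary.All as All using (All; []; _∷_)
  open import Data.List.Relation.Unary.AllPairs using (AllPairs; []; _∷_)
  open import Data.Vec using (Vec; []; _∷_; lookup)
  open import Data.Product using (∃; _×_; _,_; proj₁; proj₂)
  open import Data.Sum using (_⊎_; inj₁; inj₂)
  open import Data.Empty using (⊥-elim)
  open import Function using (_∘_)
  open import Relation.Nullary using (yes; no; ¬_)
  open import Relation.Nullary.Decidable using (⌊_⌋)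
  open import Relation.Binary.PropositionalEquality

  ⌊⌋-true : ∀ {P : Set} (d : Relation.Nullary.Dec P) → ⌊ d ⌋ ≡ true → P
  ⌊⌋-true (yes p) _ = p

  true-⌊⌋ : ∀ {P : Set} (d : Relation.Nullary.Dec P) → P → ⌊ d ⌋ ≡ true
  true-⌊⌋ (yes _) _ = refl
  true-⌊⌋ (no ¬p) p = ⊥-elim (¬p p)

  -- Each x strikes the occurrence of its image out of `ys`; as the images are distinct, those of
  -- the later elements remain.
  distinct-length : ∀ {A B : Set} (g : A → B) xs (ys : List B) → AllPairs (λ x y → g x ≢ g y) xs → All (λ x → g x ∈ ys) xs → length xs ≤ length ys
  distinct-length g []       ys d i = z≤n
  distinct-length g (x ∷ xs) ys (dx ∷ d) (ix ∷ i) with ∈-∃++ ix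
  ... | as , bs , refl = ≤-trans (s≤s (distinct-length g xs (as ++ bs) d (All.zipWith (λ (ne , m) → elsewhere ne m) (dx , i))))
          (≤-reflexive (trans (cong suc (length-++ as)) (sym (trans (length-++ as) (+-suc (length as) (length bs))))))
    where
    elsewhere : ∀ {y} → g x ≢ y → y ∈ as ++ g x ∷ bs → y ∈ as ++ bs
    elsewhere ne m with ∈-++⁻ as m
    ... | inj₁ p          = ∈-++⁺ˡ p
    ... | inj₂ (here e)   = ⊥-elim (ne (sym e))
    ... | inj₂ (there p)  = ∈-++⁺ʳ as p

  rotl rotr : ∀ {A : Set} → List A → List A
  rotl []       = []
  rotl (y ∷ ys) = ys ∷ʳ y
  rotr = reverse ∘ rotl ∘ reverse

  rotr-rotl : ∀ {A : Set} (ys : List A) → rotr (rotl ys) ≡ ys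
  rotr-rotl []       = refl
  rotr-rotl (y ∷ ys) rewrite reverse-++ ys (y ∷ []) | reverse-++ (reverse ys) (y ∷ []) | reverse-involutive ys = refl

  rotl-rotr : ∀ {A : Set} (ys : List A) → rotl (rotr ys) ≡ ys
  rotl-rotr ys with reverse ys in e
  ... | []     = trans (sym (cong reverse e)) (reverse-involutive ys)
  ... | z ∷ zs rewrite reverse-++ zs (z ∷ []) = trans (sym (unfold-reverse z zs)) (trans (sym (cong reverse e)) (reverse-involutive ys))

  -- A string carries two tracks over an alphabet of size a; every relation of the structure lies in the graph of
  -- the rotation of the second track and is cut out by a test that one scan of the string can carry out.
  module Tracks (a : ℕ) {C : Set} (finC : Finite C) (c₀ : C) (scan : C → Fin a → Fin a → C)
                (m : ℕ) (test : Fin m → Fin a → C → Bool) where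

    γ : ℕ
    γ = a * a

    X Y : Fin γ → Fin a
    X l = proj₁ (remQuot {a} a l)
    Y l = proj₂ (remQuot {a} a l)

    pair : Fin a → Fin a → Fin γ
    pair = combine

    X-pair : ∀ x y → X (pair x y) ≡ x
    X-pair x y = cong proj₁ (remQuot-combine x y)

    Y-pair : ∀ x y → Y (pair x y) ≡ y
    Y-pair x y = cong proj₂ (remQuot-combine x y)

    pair-XY : ∀ l → pair (X l) (Y l) ≡ l
    pair-XY = combine-remQuot {a} a

    -- In `spin x y`, x is the first letter on the second track of u, due at the end of v, and y is
    -- the latest letter on the second track of v, due next in u. At the end both debts must
    -- coincide.
    data Rot : Set where
      fresh broken : Rot
      spin         : Fin a → Fin a → Rot

    finRot : Finite Rot
    finRot = retract (fin⊎ finBool (fin× (finFin a) (finFin a)))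
      (λ { fresh → inj₁ true ; broken → inj₁ false ; (spin x y) → inj₂ (x , y) })
      (λ { (inj₁ true) → fresh ; (inj₁ false) → broken ; (inj₂ (x , y)) → spin x y })
      λ { fresh → refl ; broken → refl ; (spin _ _) → refl }

    Q : Set
    Q = Bool × Rot × C

    finQ : Finite Q
    finQ = fin× finBool (fin× finRot finC)

    eqS : Bool → Maybe (Fin γ) → Maybe (Fin γ) → Bool
    eqS b x y = b ∧ ⌊ ≡-dec _≟F_ x y ⌋

    rotS : Rot → Maybe (Fin γ) → Maybe (Fin γ) → Rot
    rotS fresh      (just l) (just l′) = if ⌊ X l ≟F X l′ ⌋ then spin (Y l) (Y l′) else broken
    rotS (spin x y) (just l) (just l′) = if ⌊ X l ≟F X l′ ⌋ ∧ ⌊ Y l ≟F y ⌋ then spin x (Y l′) else broken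
    rotS _          _        _         = broken

    scanS : C → Maybe (Fin γ) → C
    scanS c (just l) = scan c (X l) (Y l)
    scanS c nothing  = c

    stepQ : Q → Maybe (Fin γ) → Maybe (Fin γ) → Q
    stepQ (b , r , c) x y = eqS b x y , rotS r x y , scanS c x

    δ : Fin (size finQ) → Vec (Maybe (Fin γ)) 2 → Fin (size finQ)
    δ q (nothing ∷ nothing ∷ []) = q
    δ q (x ∷ y ∷ [])             = enc finQ (stepQ (dec finQ q) x y)

    rotated : Rot → (Fin a → Bool) → Bool
    rotated (spin x y) f = ⌊ x ≟F y ⌋ ∧ f x
    rotated _          f = false

    accept : Fin (suc m) → Q → Bool
    accept fz     (b , _ , _) = b
    accept (fs i) (_ , r , c) = rotated r (λ y → test i y c)

    final : Fin (suc m) → Fin (size finQ) → Bool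
    final i q = accept i (dec finQ q)

    q₀ : Fin (size finQ)
    q₀ = enc finQ (true , fresh , c₀)

    open Shared γ (size finQ) m q₀ δ final (λ _ → refl) public

    runQ : List (Fin γ) → List (Fin γ) → Q → Q
    runQ []      []       s = s
    runQ (l ∷ u) []       s = runQ u [] (stepQ s (just l) nothing)
    runQ []      (l′ ∷ v) s = runQ [] v (stepQ s nothing (just l′))
    runQ (l ∷ u) (l′ ∷ v) s = runQ u v (stepQ s (just l) (just l′))

    dec-stAt : ∀ n u v q → length u ≤ n → length v ≤ n → dec finQ (stAt n u v q) ≡ runQ u v (dec finQ q)
    dec-stAt zero    []      []       q _ _ = refl
    dec-stAt (suc n) []      []       q _ _ = dec-stAt n [] [] q z≤n z≤n
    dec-stAt (suc n) (l ∷ u) []       q (s≤s p) _ = trans (dec-stAt n u [] _ p z≤n) (cong (runQ u []) (dec-enc finQ _))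
    dec-stAt (suc n) []      (l′ ∷ v) q _ (s≤s p) = trans (dec-stAt n [] v _ z≤n p) (cong (runQ [] v) (dec-enc finQ _))
    dec-stAt (suc n) (l ∷ u) (l′ ∷ v) q (s≤s p) (s≤s p′) = trans (dec-stAt n u v _ p p′) (cong (runQ u v) (dec-enc finQ _))

    accepts-runQ : ∀ i u v → Accepts (automaton i) (conv (u ∷ v ∷ [])) ≡ (accept i (runQ u v (true , fresh , c₀)) ≡ true)
    accepts-runQ i u v = trans (accepts-stAt i (length u ⊔ length v) u v (m≤m⊔n _ _) (m≤n⊔m _ _))
      (cong (λ s → accept i s ≡ true) (trans (dec-stAt _ u v q₀ (m≤m⊔n _ _) (m≤n⊔m _ _)) (cong (runQ u v) (dec-enc finQ _))))

    eq-false : ∀ u v r c → proj₁ (runQ u v (false , r , c)) ≡ false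
    eq-false []      []      r c = refl
    eq-false (_ ∷ u) []      r c = eq-false u [] _ _
    eq-false []      (_ ∷ v) r c = eq-false [] v _ _
    eq-false (_ ∷ u) (_ ∷ v) r c = eq-false u v _ _

    eq-sound : ∀ u v r c → proj₁ (runQ u v (true , r , c)) ≡ true → u ≡ v
    eq-sound []      []       r c e = refl
    eq-sound (l ∷ u) []       r c e with trans (sym e) (eq-false u [] _ _)
    ... | ()
    eq-sound []      (l ∷ v)  r c e with trans (sym e) (eq-false [] v _ _)
    ... | ()
    eq-sound (l ∷ u) (l′ ∷ v) r c e with ≡-dec _≟F_ (just l) (just l′)
    ... | yes refl = cong (l ∷_) (eq-sound u v _ _ e)
    ... | no _ with trans (sym e) (eq-false u v _ _)
    ... | ()

    eq-complete : ∀ u r c → proj₁ (runQ u u (true , r , c)) ≡ true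
    eq-complete []      r c = refl
    eq-complete (l ∷ u) r c with ≡-dec _≟F_ (just l) (just l)
    ... | yes _ = eq-complete u _ _
    ... | no ne = ⊥-elim (ne refl)

    rotPart : Q → Rot
    rotPart s = proj₁ (proj₂ s)

    scanPart : Q → C
    scanPart s = proj₂ (proj₂ s)

    scanAll : C → List (Fin γ) → C
    scanAll = foldl (λ c l → scan c (X l) (Y l))

    scan-run : ∀ u v s → scanPart (runQ u v s) ≡ scanAll (scanPart s) u
    scan-run []      []      s = refl
    scan-run (_ ∷ u) []      s = scan-run u [] _
    scan-run []      (_ ∷ v) s = scan-run [] v _
    scan-run (_ ∷ u) (_ ∷ v) s = scan-run u v _

    rot-broken : ∀ u v b c → rotPart (runQ u v (b , broken , c)) ≡ broken
    rot-broken []      []      b c = refl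
    rot-broken (_ ∷ u) []      b c = rot-broken u [] _ _
    rot-broken []      (_ ∷ v) b c = rot-broken [] v _ _
    rot-broken (_ ∷ u) (_ ∷ v) b c = rot-broken u v _ _

    broken≢spin : ∀ {r x y} {P : Set} → r ≡ broken → r ≡ spin x y → P
    broken≢spin refl ()

    -- The pending letter y in front of one track and y′ at the end of the other express a
    -- comparison delayed by one position.
    spin-sound : ∀ u v b c x y {x′ y′} → rotPart (runQ u v (b , spin x y , c)) ≡ spin x′ y′ →
      x ≡ x′ × map X u ≡ map X v × y ∷ map Y v ≡ map Y u ∷ʳ y′
    spin-sound [] [] b c x y refl = refl , refl , refl
    spin-sound (l ∷ u) [] b c x y e = broken≢spin (rot-broken u [] _ _) e
    spin-sound [] (l ∷ v) b c x y e = broken≢spin (rot-broken [] v _ _) e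
    spin-sound (l ∷ u) (l′ ∷ v) b c x y e with X l ≟F X l′ | Y l ≟F y
    ... | no _  | _     = broken≢spin (rot-broken u v _ _) e
    ... | yes _ | no _  = broken≢spin (rot-broken u v _ _) e
    ... | yes p | yes refl with spin-sound u v _ _ x (Y l′) e
    ... | refl , xs , ys = refl , cong₂ _∷_ p xs , cong (Y l ∷_) ys

    Rotates : List (Fin γ) → List (Fin γ) → Fin a → Set
    Rotates u v y = map X u ≡ map X v × ∃ λ ys → map Y u ≡ y ∷ ys × map Y v ≡ ys ∷ʳ y

    rot-sound : ∀ u v {y} → rotPart (runQ u v (true , fresh , c₀)) ≡ spin y y → Rotates u v y
    rot-sound (l ∷ u) [] e = broken≢spin (rot-broken u [] _ _) e
    rot-sound [] (l ∷ v) e = broken≢spin (rot-broken [] v _ _) e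
    rot-sound (l ∷ u) (l′ ∷ v) e with X l ≟F X l′
    ... | no _  = broken≢spin (rot-broken u v _ _) e
    ... | yes p with spin-sound u v _ _ (Y l) (Y l′) e
    ... | refl , xs , ys = cong₂ _∷_ p xs , map Y u , refl , ys

    spin-complete : ∀ u v b c x y {y′} → map X u ≡ map X v → y ∷ map Y v ≡ map Y u ∷ʳ y′ → rotPart (runQ u v (b , spin x y , c)) ≡ spin x y′
    spin-complete [] [] b c x y refl refl = refl
    spin-complete (l ∷ u) (l′ ∷ v) b c x y xs ys with ∷-injective xs | ∷-injective ys
    ... | p , xs′ | q , ys′ with X l ≟F X l′ | Y l ≟F y
    ... | no np | _     = ⊥-elim (np p)
    ... | yes _ | no nq = ⊥-elim (nq (sym q))
    ... | yes _ | yes _ = spin-complete u v _ _ x (Y l′) xs′ ys′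

    rot-complete : ∀ u v {y} → Rotates u v y → rotPart (runQ u v (true , fresh , c₀)) ≡ spin y y
    rot-complete (l ∷ u) (l′ ∷ v) (xs , ._ , refl , ys) with ∷-injective xs
    ... | p , xs′ with X l ≟F X l′
    ... | no np = ⊥-elim (np p)
    ... | yes _ = spin-complete u v _ _ (Y l) (Y l′) xs′ ys

    rel-sound : ∀ i u v → Accepts (automaton (fs i)) (conv (u ∷ v ∷ [])) → ∃ λ y → Rotates u v y × test i y (scanAll c₀ u) ≡ true
    rel-sound i u v acc with runQ u v (true , fresh , c₀) in e | subst (λ A → A) (accepts-runQ (fs i) u v) acc
    ... | b , spin x y , c | t with x ≟F y
    ... | yes refl = x , rot-sound u v (cong rotPart e) , trans (cong (test i x) (trans (sym (scan-run u v _)) (cong scanPart e))) t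

    rel-complete : ∀ i u v y → Rotates u v y → test i y (scanAll c₀ u) ≡ true → Accepts (automaton (fs i)) (conv (u ∷ v ∷ []))
    rel-complete i u v y r t = subst (λ A → A) (sym (accepts-runQ (fs i) u v))
      (trans (cong₂ (λ r c → rotated r (λ y → test i y c)) (rot-complete u v r) (scan-run u v _)) (trans (cong (_∧ test i y (scanAll c₀ u)) (true-⌊⌋ (y ≟F y) refl)) t))

    eqv-sound : ∀ u v → Accepts (automaton fz) (conv (u ∷ v ∷ [])) → u ≡ v
    eqv-sound u v acc = eq-sound u v _ _ (subst (λ A → A) (accepts-runQ fz u v) acc)

    eqv-complete : ∀ u v → u ≡ v → Accepts (automaton fz) (conv (u ∷ v ∷ []))
    eqv-complete u .u refl = subst (λ A → A) (sym (accepts-runQ fz u u)) (eq-complete u _ _)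

    str : Elem P → List (Fin γ)
    str = proj₁

    ≈-sound : ∀ x y → EqP P x y → str x ≡ str y
    ≈-sound x y = eqv-sound (str x) (str y)

    ≈-complete : ∀ x y → str x ≡ str y → EqP P x y
    ≈-complete x y = eqv-complete (str x) (str y)

    valid : IsValidPresentation P
    valid = record { refl  = λ {x} → ≈-complete x x refl
                   ; sym   = λ {x} {y} e → ≈-complete y x (sym (≈-sound x y e))
                   ; trans = λ {x} {y} {z} e e′ → ≈-complete x z (trans (≈-sound x y e) (≈-sound y z e′)) } ,
      λ { r (x ∷ y ∷ []) (x′ ∷ y′ ∷ []) e h → subst₂ (λ u v → Accepts (automaton (fs r)) (conv (u ∷ v ∷ []))) (≈-sound x x′ (e fz)) (≈-sound y y′ (e (fs fz))) h }

    build : List (Fin a) → List (Fin a) → List (Fin γ)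
    build = zipWith pair

    build-map : ∀ u → build (map X u) (map Y u) ≡ u
    build-map []      = refl
    build-map (l ∷ u) = cong₂ _∷_ (pair-XY l) (build-map u)

    map-X-build : ∀ xs ys → length xs ≡ length ys → map X (build xs ys) ≡ xs
    map-X-build []       []       e = refl
    map-X-build (x ∷ xs) (y ∷ ys) e = cong₂ _∷_ (X-pair x y) (map-X-build xs ys (suc-injective e))

    map-Y-build : ∀ xs ys → length xs ≡ length ys → map Y (build xs ys) ≡ ys
    map-Y-build []       []       e = refl
    map-Y-build (x ∷ xs) (y ∷ ys) e = cong₂ _∷_ (Y-pair x y) (map-Y-build xs ys (suc-injective e))

    fwd bwd : List (Fin γ) → List (Fin γ)
    fwd u = build (map X u) (rotl (map Y u))
    bwd u = build (map X u) (rotr (map Y u))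

    rotates-fwd : ∀ {u v y} → Rotates u v y → v ≡ fwd u
    rotates-fwd {u} {v} (xs , ys , e , e′) = trans (sym (build-map v)) (cong₂ build (sym xs) (trans e′ (sym (cong rotl e))))

    rotates-bwd : ∀ {u v y} → Rotates u v y → u ≡ bwd v
    rotates-bwd {u} {v} (xs , ys , e , e′) = trans (sym (build-map u)) (cong₂ build xs (trans (sym (rotr-rotl (map Y u))) (cong rotr (trans (cong rotl e) (sym e′)))))

    length-rotl : ∀ {A : Set} (ys : List A) → length (rotl ys) ≡ length ys
    length-rotl []       = refl
    length-rotl (y ∷ ys) = trans (length-++ ys) (+-comm (length ys) 1)

    length-rotr : ∀ {A : Set} (ys : List A) → length (rotr ys) ≡ length ys
    length-rotr ys = trans (sym (length-rotl (rotr ys))) (cong length (rotl-rotr ys))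

    same-length : ∀ u → length (map X u) ≡ length (map Y u)
    same-length u = trans (length-map X u) (sym (length-map Y u))

    bwd-fwd : ∀ u → bwd (fwd u) ≡ u
    bwd-fwd u = trans (cong₂ (λ xs ys → build xs (rotr ys)) (map-X-build (map X u) (rotl (map Y u)) l) (map-Y-build (map X u) (rotl (map Y u)) l)) (trans (cong (build (map X u)) (rotr-rotl (map Y u))) (build-map u))
      where l = trans (same-length u) (sym (length-rotl (map Y u)))

    fwd-bwd : ∀ u → fwd (bwd u) ≡ u
    fwd-bwd u = trans (cong₂ (λ xs ys → build xs (rotl ys)) (map-X-build (map X u) (rotr (map Y u)) l) (map-Y-build (map X u) (rotr (map Y u)) l)) (trans (cong (build (map X u)) (rotl-rotr (map Y u))) (build-map u))
      where l = trans (same-length u) (sym (length-rotr (map Y u)))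

    -- All relations lie in the graph of the one bijection `fwd`. The same strings at both ends are
    -- excluded because adjacency requires inequality.
    neighbours : ∀ {x y : Elem P} → Adj 𝒜 x y → str y ≡ fwd (str x) ⊎ str y ≡ bwd (str x)
    neighbours {x} {y} (ne , r , (u ∷ v ∷ []) , h , (i , ei) , (j , ej)) with rel-sound r (str u) (str v) h
    ... | _ , rot , _ = cases i j ei ej
      where
      cases : ∀ i j → EqP P (lookup (u ∷ v ∷ []) i) x → EqP P (lookup (u ∷ v ∷ []) j) y → str y ≡ fwd (str x) ⊎ str y ≡ bwd (str x)
      cases fz      (fs fz) p q = inj₁ (trans (sym (≈-sound v y q)) (trans (rotates-fwd rot) (cong fwd (≈-sound u x p))))
      cases (fs fz) fz      p q = inj₂ (trans (sym (≈-sound u y q)) (trans (rotates-bwd rot) (cong bwd (≈-sound v x p))))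
      cases fz      fz      p q = ⊥-elim (ne (≈-complete x y (trans (sym (≈-sound u x p)) (≈-sound u y q))))
      cases (fs fz) (fs fz) p q = ⊥-elim (ne (≈-complete x y (trans (sym (≈-sound v x p)) (≈-sound v y q))))

    at-most : ∀ {R : Elem P → Set} (ys : List (List (Fin γ))) → (∀ {x} → R x → str x ∈ ys) → AtMost 𝒜 R (length ys)
    at-most ys f xs d r = distinct-length str xs ys (apart d) (All.map f r)
      where
      apart : ∀ {xs} → AllPairs (λ x y → ¬ (EqP P x y)) xs → AllPairs (λ x y → str x ≢ str y) xs
      apart []       = []
      apart {x ∷ _} (p ∷ ps) = All.map (λ {y} ne e → ne (≈-complete x y e)) p ∷ apart ps

    bounded-degree : BoundedDegree 𝒜
    bounded-degree = 2 , λ x → at-most {Adj 𝒜 x} (fwd (str x) ∷ bwd (str x) ∷ []) (λ {y} h → pick (neighbours {x} {y} h))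
      where
      pick : ∀ {x y : List (Fin γ)} → y ≡ fwd x ⊎ y ≡ bwd x → y ∈ fwd x ∷ bwd x ∷ []
      pick (inj₁ e) = here e
      pick (inj₂ e) = there (here e)

    iter : (List (Fin γ) → List (Fin γ)) → ℕ → List (Fin γ) → List (Fin γ)
    iter f zero    u = u
    iter f (suc n) u = iter f n (f u)

    -- A step back undoes a step forward, so a path of length n amounts to at most n steps in one
    -- direction.
    within : ∀ n {x y : Elem P} → Within 𝒜 n x y → ∃ λ i → i ≤ n × (str y ≡ iter fwd i (str x) ⊎ str y ≡ iter bwd i (str x))
    within zero    {x} {y} e        = 0 , z≤n , inj₁ (sym (≈-sound x y e))
    within (suc n) {x} {y} (inj₁ e) = 0 , z≤n , inj₁ (sym (≈-sound x y e))
    within (suc n) {x} {y} (inj₂ (z , adj , w)) with within n {z} {y} w | neighbours {x} {z} adj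
    ... | i     , i≤ , inj₁ e | inj₁ e′ = suc i , s≤s i≤ , inj₁ (trans e (cong (iter fwd i) e′))
    ... | i     , i≤ , inj₂ e | inj₂ e′ = suc i , s≤s i≤ , inj₂ (trans e (cong (iter bwd i) e′))
    ... | zero  , i≤ , inj₁ e | inj₂ e′ = 1 , s≤s z≤n , inj₂ (trans e e′)
    ... | zero  , i≤ , inj₂ e | inj₁ e′ = 1 , s≤s z≤n , inj₁ (trans e e′)
    ... | suc i , i≤ , inj₁ e | inj₂ e′ = i , ≤-trans (n≤1+n i) (≤-trans i≤ (n≤1+n n)) , inj₁ (trans e (cong (iter fwd i) (trans (cong fwd e′) (fwd-bwd (str x)))))
    ... | suc i , i≤ , inj₂ e | inj₁ e′ = i , ≤-trans (n≤1+n i) (≤-trans i≤ (n≤1+n n)) , inj₂ (trans e (cong (iter bwd i) (trans (cong bwd e′) (bwd-fwd (str x)))))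

    linear-growth : LinearGrowth 𝒜
    -- There are n + 1 candidates in either direction, and 2 * (n + 1) ≤ 4 * n as soon as n ≥ 1.
    linear-growth = 4 , 1 , λ n 1≤n → m≤m+n n _ , λ x xs d h → ≤-trans (at-most {Within 𝒜 n x} (ball n (str x)) (λ {y} w → inside n (within n {x} {y} w)) xs d h) (count n (str x) 1≤n)
      where
      ball : ℕ → List (Fin γ) → List (List (Fin γ))
      ball n u = applyUpTo (λ i → iter fwd i u) (suc n) ++ applyUpTo (λ i → iter bwd i u) (suc n)
      inside : ∀ n {u v} → (∃ λ i → i ≤ n × (v ≡ iter fwd i u ⊎ v ≡ iter bwd i u)) → v ∈ ball n u
      inside n {u} (i , i≤ , inj₁ refl) = ∈-++⁺ˡ (∈-applyUpTo⁺ (λ i → iter fwd i u) (s≤s i≤))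
      inside n {u} (i , i≤ , inj₂ refl) = ∈-++⁺ʳ (applyUpTo (λ i → iter fwd i u) (suc n)) (∈-applyUpTo⁺ (λ i → iter bwd i u) (s≤s i≤))
      count : ∀ n u → 1 ≤ n → length (ball n u) ≤ 4 * n
      count n u 1≤n = ≤-trans (≤-reflexive (trans (length-++ (applyUpTo (λ i → iter fwd i u) (suc n))) (cong₂ _+_ (length-applyUpTo (λ i → iter fwd i u) (suc n)) (length-applyUpTo (λ i → iter bwd i u) (suc n)))))
        (≤-trans (+-mono-≤ (+-monoˡ-≤ n 1≤n) (+-monoˡ-≤ n 1≤n)) (≤-reflexive (trans (+-assoc n n (n + n)) (cong (λ z → n + (n + (n + z))) (sym (+-identityʳ n))))))

-- The fixed structure and the meaning of sentences about walks

module UniversalStructure where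

  open import Defs hiding (step; run)
  open FiniteTypes
  open Presentation
  open Rotations
  open import Data.Nat using (ℕ; zero; suc; _+_; _≤_; z≤n; s≤s)
  open import Data.Nat.Properties
  open import Data.Fin using (Fin; toℕ) renaming (zero to fz; suc to fs)
  open import Data.Fin.Properties using () renaming (_≟_ to _≟F_)
  open import Data.Bool using (Bool; true; false; not; _∧_; _∨_; if_then_else_)
  open import Data.Maybe using (Maybe; just; nothing)
  open import Data.List using (List; []; _∷_; length; _++_; map; _∷ʳ_; drop)
  open import Data.List.Properties using (++-assoc; length-++; ∷-injective; map-++; ++-identityʳ)
  open import Data.List.Relation.Unary.All as All using (All; []; _∷_)
  open import Data.List.Relation.Unary.All.Properties using (++⁺; ++⁻)
  open import Data.List.Relation.Binary.Pointwise using (Pointwise; []; _∷_)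
  open import Data.Vec using ([]; _∷_)
  open import Data.Product using (∃; ∃₂; _×_; _,_; proj₁; proj₂)
  open import Data.Sum using (inj₁; inj₂)
  open import Data.Unit using (tt)
  open import Relation.Nullary using (yes; no)
  open import Relation.Nullary.Decidable using (⌊_⌋)
  open import Relation.Binary.PropositionalEquality

  -- The letters of a history: v is a bit of the current row, the key describes the rewriting rule tried on this row
  -- (bit e₁ of the first cell becomes d₁, bit e₂ of the second becomes d₂), and the role says whether the present cell is
  -- unchanged, rewritten as the first cell, or rewritten as the second cell.
  record Key : Set where
    constructor key
    field start e₁ d₁ e₂ d₂ acc : Bool
  open Key public

  data Role : Set where
    r0 r1 r2 : Role

  record Letter : Set where
    constructor letter
    field
      key′ : Key
      role : Role
      v    : Bool
  open Letter public

  finKey : Finite Key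
  finKey = retract (fin× finBool (fin× finBool (fin× finBool (fin× finBool (fin× finBool finBool)))))
    (λ k → start k , e₁ k , d₁ k , e₂ k , d₂ k , acc k) (λ (a , b , c , d , e , f) → key a b c d e f) (λ _ → refl)

  finRole : Finite Role
  finRole = retract (finFin 3) (λ { r0 → fz ; r1 → fs fz ; r2 → fs (fs fz) }) (λ { fz → r0 ; (fs fz) → r1 ; (fs (fs _)) → r2 })
    λ { r0 → refl ; r1 → refl ; r2 → refl }

  letterFin : Finite (Maybe Letter)
  letterFin = finMaybe (retract (fin× finKey (fin× finRole finBool)) (λ l → key′ l , role l , v l) (λ (k , r , b) → letter k r b) (λ _ → refl))

  -- The names of the relations. `reads` inspects the letter at the head of the second track, the
  -- others inspect the result of the scan.
  data Label : Set where
    reads : Key → Maybe Bool → Label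
    whole history periodic : Label

  labelFin : Finite Label
  labelFin = retract (fin⊎ (fin× finKey (finMaybe finBool)) (finFin 3))
    (λ { (reads k b) → inj₁ (k , b) ; whole → inj₂ fz ; history → inj₂ (fs fz) ; periodic → inj₂ (fs (fs fz)) })
    (λ { (inj₁ (k , b)) → reads k b ; (inj₂ fz) → whole ; (inj₂ (fs fz)) → history ; (inj₂ (fs (fs _))) → periodic })
    λ { (reads _ _) → refl ; whole → refl ; history → refl ; periodic → refl }

  sameKey : Key → Key → Bool
  sameKey k k′ = ⌊ enc finKey k ≟F enc finKey k′ ⌋

  sameKey-sound : ∀ k k′ → sameKey k k′ ≡ true → k ≡ k′
  sameKey-sound k k′ e = enc-injective finKey (⌊⌋-true (enc finKey k ≟F enc finKey k′) e)

  sameKey-refl : ∀ k → sameKey k k ≡ true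
  sameKey-refl k = true-⌊⌋ (enc finKey k ≟F enc finKey k) refl

  -- At the start of a cell the role may change, but a first cell is followed by a second one and a
  -- second cell needs a first one before it. Inside a cell the role is kept.
  admissible : Bool → Role → Role → Bool
  admissible true  r1 r2 = true
  admissible true  r1 _  = false
  admissible true  _  r2 = false
  admissible true  _  _  = true
  admissible false r0 r0 = true
  admissible false r1 r1 = true
  admissible false r2 r2 = true
  admissible false _  _  = false

  _==_ : Bool → Bool → Bool
  true  == b = b
  false == b = not b

  rewrites : Role → Key → Bool → Bool → Bool
  rewrites r0 k x y = x == y
  rewrites r1 k x y = (x == e₁ k) ∧ (y == d₁ k)
  rewrites r2 k x y = (x == e₂ k) ∧ (y == d₂ k)

  -- Acceptance is granted at the second cell, when both cells of the rule are being rewritten.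
  fires : Role → Key → Bool
  fires r2 k = acc k
  fires _  _ = false

  -- In `run p b` the previous letter has role p, and b tells whether an accepting rule has been
  -- applied. `after` freezes this flag once the second track has passed its origin, where the
  -- comparison would wrap around.
  data Hist : Set where
    run   : Role → Bool → Hist
    after : Bool → Hist
    bad   : Hist

  histStep : Hist → Letter → Letter → Hist
  histStep (run p b) x y = if admissible (start (key′ x)) p (role x) ∧ rewrites (role x) (key′ x) (v x) (v y)
                           then run (role x) (b ∨ fires (role x) (key′ x)) else bad
  histStep s         x y = s

  hist : Hist → Maybe Letter → Maybe Letter → Hist
  hist s         nothing  _        = s
  hist s         (just x) (just y) = histStep s x y
  hist (run p b) (just x) nothing  = after b
  hist s         (just x) nothing  = s

  histOk : Hist → Bool
  histOk (run _ b) = b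
  histOk (after b) = b
  histOk bad       = false

  data Per : Set where
    run after bad : Per

  perStep : Per → Letter → Letter → Per
  perStep run x y = if sameKey (key′ x) (key′ y) then run else bad
  perStep s   x y = s

  per : Per → Maybe Letter → Maybe Letter → Per
  per s   nothing  _        = s
  per s   (just x) (just y) = perStep s x y
  per run (just x) nothing  = after
  per s   (just x) nothing  = s

  perOk : Per → Bool
  perOk bad = false
  perOk _   = true

  data Whole : Set where
    reading ended bad : Whole

  C : Set
  C = Whole × Hist × Per

  scanFin : Finite C
  scanFin = fin× (retract (finFin 3) (λ { reading → fz ; ended → fs fz ; bad → fs (fs fz) }) (λ { fz → reading ; (fs fz) → ended ; (fs (fs _)) → bad })
                 λ { reading → refl ; ended → refl ; bad → refl })
        (fin× (retract (fin⊎ (fin× finRole finBool) (fin⊎ finBool fin⊤))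
                 (λ { (run r b) → inj₁ (r , b) ; (after b) → inj₂ (inj₁ b) ; bad → inj₂ (inj₂ tt) })
                 (λ { (inj₁ (r , b)) → run r b ; (inj₂ (inj₁ b)) → after b ; (inj₂ (inj₂ _)) → bad })
                 λ { (run _ _) → refl ; (after _) → refl ; bad → refl })
              (retract (finFin 3) (λ { run → fz ; after → fs fz ; bad → fs (fs fz) }) (λ { fz → run ; (fs fz) → after ; (fs (fs _)) → bad })
                 λ { run → refl ; after → refl ; bad → refl }))

  pairHist : Hist → List Letter → List Letter → Hist
  pairHist h (x ∷ xs) (y ∷ ys) = pairHist (histStep h x y) xs ys
  pairHist h _        _        = h

  pairPer : Per → List Letter → List Letter → Per
  pairPer p (x ∷ xs) (y ∷ ys) = pairPer (perStep p x y) xs ys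
  pairPer p _        _        = p

  sameBit : Maybe Bool → Bool → Bool
  sameBit nothing  _ = true
  sameBit (just b) c = b == c

  Lab : Set
  Lab = Key × Maybe Bool

  Fits : Lab → Letter → Set
  Fits (k , b) l = k ≡ key′ l × sameBit b (v l) ≡ true

  -- What remains of a sentence when the rotations are eliminated: conditions on the body of x₀
  -- alone, compared with itself at two distances.
  record Solution (labs₁ labs₂ : List Lab) (body : List Letter) : Set where
    field
      front back : List Letter
      body≡      : body ≡ front ++ back
      fits       : Pointwise Fits (labs₁ ++ labs₂) front
      rows       : histOk (pairHist (run r0 false) body (drop (length labs₁) body)) ≡ true
      cycles     : perOk (pairPer run body (drop (length (labs₁ ++ labs₂)) body)) ≡ true

  drop-length : ∀ {A : Set} (xs ys : List A) → drop (length xs) (xs ++ ys) ≡ ys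
  drop-length []       ys = refl
  drop-length (x ∷ xs) ys = drop-length xs ys

  split-PW : ∀ {A B : Set} {R : A → B → Set} xs {ys bs} → Pointwise R (xs ++ ys) bs → ∃₂ λ cs ds → bs ≡ cs ++ ds × Pointwise R xs cs × Pointwise R ys ds
  split-PW []       p       = [] , _ , refl , [] , p
  split-PW (x ∷ xs) (r ∷ p) with split-PW xs p
  ... | cs , ds , refl , q , q′ = _ ∷ cs , ds , refl , r ∷ q , q′

  PW-length : ∀ {A B : Set} {R : A → B → Set} {xs ys} → Pointwise R xs ys → length xs ≡ length ys
  PW-length []      = refl
  PW-length (_ ∷ p) = cong suc (PW-length p)

  _++ᴾ_ : ∀ {A B : Set} {R : A → B → Set} {xs ys xs′ ys′} → Pointwise R xs ys → Pointwise R xs′ ys′ → Pointwise R (xs ++ xs′) (ys ++ ys′)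
  []      ++ᴾ q = q
  (r ∷ p) ++ᴾ q = r ∷ (p ++ᴾ q)

  reads-fits : ∀ k b l → sameKey k (key′ l) ∧ sameBit b (v l) ≡ true → Fits (k , b) l
  reads-fits k b l e = split (sameKey k (key′ l)) refl e
    where
    split : ∀ s → sameKey k (key′ l) ≡ s → s ∧ sameBit b (v l) ≡ true → Fits (k , b) l
    split true e₁ e₂ = sameKey-sound k (key′ l) e₁ , e₂

  -- The finite encodings are kept abstract because their definitions are never needed.
  module Histories (finLetter : Finite (Maybe Letter)) (finLabel : Finite Label) (finC : Finite C) where

    a : ℕ
    a = size finLetter

    D : Fin a → Maybe Letter
    D = dec finLetter

    -- x₀ carries one word on both tracks, with a marker (a letter that decodes to `nothing`) at its
    -- end and nowhere else. Later the marker on the second track shows where the shifted copy of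
    -- the word ends.
    wholeStep : Whole → Bool → Maybe Letter → Whole
    wholeStep reading true (just _) = reading
    wholeStep reading true nothing  = ended
    wholeStep _       _    _        = bad

    scan : C → Fin a → Fin a → C
    scan (w , h , p) x y = wholeStep w ⌊ x ≟F y ⌋ (D x) , hist h (D x) (D y) , per p (D x) (D y)

    testLabel : Label → Maybe Letter → C → Bool
    testLabel (reads k b) (just l) c           = sameKey k (key′ l) ∧ sameBit b (v l)
    testLabel (reads k b) nothing  c           = false
    testLabel whole       _ (ended , _ , _)    = true
    testLabel whole       _ _                  = false
    testLabel history     _ (_ , h , _)        = histOk h
    testLabel periodic    _ (_ , _ , p)        = perOk p

    open Tracks a finC (reading , run r0 false , run) scan (size finLabel) (λ i y → testLabel (dec finLabel i) (D y)) public

    start-state : C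
    start-state = reading , run r0 false , run

    scanXY : C → List (Fin a) → List (Fin a) → C
    scanXY c (x ∷ xs) (y ∷ ys) = scanXY (scan c x y) xs ys
    scanXY c _        _        = c

    scanAll-XY : ∀ c u → scanAll c u ≡ scanXY c (map X u) (map Y u)
    scanAll-XY c []      = refl
    scanAll-XY c (l ∷ u) = scanAll-XY (scan c (X l) (Y l)) u

    Decodes : List (Fin a) → List Letter → Set
    Decodes = Pointwise (λ x l → D x ≡ just l)

    hist-after : ∀ xs ys w h p → (∀ x y → hist h x y ≡ h) → proj₁ (proj₂ (scanXY (w , h , p) xs ys)) ≡ h
    hist-after []       ys       w h p f = refl
    hist-after (x ∷ xs) []       w h p f = refl
    hist-after (x ∷ xs) (y ∷ ys) w h p f rewrite f (D x) (D y) = hist-after xs ys _ h _ f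

    per-after : ∀ xs ys w h p → (∀ x y → per p x y ≡ p) → proj₂ (proj₂ (scanXY (w , h , p) xs ys)) ≡ p
    per-after []       ys       w h p f = refl
    per-after (x ∷ xs) []       w h p f = refl
    per-after (x ∷ xs) (y ∷ ys) w h p f rewrite f (D x) (D y) = per-after xs ys _ _ p f

    after-stays : ∀ b x y → hist (after b) x y ≡ after b
    after-stays b nothing  y        = refl
    after-stays b (just x) nothing  = refl
    after-stays b (just x) (just y) = refl

    bad-stays : ∀ x y → hist bad x y ≡ bad
    bad-stays nothing  y        = refl
    bad-stays (just x) nothing  = refl
    bad-stays (just x) (just y) = refl

    after-stays′ : ∀ x y → per after x y ≡ after
    after-stays′ nothing  y        = refl
    after-stays′ (just x) nothing  = refl
    after-stays′ (just x) (just y) = refl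

    bad-stays′ : ∀ x y → per bad x y ≡ bad
    bad-stays′ nothing  y        = refl
    bad-stays′ (just x) nothing  = refl
    bad-stays′ (just x) (just y) = refl

    module _ {o : Fin a} (Do : D o ≡ nothing) where

      -- Past the origin of the second track both scans only remember their verdict.
      hist-origin : ∀ {bs body} → Decodes bs body → ∀ done w h p →
        histOk (proj₁ (proj₂ (scanXY (w , h , p) (bs ∷ʳ o) (o ∷ done)))) ≡ histOk h
      hist-origin [] done w h p rewrite Do = refl
      hist-origin {x ∷ bs} (e ∷ _) done w (run q b) p rewrite e | Do = cong histOk (hist-after (bs ∷ʳ o) done _ (after b) _ (after-stays b))
      hist-origin {x ∷ bs} (e ∷ _) done w (after b) p rewrite e | Do = cong histOk (hist-after (bs ∷ʳ o) done _ (after b) _ (after-stays b))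
      hist-origin {x ∷ bs} (e ∷ _) done w bad p rewrite e | Do = cong histOk (hist-after (bs ∷ʳ o) done _ bad _ bad-stays)

      per-origin : ∀ {bs body} → Decodes bs body → ∀ done w h p →
        perOk (proj₂ (proj₂ (scanXY (w , h , p) (bs ∷ʳ o) (o ∷ done)))) ≡ perOk p
      per-origin [] done w h p rewrite Do = refl
      per-origin {x ∷ bs} (e ∷ _) done w h run rewrite e | Do = cong perOk (per-after (bs ∷ʳ o) done _ _ after after-stays′)
      per-origin {x ∷ bs} (e ∷ _) done w h after rewrite e | Do = cong perOk (per-after (bs ∷ʳ o) done _ _ after after-stays′)
      per-origin {x ∷ bs} (e ∷ _) done w h bad rewrite e | Do = cong perOk (per-after (bs ∷ʳ o) done _ _ bad bad-stays′)

      hist-scan : ∀ {bs body ds rest} → Decodes bs body → Decodes rest ds → length rest ≤ length bs → ∀ done w h p →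
        histOk (proj₁ (proj₂ (scanXY (w , h , p) (bs ∷ʳ o) (rest ++ o ∷ done)))) ≡ histOk (pairHist h body ds)
      hist-scan {body = []}    d       []      le done w h p = hist-origin d done w h p
      hist-scan {body = _ ∷ _} d       []      le done w h p = hist-origin d done w h p
      hist-scan (e ∷ d) (f ∷ g) (s≤s le) done w h p rewrite e | f = hist-scan d g le done _ _ _

      per-scan : ∀ {bs body ds rest} → Decodes bs body → Decodes rest ds → length rest ≤ length bs → ∀ done w h p →
        perOk (proj₂ (proj₂ (scanXY (w , h , p) (bs ∷ʳ o) (rest ++ o ∷ done)))) ≡ perOk (pairPer p body ds)
      per-scan {body = []}    d       []      le done w h p = per-origin d done w h p
      per-scan {body = _ ∷ _} d       []      le done w h p = per-origin d done w h p
      per-scan (e ∷ d) (f ∷ g) (s≤s le) done w h p rewrite e | f = per-scan d g le done _ _ _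

    Atom : Set
    Atom = Label × ℕ

    lbl : ℕ → List Lab → List Atom
    lbl p []             = []
    lbl p ((k , b) ∷ ls) = (reads k b , p) ∷ lbl (suc p) ls

    -- last conjunct first
    atoms : List Lab → List Lab → List Atom
    atoms labs₁ labs₂ = lbl 0 labs₁ ++ (history , length labs₁) ∷ lbl (length labs₁) labs₂ ++ (periodic , length (labs₁ ++ labs₂)) ∷ []

    -- Positions are plain numbers, so that formulas carry no bounds; wherever the value matters the
    -- position is in range.
    clamp : ∀ n → ℕ → Fin (suc n)
    clamp n       zero    = fz
    clamp zero    (suc p) = fz
    clamp (suc n) (suc p) = fs (clamp n p)

    toℕ-clamp : ∀ n p → p ≤ n → toℕ (clamp n p) ≡ p
    toℕ-clamp n       zero    _        = refl
    toℕ-clamp (suc n) (suc p) (s≤s le) = cong suc (toℕ-clamp n p le)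

    atomQF : ∀ n → Atom → QF σ (suc n)
    atomQF n (l , p) = rel (enc finLabel l) (clamp n p ∷ clamp n (suc p) ∷ [])

    conj : ∀ n → QF σ (suc n) → List Atom → QF σ (suc n)
    conj n φ []       = φ
    conj n φ (x ∷ xs) = conj n (and (atomQF n x) φ) xs

    sentence : List Lab → List Lab → Σ₁Sentence σ
    -- The last atom relates the elements numbered n and n + 1, hence n + 2 variables.
    sentence labs₁ labs₂ = suc (suc n) , conj (suc n) (atomQF (suc n) (whole , 0)) (atoms labs₁ labs₂)
      where n = length (labs₁ ++ labs₂)

    whole-bad : ∀ xs ys h p → proj₁ (scanXY (bad , h , p) xs ys) ≡ bad
    whole-bad []       ys       h p = refl
    whole-bad (x ∷ xs) []       h p = refl
    whole-bad (x ∷ xs) (y ∷ ys) h p = whole-bad xs ys _ _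

    bad≢ended : ∀ {w : Whole} {A : Set} → w ≡ bad → w ≡ ended → A
    bad≢ended refl ()

    whole-sound : ∀ xs ys h p → length xs ≡ length ys → proj₁ (scanXY (reading , h , p) xs ys) ≡ ended →
      ∃₂ λ bs o → ∃ λ body → xs ≡ bs ∷ʳ o × ys ≡ bs ∷ʳ o × D o ≡ nothing × Decodes bs body
    whole-sound (x ∷ xs) (y ∷ ys) h p l e with x ≟F y
    ... | no _ = bad≢ended (whole-bad xs ys _ _) e
    ... | yes refl with D x in dx
    ... | just L with whole-sound xs ys _ _ (suc-injective l) e
    ... | bs , o , body , refl , refl , Do , d = x ∷ bs , o , L ∷ body , refl , refl , Do , dx ∷ d
    whole-sound (x ∷ []) (x ∷ []) h p l e | yes refl | nothing = [] , x , [] , refl , refl , dx , []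
    whole-sound (x ∷ x′ ∷ xs) (x ∷ y′ ∷ ys) h p l e | yes refl | nothing = bad≢ended (whole-bad xs ys _ _) e

    whole-test : ∀ y c → testLabel whole y c ≡ true → proj₁ c ≡ ended
    whole-test y (ended , _ , _) e = refl

    module Chain (U : ℕ → List (Fin γ)) where

      AtomOk : Atom → Set
      AtomOk (l , p) = ∃ λ y → Rotates (U p) (U (suc p)) y × testLabel l (D y) (scanAll start-state (U p)) ≡ true

      -- After p rotations the letters `done` have moved behind the marker o on the second track,
      -- while the first track is still the whole word.
      record State (o : Fin a) (p : ℕ) (done rest : List (Fin a)) : Set where
        constructor state
        field
          X≡ : map X (U p) ≡ (done ++ rest) ∷ʳ o
          Y≡ : map Y (U p) ≡ rest ++ o ∷ done

      scan-state : ∀ {o p done rest} → State o p done rest → scanAll start-state (U p) ≡ scanXY start-state ((done ++ rest) ∷ʳ o) (rest ++ o ∷ done)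
      scan-state {p = p} (state X≡ Y≡) = trans (scanAll-XY start-state (U p)) (cong₂ (scanXY start-state) X≡ Y≡)

      advance : ∀ {o p done z rest} → State o p done (z ∷ rest) → ∀ {y} → Rotates (U p) (U (suc p)) y → y ≡ z × State o (suc p) (done ∷ʳ z) rest
      advance {o} {p} {done} {z} {rest} (state X≡ Y≡) (xs , ys , e , e′) with ∷-injective (trans (sym e) Y≡)
      ... | refl , refl = refl , state (trans (sym xs) (trans X≡ (cong (_∷ʳ o) (sym (++-assoc done (z ∷ []) rest))))) (trans e′ (++-assoc rest (o ∷ done) (z ∷ [])))

      module _ {o : Fin a} (Do : D o ≡ nothing) where

        labels-sound : ∀ ls p done rest {body} → State o p done rest → Decodes rest body → All AtomOk (lbl p ls) →
          ∃₂ λ zs rest′ → ∃₂ λ front back → body ≡ front ++ back × Pointwise Fits ls front × Decodes zs front × Decodes rest′ back × State o (length ls + p) (done ++ zs) rest′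
        labels-sound [] p done rest st d [] = [] , rest , [] , _ , refl , [] , [] , d , subst (λ z → State o p z rest) (sym (++-identityʳ done)) st
        -- Here the marker stands at the head of the second track. It decodes to `nothing`, which no
        -- `reads` accepts, so the body is long enough for all labels.
        labels-sound ((k , b) ∷ ls) p done [] (state X≡ Y≡) d ((y , (xs , ys , e , e′) , t) ∷ al) with ∷-injective (trans (sym e) Y≡)
        ... | refl , refl with subst (λ m → testLabel (reads k b) m (scanAll start-state (U p)) ≡ true) Do t
        ... | ()
        labels-sound ((k , b) ∷ ls) p done (z ∷ rest) {L ∷ body} st (dz ∷ d) ((y , r , t) ∷ al) with advance st r
        ... | refl , st′ with labels-sound ls (suc p) (done ∷ʳ z) rest st′ d al
        ... | zs , rest′ , front , back , refl , fts , df , db , st″ =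
          z ∷ zs , rest′ , L ∷ front , back , refl , fit ∷ fts , dz ∷ df , db ,
          subst₂ (λ q w → State o q w rest′) (+-suc (length ls) p) (++-assoc done (z ∷ []) zs) st″
          where
          t′ : sameKey k (key′ L) ∧ sameBit b (v L) ≡ true
          t′ = subst (λ m → testLabel (reads k b) m (scanAll start-state (U p)) ≡ true) dz t
          fit : Fits (k , b) L
          fit = reads-fits k b L t′

        rows-at : ∀ {p done rest body ds} → State o p done rest → Decodes (done ++ rest) body → Decodes rest ds →
          histOk (proj₁ (proj₂ (scanAll start-state (U p)))) ≡ histOk (pairHist (run r0 false) body ds)
        rows-at {p} {done} {rest} st d d′ = trans (cong (λ c → histOk (proj₁ (proj₂ c))) (scan-state st))
          (hist-scan Do d d′ (≤-trans (m≤n+m (length rest) (length done)) (≤-reflexive (sym (length-++ done)))) done reading (run r0 false) run)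

        cycles-at : ∀ {p done rest body ds} → State o p done rest → Decodes (done ++ rest) body → Decodes rest ds →
          perOk (proj₂ (proj₂ (scanAll start-state (U p)))) ≡ perOk (pairPer run body ds)
        cycles-at {p} {done} {rest} st d d′ = trans (cong (λ c → perOk (proj₂ (proj₂ c))) (scan-state st))
          (per-scan Do d d′ (≤-trans (m≤n+m (length rest) (length done)) (≤-reflexive (sym (length-++ done)))) done reading (run r0 false) run)

        solve : ∀ labs₁ labs₂ {bs body} → State o 0 [] bs → Decodes bs body → All AtomOk (atoms labs₁ labs₂) → Solution labs₁ labs₂ body
        solve labs₁ labs₂ {bs} {body} st d al with ++⁻ (lbl 0 labs₁) al
        ... | al₁ , (y , r , h) ∷ al₂ with labels-sound labs₁ 0 [] bs st d al₁
        ... | zs₁ , rest₁ , f₁ , b₁ , refl , fit₁ , d₁ , db₁ , st₁ with ++⁻ (lbl (length labs₁) labs₂) al₂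
        ... | al₃ , (y′ , r′ , h′) ∷ [] with labels-sound labs₂ (length labs₁) zs₁ rest₁ (subst (λ q → State o q zs₁ rest₁) (+-identityʳ _) st₁) db₁ al₃
        ... | zs₂ , rest₂ , f₂ , b₂ , refl , fit₂ , d₂ , db₂ , st₂ = record
          { front = f₁ ++ f₂
          ; back = b₂
          ; body≡ = sym (++-assoc f₁ f₂ b₂)
          ; fits = fit₁ ++ᴾ fit₂
          ; rows = trans (cong (λ x → histOk (pairHist (run r0 false) (f₁ ++ (f₂ ++ b₂)) x)) drop₁) (trans (sym (rows-at (subst (λ q → State o q zs₁ rest₁) (+-identityʳ _) st₁) (d₁ ++ᴾ db₁) db₁)) h)
          ; cycles = trans (cong (λ x → perOk (pairPer run (f₁ ++ (f₂ ++ b₂)) x)) drop₂)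
                      (trans (sym (cycles-at (subst (λ q → State o q (zs₁ ++ zs₂) rest₂) count st₂)
                         (subst (Decodes ((zs₁ ++ zs₂) ++ rest₂)) (++-assoc f₁ f₂ b₂) ((d₁ ++ᴾ d₂) ++ᴾ db₂)) db₂)) h′)
          }
          where
          drop₁ : drop (length labs₁) (f₁ ++ (f₂ ++ b₂)) ≡ f₂ ++ b₂
          drop₁ = trans (cong (λ n → drop n (f₁ ++ (f₂ ++ b₂))) (PW-length fit₁)) (drop-length f₁ _)
          count : length labs₂ + length labs₁ ≡ length (labs₁ ++ labs₂)
          count = trans (+-comm (length labs₂) _) (sym (length-++ labs₁))
          drop₂ : drop (length (labs₁ ++ labs₂)) (f₁ ++ (f₂ ++ b₂)) ≡ b₂
          drop₂ = trans (cong₂ (λ n l → drop n l) (PW-length (fit₁ ++ᴾ fit₂)) (sym (++-assoc f₁ f₂ b₂))) (drop-length (f₁ ++ f₂) b₂)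

      found : ∀ labs₁ labs₂ → AtomOk (whole , 0) → All AtomOk (atoms labs₁ labs₂) → ∃ (Solution labs₁ labs₂)
      found labs₁ labs₂ (y , _ , t) al = finish (whole-sound (map X (U 0)) (map Y (U 0)) (run r0 false) run (same-length (U 0))
          (trans (cong proj₁ (sym (scanAll-XY start-state (U 0)))) (whole-test (D y) (scanAll start-state (U 0)) t)))
        where
        finish : (∃₂ λ bs o → ∃ λ body → map X (U 0) ≡ bs ∷ʳ o × map Y (U 0) ≡ bs ∷ʳ o × D o ≡ nothing × Decodes bs body) → ∃ (Solution labs₁ labs₂)
        finish (bs , o , body , xs≡ , ys≡ , Do , d) = body , solve Do labs₁ labs₂ (state xs≡ ys≡) d al

    conj-sound : ∀ n φ xs ρ → ⟦_⟧ 𝒜 (conj n φ xs) ρ → ⟦_⟧ 𝒜 φ ρ × All (λ x → ⟦_⟧ 𝒜 (atomQF n x) ρ) xs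
    conj-sound n φ []       ρ h = h , []
    conj-sound n φ (x ∷ xs) ρ h =
      let (hxφ , hs) = conj-sound n (and (atomQF n x) φ) xs ρ h
      in proj₂ hxφ , proj₁ hxφ ∷ hs

    conj-complete : ∀ n φ xs ρ → ⟦_⟧ 𝒜 φ ρ → All (λ x → ⟦_⟧ 𝒜 (atomQF n x) ρ) xs → ⟦_⟧ 𝒜 (conj n φ xs) ρ
    conj-complete n φ []       ρ hφ []        = hφ
    conj-complete n φ (x ∷ xs) ρ hφ (hx ∷ hs) = conj-complete n (and (atomQF n x) φ) xs ρ (hx , hφ) hs

    sentence-sound : ∀ labs₁ labs₂ → Holds 𝒜 (sentence labs₁ labs₂) → ∃ (Solution labs₁ labs₂)
    sentence-sound labs₁ labs₂ (ρ , h) =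
        let (h₀ , hs) = conj-sound n _ (atoms labs₁ labs₂) ρ h
        in found labs₁ labs₂ (atom-ok (whole , 0) h₀) (All.map (λ {x} → atom-ok x) hs)
      where
      n = suc (length (labs₁ ++ labs₂))
      U : ℕ → List (Fin γ)
      U p = proj₁ (ρ (clamp n p))
      open Chain U
      atom-ok : ∀ x → ⟦_⟧ 𝒜 (atomQF n x) ρ → AtomOk x
      atom-ok (l , p) hx =
        let (y , r , t) = rel-sound (enc finLabel l) (U p) (U (suc p)) hx
        in y , r , subst (λ l′ → testLabel l′ (D y) (scanAll start-state (U p)) ≡ true) (dec-enc finLabel l) t

    module _ (bs : List (Fin a)) (o : Fin a) where

      V₀ : ℕ → List (Fin γ)
      V₀ zero    = build (bs ∷ʳ o) (bs ∷ʳ o)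
      V₀ (suc p) = fwd (V₀ p)

      open Chain V₀

      fwd-rotates : ∀ u {y ys} → map Y u ≡ y ∷ ys → Rotates u (fwd u) y
      fwd-rotates u {y} {ys} e = sym (map-X-build (map X u) (rotl (map Y u)) l) , ys , e , trans (map-Y-build (map X u) (rotl (map Y u)) l) (cong rotl e)
        where l = trans (same-length u) (sym (length-rotl (map Y u)))

      state₀ : State o 0 [] bs
      state₀ = state (map-X-build (bs ∷ʳ o) (bs ∷ʳ o) refl) (map-Y-build (bs ∷ʳ o) (bs ∷ʳ o) refl)

      turn : ∀ {p done rest} → State o p done rest → ∃ λ y → Rotates (V₀ p) (V₀ (suc p)) y
      turn {p} {rest = []}    (state _ Y≡) = o , fwd-rotates (V₀ p) Y≡
      turn {p} {rest = z ∷ _} (state _ Y≡) = z , fwd-rotates (V₀ p) Y≡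

      labels-complete : ∀ ls p done zs rest {front} → State o p done (zs ++ rest) → Decodes zs front → Pointwise Fits ls front →
        All AtomOk (lbl p ls) × State o (length ls + p) (done ++ zs) rest
      labels-complete [] p done [] rest st [] [] = [] , subst (λ z → State o p z rest) (sym (++-identityʳ done)) st
      labels-complete ((k , b) ∷ ls) p done (z ∷ zs) rest {L ∷ front} st (dz ∷ d) ((refl , sb) ∷ ft) =
        let r = fwd-rotates (V₀ p) (State.Y≡ st)
            (al , st′) = labels-complete ls (suc p) (done ∷ʳ z) zs rest (proj₂ (advance st r)) d ft
        in (z , r , trans (cong (λ m → testLabel (reads k b) m (scanAll start-state (V₀ p))) dz) (cong₂ _∧_ (sameKey-refl k) sb)) ∷ al ,
           subst₂ (λ q w → State o q w rest) (+-suc (length ls) p) (++-assoc done (z ∷ []) zs) st′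

      whole-complete : ∀ {bs body} → D o ≡ nothing → Decodes bs body → ∀ h p → proj₁ (scanXY (reading , h , p) (bs ∷ʳ o) (bs ∷ʳ o)) ≡ ended
      whole-complete Do [] h p rewrite Do | true-⌊⌋ (o ≟F o) refl = refl
      whole-complete {x ∷ _} Do (e ∷ d) h p rewrite e | true-⌊⌋ (x ≟F x) refl = whole-complete Do d _ _

    lbl-bound : ∀ ls p {q} → p + length ls ≤ q → All (λ x → proj₂ x ≤ q) (lbl p ls)
    lbl-bound []       p le = []
    lbl-bound (l ∷ ls) p le = ≤-trans (m≤m+n p _) le ∷ lbl-bound ls (suc p) (≤-trans (≤-reflexive (sym (+-suc p (length ls)))) le)

    atoms-bound : ∀ labs₁ labs₂ → All (λ x → proj₂ x ≤ length (labs₁ ++ labs₂)) (atoms labs₁ labs₂)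
    atoms-bound labs₁ labs₂ = ++⁺ (lbl-bound labs₁ 0 le) (le ∷ ++⁺ (lbl-bound labs₂ (length labs₁) (≤-reflexive (sym (length-++ labs₁)))) (≤-refl ∷ []))
      where
      le : length labs₁ ≤ length (labs₁ ++ labs₂)
      le = ≤-trans (m≤m+n (length labs₁) (length labs₂)) (≤-reflexive (sym (length-++ labs₁)))

    sentence-complete : ∀ labs₁ labs₂ body → Solution labs₁ labs₂ body → Holds 𝒜 (sentence labs₁ labs₂)
    sentence-complete labs₁ labs₂ body sol = ρ , conj-complete n _ (atoms labs₁ labs₂) ρ
        (atom-holds (whole , 0) z≤n (proj₁ (turn bs o (state₀ bs o)) , proj₂ (turn bs o (state₀ bs o)) , whole-ok))
        (All.map (λ {x} (le , ok) → atom-holds x le ok) (All.zip (atoms-bound labs₁ labs₂ , all-ok)))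
      where
      open Solution sol
      n = suc (length (labs₁ ++ labs₂))
      o = enc finLetter nothing
      code = λ l → enc finLetter (just l)
      bs = map code body
      Do : D o ≡ nothing
      Do = dec-enc finLetter nothing
      U = V₀ bs o
      open Chain U
      decodes : ∀ ls → Decodes (map code ls) ls
      decodes []       = []
      decodes (l ∷ ls) = dec-enc finLetter (just l) ∷ decodes ls
      ρ : Fin (suc n) → Elem P
      ρ i = U (toℕ i) , refl
      atom-holds : ∀ x → proj₂ x ≤ length (labs₁ ++ labs₂) → AtomOk x → ⟦_⟧ 𝒜 (atomQF n x) ρ
      atom-holds (l , p) le (y , r , t) = subst₂ (λ i j → Accepts (automaton (fs (enc finLabel l))) (conv (U i ∷ U j ∷ [])))
        (sym (toℕ-clamp n p (≤-trans le (n≤1+n _)))) (sym (toℕ-clamp n (suc p) (s≤s le)))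
        (rel-complete (enc finLabel l) (U p) (U (suc p)) y r (subst (λ l′ → testLabel l′ (D y) (scanAll start-state (U p)) ≡ true) (sym (dec-enc finLabel l)) t))
      ended-test : ∀ y c → proj₁ c ≡ ended → testLabel whole y c ≡ true
      ended-test y (ended , _ , _) refl = refl
      whole-ok : testLabel whole (D (proj₁ (turn bs o (state₀ bs o)))) (scanAll start-state (U 0)) ≡ true
      whole-ok = ended-test (D (proj₁ (turn bs o (state₀ bs o)))) (scanAll start-state (U 0)) (trans (cong proj₁ (scan-state (state₀ bs o))) (whole-complete bs o Do (decodes body) _ _))
      cut = split-PW labs₁ fits
      f₁ = proj₁ cut
      f₂ = proj₁ (proj₂ cut)
      front≡ : front ≡ f₁ ++ f₂
      front≡ = proj₁ (proj₂ (proj₂ cut))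
      fit₁ = proj₁ (proj₂ (proj₂ (proj₂ cut)))
      fit₂ = proj₂ (proj₂ (proj₂ (proj₂ cut)))
      body₂ : body ≡ f₁ ++ (f₂ ++ back)
      body₂ = trans body≡ (trans (cong (_++ back) front≡) (++-assoc f₁ f₂ back))
      bs≡ : bs ≡ map code f₁ ++ (map code f₂ ++ map code back)
      bs≡ = trans (cong (map code) body₂) (trans (map-++ code f₁ (f₂ ++ back)) (cong (map code f₁ ++_) (map-++ code f₂ back)))
      part₁ = labels-complete bs o labs₁ 0 [] (map code f₁) (map code f₂ ++ map code back) (subst (State o 0 []) bs≡ (state₀ bs o)) (decodes f₁) fit₁
      st₁ : State o (length labs₁) (map code f₁) (map code f₂ ++ map code back)
      st₁ = subst (λ q → State o q (map code f₁) (map code f₂ ++ map code back)) (+-identityʳ _) (proj₂ part₁)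
      part₂ = labels-complete bs o labs₂ (length labs₁) (map code f₁) (map code f₂) (map code back) st₁ (decodes f₂) fit₂
      st₂ : State o (length (labs₁ ++ labs₂)) (map code f₁ ++ map code f₂) (map code back)
      st₂ = subst (λ q → State o q (map code f₁ ++ map code f₂) (map code back)) (trans (+-comm (length labs₂) _) (sym (length-++ labs₁))) (proj₂ part₂)
      rows-ok : histOk (proj₁ (proj₂ (scanAll start-state (U (length labs₁))))) ≡ true
      rows-ok = trans (rows-at Do st₁ (subst (λ z → Decodes z body) bs≡ (decodes body)) (subst (λ z → Decodes z (f₂ ++ back)) (map-++ code f₂ back) (decodes (f₂ ++ back))))
        (trans (cong (λ x → histOk (pairHist (run r0 false) body x)) (sym (trans (cong₂ drop (PW-length fit₁) body₂) (drop-length f₁ _)))) rows)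
      cycles-ok : perOk (proj₂ (proj₂ (scanAll start-state (U (length (labs₁ ++ labs₂)))))) ≡ true
      cycles-ok = trans (cycles-at Do st₂ (subst (λ z → Decodes z body) (trans bs≡ (sym (++-assoc (map code f₁) _ _))) (decodes body)) (decodes back))
        (trans (cong (λ x → perOk (pairPer run body x)) (sym (trans (cong₂ drop (PW-length fits) body≡) (drop-length front back)))) cycles)
      all-ok : All AtomOk (atoms labs₁ labs₂)
      all-ok = ++⁺ (proj₁ part₁) ((_ , proj₂ (turn bs o st₁) , rows-ok) ∷ ++⁺ (proj₁ part₂) ((_ , proj₂ (turn bs o st₂) , cycles-ok) ∷ []))

-- One cell of a row compared with its successor

module Cells where

  open FiniteTypes
  open UniversalStructure
  open import Data.Nat using (ℕ; zero; suc; _≤_; _<_; s≤s)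
  open import Data.Nat.Properties
  open import Data.Bool using (Bool; true; false; _∧_; _∨_)
  open import Data.Bool.Properties using (∨-identityʳ; ∧-zeroʳ; ∧-identityʳ)
  open import Data.List using (List; []; _∷_; length; _++_; map)
  open import Data.List.Properties using (∷-injective)
  open import Data.Vec using (Vec; []; _∷_; toList)
  open import Data.Product using (_×_; _,_)
  open import Data.Empty using (⊥-elim)
  open import Relation.Binary.PropositionalEquality

  pairHist-bad : ∀ zs ys → pairHist bad zs ys ≡ bad
  pairHist-bad []       ys       = refl
  pairHist-bad (z ∷ zs) []       = refl
  pairHist-bad (z ∷ zs) (y ∷ ys) = pairHist-bad zs ys

  pairHist-++ : ∀ h z z′ y y′ → length z ≡ length y → pairHist h (z ++ z′) (y ++ y′) ≡ pairHist (pairHist h z y) z′ y′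
  pairHist-++ h []      z′ []      y′ e = refl
  pairHist-++ h (x ∷ z) z′ (w ∷ y) y′ e = pairHist-++ (histStep h x w) z z′ y y′ (suc-injective e)

  pairHist-short : ∀ h z z′ y → length y ≤ length z → pairHist h (z ++ z′) y ≡ pairHist h z y
  pairHist-short h []      []      []      le = refl
  pairHist-short h []      (_ ∷ _) []      le = refl
  pairHist-short h (x ∷ z) z′      []      le = refl
  pairHist-short h (x ∷ z) z′      (w ∷ y) (s≤s le) = pairHist-short (histStep h x w) z z′ y le

  ==-sound : ∀ x y → (x == y) ≡ true → x ≡ y
  ==-sound true  true  _ = refl
  ==-sound false false _ = refl

  ==-refl : ∀ x → (x == x) ≡ true
  ==-refl true  = refl
  ==-refl false = refl

  last? : ℕ → Bool
  last? zero    = true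
  last? (suc _) = false

  -- the letters (without roles) of one cell with content cv, under the rule that rewrites E₁ E₂ to D₁ D₂
  letters : ∀ {n} → Bool → Bool → (E₁ D₁ E₂ D₂ cv : Vec Bool n) → List (Key × Bool)
  letters st ac []       []       []       []       []       = []
  letters {suc n} st ac (x ∷ xs) (y ∷ ys) (z ∷ zs) (w ∷ ws) (c ∷ cs) = (key st x y z w (ac ∧ last? n) , c) ∷ letters false ac xs ys zs ws cs

  kb : Letter → Key × Bool
  kb l = key′ l , v l

  firing : Role → Bool → Bool
  firing r2 ac = ac
  firing _  _  = false

  fireAt : ℕ → Role → Bool → Bool
  fireAt zero    r ac = false
  fireAt (suc _) r ac = firing r ac

  fires≡ : ∀ r {st x y z w ac} → fires r (key st x y z w ac) ≡ firing r ac
  fires≡ r0 = refl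
  fires≡ r1 = refl
  fires≡ r2 = refl

  firing-false : ∀ r → firing r false ≡ false
  firing-false r0 = refl
  firing-false r1 = refl
  firing-false r2 = refl

  Becomes : ∀ {n} → Role → (E₁ D₁ E₂ D₂ cv new : Vec Bool n) → Set
  Becomes r0 E₁ D₁ E₂ D₂ cv new = new ≡ cv
  Becomes r1 E₁ D₁ E₂ D₂ cv new = cv ≡ E₁ × new ≡ D₁
  Becomes r2 E₁ D₁ E₂ D₂ cv new = cv ≡ E₂ × new ≡ D₂

  becomes-∷ : ∀ {n} r {E₁ D₁ E₂ D₂ cv new : Vec Bool n} {x y z w c d st ac} →
    rewrites r (key st x y z w ac) c d ≡ true → Becomes r E₁ D₁ E₂ D₂ cv new → Becomes r (x ∷ E₁) (y ∷ D₁) (z ∷ E₂) (w ∷ D₂) (c ∷ cv) (d ∷ new)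
  becomes-∷ r0 {c = c} {d} e b = cong₂ _∷_ (sym (==-sound c d e)) b
  becomes-∷ r1 {x = x} {y} {c = c} {d} e (b , b′) with c == x in e₁ | d == y in e₂
  ... | true | true = cong₂ _∷_ (==-sound c x e₁) b , cong₂ _∷_ (==-sound d y e₂) b′
  becomes-∷ r2 {z = z} {w} {c = c} {d} e (b , b′) with c == z in e₁ | d == w in e₂
  ... | true | true = cong₂ _∷_ (==-sound c z e₁) b , cong₂ _∷_ (==-sound d w e₂) b′

  becomes-rewrites : ∀ {n} r {E₁ D₁ E₂ D₂ cv new : Vec Bool n} {x y z w c d st ac} →
    Becomes r (x ∷ E₁) (y ∷ D₁) (z ∷ E₂) (w ∷ D₂) (c ∷ cv) (d ∷ new) → rewrites r (key st x y z w ac) c d ≡ true × Becomes r E₁ D₁ E₂ D₂ cv new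
  becomes-rewrites r0 {c = c} refl = ==-refl c , refl
  becomes-rewrites r1 {x = x} {y} (refl , refl) = cong₂ _∧_ (==-refl x) (==-refl y) , refl , refl
  becomes-rewrites r2 {z = z} {w} (refl , refl) = cong₂ _∧_ (==-refl z) (==-refl w) , refl , refl

  same-role : ∀ p r → admissible false p r ≡ true → p ≡ r
  same-role r0 r0 _ = refl
  same-role r1 r1 _ = refl
  same-role r2 r2 _ = refl

  same-role-refl : ∀ r → admissible false r r ≡ true
  same-role-refl r0 = refl
  same-role-refl r1 = refl
  same-role-refl r2 = refl

  -- The two conditions on n serve the induction: past the last letter the role before it is passed
  -- on, whereas a nonempty rest starts with an admissible role.
  data Result {n} (st ac : Bool) (E₁ D₁ E₂ D₂ cv : Vec Bool n) (p : Role) (b : Bool) (ys : List Letter) (h : Hist) : Set where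
    broken : h ≡ bad → Result st ac E₁ D₁ E₂ D₂ cv p b ys h
    fine   : ∀ r new → (n ≡ 0 → r ≡ p) → (n ≢ 0 → admissible st p r ≡ true) → Becomes r E₁ D₁ E₂ D₂ cv new → map v ys ≡ toList new →
             h ≡ run r (b ∨ fireAt n r ac) → Result st ac E₁ D₁ E₂ D₂ cv p b ys h

  -- Only the first letter of a cell can change the role, so the comparisons of single bits add up
  -- to one rewriting of the whole cell.
  cell-sound : ∀ {n} st ac (E₁ D₁ E₂ D₂ cv : Vec Bool n) p b zs ys → map kb zs ≡ letters st ac E₁ D₁ E₂ D₂ cv → length ys ≡ n →
    Result st ac E₁ D₁ E₂ D₂ cv p b ys (pairHist (run p b) zs ys)
  cell-sound st ac [] [] [] [] [] r0 b [] [] refl e = fine r0 [] (λ _ → refl) (λ ne → ⊥-elim (ne refl)) refl refl (cong (run r0) (sym (∨-identityʳ b)))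
  cell-sound st ac [] [] [] [] [] r1 b [] [] refl e = fine r1 [] (λ _ → refl) (λ ne → ⊥-elim (ne refl)) (refl , refl) refl (cong (run r1) (sym (∨-identityʳ b)))
  cell-sound st ac [] [] [] [] [] r2 b [] [] refl e = fine r2 [] (λ _ → refl) (λ ne → ⊥-elim (ne refl)) (refl , refl) refl (cong (run r2) (sym (∨-identityʳ b)))
  cell-sound {suc n} st ac (x ∷ E₁) (y ∷ D₁) (z ∷ E₂) (w ∷ D₂) (c ∷ cv) p b (letter k r _ ∷ zs) (l ∷ ys) ez ey with ∷-injective ez
  ... | refl , ez′ with admissible st p r in adm | rewrites r (key st x y z w (ac ∧ last? n)) c (v l) in rw
  ... | false | _     = broken (pairHist-bad zs ys)
  ... | true  | false = broken (pairHist-bad zs ys)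
  ... | true  | true  with cell-sound false ac E₁ D₁ E₂ D₂ cv r (b ∨ fires r (key st x y z w (ac ∧ last? n))) zs ys ez′ (suc-injective ey)
  ... | broken e = broken e
  ... | fine r′ new e₀ e₁ bec vy h = go n e₀ e₁ refl
    where
    go : ∀ m → (n ≡ 0 → r′ ≡ r) → (n ≢ 0 → admissible false r r′ ≡ true) → m ≡ n → Result st ac (x ∷ E₁) (y ∷ D₁) (z ∷ E₂) (w ∷ D₂) (c ∷ cv) p b (l ∷ ys) (pairHist (run r (b ∨ fires r (key st x y z w (ac ∧ last? n)))) zs ys)
    go zero f₀ f₁ refl with f₀ refl
    ... | refl = fine r (v l ∷ new) (λ ()) (λ _ → adm) (becomes-∷ r {st = st} {ac = ac ∧ true} rw bec) (cong (v l ∷_) vy)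
                   (trans h (cong (run r) (trans (∨-identityʳ _) (cong (b ∨_) (trans (fires≡ r) (cong (firing r) (∧-identityʳ ac)))))))
    go (suc m) f₀ f₁ refl with same-role r r′ (f₁ (λ ()))
    ... | refl = fine r (v l ∷ new) (λ ()) (λ _ → adm) (becomes-∷ r {st = st} {ac = ac ∧ false} rw bec) (cong (v l ∷_) vy)
                   (trans h (cong (λ t → run r (t ∨ firing r ac)) (trans (cong (b ∨_) (trans (fires≡ r) (trans (cong (firing r) (∧-zeroʳ ac)) (firing-false r)))) (∨-identityʳ b))))

  -- The accepting bit sits on the last letter of a cell, so an incomplete cell does not fire.
  cell-short : ∀ {n} st ac (E₁ D₁ E₂ D₂ cv : Vec Bool n) p b zs ys → map kb zs ≡ letters st ac E₁ D₁ E₂ D₂ cv → length ys < n →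
    histOk (pairHist (run p b) zs ys) ≡ true → b ≡ true
  cell-short st ac (x ∷ E₁) (y ∷ D₁) (z ∷ E₂) (w ∷ D₂) (c ∷ cv) p b (_ ∷ zs) [] ez ey h = h
  cell-short {suc zero} st ac (x ∷ E₁) (y ∷ D₁) (z ∷ E₂) (w ∷ D₂) (c ∷ cv) p b (_ ∷ zs) (_ ∷ _) ez (s≤s ()) h
  cell-short {suc (suc n)} st ac (x ∷ E₁) (y ∷ D₁) (z ∷ E₂) (w ∷ D₂) (c ∷ cv) p b (letter k r _ ∷ zs) (l ∷ ys) ez (s≤s ey) h with ∷-injective ez
  ... | refl , ez′ with admissible st p r | rewrites r (key st x y z w (ac ∧ false)) c (v l)
  ... | false | _     = ⊥-elim (no-bad (trans (sym h) (cong histOk (pairHist-bad zs ys))))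
    where
    no-bad : true ≢ false
    no-bad ()
  ... | true  | false = ⊥-elim (no-bad (trans (sym h) (cong histOk (pairHist-bad zs ys))))
    where
    no-bad : true ≢ false
    no-bad ()
  ... | true  | true  = trans (sym (trans (cong (b ∨_) (trans (fires≡ r) (trans (cong (firing r) (∧-zeroʳ ac)) (firing-false r)))) (∨-identityʳ b)))
                          (cell-short false ac E₁ D₁ E₂ D₂ cv r (b ∨ fires r (key st x y z w (ac ∧ false))) zs ys ez′ ey h)

  dress : Role → List (Key × Bool) → List Letter
  dress r = map (λ (k , b) → letter k r b)

  kb-dress : ∀ r xs → map kb (dress r xs) ≡ xs
  kb-dress r []       = refl
  kb-dress r (x ∷ xs) = cong (x ∷_) (kb-dress r xs)

  cell-complete : ∀ {n} st ac (E₁ D₁ E₂ D₂ cv new : Vec Bool n) p r b ys → (n ≡ 0 → r ≡ p) → (n ≢ 0 → admissible st p r ≡ true) →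
    Becomes r E₁ D₁ E₂ D₂ cv new → map v ys ≡ toList new →
    pairHist (run p b) (dress r (letters st ac E₁ D₁ E₂ D₂ cv)) ys ≡ run r (b ∨ fireAt n r ac)
  cell-complete st ac [] [] [] [] [] [] p r b [] e₀ e₁ bec vy rewrite e₀ refl = cong (run p) (sym (∨-identityʳ b))
  cell-complete {suc n} st ac (x ∷ E₁) (y ∷ D₁) (z ∷ E₂) (w ∷ D₂) (c ∷ cv) (d ∷ new) p r b (l ∷ ys) e₀ e₁ bec vy with ∷-injective vy
  ... | refl , vy′ with becomes-rewrites r {st = st} {ac = ac ∧ last? n} bec
  ... | rw , bec′ rewrite e₁ (λ ()) | rw = trans (cell-complete false ac E₁ D₁ E₂ D₂ cv new r r _ ys (λ _ → refl) (λ _ → same-role-refl r) bec′ vy′) (cong (run r) (settle n))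
    where
    settle : ∀ n → (b ∨ fires r (key st x y z w (ac ∧ last? n))) ∨ fireAt n r ac ≡ b ∨ firing r ac
    settle zero    = trans (∨-identityʳ _) (cong (b ∨_) (trans (fires≡ r) (cong (firing r) (∧-identityʳ ac))))
    settle (suc n) = cong (_∨ firing r ac) (trans (cong (b ∨_) (trans (fires≡ r) (trans (cong (firing r) (∧-zeroʳ ac)) (firing-false r)))) (∨-identityʳ b))

-- Rewriting rules of a Turing machine and comparison of rows

module Simulation where

  open import Defs hiding (step; run; QF; eq; rel; neg; and; or)
  open FiniteTypes
  open UniversalStructure
  open Cells
  open Rotations using (true-⌊⌋; ⌊⌋-true)
  open import Data.Nat using (ℕ; zero; suc; _+_; _*_; _<_; z≤n; s≤s)
  open import Data.Nat.Properties
  open import Data.Fin using (Fin)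
  open import Data.Fin.Properties using () renaming (_≟_ to _≟F_)
  open import Data.Bool using (Bool; true; false; _∨_)
  open import Data.Bool.Properties using (∨-identityʳ; ∨-assoc)
  open import Data.Maybe using (just; nothing)
  open import Data.List using (List; []; _∷_; length; _++_; map; concatMap)
  open import Data.List.Properties using (∷-injective; length-++; length-map; ++-assoc; map-++)
  open import Data.List.Relation.Binary.Pointwise using ([]; _∷_)
  open import Data.Vec using (Vec; []; _∷_; toList; tabulate; lookup)
  open import Data.Vec.Properties using (lookup∘tabulate; length-toList)
  open import Data.Product using (∃; ∃₂; _×_; _,_; proj₁; proj₂)
  open import Data.Sum using (_⊎_; inj₁; inj₂)
  open import Data.Empty using (⊥-elim)
  open import Function using (_∘_)
  open import Relation.Nullary.Decidable using (⌊_⌋)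
  open import Relation.Binary.PropositionalEquality

  map-split : ∀ {A B : Set} (f : A → B) z xs {ys} → map f z ≡ xs ++ ys → ∃₂ λ z₁ z₂ → z ≡ z₁ ++ z₂ × map f z₁ ≡ xs × map f z₂ ≡ ys
  map-split f z       []       e = [] , z , refl , refl , e
  map-split f (x ∷ z) (_ ∷ xs) e with ∷-injective e
  ... | refl , e′ with map-split f z xs e′
  ... | z₁ , z₂ , refl , refl , e₂ = x ∷ z₁ , z₂ , refl , refl , e₂

  chunk : ∀ {A : Set} n (ys : List A) → (∃₂ λ y₁ y₂ → ys ≡ y₁ ++ y₂ × length y₁ ≡ n) ⊎ length ys < n
  chunk zero    ys       = inj₁ ([] , ys , refl , refl)
  chunk (suc n) []       = inj₂ (s≤s z≤n)
  chunk (suc n) (y ∷ ys) with chunk n ys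
  ... | inj₁ (y₁ , y₂ , refl , refl) = inj₁ (y ∷ y₁ , y₂ , refl , refl)
  ... | inj₂ lt = inj₂ (s≤s lt)

  true≢false : ∀ {A : Set} → true ≡ false → A
  true≢false ()

  module Machine (M : TM) where

    open TM M

    data Cell : Set where
      plain : Sym M → Cell
      head  : Fin nQ → Sym M → Cell
      wall  : Cell

    finCell : Finite Cell
    finCell = retract (finMaybe (fin⊎ (finFin (3 + nΓ)) (fin× (finFin nQ) (finFin (3 + nΓ)))))
      (λ { (plain s) → just (inj₁ s) ; (head q s) → just (inj₂ (q , s)) ; wall → nothing })
      (λ { (just (inj₁ s)) → plain s ; (just (inj₂ (q , s))) → head q s ; nothing → wall })
      λ { (plain _) → refl ; (head _ _) → refl ; wall → refl }

    width : ℕ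
    width = size finCell

    nonzero : ∀ {n} → Fin n → n ≢ 0
    nonzero () refl

    width≢0 : width ≢ 0
    width≢0 = nonzero (enc finCell wall)

    -- One-hot coding: two codes are told apart at a single position, and the width depends on the
    -- machine only.
    code : Cell → Vec Bool width
    code c = tabulate (λ i → ⌊ i ≟F enc finCell c ⌋)

    code-injective : ∀ {c c′} → code c ≡ code c′ → c ≡ c′
    code-injective {c} {c′} e = enc-injective finCell (⌊⌋-true (enc finCell c ≟F enc finCell c′)
      (trans (sym (lookup∘tabulate _ (enc finCell c))) (trans (cong (λ v → lookup v (enc finCell c)) (sym e))
        (trans (lookup∘tabulate _ (enc finCell c)) (true-⌊⌋ (enc finCell c ≟F enc finCell c) refl)))))

    record Rule : Set where
      constructor mk
      field
        c₁ c₂ n₁ n₂ : Cell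
        ac          : Bool
    open Rule

    -- A rule covers the cell of the head and the neighbour it moves to; for a move to the left the
    -- head is the second cell. `stay` and halting take the right neighbour along. A halting
    -- configuration is rewritten into itself, and there alone can acceptance be granted.
    ruleOf : Bool → Fin nQ × Sym M × Move → Fin nQ → Sym M → Sym M → Rule
    ruleOf true  _                q s t = mk (head q s) (plain t) (head q s) (plain t) (accepting q)
    ruleOf false (q′ , s′ , right) q s t = mk (head q s) (plain t) (plain s′) (head q′ t) false
    ruleOf false (q′ , s′ , left)  q s t = mk (plain t) (head q s) (head q′ t) (plain s′) false
    ruleOf false (q′ , s′ , stay)  q s t = mk (head q s) (plain t) (head q′ s′) (plain t) false

    Triple : Set
    Triple = Fin nQ × Sym M × Sym M

    rule : Triple → Rule
    rule (q , s , t) = ruleOf (halting q) (δ q s) q s t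

    data Step (ρ : Rule) (p : Role) (c : Cell) : Role → Cell → Set where
      idle   : p ≢ r1 → Step ρ p c r0 c
      first  : p ≢ r1 → c ≡ c₁ ρ → Step ρ p c r1 (n₁ ρ)
      second : p ≡ r1 → c ≡ c₂ ρ → Step ρ p c r2 (n₂ ρ)

    data Steps (ρ : Rule) : Role → List Cell → Role → List Cell → Bool → Set where
      []  : ∀ {p} → Steps ρ p [] p [] false
      _∷_ : ∀ {p c r c′ cs r′ cs′ f} → Step ρ p c r c′ → Steps ρ r cs r′ cs′ f → Steps ρ p (c ∷ cs) r′ (c′ ∷ cs′) (firing r (ac ρ) ∨ f)

    cellKB : Rule → Cell → List (Key × Bool)
    cellKB ρ c = letters true (ac ρ) (code (c₁ ρ)) (code (n₁ ρ)) (code (c₂ ρ)) (code (n₂ ρ)) (code c)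

    rowKB : Rule → List Cell → List (Key × Bool)
    rowKB ρ = concatMap (cellKB ρ)

    bits : List Cell → List Bool
    bits = concatMap (toList ∘ code)

    length-letters : ∀ {n} st a (E₁ D₁ E₂ D₂ cv : Vec Bool n) → length (letters st a E₁ D₁ E₂ D₂ cv) ≡ n
    length-letters st a []       []       []       []       []       = refl
    length-letters st a (_ ∷ E₁) (_ ∷ D₁) (_ ∷ E₂) (_ ∷ D₂) (_ ∷ cv) = cong suc (length-letters false a E₁ D₁ E₂ D₂ cv)

    length-cellKB : ∀ ρ c → length (cellKB ρ c) ≡ width
    length-cellKB ρ c = length-letters true (ac ρ) (code (c₁ ρ)) (code (n₁ ρ)) (code (c₂ ρ)) (code (n₂ ρ)) (code c)

    length-rowKB : ∀ ρ cs → length (rowKB ρ cs) ≡ length cs * width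
    length-rowKB ρ []       = refl
    length-rowKB ρ (c ∷ cs) = trans (length-++ (cellKB ρ c)) (cong₂ _+_ (length-cellKB ρ c) (length-rowKB ρ cs))

    length-bits : ∀ cs → length (bits cs) ≡ length cs * width
    length-bits []       = refl
    length-bits (c ∷ cs) = trans (length-++ (toList (code c))) (cong₂ _+_ (length-toList (code c)) (length-bits cs))

    length-Steps : ∀ {ρ p cs r cs′ f} → Steps ρ p cs r cs′ f → length cs ≡ length cs′
    length-Steps []       = refl
    length-Steps (_ ∷ ss) = cong suc (length-Steps ss)

    adm-start : ∀ {p r} → admissible true p r ≡ true → (p ≡ r1 × r ≡ r2) ⊎ (p ≢ r1 × r ≢ r2)
    adm-start {r1} {r2} _ = inj₁ (refl , refl)
    adm-start {r0} {r0} _ = inj₂ ((λ ()) , λ ())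
    adm-start {r0} {r1} _ = inj₂ ((λ ()) , λ ())
    adm-start {r2} {r0} _ = inj₂ ((λ ()) , λ ())
    adm-start {r2} {r1} _ = inj₂ ((λ ()) , λ ())

    become-step : ∀ ρ p r c {new} → admissible true p r ≡ true → Becomes r (code (c₁ ρ)) (code (n₁ ρ)) (code (c₂ ρ)) (code (n₂ ρ)) (code c) new →
      ∃ λ c′ → new ≡ code c′ × Step ρ p c r c′
    become-step ρ p r0 c a refl with adm-start {p} {r0} a
    ... | inj₁ (_ , ())
    ... | inj₂ (ne , _) = c , refl , idle ne
    become-step ρ p r1 c a (e , refl) with adm-start {p} {r1} a
    ... | inj₁ (_ , ())
    ... | inj₂ (ne , _) = n₁ ρ , refl , first ne (code-injective e)
    become-step ρ p r2 c a (e , refl) with adm-start {p} {r2} a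
    ... | inj₁ (eq , _) = n₂ ρ , refl , second eq (code-injective e)
    ... | inj₂ (_ , ne) = ⊥-elim (ne refl)

    step-become : ∀ {ρ p c r c′} → Step ρ p c r c′ → admissible true p r ≡ true × Becomes r (code (c₁ ρ)) (code (n₁ ρ)) (code (c₂ ρ)) (code (n₂ ρ)) (code c) (code c′)
    step-become {p = r0} (idle _)          = refl , refl
    step-become {p = r2} (idle _)          = refl , refl
    step-become {p = r1} (idle ne)         = ⊥-elim (ne refl)
    step-become {p = r0} (first _ refl)    = refl , refl , refl
    step-become {p = r2} (first _ refl)    = refl , refl , refl
    step-become {p = r1} (first ne _)      = ⊥-elim (ne refl)
    step-become (second refl refl)         = refl , refl , refl

    fireAt-width : ∀ r a → fireAt width r a ≡ firing r a
    fireAt-width r a with width | width≢0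
    ... | zero  | ne = ⊥-elim (ne refl)
    ... | suc _ | _  = refl

    -- In the case `short` the history ends inside the successor row; then only the cells `cs₁` that
    -- have been compared completely count.
    data RowResult (ρ : Rule) (p : Role) (b : Bool) (cs : List Cell) (zs ys : List Letter) (h : Hist) : Set where
      broken : h ≡ bad → RowResult ρ p b cs zs ys h
      full   : ∀ r cs′ f y₁ y₂ → ys ≡ y₁ ++ y₂ → length y₁ ≡ length zs → map v y₁ ≡ bits cs′ → Steps ρ p cs r cs′ f →
               h ≡ run r (b ∨ f) → RowResult ρ p b cs zs ys h
      short  : length ys < length zs → ∀ cs₁ cs₂ r cs′ f → cs ≡ cs₁ ++ cs₂ → Steps ρ p cs₁ r cs′ f → (histOk h ≡ true → b ∨ f ≡ true) →
               RowResult ρ p b cs zs ys h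

    row-sound : ∀ ρ p b cs zs ys → map kb zs ≡ rowKB ρ cs → RowResult ρ p b cs zs ys (pairHist (run p b) zs ys)
    row-sound ρ p b [] [] ys e = full p [] false [] ys refl refl refl [] (cong (run p) (sym (∨-identityʳ b)))
    row-sound ρ p b (c ∷ cs) zs ys e with map-split kb zs (cellKB ρ c) e
    ... | z₁ , z₂ , refl , e₁ , e₂ with chunk width ys
    ... | inj₂ lt = short (≤-trans lt (≤-trans (≤-reflexive (sym len₁)) (≤-trans (m≤m+n _ _) (≤-reflexive (sym (length-++ z₁)))))) [] (c ∷ cs) p [] false refl []
                      (λ h → trans (∨-identityʳ b) (cell-short true (ac ρ) _ _ _ _ (code c) p b z₁ ys e₁ lt (trans (cong histOk (sym (pairHist-short (run p b) z₁ z₂ ys (≤-trans (<⇒≤ lt) (≤-reflexive (sym len₁)))))) h)))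
      where
      len₁ : length z₁ ≡ width
      len₁ = trans (sym (length-map kb z₁)) (trans (cong length e₁) (length-cellKB ρ c))
    ... | inj₁ (y₁ , y₂ , refl , ly) with cell-sound true (ac ρ) (code (c₁ ρ)) (code (n₁ ρ)) (code (c₂ ρ)) (code (n₂ ρ)) (code c) p b z₁ y₁ e₁ ly
    ... | broken hb = broken (trans (pairHist-++ (run p b) z₁ z₂ y₁ y₂ (trans len₁ (sym ly))) (trans (cong (λ h → pairHist h z₂ y₂) hb) (pairHist-bad z₂ y₂)))
      where
      len₁ : length z₁ ≡ width
      len₁ = trans (sym (length-map kb z₁)) (trans (cong length e₁) (length-cellKB ρ c))
    ... | fine r new _ adm bec vy hf with become-step ρ p r c (adm width≢0) bec
    ... | c′ , refl , st = continue (row-sound ρ r (b ∨ firing r (ac ρ)) cs z₂ y₂ e₂)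
      where
      len₁ : length z₁ ≡ width
      len₁ = trans (sym (length-map kb z₁)) (trans (cong length e₁) (length-cellKB ρ c))
      whole-run : pairHist (run p b) (z₁ ++ z₂) (y₁ ++ y₂) ≡ pairHist (run r (b ∨ firing r (ac ρ))) z₂ y₂
      whole-run = trans (pairHist-++ (run p b) z₁ z₂ y₁ y₂ (trans len₁ (sym ly)))
        (cong (λ h → pairHist h z₂ y₂) (trans hf (cong (λ f → run r (b ∨ f)) (fireAt-width r (ac ρ)))))
      continue : RowResult ρ r (b ∨ firing r (ac ρ)) cs z₂ y₂ (pairHist (run r (b ∨ firing r (ac ρ))) z₂ y₂) →
                 RowResult ρ p b (c ∷ cs) (z₁ ++ z₂) (y₁ ++ y₂) (pairHist (run p b) (z₁ ++ z₂) (y₁ ++ y₂))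
      continue (broken e) = broken (trans whole-run e)
      continue (full r′ cs′ f y₃ y₄ refl ly′ vy′ ss h) = full r′ (c′ ∷ cs′) (firing r (ac ρ) ∨ f) (y₁ ++ y₃) y₄ (sym (++-assoc y₁ y₃ y₄))
        (trans (length-++ y₁) (trans (cong₂ _+_ (trans ly (sym len₁)) ly′) (sym (length-++ z₁))))
        (trans (map-++ v y₁ y₃) (cong₂ _++_ vy vy′)) (st ∷ ss) (trans whole-run (trans h (cong (run r′) (∨-assoc b _ f))))
      continue (short lt cs₁ cs₂ r′ cs′ f refl ss imp) = short
        (≤-trans (s≤s (≤-reflexive (length-++ y₁))) (≤-trans (≤-reflexive (sym (+-suc (length y₁) (length y₂)))) (≤-trans (+-mono-≤ (≤-reflexive (trans ly (sym len₁))) lt) (≤-reflexive (sym (length-++ z₁))))))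
        (c ∷ cs₁) cs₂ r′ (c′ ∷ cs′) (firing r (ac ρ) ∨ f) refl (st ∷ ss)
        (λ h → trans (sym (∨-assoc b _ f)) (imp (trans (cong histOk (sym whole-run)) h)))

    rowLetters : ∀ {ρ p cs r cs′ f} → Steps ρ p cs r cs′ f → List Letter
    rowLetters []                              = []
    rowLetters {ρ} (_∷_ {c = c} {r = r} st ss) = dress r (cellKB ρ c) ++ rowLetters ss

    kb-rowLetters : ∀ {ρ p cs r cs′ f} (ss : Steps ρ p cs r cs′ f) → map kb (rowLetters ss) ≡ rowKB ρ cs
    kb-rowLetters []                              = refl
    kb-rowLetters {ρ} (_∷_ {c = c} {r = r} st ss) = trans (map-++ kb (dress r (cellKB ρ c)) (rowLetters ss)) (cong₂ _++_ (kb-dress r (cellKB ρ c)) (kb-rowLetters ss))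

    row-complete : ∀ {ρ p cs r cs′ f} (ss : Steps ρ p cs r cs′ f) b ys → map v ys ≡ bits cs′ → pairHist (run p b) (rowLetters ss) ys ≡ run r (b ∨ f)
    row-complete {p = p} [] b [] e = cong (run p) (sym (∨-identityʳ b))
    row-complete {ρ} {p} (_∷_ {c = c} {r = r} {c′ = c′} {f = f} st ss) b ys e with map-split v ys (toList (code c′)) e
    ... | y₁ , y₂ , refl , e₁ , e₂ = trans (pairHist-++ (run p b) (dress r (cellKB ρ c)) (rowLetters ss) y₁ y₂ lens)
        (trans (cong (λ h → pairHist h (rowLetters ss) y₂)
                 (trans (cell-complete true (ac ρ) _ _ _ _ (code c) (code c′) p r b y₁ (λ e → ⊥-elim (width≢0 e)) (λ _ → proj₁ (step-become st)) (proj₂ (step-become st)) e₁)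
                        (cong (λ g → run r (b ∨ g)) (fireAt-width r (ac ρ)))))
          (trans (row-complete ss (b ∨ firing r (ac ρ)) y₂ e₂) (cong (run _) (∨-assoc b _ f))))
      where
      lens : length (dress r (cellKB ρ c)) ≡ length y₁
      lens = trans (length-map _ (cellKB ρ c)) (trans (length-cellKB ρ c) (sym (trans (sym (length-map v y₁)) (trans (cong length e₁) (length-toList (code c′))))))

-- Soundness of histories: rows follow the run of the machine

module Acceptance where

  open import Defs hiding (step; run; QF; eq; rel; neg; and; or)
  open FiniteTypes
  open Compilation using (step-δ)
  open UniversalStructure
  open Cells
  open import Data.Nat using (ℕ; zero; suc; _+_; _*_; _≤_; _<_)
  open import Data.Nat.Properties
  open import Data.Fin using (Fin)
  open import Data.Bool using (Bool; true; false; _∨_)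
  open import Data.List using (List; []; _∷_; length; _++_; map; reverse; replicate; _∷ʳ_)
  open import Data.List.Properties using (∷-injective; length-++; length-map; ++-assoc; ++-identityʳ; map-++; unfold-reverse; ∷ʳ-injective)
  open import Data.List.Membership.Propositional using (_∈_)
  open import Data.List.Membership.Propositional.Properties using (∈-++⁺ˡ; ∈-++⁻; ∈-map⁻)
  open import Data.List.Relation.Unary.Any using (here; there)
  open import Data.List.Relation.Binary.Pointwise using ([]; _∷_)
  open import Data.Vec using (Vec; []; _∷_; toList)
  open import Data.Product using (∃; _×_; _,_; proj₁; proj₂)
  open import Data.Sum using (_⊎_; inj₁; inj₂)
  open import Data.Empty using (⊥; ⊥-elim)
  open import Relation.Binary.PropositionalEquality
  open Simulation
  open import Defs using () renaming (step to stepTM; run to runTM)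

  module Tape (M : TM) where

    open TM M
    open Machine M
    open Rule

    -- The wall occurs on the left side of no rule, so no rewriting straddles the end of one row and
    -- the start of the next.
    row : List (Sym M) → Fin nQ → Sym M → List (Sym M) → List Cell
    row l q h r = map plain (reverse l) ++ head q h ∷ map plain r ++ wall ∷ []

    -- Steps on a row of fixed width: a move beyond the last cell has no successor here, whereas the
    -- machine itself would append a blank.
    data Next (l : List (Sym M)) (q : Fin nQ) (h : Sym M) (r : List (Sym M)) : List (Sym M) → Fin nQ → Sym M → List (Sym M) → Set where
      halt : halting q ≡ true → Next l q h r l q h r
      goR  : ∀ {q′ s x r′} → halting q ≡ false → δ q h ≡ (q′ , s , right) → r ≡ x ∷ r′ → Next l q h r (s ∷ l) q′ x r′
      goL  : ∀ {q′ s x l′} → halting q ≡ false → δ q h ≡ (q′ , s , left) → l ≡ x ∷ l′ → Next l q h r l′ q′ x (s ∷ r)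
      goS  : ∀ {q′ s} → halting q ≡ false → δ q h ≡ (q′ , s , stay) → Next l q h r l q′ s r

    record Moved (l : List (Sym M)) (q : Fin nQ) (h : Sym M) (r : List (Sym M)) (cs : List Cell) : Set where
      constructor moved
      field
        {l′}  : List (Sym M)
        {q′}  : Fin nQ
        {h′}  : Sym M
        {r′}  : List (Sym M)
        next  : Next l q h r l′ q′ h′ r′
        cells : cs ≡ row l′ q′ h′ r′

    row-∷ : ∀ s l cs → map plain (reverse (s ∷ l)) ++ cs ≡ map plain (reverse l) ++ plain s ∷ cs
    row-∷ s l cs = trans (cong (λ z → map plain z ++ cs) (unfold-reverse s l))
      (trans (cong (_++ cs) (map-++ plain (reverse l) (s ∷ []))) (++-assoc (map plain (reverse l)) (plain s ∷ []) cs))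

    tailCells : List (Sym M) → List Cell
    tailCells r = map plain r ++ wall ∷ []

    data View (ρ : Rule) (τ : Triple) : Set where
      headFirst  : c₁ ρ ≡ head (proj₁ τ) (proj₁ (proj₂ τ)) → c₂ ρ ≡ plain (proj₂ (proj₂ τ)) → (ac ρ ≡ true → halting (proj₁ τ) ≡ true × accepting (proj₁ τ) ≡ true) →
               (∀ l r → Moved l (proj₁ τ) (proj₁ (proj₂ τ)) (proj₂ (proj₂ τ) ∷ r) (map plain (reverse l) ++ n₁ ρ ∷ n₂ ρ ∷ tailCells r)) → View ρ τ
      headSecond : c₁ ρ ≡ plain (proj₂ (proj₂ τ)) → c₂ ρ ≡ head (proj₁ τ) (proj₁ (proj₂ τ)) → ac ρ ≡ false →
               (∀ l r → Moved (proj₂ (proj₂ τ) ∷ l) (proj₁ τ) (proj₁ (proj₂ τ)) r (map plain (reverse l) ++ n₁ ρ ∷ n₂ ρ ∷ tailCells r)) → View ρ τ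

    view : ∀ τ → View (rule τ) τ
    view (q , s , t) with halting q in hq | δ q s in dq
    ... | true  | _                 = headFirst refl refl (λ a → hq , a) (λ l r → moved (halt hq) refl)
    ... | false | (q′ , s′ , right) = headFirst refl refl (λ ()) (λ l r → moved (goR hq dq refl) (sym (row-∷ s′ l _)))
    ... | false | (q′ , s′ , left)  = headSecond refl refl refl (λ l r → moved (goL hq dq refl) refl)
    ... | false | (q′ , s′ , stay)  = headFirst refl refl (λ ()) (λ l r → moved (goS hq dq) refl)

    module _ (τ : Triple) where

      private
        ρ = rule τ

      no-plain-after : ∀ x xs {r cs′ f} → Steps ρ r1 (plain x ∷ xs) r cs′ f → c₁ ρ ≡ plain (proj₂ (proj₂ τ)) → c₂ ρ ≡ head (proj₁ τ) (proj₁ (proj₂ τ)) → ⊥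
      no-plain-after x xs (idle ne ∷ _)      e₁ e₂ = ne refl
      no-plain-after x xs (first ne _ ∷ _)   e₁ e₂ = ne refl
      no-plain-after x xs (second _ e ∷ _)   e₁ e₂ with trans e e₂
      ... | ()

      no-wall-after : ∀ {r cs cs′ f} → Steps ρ r1 (wall ∷ cs) r cs′ f → ⊥
      no-wall-after (idle ne ∷ _)    = ne refl
      no-wall-after (first ne _ ∷ _) = ne refl
      no-wall-after (second _ e ∷ _) with view τ
      ... | headFirst _ e₂ _ _ with trans e e₂
      ... | ()
      no-wall-after (second _ e ∷ _) | headSecond _ e₂ _ _ with trans e e₂
      ... | ()

      plain-first : ∀ {x} → plain x ≡ c₁ ρ → c₁ ρ ≡ plain (proj₂ (proj₂ τ)) × c₂ ρ ≡ head (proj₁ τ) (proj₁ (proj₂ τ))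
      plain-first e with view τ
      ... | headFirst e₁ _ _ _ with trans e e₁
      ... | ()
      plain-first e | headSecond e₁ e₂ _ _ = e₁ , e₂

      -- Every rule needs a head and the tail has none; a rewriting begun there would find a plain
      -- cell or the wall in place of its second cell.
      tail-fixed : ∀ xs {p r cs′ f} → p ≢ r1 → Steps ρ p (tailCells xs) r cs′ f → r ≡ r0 × cs′ ≡ tailCells xs
      tail-fixed [] ne (idle _ ∷ [])       = refl , refl
      tail-fixed [] ne (second e _ ∷ _)    = ⊥-elim (ne e)
      tail-fixed [] ne (first _ e ∷ [])    with view τ
      ... | headFirst e₁ _ _ _ with trans e e₁
      ... | ()
      tail-fixed [] ne (first _ e ∷ []) | headSecond e₁ _ _ _ with trans e e₁
      ... | ()
      tail-fixed (x ∷ xs) ne (idle _ ∷ ss) with tail-fixed xs (λ ()) ss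
      ... | refl , refl = refl , refl
      tail-fixed (x ∷ xs) ne (second e _ ∷ _) = ⊥-elim (ne e)
      tail-fixed (x ∷ []) ne (first _ e ∷ ss) = ⊥-elim (no-wall-after ss)
      tail-fixed (x ∷ y ∷ xs) ne (first _ e ∷ ss) = ⊥-elim (no-plain-after y _ ss (proj₁ (plain-first e)) (proj₂ (plain-first e)))

      data Outcome (ls : List (Sym M)) (q : Fin nQ) (h : Sym M) (r : List (Sym M)) (cs : List Cell) : Set where
        same   : cs ≡ map plain ls ++ head q h ∷ tailCells r → Outcome ls q h r cs
        onward : ∀ r′ → head q h ≡ c₁ ρ → r ≡ proj₂ (proj₂ τ) ∷ r′ → cs ≡ map plain ls ++ n₁ ρ ∷ n₂ ρ ∷ tailCells r′ → Outcome ls q h r cs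
        backward   : ∀ ls′ → head q h ≡ c₂ ρ → ls ≡ ls′ ∷ʳ proj₂ (proj₂ τ) → cs ≡ map plain ls′ ++ n₁ ρ ∷ n₂ ρ ∷ tailCells r → Outcome ls q h r cs

      plain-injective : ∀ {x y} → plain x ≡ plain y → x ≡ y
      plain-injective refl = refl

      head-first : ∀ {q h x} → head q h ≡ c₁ ρ → plain x ≡ c₂ ρ → x ≡ proj₂ (proj₂ τ)
      head-first e e′ with view τ
      ... | headFirst _ e₂ _ _ = plain-injective (trans e′ e₂)
      ... | headSecond e₁ _ _ _ with trans e e₁
      ... | ()

      head-out : ∀ q h r {p r′ cs′ f} → p ≢ r1 → Steps ρ p (head q h ∷ tailCells r) r′ cs′ f → r′ ≡ r0 × Outcome [] q h r cs′
      head-out q h r ne (idle _ ∷ ss) with tail-fixed r (λ ()) ss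
      ... | refl , refl = refl , same refl
      head-out q h r ne (second e _ ∷ _) = ⊥-elim (ne e)
      head-out q h [] ne (first _ e ∷ ss) = ⊥-elim (no-wall-after ss)
      head-out q h (x ∷ r) ne (first _ e ∷ (idle n ∷ ss)) = ⊥-elim (n refl)
      head-out q h (x ∷ r) ne (first _ e ∷ (first n _ ∷ ss)) = ⊥-elim (n refl)
      head-out q h (x ∷ r) ne (first _ e ∷ (second _ e′ ∷ ss)) with tail-fixed r (λ ()) ss
      ... | refl , refl = refl , onward r e (cong (_∷ r) (head-first e e′)) refl

      outcome : ∀ ls q h r {r′ cs′ f p} → p ≢ r1 → Steps ρ p (map plain ls ++ head q h ∷ tailCells r) r′ cs′ f → r′ ≡ r0 × Outcome ls q h r cs′
      outcome [] q h r ne ss = head-out q h r ne ss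
      outcome (x ∷ ls) q h r ne (idle _ ∷ ss) with outcome ls q h r (λ ()) ss
      ... | refl , same refl = refl , same refl
      ... | refl , onward r′ e e′ refl = refl , onward r′ e e′ refl
      ... | refl , backward ls′ e refl refl = refl , backward (x ∷ ls′) e refl refl
      outcome (x ∷ ls) q h r ne (second e _ ∷ _) = ⊥-elim (ne e)
      outcome (x ∷ y ∷ ls) q h r ne (first _ e ∷ ss) = ⊥-elim (no-plain-after y _ ss (proj₁ (plain-first e)) (proj₂ (plain-first e)))
      outcome (x ∷ []) q h r ne (first _ e ∷ (idle n ∷ ss)) = ⊥-elim (n refl)
      outcome (x ∷ []) q h r ne (first _ e ∷ (first n _ ∷ ss)) = ⊥-elim (n refl)
      outcome (x ∷ []) q h r ne (first _ e ∷ (second _ e′ ∷ ss)) with tail-fixed r (λ ()) ss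
      ... | refl , refl = refl , backward [] e′ (cong (_∷ []) (plain-injective (trans e (proj₁ (plain-first e))))) refl

      head-injective : ∀ {q h q′ h′} → head q h ≡ head q′ h′ → q ≡ q′ × h ≡ h′
      head-injective refl = refl , refl

      unreverse : ∀ (l : List (Sym M)) ls′ t → reverse l ≡ ls′ ∷ʳ t → ∃ λ l′ → l ≡ t ∷ l′ × ls′ ≡ reverse l′
      unreverse [] ls′ t e with trans (cong length e) (trans (length-++ ls′) (+-comm (length ls′) 1))
      ... | ()
      unreverse (x ∷ l) ls′ t e with ∷ʳ-injective (reverse l) ls′ (trans (sym (unfold-reverse x l)) e)
      ... | refl , refl = l , refl , refl

      -- A row holds exactly one head and every rule consumes one, so a rule is applied at most once
      -- in a row. The role at the end of the row is again `r0`, so the next row starts afresh.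
      row-next : ∀ l q h r {r′ cs′ f} → Steps ρ r0 (row l q h r) r′ cs′ f → r′ ≡ r0 × (cs′ ≡ row l q h r ⊎ Moved l q h r cs′)
      row-next l q h r ss with outcome (reverse l) q h r (λ ()) ss
      ... | e , same e′ = e , inj₁ e′
      ... | e , onward r′ eh refl refl = e , inj₂ (go (view τ))
        where
        go : View ρ τ → Moved l q h (proj₂ (proj₂ τ) ∷ r′) (map plain (reverse l) ++ n₁ ρ ∷ n₂ ρ ∷ tailCells r′)
        go (headFirst e₁ _ _ mv) with head-injective (trans eh e₁)
        ... | refl , refl = mv l r′
        go (headSecond e₁ _ _ _) with trans eh e₁
        ... | ()
      ... | e , backward ls′ eh el refl with unreverse l ls′ (proj₂ (proj₂ τ)) el
      ... | l′ , refl , refl = e , inj₂ (go (view τ))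
        where
        go : View ρ τ → Moved (proj₂ (proj₂ τ) ∷ l′) q h r (map plain (reverse l′) ++ n₁ ρ ∷ n₂ ρ ∷ tailCells r)
        go (headSecond _ e₂ _ mv) with head-injective (trans eh e₂)
        ... | refl , refl = mv l′ r
        go (headFirst _ e₂ _ _) with trans eh e₂
        ... | ()

      fired : ∀ {p cs r cs′ f} → Steps ρ p cs r cs′ f → f ≡ true → p ≡ r1 ⊎ c₁ ρ ∈ cs
      fired (idle _ ∷ ss)           e with fired ss e
      ... | inj₁ ()
      ... | inj₂ m = inj₂ (there m)
      fired (first _ refl ∷ ss)     e = inj₂ (here refl)
      fired (second p≡ _ ∷ ss)      e = inj₁ p≡

      fired-ac : ∀ {p cs r cs′ f} → Steps ρ p cs r cs′ f → f ≡ true → ac ρ ≡ true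
      fired-ac (idle _ ∷ ss)    e = fired-ac ss e
      fired-ac (first _ _ ∷ ss) e = fired-ac ss e
      fired-ac (second _ _ ∷ ss) e = or-true (ac ρ) _ e (fired-ac ss)
        where
        or-true : ∀ a b → a ∨ b ≡ true → (b ≡ true → a ≡ true) → a ≡ true
        or-true true  b e f = refl
        or-true false b e f = f e

      row-head : ∀ l q h r q′ h′ → head q′ h′ ∈ row l q h r → q′ ≡ q
      row-head l q h r q′ h′ m with ∈-++⁻ (map plain (reverse l)) m
      ... | inj₁ m′ with ∈-map⁻ plain m′
      ... | _ , _ , ()
      row-head l q h r q′ h′ m | inj₂ (here refl) = refl
      row-head l q h r q′ h′ m | inj₂ (there m′) with ∈-++⁻ (map plain r) m′
      ... | inj₁ m″ with ∈-map⁻ plain m″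
      ... | _ , _ , ()
      row-head l q h r q′ h′ m | inj₂ (there m′) | inj₂ (here ())

    -- Formulated for a prefix `cs₁` of the row because the history may break off during the last
    -- comparison.
    fired-accepts : ∀ τ {r′ cs₁ cs₂ cs′ f} l q h r → Steps (rule τ) r0 cs₁ r′ cs′ f → f ≡ true → row l q h r ≡ cs₁ ++ cs₂ → halting q ≡ true × accepting q ≡ true
    fired-accepts τ {cs₁ = cs₁} {cs₂} l q h r ss e rw with fired τ ss e | view τ
    ... | inj₁ () | _
    ... | inj₂ m | headSecond _ _ a _ = true≢false (trans (sym (fired-ac τ ss e)) a)
    ... | inj₂ m | headFirst e₁ _ a _ = subst (λ q → halting q ≡ true × accepting q ≡ true)
            (row-head τ l q h r _ _ (subst₂ _∈_ e₁ (sym rw) (∈-++⁺ˡ {ys = cs₂} m))) (a (fired-ac τ ss e))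

    blanks : ℕ → List (Sym M)
    blanks n = replicate n (blank M)

    -- The row may carry more blanks than the machine has visited; S bounds from below the room left on either side.
    record Rep (S : ℕ) (cf : Config M) (l : List (Sym M)) (q : Fin nQ) (h : Sym M) (r : List (Sym M)) : Set where
      constructor rep
      field
        i j : ℕ
        l≡  : l ≡ Config.lft cf ++ blanks i
        q≡  : q ≡ Config.state cf
        h≡  : h ≡ Config.hd cf
        r≡  : r ≡ Config.rgt cf ++ blanks j
        i≥  : S ≤ i + space M cf
        j≥  : S ≤ j + space M cf

    step-halt : ∀ q l h r → halting q ≡ true → stepTM M (cfg q l h r) ≡ cfg q l h r
    step-halt q l h r e with δ q h
    ... | _ rewrite e = refl

    -- A move onto padding uses up one blank while the configuration grows by one cell, so neither
    -- `i + space` nor `j + space` decreases.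
    rep-next : ∀ {S cf l q h r l′ q′ h′ r′} → Rep S cf l q h r → Next l q h r l′ q′ h′ r′ → Rep S (stepTM M cf) l′ q′ h′ r′
    rep-next {S} {cfg q l h r} (rep i j refl refl refl refl li lj) (halt e) = subst (λ c → Rep S c _ _ _ _) (sym (step-halt q l h r e)) (rep i j refl refl refl refl li lj)
    rep-next {S} {cfg q l h r} (rep i j refl refl refl refl li lj) (goS e d) = subst (λ c → Rep S c _ _ _ _) (sym (step-δ M q l h r d e)) (rep i j refl refl refl refl li lj)
    rep-next {S} {cfg q l h (x ∷ r)} (rep i j refl refl refl refl li lj) (goR e d refl) = subst (λ c → Rep S c _ _ _ _) (sym (step-δ M q l h (x ∷ r) d e))
      (rep i j refl refl refl refl (≤-trans li (≤-reflexive (cong (i +_) (+-suc (length l) _)))) (≤-trans lj (≤-reflexive (cong (j +_) (+-suc (length l) _)))))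
    rep-next {S} {cfg q l h []} (rep i (suc j) refl refl refl refl li lj) (goR e d refl) = subst (λ c → Rep S c _ _ _ _) (sym (step-δ M q l h [] d e))
      (rep i j refl refl refl refl (≤-trans li (+-monoʳ-≤ i (n≤1+n _))) (≤-trans lj (≤-reflexive (sym (+-suc j _)))))
    rep-next {S} {cfg q (x ∷ l) h r} (rep i j refl refl refl refl li lj) (goL e d refl) = subst (λ c → Rep S c _ _ _ _) (sym (step-δ M q (x ∷ l) h r d e))
      (rep i j refl refl refl refl (≤-trans li (≤-reflexive (cong (i +_) (sym (+-suc (length l) _))))) (≤-trans lj (≤-reflexive (cong (j +_) (sym (+-suc (length l) _))))))
    rep-next {S} {cfg q [] h r} (rep (suc i) j refl refl refl refl li lj) (goL e d refl) = subst (λ c → Rep S c _ _ _ _) (sym (step-δ M q [] h r d e))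
      (rep i j refl refl refl refl (≤-trans li (≤-reflexive (sym (+-suc i _)))) (≤-trans lj (+-monoʳ-≤ j (n≤1+n _))))

    letters-keys : ∀ {n} st a (E₁ D₁ E₂ D₂ cv cv′ : Vec Bool n) → map proj₁ (letters st a E₁ D₁ E₂ D₂ cv) ≡ map proj₁ (letters st a E₁ D₁ E₂ D₂ cv′)
    letters-keys st a []       []       []       []       []       []       = refl
    letters-keys st a (_ ∷ E₁) (_ ∷ D₁) (_ ∷ E₂) (_ ∷ D₂) (_ ∷ cv) (_ ∷ cv′) = cong (_ ∷_) (letters-keys false a E₁ D₁ E₂ D₂ cv cv′)

    letters-bits : ∀ {n} st a (E₁ D₁ E₂ D₂ cv : Vec Bool n) → map proj₂ (letters st a E₁ D₁ E₂ D₂ cv) ≡ toList cv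
    letters-bits st a []       []       []       []       []       = refl
    letters-bits st a (_ ∷ E₁) (_ ∷ D₁) (_ ∷ E₂) (_ ∷ D₂) (c ∷ cv) = cong (c ∷_) (letters-bits false a E₁ D₁ E₂ D₂ cv)

    -- Keys do not depend on the contents of the cell, as `letters-keys` shows, so the wall stands
    -- for any cell.
    cellK : Rule → List Key
    cellK ρ = map proj₁ (cellKB ρ wall)

    rowK : Rule → ℕ → List Key
    rowK ρ zero    = []
    rowK ρ (suc n) = cellK ρ ++ rowK ρ n

    rowKB-keys : ∀ ρ cs → map proj₁ (rowKB ρ cs) ≡ rowK ρ (length cs)
    rowKB-keys ρ []       = refl
    rowKB-keys ρ (c ∷ cs) = trans (map-++ proj₁ (cellKB ρ c) (rowKB ρ cs))
      (cong₂ _++_ (letters-keys true (ac ρ) (code (c₁ ρ)) (code (n₁ ρ)) (code (c₂ ρ)) (code (n₂ ρ)) (code c) (code wall)) (rowKB-keys ρ cs))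

    rowKB-bits : ∀ ρ cs → map proj₂ (rowKB ρ cs) ≡ bits cs
    rowKB-bits ρ []       = refl
    rowKB-bits ρ (c ∷ cs) = trans (map-++ proj₂ (cellKB ρ c) (rowKB ρ cs))
      (cong₂ _++_ (letters-bits true (ac ρ) (code (c₁ ρ)) (code (n₁ ρ)) (code (c₂ ρ)) (code (n₂ ρ)) (code c)) (rowKB-bits ρ cs))

    length-rowK : ∀ ρ n → length (rowK ρ n) ≡ n * width
    length-rowK ρ zero    = refl
    length-rowK ρ (suc n) = trans (length-++ (cellK ρ)) (cong₂ _+_ (trans (length-map proj₁ (cellKB ρ wall)) (length-cellKB ρ wall)) (length-rowK ρ n))

    kb-unique : ∀ z xs → map key′ z ≡ map proj₁ xs → map v z ≡ map proj₂ xs → map kb z ≡ xs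
    kb-unique []      []       e e′ = refl
    kb-unique (l ∷ z) (x ∷ xs) e e′ with ∷-injective e | ∷-injective e′
    ... | refl , e₁ | refl , e₂ = cong (x ∷_) (kb-unique z xs e₁ e₂)

    module Sound (w : List Bool) (n : ℕ) where

      N : ℕ
      N = n * width

      -- Keys cut into rows, each following the rule of some triple, with an incomplete row at the
      -- end.
      data Blocks (ks : List Key) : Set where
        short : length ks < N → Blocks ks
        block : ∀ τ ks′ → ks ≡ rowK (rule τ) n ++ ks′ → Blocks ks′ → Blocks ks

      Accepting : Set
      Accepting = ∃ λ t → halting (Config.state (runTM M w t)) ≡ true × accepting (Config.state (runTM M w t)) ≡ true

      -- z is the current row and `zt` the rest of the history, which is also the history shifted by
      -- one row. A row that is copied leaves the time t as it is, any other successor advances it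
      -- by one; the fuel bounds the letters left.
      sound-loop : ∀ fuel z zt τ l q h r t → length zt ≤ fuel → map kb z ≡ rowKB (rule τ) (row l q h r) → length (row l q h r) ≡ n →
        Rep 0 (runTM M w t) l q h r → Blocks (map key′ zt) → histOk (pairHist (run r0 false) (z ++ zt) zt) ≡ true → N ≢ 0 → Accepting
      sound-loop fuel z zt τ l q h r t le ez len rp bl hist N≢0 = cases bl
        where
        lz : length z ≡ N
        lz = trans (sym (length-map kb z)) (trans (cong length ez) (trans (length-rowKB (rule τ) (row l q h r)) (cong (_* width) len)))
        accept : halting q ≡ true × accepting q ≡ true → Accepting
        accept (a , b) = t , trans (cong halting (sym (Rep.q≡ rp))) a , trans (cong accepting (sym (Rep.q≡ rp))) b
        cases : Blocks (map key′ zt) → Accepting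
        cases (short lt) = last (row-sound (rule τ) r0 false (row l q h r) z zt ez)
          where
          lt′ : length zt < N
          lt′ = subst (_< N) (length-map key′ zt) lt
          hist′ : histOk (pairHist (run r0 false) z zt) ≡ true
          hist′ = trans (cong histOk (sym (pairHist-short (run r0 false) z zt zt (≤-trans (<⇒≤ lt′) (≤-reflexive (sym lz)))))) hist
          last : RowResult (rule τ) r0 false (row l q h r) z zt (pairHist (run r0 false) z zt) → Accepting
          last (broken e) = true≢false (trans (sym hist′) (cong histOk e))
          last (full _ _ _ y₁ y₂ e ly _ _ _) = ⊥-elim (<-irrefl refl (≤-trans lt′ (≤-trans (≤-reflexive (sym (trans ly lz))) (≤-trans (m≤m+n _ _) (≤-reflexive (sym (trans (cong length e) (length-++ y₁))))))))
          last (short _ cs₁ cs₂ r′ cs′ f e ss imp) = accept (fired-accepts τ l q h r ss (imp hist′) e)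
        cases (block τ′ ks′ e bl′) with map-split key′ zt (rowK (rule τ′) n) e
        ... | y , zt′ , refl , ey , refl = next (row-sound (rule τ) r0 false (row l q h r) z y ez)
          where
          ly : length y ≡ N
          ly = trans (sym (length-map key′ y)) (trans (cong length ey) (length-rowK (rule τ′) n))
          hist′ : histOk (pairHist (pairHist (run r0 false) z y) (y ++ zt′) zt′) ≡ true
          hist′ = trans (cong histOk (sym (pairHist-++ (run r0 false) z (y ++ zt′) y zt′ (trans lz (sym ly))))) hist
          next : RowResult (rule τ) r0 false (row l q h r) z y (pairHist (run r0 false) z y) → Accepting
          next (broken eb) = true≢false (trans (sym hist′) (trans (cong (λ x → histOk (pairHist x (y ++ zt′) zt′)) eb) (cong histOk (pairHist-bad (y ++ zt′) zt′))))
          next (short lt _ _ _ _ _ _ _ _) = ⊥-elim (<-irrefl refl (≤-trans lt (≤-reflexive (trans lz (sym ly)))))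
          next (full r′ cs′ true y₁ y₂ _ _ _ ss _) = accept (fired-accepts τ {cs₂ = []} l q h r ss refl (sym (++-identityʳ _)))
          next (full r′ cs′ false y₁ y₂ refl ly₁ vy ss h≡) with row-next τ l q h r ss
          ... | refl , out = go fuel le out
            where
            y₂≡[] : y₂ ≡ []
            y₂≡[] = none y₂ (+-cancelˡ-≡ (length y₁) (length y₂) 0 (trans (sym (length-++ y₁)) (trans (trans ly (sym lz)) (trans (sym ly₁) (sym (+-identityʳ _))))))
              where
              none : ∀ {A : Set} (xs : List A) → length xs ≡ 0 → xs ≡ []
              none [] _ = refl
            bits-y : map v (y₁ ++ y₂) ≡ bits cs′
            bits-y = trans (cong (map v) (trans (cong (y₁ ++_) y₂≡[]) (++-identityʳ y₁))) vy
            kb-y : length cs′ ≡ n → map kb (y₁ ++ y₂) ≡ rowKB (rule τ′) cs′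
            kb-y lc = kb-unique (y₁ ++ y₂) (rowKB (rule τ′) cs′) (trans ey (trans (cong (rowK (rule τ′)) (sym lc)) (sym (rowKB-keys (rule τ′) cs′)))) (trans bits-y (sym (rowKB-bits (rule τ′) cs′)))
            hist″ : histOk (pairHist (run r0 false) ((y₁ ++ y₂) ++ zt′) zt′) ≡ true
            hist″ = trans (cong (λ x → histOk (pairHist x ((y₁ ++ y₂) ++ zt′) zt′)) (sym h≡)) hist′
            lc′ : length cs′ ≡ n
            lc′ = trans (sym (length-Steps ss)) len
            smaller : ∀ {f} → length ((y₁ ++ y₂) ++ zt′) ≤ suc f → length zt′ ≤ f
            smaller {f} le′ = ≤-pred (≤-trans (+-monoˡ-≤ (length zt′) (≤-trans (n≢0⇒n>0 N≢0) (≤-reflexive (sym ly)))) (≤-trans (≤-reflexive (sym (length-++ (y₁ ++ y₂)))) le′))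
            go : ∀ fuel → length ((y₁ ++ y₂) ++ zt′) ≤ fuel → cs′ ≡ row l q h r ⊎ Moved l q h r cs′ → Accepting
            go zero le′ _ = ⊥-elim (N≢0 (n≤0⇒n≡0 (≤-trans (≤-reflexive (sym ly)) (≤-trans (m≤m+n _ (length zt′)) (≤-trans (≤-reflexive (sym (length-++ (y₁ ++ y₂)))) le′)))))
            go (suc f) le′ (inj₁ refl) = sound-loop f (y₁ ++ y₂) zt′ τ′ l q h r t (smaller le′) (kb-y lc′) lc′ rp bl′ hist″ N≢0
            go (suc f) le′ (inj₂ (moved {l″} {q″} {h″} {r″} nx refl)) = sound-loop f (y₁ ++ y₂) zt′ τ′ l″ q″ h″ r″ (suc t) (smaller le′) (kb-y lc′) lc′ (rep-next rp nx) bl′ hist″ N≢0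

-- The periodic schedule of rules and the completeness of histories

module RewritingSystem where

  open import Defs hiding (step; run; QF; eq; rel; neg; and; or)
  open FiniteTypes
  open UniversalStructure
  open Cells
  open import Data.Nat using (ℕ; zero; suc; _+_; _*_; _≤_; s≤s)
  open import Data.Nat.Properties
  open import Data.Fin using (Fin)
  open import Data.Bool using (Bool; true; false; _∨_)
  open import Data.Bool.Properties using (∨-identityʳ; ∨-assoc; ∨-zeroʳ)
  open import Data.Maybe using (just; nothing)
  open import Data.List using (List; []; _∷_; length; _++_; map; concatMap; reverse; drop)
  open import Data.List.Properties using (∷-injective; length-++; length-map; ++-assoc; ++-identityʳ; map-++; map-∘)
  open import Data.List.Membership.Propositional using (_∈_)
  open import Data.List.Relation.Binary.Pointwise using (Pointwise; []; _∷_)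
  open import Data.Vec using ([]; _∷_)
  open import Data.Product using (∃; ∃₂; _×_; _,_; proj₁; proj₂)
  open import Data.Empty using (⊥-elim)
  open import Relation.Nullary using (yes; no)
  open import Relation.Binary.PropositionalEquality
  open Simulation
  open import Defs using () renaming (run to runTM)
  open Acceptance
  open import Data.List using (allFin; cartesianProduct)
  open import Data.List.Membership.Propositional.Properties using (∈-cartesianProduct⁺; ∈-allFin; ∈-∃++)

  pairPer-bad : ∀ zs ys → pairPer bad zs ys ≡ bad
  pairPer-bad []       ys       = refl
  pairPer-bad (z ∷ zs) []       = refl
  pairPer-bad (z ∷ zs) (y ∷ ys) = pairPer-bad zs ys

  pairPer-sound : ∀ zs ys → length ys ≤ length zs → perOk (pairPer run zs ys) ≡ true → ∃ λ t → map key′ ys ++ t ≡ map key′ zs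
  pairPer-sound zs       []       le e = map key′ zs , refl
  pairPer-sound (z ∷ zs) (y ∷ ys) (s≤s le) e with sameKey (key′ z) (key′ y) in k
  ... | false = true≢false (trans (sym e) (cong perOk (pairPer-bad zs ys)))
  ... | true with pairPer-sound zs ys le e
  ... | t , e′ = t , cong₂ _∷_ (sym (sameKey-sound (key′ z) (key′ y) k)) e′

  pairPer-complete : ∀ zs ys t → map key′ ys ++ t ≡ map key′ zs → pairPer run zs ys ≡ run
  pairPer-complete []       []       t e = refl
  pairPer-complete (z ∷ zs) []       t e = refl
  pairPer-complete (z ∷ zs) (y ∷ ys) t e with ∷-injective e
  ... | e₁ , e₂ rewrite e₁ | sameKey-refl (key′ z) = pairPer-complete zs ys t e₂

  prefix-split : ∀ {A : Set} (x t p s : List A) → length p ≤ length x → x ++ t ≡ p ++ s → ∃ λ x′ → x ≡ p ++ x′ × x′ ++ t ≡ s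
  prefix-split x       t []      s le e = x , refl , e
  prefix-split (y ∷ x) t (z ∷ p) s (s≤s le) e with ∷-injective e
  ... | refl , e′ with prefix-split x t p s le e′
  ... | x′ , refl , e″ = x′ , refl , e″

  module Rewriting (M : TM) where

    open TM M
    open Machine M
    open Rule
    open Tape M

    triples : List Triple
    triples = cartesianProduct (allFin nQ) (cartesianProduct (allFin (3 + nΓ)) (allFin (3 + nΓ)))

    every : ∀ τ → τ ∈ triples
    every (q , s , t) = ∈-cartesianProduct⁺ (∈-allFin q) (∈-cartesianProduct⁺ (∈-allFin s) (∈-allFin t))

    withBit : Key × Bool → Lab
    withBit (k , b) = k , just b

    free : Key → Lab
    free k = k , nothing

    keysOf : ℕ → List Triple → List Key
    keysOf n = concatMap (λ τ → rowK (rule τ) n)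

    fits-withBit : ∀ xs {front} → Pointwise Fits (map withBit xs) front → map kb front ≡ xs
    fits-withBit []             []               = refl
    fits-withBit ((k , b) ∷ xs) ((refl , e) ∷ p) = cong₂ _∷_ (cong (k ,_) (sym (==-sound b _ e))) (fits-withBit xs p)

    withBit-fits : ∀ front → Pointwise Fits (map withBit (map kb front)) front
    withBit-fits []      = []
    withBit-fits (l ∷ f) = (refl , ==-refl (v l)) ∷ withBit-fits f

    fits-free : ∀ ks {front} → Pointwise Fits (map free ks) front → map key′ front ≡ ks
    fits-free []       []               = refl
    fits-free (k ∷ ks) ((refl , _) ∷ p) = cong (k ∷_) (fits-free ks p)

    free-fits : ∀ front → Pointwise Fits (map free (map key′ front)) front
    free-fits []      = []
    free-fits (l ∷ f) = (refl , refl) ∷ free-fits f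

    module Labels (τ₀ : Triple) (τs : List Triple) (cs₀ : List Cell) where

      n : ℕ
      n = length cs₀

      labs₁ labs₂ : List Lab
      labs₁ = map withBit (rowKB (rule τ₀) cs₀)
      labs₂ = map free (keysOf n τs)

      length-labs₁ : length labs₁ ≡ n * width
      length-labs₁ = trans (length-map withBit (rowKB (rule τ₀) cs₀)) (length-rowKB (rule τ₀) cs₀)

      module _ (w : List Bool) where

        open Sound w n

        -- By `again`, `ks₀` is a prefix of one round followed by `ks₀` itself. Rows are cut off x
        -- along the rules `rem` left in the current round, and when these are used up `again`
        -- supplies the next round.
        blocks : ∀ fuel ks₀ t₀ x rem t → N ≢ 0 → ks₀ ++ t₀ ≡ keysOf n (τ₀ ∷ τs) ++ ks₀ → length x ≤ fuel → x ++ t ≡ keysOf n rem ++ ks₀ → Blocks x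
        blocks fuel ks₀ t₀ x rem t N≢0 again le e with length x <? N
        ... | yes lt = short lt
        blocks zero ks₀ t₀ x rem t N≢0 again le e | no nlt = ⊥-elim (N≢0 (n≤0⇒n≡0 (≤-trans (≮⇒≥ nlt) le)))
        blocks (suc fuel) ks₀ t₀ x (τ ∷ rem) t N≢0 again le e | no nlt = one-block τ rem e
          where
          one-block : ∀ τ rem {t} → x ++ t ≡ keysOf n (τ ∷ rem) ++ ks₀ → Blocks x
          one-block τ rem {t} e with prefix-split x t (rowK (rule τ) n) (keysOf n rem ++ ks₀) (≤-trans (≤-reflexive (length-rowK (rule τ) n)) (≮⇒≥ nlt)) (trans e (++-assoc (rowK (rule τ) n) (keysOf n rem) ks₀))
          ... | x′ , refl , e′ = block τ x′ refl (blocks fuel ks₀ t₀ x′ rem t N≢0 again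
                  (≤-pred (≤-trans (+-monoˡ-≤ (length x′) (≤-trans (n≢0⇒n>0 N≢0) (≤-reflexive (sym (length-rowK (rule τ) n))))) (≤-trans (≤-reflexive (sym (length-++ (rowK (rule τ) n)))) le))) e′)
        blocks (suc fuel) ks₀ t₀ x [] t N≢0 again le e | no nlt with prefix-split x (t ++ t₀) (rowK (rule τ₀) n) (keysOf n τs ++ ks₀) (≤-trans (≤-reflexive (length-rowK (rule τ₀) n)) (≮⇒≥ nlt))
                    (trans (sym (++-assoc x t t₀)) (trans (cong (_++ t₀) e) (trans again (++-assoc (rowK (rule τ₀) n) (keysOf n τs) ks₀))))
        ... | x′ , refl , e′ = block τ₀ x′ refl (blocks fuel ks₀ t₀ x′ τs (t ++ t₀) N≢0 again
                  (≤-pred (≤-trans (+-monoˡ-≤ (length x′) (≤-trans (n≢0⇒n>0 N≢0) (≤-reflexive (sym (length-rowK (rule τ₀) n))))) (≤-trans (≤-reflexive (sym (length-++ (rowK (rule τ₀) n)))) le))) e′)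

        solution-sound : ∀ {body l q h r} → cs₀ ≡ row l q h r → Rep 0 (initCfg M w) l q h r → N ≢ 0 → Solution labs₁ labs₂ body → Accepting
        solution-sound {body} {l} {q} {h} {r} cs≡ rp N≢0 sol with split-PW labs₁ (Solution.fits sol)
        ... | f₁ , f₂ , e , p₁ , p₂ = sound-loop (length zt) f₁ zt τ₀ l q h r 0 ≤-refl
                (trans (fits-withBit (rowKB (rule τ₀) cs₀) p₁) (cong (rowKB (rule τ₀)) cs≡)) (cong length (sym cs≡)) rp
                (blocks (length (map key′ zt)) (map key′ back) t₀ (map key′ zt) τs [] N≢0 again ≤-refl (trans (++-identityʳ _) (trans (map-++ key′ f₂ back) (cong (_++ map key′ back) (fits-free (keysOf n τs) p₂)))))
                (trans (cong₂ (λ x y → histOk (pairHist (run r0 false) x y)) (sym body₂) (sym (trans (cong₂ drop (PW-length p₁) body₂) (drop-length f₁ zt)))) rows) N≢0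
          where
          open Solution sol
          zt = f₂ ++ back
          body₂ : body ≡ f₁ ++ zt
          body₂ = trans body≡ (trans (cong (_++ back) e) (++-assoc f₁ f₂ back))
          drop-P : drop (length (labs₁ ++ labs₂)) body ≡ back
          drop-P = trans (cong₂ drop (PW-length fits) body≡) (drop-length front back)
          agree = pairPer-sound body back (≤-trans (m≤n+m _ (length front)) (≤-reflexive (sym (trans (cong length body≡) (length-++ front))))) (trans (cong (λ x → perOk (pairPer run body x)) (sym drop-P)) cycles)
          t₀ = proj₁ agree
          keys₁ : map key′ f₁ ≡ rowK (rule τ₀) n
          keys₁ = trans (map-∘ f₁) (trans (cong (map proj₁) (fits-withBit (rowKB (rule τ₀) cs₀) p₁)) (rowKB-keys (rule τ₀) cs₀))
          again : map key′ back ++ t₀ ≡ keysOf n (τ₀ ∷ τs) ++ map key′ back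
          again = trans (proj₂ agree) (trans (cong (map key′) body₂) (trans (map-++ key′ f₁ zt)
            (trans (cong₂ _++_ keys₁ (trans (map-++ key′ f₂ back) (cong (_++ map key′ back) (fits-free (keysOf n τs) p₂)))) (sym (++-assoc (rowK (rule τ₀) n) (keysOf n τs) (map key′ back))))))

    idle-row : ∀ ρ cs → Steps ρ r0 cs r0 cs false
    idle-row ρ []       = []
    idle-row ρ (c ∷ cs) = idle (λ ()) ∷ idle-row ρ cs

    idle-tail : ∀ ρ r → Steps ρ r2 (tailCells r) r0 (tailCells r) false
    idle-tail ρ []      = idle (λ ()) ∷ []
    idle-tail ρ (x ∷ r) = idle (λ ()) ∷ idle-row ρ (tailCells r)

    idle-before : ∀ {ρ} cs {ds r ds′ f} → Steps ρ r0 ds r ds′ f → Steps ρ r0 (cs ++ ds) r (cs ++ ds′) f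
    idle-before []       ss = ss
    idle-before (c ∷ cs) ss = idle (λ ()) ∷ idle-before cs ss

    record Active (l : List (Sym M)) (q : Fin nQ) (h : Sym M) (r : List (Sym M)) : Set where
      field
        τ       : Triple
        {l′}    : List (Sym M)
        {q′}    : Fin nQ
        {h′}    : Sym M
        {r′}    : List (Sym M)
        fire    : Bool
        next    : Next l q h r l′ q′ h′ r′
        steps   : Steps (rule τ) r0 (row l q h r) r0 (row l′ q′ h′ r′) fire
        accepts : halting q ≡ true → accepting q ≡ true → fire ≡ true

    rule-ac : ∀ q s t → halting q ≡ true → accepting q ≡ true → ac (rule (q , s , t)) ∨ false ≡ true
    rule-ac q s t hq aq rewrite hq | aq = refl

    -- With a cell on either side of the head, both cells of the rule lie in the row whatever the
    -- direction of the move.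
    active : ∀ x l q h y r → Active (x ∷ l) q h (y ∷ r)
    active x l q h y r with halting q in hq | δ q h in dq
    ... | true  | _ = record { τ = q , h , y ; fire = ac (rule (q , h , y)) ∨ false ; next = halt hq
                             ; steps = subst₂ (λ ρ cs → Steps ρ r0 (row (x ∷ l) q h (y ∷ r)) r0 cs (ac ρ ∨ false)) eq refl
                                 (idle-before (map plain (reverse (x ∷ l))) (first (λ ()) refl ∷ (second refl refl ∷ idle-tail _ r)))
                             ; accepts = λ _ b → rule-ac q h y hq b }
      where
      eq : mk (head q h) (plain y) (head q h) (plain y) (accepting q) ≡ rule (q , h , y)
      eq = cong (λ b → ruleOf b (δ q h) q h y) (sym hq)
    ... | false | (q′ , s , right) = record { τ = q , h , y ; fire = ac (rule (q , h , y)) ∨ false ; next = goR hq dq refl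
                             ; steps = subst₂ (λ ρ cs → Steps ρ r0 (row (x ∷ l) q h (y ∷ r)) r0 cs (ac ρ ∨ false)) eq (sym (row-∷ s (x ∷ l) _))
                                 (idle-before (map plain (reverse (x ∷ l))) (first (λ ()) refl ∷ (second refl refl ∷ idle-tail _ r)))
                             ; accepts = λ e _ → true≢false (trans (sym e) hq) }
      where
      eq : mk (head q h) (plain y) (plain s) (head q′ y) false ≡ rule (q , h , y)
      eq = cong₂ (λ b d → ruleOf b d q h y) (sym hq) (sym dq)
    ... | false | (q′ , s , stay) = record { τ = q , h , y ; fire = ac (rule (q , h , y)) ∨ false ; next = goS hq dq
                             ; steps = subst₂ (λ ρ cs → Steps ρ r0 (row (x ∷ l) q h (y ∷ r)) r0 cs (ac ρ ∨ false)) eq refl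
                                 (idle-before (map plain (reverse (x ∷ l))) (first (λ ()) refl ∷ (second refl refl ∷ idle-tail _ r)))
                             ; accepts = λ e _ → true≢false (trans (sym e) hq) }
      where
      eq : mk (head q h) (plain y) (head q′ s) (plain y) false ≡ rule (q , h , y)
      eq = cong₂ (λ b d → ruleOf b d q h y) (sym hq) (sym dq)
    ... | false | (q′ , s , left) = record { τ = q , h , x ; fire = ac (rule (q , h , x)) ∨ false ; next = goL hq dq refl
                             ; steps = subst₂ (λ ρ cs → Steps ρ r0 cs r0 (row l q′ x (s ∷ y ∷ r)) (ac ρ ∨ false)) eq (sym (row-∷ x l _))
                                 (idle-before (map plain (reverse l)) (first (λ ()) refl ∷ (second refl refl ∷ idle-tail _ (y ∷ r))))
                             ; accepts = λ e _ → true≢false (trans (sym e) hq) }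
      where
      eq : mk (plain x) (head q h) (head q′ x) (plain s) false ≡ rule (q , h , x)
      eq = cong₂ (λ b d → ruleOf b d q h x) (sym hq) (sym dq)

    data Rows : List Triple → List Cell → List Cell → Bool → Set where
      []  : ∀ {cs} → Rows [] cs cs false
      _∷_ : ∀ {τ τs cs cs′ cs″ f g} → Steps (rule τ) r0 cs r0 cs′ f → Rows τs cs′ cs″ g → Rows (τ ∷ τs) cs cs″ (f ∨ g)

    rows-++ : ∀ {τs τs′ cs cs′ cs″ f g} → Rows τs cs cs′ f → Rows τs′ cs′ cs″ g → Rows (τs ++ τs′) cs cs″ (f ∨ g)
    rows-++ []                              R′ = R′
    rows-++ {g = g} (_∷_ {f = f} {g = g′} s R) R′ = subst (Rows _ _ _) (sym (∨-assoc f g′ g)) (s ∷ rows-++ R R′)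

    idle-rows : ∀ τs cs → Rows τs cs cs false
    idle-rows []       cs = []
    idle-rows (τ ∷ τs) cs = idle-row (rule τ) cs ∷ idle-rows τs cs

    -- Of the rows in a round only that of the active rule changes anything; the others copy their
    -- predecessor.
    cycle : ∀ {τs τ cs cs′ f} → τ ∈ τs → Steps (rule τ) r0 cs r0 cs′ f → Rows τs cs cs′ f
    cycle {τ = τ} {cs} {cs′} {f} m ss with ∈-∃++ m
    ... | as , bs , refl = rows-++ (idle-rows as cs) (subst (Rows _ _ _) (∨-identityʳ f) (ss ∷ idle-rows bs cs′))

    rowsLetters : ∀ {τs cs cs′ f} → Rows τs cs cs′ f → List Letter
    rowsLetters []      = []
    rowsLetters (s ∷ R) = rowLetters s ++ rowsLetters R

    keys-rowLetters : ∀ {ρ cs cs′ f p r} (s : Steps ρ p cs r cs′ f) → map key′ (rowLetters s) ≡ rowK ρ (length cs)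
    keys-rowLetters {ρ} {cs} s = trans (map-∘ (rowLetters s)) (trans (cong (map proj₁) (kb-rowLetters s)) (rowKB-keys ρ cs))

    bits-rowLetters : ∀ {ρ cs cs′ f p r} (s : Steps ρ p cs r cs′ f) → map v (rowLetters s) ≡ bits cs
    bits-rowLetters {ρ} {cs} s = trans (map-∘ (rowLetters s)) (trans (cong (map proj₂) (kb-rowLetters s)) (rowKB-bits ρ cs))

    length-rowLetters : ∀ {ρ cs cs′ f p r} (s : Steps ρ p cs r cs′ f) → length (rowLetters s) ≡ length cs * width
    length-rowLetters {ρ} {cs} s = trans (sym (length-map v (rowLetters s))) (trans (cong length (bits-rowLetters s)) (length-bits cs))

    keys-rowsLetters : ∀ {τs cs cs′ f n} → length cs ≡ n → (R : Rows τs cs cs′ f) → map key′ (rowsLetters R) ≡ keysOf n τs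
    keys-rowsLetters l []      = refl
    keys-rowsLetters {cs = cs} refl (_∷_ {τ = τ} s R) = trans (map-++ key′ (rowLetters s) (rowsLetters R)) (cong₂ _++_ (keys-rowLetters s) (keys-rowsLetters (sym (length-Steps s)) R))

    length-Rows : ∀ {τs cs cs′ f} → Rows τs cs cs′ f → length cs ≡ length cs′
    length-Rows []      = refl
    length-Rows (s ∷ R) = trans (length-Steps s) (length-Rows R)

    -- A history that ends with one idle row, whose only purpose is to let the last proper row be compared with its successor.
    first-row : ∀ {τs cs cs′ f ρ} (R : Rows τs cs cs′ f) → ∃₂ λ y L → rowsLetters R ++ rowLetters (idle-row ρ cs′) ≡ y ++ L × map v y ≡ bits cs
    first-row {cs = cs} {ρ = ρ} [] = rowLetters (idle-row ρ cs) , [] , sym (++-identityʳ _) , bits-rowLetters (idle-row ρ cs)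
    first-row {cs′ = cs′} {ρ = ρ} (s ∷ R) = rowLetters s , rowsLetters R ++ rowLetters (idle-row ρ cs′) , ++-assoc (rowLetters s) (rowsLetters R) _ , bits-rowLetters s

    history-ok : ∀ {τs cs cs′ f ρ} (R : Rows τs cs cs′ f) b →
      pairHist (run r0 b) (rowsLetters R ++ rowLetters (idle-row ρ cs′)) (drop (length cs * width) (rowsLetters R ++ rowLetters (idle-row ρ cs′))) ≡ run r0 (b ∨ f)
    history-ok {cs = cs} {ρ = ρ} [] b = trans (cong (pairHist (run r0 b) Z) (trans (cong₂ drop (sym (length-rowLetters (idle-row ρ cs))) (sym (++-identityʳ Z))) (drop-length Z [])))
        (trans (stop Z) (cong (run r0) (sym (∨-identityʳ b))))
      where
      Z = rowLetters (idle-row ρ cs)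
      stop : ∀ Z → pairHist (run r0 b) Z [] ≡ run r0 b
      stop []      = refl
      stop (_ ∷ _) = refl
    history-ok {cs = cs} {cs′ = cs″} {ρ = ρ} (_∷_ {cs′ = cs′} {f = f} {g = g} s R) b with first-row {ρ = ρ} R | history-ok {ρ = ρ} R (b ∨ f)
    ... | y , L , eL , vy | ih = trans (cong₂ (pairHist (run r0 b)) (++-assoc (rowLetters s) (rowsLetters R) Z) (trans (cong₂ drop (sym (length-rowLetters s)) (++-assoc (rowLetters s) (rowsLetters R) Z)) (drop-length (rowLetters s) (rowsLetters R ++ Z))))
        (trans (cong (pairHist (run r0 b) (rowLetters s ++ (rowsLetters R ++ Z))) eL)
          (trans (pairHist-++ (run r0 b) (rowLetters s) (rowsLetters R ++ Z) y L (trans (length-rowLetters s) (sym ly)))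
            (trans (cong (λ h → pairHist h (rowsLetters R ++ Z) L) (row-complete s b y vy))
              (trans (cong (pairHist (run r0 (b ∨ f)) (rowsLetters R ++ Z)) (sym (trans (cong₂ drop (trans (cong (_* width) (sym (length-Steps s))) (sym ly)) eL) (drop-length y L))))
                (trans ih (cong (run r0) (∨-assoc b f g)))))))
      where
      Z = rowLetters (idle-row ρ cs″)
      ly : length y ≡ length cs * width
      ly = trans (sym (length-map v y)) (trans (cong length vy) (trans (length-bits cs′) (cong (_* width) (sym (length-Steps s)))))

    repeat : ℕ → List Triple → List Triple
    repeat zero    τs = []
    repeat (suc k) τs = τs ++ repeat k τs

    module Complete (w : List Bool) (bound : ℕ) (all : List Triple) (all∋ : ∀ τ → τ ∈ all) where

      -- The room `suc bound` against a space of at most `bound` leaves a blank on each side, which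
      -- refutes the cases with the head at the edge of the row. Each machine step takes one round,
      -- and one more round applies the accepting rule.
      run-rows : ∀ k t l q h r → (∀ t′ → t′ ≤ k + t → space M (runTM M w t′) ≤ bound) →
        halting (Config.state (runTM M w (k + t))) ≡ true → accepting (Config.state (runTM M w (k + t))) ≡ true →
        Rep (suc bound) (runTM M w t) l q h r → ∃ λ cs′ → Rows (repeat (suc k) all) (row l q h r) cs′ true
      run-rows k t [] q h r sp hq aq (rep zero j _ _ _ _ li _) = ⊥-elim (<-irrefl refl (≤-trans li (sp t (m≤n+m t k))))
      run-rows k t [] q h r sp hq aq (rep (suc i) j l≡ _ _ _ _ _) with cong length l≡
      ... | e with trans e (trans (length-++ (Config.lft (runTM M w t))) (+-suc _ _))
      ... | ()
      run-rows k t (x ∷ l) q h [] sp hq aq (rep i zero _ _ _ _ _ lj) = ⊥-elim (<-irrefl refl (≤-trans lj (sp t (m≤n+m t k))))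
      run-rows k t (x ∷ l) q h [] sp hq aq (rep i (suc j) _ _ _ r≡ _ _) with cong length r≡
      ... | e with trans e (trans (length-++ (Config.rgt (runTM M w t))) (+-suc _ _))
      ... | ()
      run-rows k t (x ∷ l) q h (y ∷ r) sp hq aq rp = go k sp hq aq
        where
        A = active x l q h y r
        open Active A
        go : ∀ k → (∀ t′ → t′ ≤ k + t → space M (runTM M w t′) ≤ bound) →
          halting (Config.state (runTM M w (k + t))) ≡ true → accepting (Config.state (runTM M w (k + t))) ≡ true →
          ∃ λ cs′ → Rows (repeat (suc k) all) (row (x ∷ l) q h (y ∷ r)) cs′ true
        go zero sp hq aq = _ , subst₂ (λ τs f → Rows τs (row (x ∷ l) q h (y ∷ r)) (row l′ q′ h′ r′) f) (sym (++-identityʳ all))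
          (accepts (trans (cong halting (Rep.q≡ rp)) hq) (trans (cong accepting (Rep.q≡ rp)) aq)) (cycle (all∋ τ) steps)
        go (suc k) sp hq aq =
          let (cs′ , R) = run-rows k (suc t) l′ q′ h′ r′ (λ t′ le → sp t′ (≤-trans le (≤-reflexive (+-suc k t))))
                            (trans (cong (λ s → halting (Config.state (runTM M w s))) (+-suc k t)) hq)
                            (trans (cong (λ s → accepting (Config.state (runTM M w s))) (+-suc k t)) aq) (rep-next rp next)
          in cs′ , subst (Rows _ _ _) (∨-zeroʳ fire) (rows-++ (cycle (all∋ τ) steps) R)

    keysOf-++ : ∀ n τs τs′ → keysOf n (τs ++ τs′) ≡ keysOf n τs ++ keysOf n τs′
    keysOf-++ n []       τs′ = refl
    keysOf-++ n (τ ∷ τs) τs′ = trans (cong (rowK (rule τ) n ++_) (keysOf-++ n τs τs′)) (sym (++-assoc (rowK (rule τ) n) (keysOf n τs) (keysOf n τs′)))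

    repeat-snoc : ∀ k τs → repeat k τs ++ τs ≡ τs ++ repeat k τs
    repeat-snoc zero    τs = sym (++-identityʳ τs)
    repeat-snoc (suc k) τs = trans (++-assoc τs (repeat k τs) τs) (cong (τs ++_) (repeat-snoc k τs))

    rows-split : ∀ τs {τs′ cs cs′ f} → (R : Rows (τs ++ τs′) cs cs′ f) → ∃₂ λ cs₁ f₁ → ∃₂ λ (R₁ : Rows τs cs cs₁ f₁) f₂ → ∃ λ (R₂ : Rows τs′ cs₁ cs′ f₂) → rowsLetters R ≡ rowsLetters R₁ ++ rowsLetters R₂
    rows-split []       R       = _ , _ , [] , _ , R , refl
    rows-split (τ ∷ τs) (s ∷ R) with rows-split τs R
    ... | cs₁ , f₁ , R₁ , f₂ , R₂ , e = cs₁ , _ , s ∷ R₁ , f₂ , R₂ , trans (cong (rowLetters s ++_) e) (sym (++-assoc (rowLetters s) (rowsLetters R₁) (rowsLetters R₂)))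

    module Labels′ (τ₀ : Triple) (τs : List Triple) (cs₀ : List Cell) where

      open Labels τ₀ τs cs₀

      solution-complete : ∀ {k cs′} → Rows (repeat (suc k) (τ₀ ∷ τs)) cs₀ cs′ true → ∃ (Solution labs₁ labs₂)
      solution-complete {k} {cs′} R with rows-split (τ₀ ∷ τs) R
      ... | cs₁ , _ , (s ∷ R₁) , _ , R₂ , eR = body , record
          { front = front₁ ; back = rowsLetters R₂ ++ Z
          ; body≡ = trans (cong (_++ Z) eR) (++-assoc front₁ (rowsLetters R₂) Z)
          ; fits = subst₂ (λ xs ys → Pointwise Fits (map withBit xs ++ map free ys) front₁) (kb-rowLetters s) keys₁ (withBit-fits (rowLetters s) ++ᴾ free-fits (rowsLetters R₁))
          ; rows = trans (cong (λ m → histOk (pairHist (run r0 false) body (drop m body))) length-labs₁) (cong histOk (history-ok R false))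
          -- Without its first round the body has the keys of k rounds and of a row for `τ₀`.
          -- Completing that round and adding another row for `τ₀` gives the keys of the whole body.
          ; cycles = cong perOk (pairPer-complete body (drop (length (labs₁ ++ labs₂)) body) (keysOf n τs ++ rowK (rule τ₀) n) agree)
          }
        where
        Z = rowLetters (idle-row (rule τ₀) cs′)
        body = rowsLetters R ++ Z
        front₁ = rowLetters s ++ rowsLetters R₁
        keys₁ : map key′ (rowsLetters R₁) ≡ keysOf n τs
        keys₁ = keys-rowsLetters (sym (length-Steps s)) R₁
        lenP : length (labs₁ ++ labs₂) ≡ length front₁
        lenP = trans (length-++ labs₁) (trans (cong₂ _+_ (trans length-labs₁ (sym (length-rowLetters s))) (trans (length-map free (keysOf n τs)) (trans (cong length (sym keys₁)) (length-map key′ (rowsLetters R₁))))) (sym (length-++ (rowLetters s))))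
        dropped : drop (length (labs₁ ++ labs₂)) body ≡ rowsLetters R₂ ++ Z
        dropped = trans (cong₂ drop lenP (trans (cong (_++ Z) eR) (++-assoc front₁ (rowsLetters R₂) Z))) (drop-length front₁ (rowsLetters R₂ ++ Z))
        len₁ : length cs₁ ≡ n
        len₁ = sym (length-Rows (s ∷ R₁))
        keysZ : map key′ Z ≡ rowK (rule τ₀) n
        keysZ = trans (keys-rowLetters (idle-row (rule τ₀) cs′)) (cong (rowK (rule τ₀)) (sym (length-Rows R)))
        agree : map key′ (drop (length (labs₁ ++ labs₂)) body) ++ (keysOf n τs ++ rowK (rule τ₀) n) ≡ map key′ body
        agree = trans (cong (λ x → map key′ x ++ (keysOf n τs ++ rowK (rule τ₀) n)) dropped)
          (trans (cong (_++ (keysOf n τs ++ rowK (rule τ₀) n)) (trans (map-++ key′ (rowsLetters R₂) Z) (cong₂ _++_ (keys-rowsLetters len₁ R₂) keysZ)))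
          (trans (++-assoc (keysOf n (repeat k (τ₀ ∷ τs))) (rowK (rule τ₀) n) _)
          (trans (cong (keysOf n (repeat k (τ₀ ∷ τs)) ++_) (sym (++-assoc (rowK (rule τ₀) n) (keysOf n τs) (rowK (rule τ₀) n))))
          (trans (sym (++-assoc (keysOf n (repeat k (τ₀ ∷ τs))) (keysOf n (τ₀ ∷ τs)) (rowK (rule τ₀) n)))
          (trans (cong (_++ rowK (rule τ₀) n) (trans (sym (keysOf-++ n (repeat k (τ₀ ∷ τs)) (τ₀ ∷ τs))) (cong (keysOf n) (repeat-snoc k (τ₀ ∷ τs)))))
            (sym (trans (map-++ key′ (rowsLetters R) Z) (cong₂ _++_ (keys-rowsLetters refl R) keysZ))))))))

-- The reduction as a stack program: writing atoms

module AtomOutput where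

  open import Defs using (TM; and; unary; encQF)
  open FiniteTypes
  open StackPrograms
  open UniversalStructure
  open Cells
  open Simulation
  open Acceptance
  open RewritingSystem
  open import Data.Nat using (ℕ; zero; suc; _+_; _≤_; _<_)
  open import Data.Nat.Properties
  open import Data.Fin using (Fin; toℕ; #_) renaming (zero to fz; suc to fs)
  open import Data.Bool using (Bool; true; false; _∧_)
  open import Data.Maybe using (Maybe; just; nothing)
  open import Data.List using (List; []; _∷_; length; _++_; map; _ʳ++_; replicate; reverse; concatMap)
  open import Data.List.Properties using (++-assoc; ++-identityʳ; length-map; length-ʳ++; length-++; length-replicate; ʳ++-defn; reverse-involutive)
  open import Data.List.Relation.Unary.All using (All; []; _∷_)
  open import Data.Vec using (Vec; []; _∷_; lookup)
  open import Data.Product using (_,_; proj₂)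
  open import Data.Sum using (inj₁; inj₂)
  open import Function using (_∘_; id)
  open import Relation.Binary.PropositionalEquality

  module Reducer (finLetter : Finite (Maybe Letter)) (finLabel : Finite Label) (finC : Finite C) (M : TM) where

    open Histories finLetter finLabel finC using (Atom; lbl; atomQF; conj; toℕ-clamp)
    open Machine M hiding (idle; first; second)
    open Rule
    open Tape M using (cellK)
    open Rewriting M using (withBit; free)

    data Sy : Set where
      bit  : Bool → Sy
      one  : Sy
      cell : Cell → Sy

    finSy : Finite Sy
    finSy = retract (fin⊎ finBool (finMaybe finCell))
      (λ { (bit b) → inj₁ b ; one → inj₂ nothing ; (cell c) → inj₂ (just c) })
      (λ { (inj₁ b) → bit b ; (inj₂ nothing) → one ; (inj₂ (just c)) → cell c })
      λ { (bit _) → refl ; one → refl ; (cell _) → refl }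

    unbit : Sy → Bool
    unbit (bit b) = b
    unbit _       = false

    open Language 9 Sy public
    open Basics 9 one public

    record St : Set where
      field out uu u2 ac′ rs rw rowS row2 ct c2 : List Sy
    open St public

    toVec : St → Store
    toVec s = out s ∷ uu s ∷ u2 s ∷ ac′ s ∷ rs s ∷ rw s ∷ rowS s ∷ row2 s ∷ ct s ∷ c2 s ∷ []

    out# uu# u2# ac# rs# rw# row# row2# ct# c2# : Fin 10
    out# = # 0
    uu# = # 1
    u2# = # 2
    ac# = # 3
    rs# = # 4
    rw# = # 5
    row# = # 6
    row2# = # 7
    ct# = # 8
    c2# = # 9

    bits′ : List Bool → List Sy
    bits′ = map bit

    ones : ℕ → List Sy
    ones n = replicate n one

    trues : ℕ → List Sy → List Sy
    trues zero    xs = xs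
    trues (suc n) xs = bit true ∷ trues n xs

    ones-ʳ++ : ∀ a b → ones a ʳ++ ones b ≡ ones (a + b)
    ones-ʳ++ zero    b = refl
    ones-ʳ++ (suc a) b = trans (ones-ʳ++ a (suc b)) (cong ones (+-suc a b))

    trues-suc : ∀ n xs → trues n (bit true ∷ xs) ≡ bit true ∷ trues n xs
    trues-suc zero    xs = refl
    trues-suc (suc n) xs = cong (bit true ∷_) (trues-suc n xs)

    unary-bits : ∀ n acc → trues n (bit false ∷ bits′ acc) ≡ bits′ (unary n ++ acc)
    unary-bits zero    acc = refl
    unary-bits (suc n) acc = cong (bit true ∷_) (unary-bits n acc)

    num : Label → ℕ
    num l = toℕ (enc finLabel l)

    countP : Prog
    countP = while (nonempty ct#) (put out# (bit true) ⨾ put c2# one ⨾ del ct#) ⨾ mv c2# ct#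

    onesP : ℕ → Prog
    onesP zero    = idle
    onesP (suc n) = put out# (bit true) ⨾ onesP n

    -- The output grows at its left end, since it is a stack, so every code is pushed last bit
    -- first. `emitP` finally puts the tag of `and` in front.
    atomP emitP : Label → Prog
    atomP l = put out# (bit false) ⨾ countP ⨾ put out# (bit true) ⨾ put out# (bit false) ⨾ countP ⨾ put out# (bit false) ⨾ onesP (num l)
            ⨾ put out# (bit true) ⨾ put out# (bit false) ⨾ put out# (bit false)
    emitP l = atomP l ⨾ put out# (bit true) ⨾ put out# (bit true) ⨾ put out# (bit false)

    codeBit : Fin width → Maybe Sy → Bool
    codeBit i (just (cell c)) = lookup (code c) i
    codeBit i _               = false

    -- The bits of a cell are unrolled in the program, which may depend on the machine; only the
    -- number of cells depends on the input.
    cell₁ : ∀ {n} → Bool → Bool → (E₁ D₁ E₂ D₂ : Vec Bool n) → (Fin n → Fin width) → Prog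
    cell₁ st a []       []       []       []       e = idle
    cell₁ {suc n} st a (x ∷ E₁) (y ∷ D₁) (z ∷ E₂) (w ∷ D₂) e =
      ifte (λ v → codeBit (e fz) (lookup v row#)) (emitP (reads κ (just true))) (emitP (reads κ (just false)))
      ⨾ put ct# one ⨾ cell₁ false a E₁ D₁ E₂ D₂ (e ∘ fs)
      where κ = key st x y z w (a ∧ last? n)

    cell₂ : List Key → Prog
    cell₂ []       = idle
    cell₂ (κ ∷ ks) = emitP (reads κ nothing) ⨾ put ct# one ⨾ cell₂ ks

    rowP : Prog → Prog
    rowP p = while (nonempty row#) (p ⨾ copy row# row2# ⨾ del row#) ⨾ mv row2# row#

    firstP : Rule → Prog
    firstP ρ = rowP (cell₁ true (ac ρ) (code (c₁ ρ)) (code (n₁ ρ)) (code (c₂ ρ)) (code (n₂ ρ)) id)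

    restP : List Triple → Prog
    restP []       = idle
    restP (τ ∷ τs) = rowP (cell₂ (cellK (rule τ))) ⨾ restP τs

    sentenceP : Triple → List Triple → Prog
    sentenceP τ₀ τs = atomP whole ⨾ firstP (rule τ₀) ⨾ emitP history ⨾ restP τs ⨾ emitP periodic
      -- The counter now stands at the position P of the last atom; the two further bits make it P +
      -- 2, the number of variables.
      ⨾ put out# (bit false) ⨾ countP ⨾ put out# (bit true) ⨾ put out# (bit true)

    encAtom : Atom → List Bool
    encAtom (l , p) = false ∷ false ∷ true ∷ (unary (num l) ++ unary p ++ unary (suc p))

    -- The text obtained by adding conjuncts in front, as `conj` nests them. Thus the atoms can be
    -- emitted by increasing position although the text is written from right to left.
    outAfter : List Bool → List Atom → List Bool
    outAfter acc []       = acc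
    outAfter acc (x ∷ xs) = outAfter (false ∷ true ∷ true ∷ (encAtom x ++ acc)) xs

    outAfter-++ : ∀ acc xs ys → outAfter acc (xs ++ ys) ≡ outAfter (outAfter acc xs) ys
    outAfter-++ acc []       ys = refl
    outAfter-++ acc (x ∷ xs) ys = outAfter-++ _ xs ys

    lbl-++ : ∀ p xs ys → lbl p (xs ++ ys) ≡ lbl p xs ++ lbl (length xs + p) ys
    lbl-++ p []       ys = refl
    lbl-++ p (x ∷ xs) ys = cong (_ ∷_) (trans (lbl-++ (suc p) xs ys) (cong (λ q → lbl (suc p) xs ++ lbl q ys) (+-suc (length xs) p)))

    enc-atomQF : ∀ n x → proj₂ x < n → encQF (atomQF n x) ≡ encAtom x
    enc-atomQF n (l , p) lt = cong (λ z → false ∷ false ∷ true ∷ (unary (num l) ++ z))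
      (cong₂ _++_ (cong unary (toℕ-clamp n p (<⇒≤ lt))) (trans (++-identityʳ _) (cong unary (toℕ-clamp n (suc p) lt))))

    enc-conj : ∀ n φ xs → All (λ x → proj₂ x < n) xs → encQF (conj n φ xs) ≡ outAfter (encQF φ) xs
    enc-conj n φ []       []       = refl
    enc-conj n φ (x ∷ xs) (lt ∷ a) = trans (enc-conj n (and (atomQF n x) φ) xs a) (cong (λ z → outAfter (false ∷ true ∷ true ∷ (z ++ encQF φ)) xs) (enc-atomQF n x lt))

    cells : List Cell → List Sy
    cells = map cell

    cells-ʳ++ : ∀ xs ys → cells xs ʳ++ cells ys ≡ cells (xs ʳ++ ys)
    cells-ʳ++ []       ys = refl
    cells-ʳ++ (x ∷ xs) ys = cells-ʳ++ xs (x ∷ ys)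

    module _ (B : ℕ) where

      open Loops B
      open Moves B

      Em : St → List Sy → ℕ → St
      Em s o p = record s { out = o ; ct = ones p ; c2 = [] }

      count-loop : ∀ s o n a → Loop (nonempty ct#) (put out# (bit true) ⨾ put c2# one ⨾ del ct#) n
        (toVec (record s { out = o ; ct = ones n ; c2 = ones a })) (toVec (record s { out = trues n o ; ct = [] ; c2 = ones (n + a) }))
      count-loop s o zero    a = stop refl
      count-loop s o (suc n) a = more refl acts
        (Loop-cast (cong₂ (λ x y → toVec (record s { out = x ; ct = [] ; c2 = ones y })) (trues-suc n o) (+-suc n a)) (count-loop s (bit true ∷ o) n (suc a)))

      count-run : ∀ s o p → p ≤ B → countP ⊢ toVec (Em s o p) ⇒ toVec (Em s (trues p o) p)
      count-run s o p p≤ = via (toVec (record s { out = trues p o ; ct = [] ; c2 = ones (p + 0) })) (while p≤ (count-loop s o p 0))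
        (cast (cong (λ x → toVec (record s { out = trues p o ; ct = x ; c2 = [] })) (trans (ones-ʳ++ (p + 0) 0) (cong ones (trans (+-identityʳ (p + 0)) (+-identityʳ p)))))
          (mv-run c2# ct# (λ ()) _ (≤-trans (≤-reflexive (trans (length-replicate (p + 0)) (+-identityʳ p))) p≤)))

      ones-run : ∀ s o p n → onesP n ⊢ toVec (Em s o p) ⇒ toVec (Em s (trues n o) p)
      ones-run s o p zero    = act
      ones-run s o p (suc n) = via (toVec (Em s (bit true ∷ o) p)) act (cast (cong (λ x → toVec (Em s x p)) (trues-suc n o)) (ones-run s (bit true ∷ o) p n))

      atom-run : ∀ s acc l p → p ≤ B → atomP l ⊢ toVec (Em s (bits′ acc) p) ⇒ toVec (Em s (bits′ (encAtom (l , p) ++ acc)) p)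
      atom-run s acc l p p≤ = via (toVec (Em s (bit false ∷ bits′ acc) p)) act
        (via (toVec (Em s (bits′ (unary p ++ acc)) p)) (cast (cong (λ x → toVec (Em s x p)) (unary-bits p acc)) (count-run s (bit false ∷ bits′ acc) p p≤))
        (act ⨾ via (toVec (Em s (bits′ (false ∷ a₁)) p)) act
        (via (toVec (Em s (bits′ a₂) p)) (cast (cong (λ x → toVec (Em s x p)) (unary-bits p a₁)) (count-run s (bit false ∷ bits′ a₁) p p≤))
        (via (toVec (Em s (bits′ (false ∷ a₂)) p)) act
        (via (toVec (Em s (bits′ a₃) p)) (cast (cong (λ x → toVec (Em s x p)) (unary-bits (num l) a₂)) (ones-run s (bit false ∷ bits′ a₂) p (num l)))
        (act ⨾ act ⨾ cast (cong (λ x → toVec (Em s (bits′ (false ∷ false ∷ true ∷ x)) p)) assoc) act))))))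
        where
        a₁ = unary (suc p) ++ acc
        a₂ = unary p ++ a₁
        a₃ = unary (num l) ++ a₂
        assoc : a₃ ≡ (unary (num l) ++ unary p ++ unary (suc p)) ++ acc
        assoc = sym (trans (++-assoc (unary (num l)) (unary p ++ unary (suc p)) acc) (cong (unary (num l) ++_) (++-assoc (unary p) (unary (suc p)) acc)))

      emit-run : ∀ s acc l p → p ≤ B → emitP l ⊢ toVec (Em s (bits′ acc) p) ⇒ toVec (Em s (bits′ (outAfter acc ((l , p) ∷ []))) p)
      emit-run s acc l p p≤ = via (toVec (Em s (bits′ (encAtom (l , p) ++ acc)) p)) (atom-run s acc l p p≤) acts

      After : St → List Bool → ℕ → List Lab → St
      After s acc p ls = Em s (bits′ (outAfter acc (lbl p ls))) (length ls + p)

      after-∷ : ∀ s acc p k b ls → After s (outAfter acc ((reads k b , p) ∷ [])) (suc p) ls ≡ After s acc p ((k , b) ∷ ls)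
      after-∷ s acc p k b ls = cong (Em s (bits′ (outAfter acc (lbl p ((k , b) ∷ ls))))) (+-suc (length ls) p)

      after-++ : ∀ s acc p xs ys → After s (outAfter acc (lbl p xs)) (length xs + p) ys ≡ After s acc p (xs ++ ys)
      after-++ s acc p xs ys = cong₂ (λ x y → Em s (bits′ x) y)
        (trans (sym (outAfter-++ acc (lbl p xs) (lbl (length xs + p) ys))) (cong (outAfter acc) (sym (lbl-++ p xs ys))))
        (trans (sym (+-assoc (length ys) (length xs) p)) (cong (_+ p) (trans (+-comm (length ys) (length xs)) (sym (length-++ xs)))))

      cell₁-run : ∀ {n} st a (E₁ D₁ E₂ D₂ cv : Vec Bool n) e s acc p c rest → (∀ i → lookup (code c) (e i) ≡ lookup cv i) → n + p ≤ B →
        cell₁ st a E₁ D₁ E₂ D₂ e ⊢ toVec (Em (record s { rowS = cell c ∷ rest }) (bits′ acc) p) ⇒ toVec (After (record s { rowS = cell c ∷ rest }) acc p (map withBit (letters st a E₁ D₁ E₂ D₂ cv)))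
      cell₁-run st a [] [] [] [] [] e s acc p c rest ce le = act
      cell₁-run {suc n} st a (x ∷ E₁) (y ∷ D₁) (z ∷ E₂) (w ∷ D₂) (b ∷ cv) e s acc p c rest ce le =
        via (toVec (Em s′ (bits′ acc′) p)) (choose b (ce fz))
        (via (toVec (Em s′ (bits′ acc′) (suc p))) act
          (cast (cong toVec (after-∷ s′ acc p κ (just b) (map withBit (letters false a E₁ D₁ E₂ D₂ cv))))
            (cell₁-run false a E₁ D₁ E₂ D₂ cv (e ∘ fs) s acc′ (suc p) c rest (ce ∘ fs) (≤-trans (≤-reflexive (+-suc n p)) le))))
        where
        s′ = record s { rowS = cell c ∷ rest }
        κ = key st x y z w (a ∧ last? n)
        acc′ = outAfter acc ((reads κ (just b) , p) ∷ [])
        p≤ : p ≤ B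
        p≤ = ≤-trans (m≤n+m p (suc n)) le
        choose : ∀ b → lookup (code c) (e fz) ≡ b → ifte (λ v → codeBit (e fz) (lookup v row#)) (emitP (reads κ (just true))) (emitP (reads κ (just false)))
          ⊢ toVec (Em s′ (bits′ acc) p) ⇒ toVec (Em s′ (bits′ (outAfter acc ((reads κ (just b) , p) ∷ []))) p)
        choose true  eq = then′ eq (emit-run s′ acc (reads κ (just true)) p p≤)
        choose false eq = else′ eq (emit-run s′ acc (reads κ (just false)) p p≤)

      cell₂-run : ∀ ks s acc p → length ks + p ≤ B → cell₂ ks ⊢ toVec (Em s (bits′ acc) p) ⇒ toVec (After s acc p (map free ks))
      cell₂-run []       s acc p le = act
      cell₂-run (κ ∷ ks) s acc p le = via (toVec (Em s (bits′ acc′) p)) (emit-run s acc (reads κ nothing) p (≤-trans (m≤n+m p (suc (length ks))) le))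
        (via (toVec (Em s (bits′ acc′) (suc p))) act
          (cast (cong toVec (after-∷ s acc p κ nothing (map free ks))) (cell₂-run ks s acc′ (suc p) (≤-trans (≤-reflexive (+-suc (length ks) p)) le))))
        where acc′ = outAfter acc ((reads κ nothing , p) ∷ [])

      row-loop : ∀ prog (lab : Cell → List Lab) → (∀ s acc p c rest → length (lab c) + p ≤ B →
          prog ⊢ toVec (Em (record s { rowS = cell c ∷ rest }) (bits′ acc) p) ⇒ toVec (After (record s { rowS = cell c ∷ rest }) acc p (lab c))) →
        ∀ s cs done acc p → length (concatMap lab cs) + p ≤ B →
        Loop (nonempty row#) (prog ⨾ copy row# row2# ⨾ del row#) (length cs)
          (toVec (Em (record s { rowS = cells cs ; row2 = cells done }) (bits′ acc) p))
          (toVec (After (record s { rowS = [] ; row2 = cells (cs ʳ++ done) }) acc p (concatMap lab cs)))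
      row-loop prog lab f s []       done acc p le = stop refl
      row-loop prog lab f s (c ∷ cs) done acc p le = more refl
        (via (toVec (After (record s { rowS = cells (c ∷ cs) ; row2 = cells done }) acc p (lab c))) (f (record s { row2 = cells done }) acc p c (cells cs) (≤-trans (+-monoˡ-≤ p (≤-trans (m≤m+n _ _) (≤-reflexive (sym (length-++ (lab c)))))) le)) acts)
        (Loop-cast (cong toVec (after-++ (record s { rowS = [] ; row2 = cells (cs ʳ++ (c ∷ done)) }) acc p (lab c) (concatMap lab cs)))
          (row-loop prog lab f s cs (c ∷ done) (outAfter acc (lbl p (lab c))) (length (lab c) + p)
            (≤-trans (≤-reflexive (trans (sym (+-assoc (length (concatMap lab cs)) (length (lab c)) p)) (cong (_+ p) (trans (+-comm (length (concatMap lab cs)) _) (sym (length-++ (lab c))))))) le)))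

      row-run : ∀ prog (lab : Cell → List Lab) → (∀ s acc p c rest → length (lab c) + p ≤ B →
          prog ⊢ toVec (Em (record s { rowS = cell c ∷ rest }) (bits′ acc) p) ⇒ toVec (After (record s { rowS = cell c ∷ rest }) acc p (lab c))) →
        ∀ s cs acc p → length (concatMap lab cs) + p ≤ B → length cs ≤ B →
        rowP prog ⊢ toVec (Em (record s { rowS = cells cs ; row2 = [] }) (bits′ acc) p) ⇒ toVec (After (record s { rowS = cells cs ; row2 = [] }) acc p (concatMap lab cs))
      row-run prog lab f s cs acc p le le′ = via (toVec (After (record s { rowS = [] ; row2 = cells (cs ʳ++ []) }) acc p (concatMap lab cs))) (while le′ (row-loop prog lab f s cs [] acc p le))
        (cast (cong (λ x → toVec (After (record s { rowS = x ; row2 = [] }) acc p (concatMap lab cs)))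
                (trans (cells-ʳ++ (cs ʳ++ []) []) (cong cells (trans (ʳ++-defn (cs ʳ++ [])) (trans (++-identityʳ _) (trans (cong reverse (trans (ʳ++-defn cs) (++-identityʳ _))) (reverse-involutive cs)))))))
          (mv-run row2# row# (λ ()) _ (≤-trans (≤-reflexive (trans (length-map cell (cs ʳ++ [])) (trans (length-ʳ++ cs) (+-identityʳ _)))) le′)))

-- The reduction as a stack program: writing the sentence

module SentenceOutput where

  open import Defs using (TM; blank; bitSym; unary; encSentence)
  open FiniteTypes
  open StackPrograms
  open UniversalStructure
  open Simulation
  open Acceptance
  open RewritingSystem
  open AtomOutput
  open import Data.Nat using (ℕ; zero; suc; _+_; _≤_; z≤n; s≤s)
  open import Data.Nat.Properties
  open import Data.Bool using (true; false)
  open import Data.Maybe using (Maybe; just)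
  open import Data.List using (List; []; _∷_; length; _++_; map; _ʳ++_; replicate; concatMap)
  open import Data.List.Properties using (++-identityʳ; length-map; length-++; map-++; map-concatMap)
  open import Data.List.Relation.Unary.All as All using (All)
  open import Data.Vec using ([]; _∷_; lookup)
  open import Data.Product using (_,_)
  open import Function using (_∘_; id)
  open import Relation.Binary.PropositionalEquality

  module Reduction (finLetter : Finite (Maybe Letter)) (finLabel : Finite Label) (finC : Finite C) (M : TM) where

    open Histories finLetter finLabel finC using (lbl; atoms; atomQF; sentence; atoms-bound)
    open Reducer finLetter finLabel finC M
    open TM M using () renaming (start to q₀)
    open Machine M hiding (idle; first; second)
    open Tape M using (cellK; rowK)
    open Rewriting M using (withBit; free; keysOf; module Labels)

    replicate-∷ : ∀ {A : Set} a (x : A) ys → replicate a x ++ x ∷ ys ≡ x ∷ replicate a x ++ ys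
    replicate-∷ zero    x ys = refl
    replicate-∷ (suc a) x ys = cong (x ∷_) (replicate-∷ a x ys)

    replicate-ʳ++ : ∀ {A : Set} a (x : A) ys → replicate a x ʳ++ ys ≡ replicate a x ++ ys
    replicate-ʳ++ zero    x ys = refl
    replicate-ʳ++ (suc a) x ys = trans (replicate-ʳ++ a x (x ∷ ys)) (replicate-∷ a x ys)

    rowK-free : ∀ ρ (cs : List Cell) → concatMap (λ _ → map free (cellK ρ)) cs ≡ map free (rowK ρ (length cs))
    rowK-free ρ []       = refl
    rowK-free ρ (c ∷ cs) = trans (cong (map free (cellK ρ) ++_) (rowK-free ρ cs)) (sym (map-++ free (cellK ρ) (rowK ρ (length cs))))

    inputP : Prog
    -- The additional unit makes `uu` hold n + 1, the base of the power in `polyBound`.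
    inputP = while (nonempty out#) (copy out# rw# ⨾ put uu# one ⨾ del out#) ⨾ put uu# one

    addP mulP : Prog
    addP = while (nonempty uu#) (put rs# one ⨾ put u2# one ⨾ del uu#) ⨾ mv u2# uu#
    mulP = while (nonempty ac#) (addP ⨾ del ac#) ⨾ mv rs# ac#

    -- Starting from c and multiplying c times by n + 1 gives `polyBound c n`. As c is fixed, the
    -- multiplications are unrolled.
    seedP powP : ℕ → Prog
    seedP zero    = idle
    seedP (suc c) = put ac# one ⨾ seedP c
    powP zero    = idle
    powP (suc c) = mulP ⨾ powP c

    -- The row is pushed from its right end: wall, blanks, the input (which lies reversed on `rw`),
    -- blanks. The first input symbol is pushed as a plain cell and then turned into the cell of the
    -- head.
    padP bitsP headP buildP : Prog
    padP   = while (nonempty ac#) (put row# (cell (plain (blank M))) ⨾ put rs# one ⨾ del ac#) ⨾ mv rs# ac#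
    bitsP  = while (nonempty rw#) (act (λ v → push row# (cell (plain (bitSym M (unbit (sym? (lookup v rw#))))))) ⨾ del rw#)
    headP  = act (λ v → push row2# (underHead (lookup v row#))) ⨾ del row# ⨾ copy row2# row# ⨾ del row2#
      where
      underHead : Maybe Sy → Sy
      underHead (just (cell (plain x))) = cell (head q₀ x)
      underHead _                       = one
    buildP = put row# (cell wall) ⨾ padP ⨾ ifte (nonempty rw#) (bitsP ⨾ headP) (put row# (cell (head q₀ (blank M)))) ⨾ padP

    module _ (τ₀ : Triple) (τs : List Triple) (cs : List Cell) where

      open Labels τ₀ τs cs

      private
        P = length labs₂ + (length labs₁ + 0)
        acc₀ = encAtom (whole , 0) ++ []
        acc₁ = outAfter acc₀ (lbl 0 labs₁)
        acc₂ = outAfter acc₁ ((history , length labs₁ + 0) ∷ [])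
        acc₃ = outAfter acc₂ (lbl (length labs₁ + 0) labs₂)
        acc₄ = outAfter acc₃ ((periodic , P) ∷ [])

      written : unary (2 + P) ++ acc₄ ≡ encSentence (sentence labs₁ labs₂)
      written = cong₂ (λ x y → unary (2 + x) ++ y) P≡
        (sym (trans (enc-conj (suc m) (atomQF (suc m) (whole , 0)) (atoms labs₁ labs₂) (All.map s≤s (atoms-bound labs₁ labs₂)))
          (trans (cong (λ x → outAfter x (atoms labs₁ labs₂)) (trans (enc-atomQF (suc m) (whole , 0) (s≤s z≤n)) (sym (++-identityʳ (encAtom (whole , 0))))))
          (trans (outAfter-++ acc₀ (lbl 0 labs₁) _)
          (trans (cong (λ x → outAfter (outAfter acc₁ ((history , x) ∷ [])) (lbl x labs₂ ++ (periodic , m) ∷ [])) (sym (+-identityʳ (length labs₁))))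
          (trans (outAfter-++ acc₂ (lbl (length labs₁ + 0) labs₂) _) (cong (λ x → outAfter acc₃ ((periodic , x) ∷ [])) (sym P≡))))))))
        where
        m = length (labs₁ ++ labs₂)
        P≡ : P ≡ m
        P≡ = trans (cong (length labs₂ +_) (+-identityʳ _)) (trans (+-comm (length labs₂) _) (sym (length-++ labs₁)))

      module _ (B : ℕ) (n≤ : n ≤ B) (P≤ : length labs₂ + (length labs₁ + 0) ≤ B) where

        open Language.Loops 9 Sy B
        open Basics.Moves 9 one B

        first-run : ∀ s acc p → length labs₁ + p ≤ B →
          firstP (rule τ₀) ⊢ toVec (Em B (record s { rowS = cells cs ; row2 = [] }) (bits′ acc) p) ⇒ toVec (After B (record s { rowS = cells cs ; row2 = [] }) acc p labs₁)
        first-run s acc p le = cast (cong (λ ls → toVec (After B (record s { rowS = cells cs ; row2 = [] }) acc p ls)) e)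
          (row-run B _ (map withBit ∘ cellKB ρ) (λ s acc p c rest le → cell₁-run B true _ _ _ _ _ (code c) id s acc p c rest (λ _ → refl) (≤-trans (≤-reflexive (cong (_+ p) (sym (trans (length-map withBit (cellKB ρ c)) (length-cellKB ρ c))))) le))
            s cs acc p (≤-trans (≤-reflexive (cong (λ ls → length ls + p) e)) le) n≤)
          where
          ρ = rule τ₀
          e : concatMap (map withBit ∘ cellKB ρ) cs ≡ labs₁
          e = sym (map-concatMap withBit (cellKB ρ) cs)

        rest-run : ∀ τs s acc p → length (map free (keysOf n τs)) + p ≤ B →
          restP τs ⊢ toVec (Em B (record s { rowS = cells cs ; row2 = [] }) (bits′ acc) p) ⇒ toVec (After B (record s { rowS = cells cs ; row2 = [] }) acc p (map free (keysOf n τs)))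
        rest-run []       s acc p le = act
        rest-run (τ ∷ τs) s acc p le = via (toVec (After B s′ acc p r₁))
          (cast (cong (λ ls → toVec (After B s′ acc p ls)) (rowK-free ρ cs))
            (row-run B _ (λ _ → map free (cellK ρ)) (λ s acc p c rest le → cell₂-run B (cellK ρ) (record s { rowS = cell c ∷ rest }) acc p (≤-trans (≤-reflexive (cong (_+ p) (sym (length-map free (cellK ρ))))) le)) s cs acc p
              (≤-trans (≤-reflexive (cong (λ ls → length ls + p) (rowK-free ρ cs))) (≤-trans (+-monoˡ-≤ p (≤-trans (m≤m+n (length r₁) (length r₂)) (≤-reflexive (sym (length-++ r₁))))) le₁)) n≤))
          (cast (cong toVec (trans (after-++ B s′ acc p r₁ r₂) (cong (After B s′ acc p) (sym e)))) (rest-run τs s (outAfter acc (lbl p r₁)) (length r₁ + p)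
            (≤-trans (≤-reflexive (trans (sym (+-assoc (length r₂) (length r₁) p)) (cong (_+ p) (trans (+-comm (length r₂) (length r₁)) (sym (length-++ r₁)))))) le₁)))
          where
          ρ = rule τ
          s′ = record s { rowS = cells cs ; row2 = [] }
          r₁ = map free (rowK ρ n)
          r₂ = map free (keysOf n τs)
          e : map free (keysOf n (τ ∷ τs)) ≡ r₁ ++ r₂
          e = map-++ free (rowK ρ n) (keysOf n τs)
          le₁ : length (r₁ ++ r₂) + p ≤ B
          le₁ = ≤-trans (≤-reflexive (cong (λ ls → length ls + p) (sym e))) le

        sentence-run : ∀ s → sentenceP τ₀ τs ⊢ toVec (Em B (record s { rowS = cells cs ; row2 = [] }) [] 0)
          ⇒ toVec (Em B (record s { rowS = cells cs ; row2 = [] }) (bits′ (encSentence (sentence labs₁ labs₂))) P)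
        sentence-run s = via (toVec (Em B s′ (bits′ acc₀) 0)) (atom-run B s′ [] whole 0 z≤n)
          (via (toVec (Em B s′ (bits′ acc₁) (length labs₁ + 0))) (first-run s acc₀ 0 le₁)
          (via (toVec (Em B s′ (bits′ acc₂) (length labs₁ + 0))) (emit-run B s′ acc₁ history (length labs₁ + 0) le₁)
          (via (toVec (Em B s′ (bits′ acc₃) P)) (rest-run τs s acc₂ (length labs₁ + 0) P≤)
          (via (toVec (Em B s′ (bits′ acc₄) P)) (emit-run B s′ acc₃ periodic P P≤)
          (via (toVec (Em B s′ (bits′ (false ∷ acc₄)) P)) act
          (via (toVec (Em B s′ (trues P (bits′ (false ∷ acc₄))) P)) (count-run B s′ (bits′ (false ∷ acc₄)) P P≤)
          (act ⨾ cast (cong (λ x → toVec (Em B s′ x P)) (trans (unary-bits (2 + P) acc₄) (cong bits′ written))) act)))))))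
          where
          s′ = record s { rowS = cells cs ; row2 = [] }
          le₁ : length labs₁ + 0 ≤ B
          le₁ = ≤-trans (m≤n+m _ (length labs₂)) P≤

-- The reduction as a stack program: building the initial row

module RowOutput where

  open import Defs using (TM; Config; blank; bitSym; initCfg)
  open FiniteTypes
  open StackPrograms
  open Compilation
  open UniversalStructure
  open Simulation
  open Acceptance
  open RewritingSystem
  open AtomOutput
  open SentenceOutput
  open import Data.Nat using (ℕ; zero; suc; _+_; _*_; _^_; _≤_)
  open import Data.Nat.Properties
  open import Data.Bool using (Bool)
  open import Data.Maybe using (Maybe)
  open import Data.List using (List; []; _∷_; length; _++_; map; _ʳ++_; replicate; reverse)
  open import Data.List.Properties using (++-assoc; ++-identityʳ; length-replicate; ʳ++-defn; reverse-involutive; map-++; map-replicate; length-reverse; map-∘; reverse-map)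
  open import Data.Vec using ([]; _∷_; lookup)
  open import Data.Empty using (⊥-elim)
  open import Function using (_∘_)
  open import Relation.Binary.PropositionalEquality

  module Transducer (finLetter : Finite (Maybe Letter)) (finLabel : Finite Label) (finC : Finite C) (M : TM) where

    open Reducer finLetter finLabel finC M
    open Reduction finLetter finLabel finC M
    open TM M using () renaming (start to q₀)
    open Machine M hiding (idle; first; second)
    open Tape M using (row; blanks)

    -- The tape is infinite in both directions and the run may use its space on either side, so
    -- blanks are added on both.
    startRow : List Bool → ℕ → List Cell
    startRow w S = row (Config.lft cf ++ blanks S) (Config.state cf) (Config.hd cf) (Config.rgt cf ++ blanks S)
      where cf = initCfg M w

    void : Cell
    void = plain (blank M)

    row-padded : ∀ S q h r → row (blanks S) q h (r ++ blanks S) ≡ replicate S void ++ head q h ∷ (map plain r ++ (replicate S void ++ wall ∷ []))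
    row-padded S q h r = cong₂ (λ x y → x ++ head q h ∷ y)
      (trans (cong (map plain) (trans (replicate-ʳ++ S (blank M) []) (++-identityʳ (blanks S)))) (map-replicate plain S (blank M)))
      (trans (cong (_++ wall ∷ []) (map-++ plain r (blanks S)))
        (trans (++-assoc (map plain r) (map plain (blanks S)) (wall ∷ [])) (cong (λ x → map plain r ++ (x ++ wall ∷ [])) (map-replicate plain S (blank M)))))

    module _ (B : ℕ) where

      open Language.Loops 9 Sy B
      open Basics.Moves 9 one B

      input-loop : ∀ s w xs n → Loop (nonempty out#) (copy out# rw# ⨾ put uu# one ⨾ del out#) (length w)
        (toVec (record s { out = bits′ w ; uu = ones n ; rw = bits′ xs })) (toVec (record s { out = [] ; uu = ones (length w + n) ; rw = bits′ (w ʳ++ xs) }))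
      input-loop s []      xs n = stop refl
      input-loop s (b ∷ w) xs n = more refl acts
        (Loop-cast (cong (λ x → toVec (record s { out = [] ; uu = ones x ; rw = bits′ (w ʳ++ (b ∷ xs)) })) (+-suc (length w) n)) (input-loop s w (b ∷ xs) (suc n)))

      input-run : ∀ s w → length w ≤ B → inputP ⊢ toVec (record s { out = bits′ w ; uu = [] ; rw = [] }) ⇒ toVec (record s { out = [] ; uu = ones (suc (length w)) ; rw = bits′ (reverse w) })
      input-run s w le = via (toVec (record s { out = [] ; uu = ones (length w) ; rw = bits′ (reverse w) }))
        (cast (cong (λ x → toVec (record s { out = [] ; uu = ones x ; rw = bits′ (reverse w) })) (+-identityʳ (length w))) (while le (input-loop s w [] 0))) act

      ones-mv : ∀ n → ones n ʳ++ [] ≡ ones n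
      ones-mv n = trans (ones-ʳ++ n 0) (cong ones (+-identityʳ n))

      length-ones : ∀ {n} → n ≤ B → length (ones n) ≤ B
      length-ones {n} le = ≤-trans (≤-reflexive (length-replicate n)) le

      add-loop : ∀ s m r u → Loop (nonempty uu#) (put rs# one ⨾ put u2# one ⨾ del uu#) m
        (toVec (record s { uu = ones m ; rs = ones r ; u2 = ones u })) (toVec (record s { uu = [] ; rs = ones (m + r) ; u2 = ones (m + u) }))
      add-loop s zero    r u = stop refl
      add-loop s (suc m) r u = more refl acts
        (Loop-cast (cong₂ (λ x y → toVec (record s { uu = [] ; rs = ones x ; u2 = ones y })) (+-suc m r) (+-suc m u)) (add-loop s m (suc r) (suc u)))

      add-run : ∀ s m r → m ≤ B → addP ⊢ toVec (record s { uu = ones m ; rs = ones r ; u2 = [] }) ⇒ toVec (record s { uu = ones m ; rs = ones (m + r) ; u2 = [] })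
      add-run s m r le = via (toVec (record s { uu = [] ; rs = ones (m + r) ; u2 = ones m }))
        (cast (cong (λ x → toVec (record s { uu = [] ; rs = ones (m + r) ; u2 = ones x })) (+-identityʳ m)) (while le (add-loop s m r 0)))
        (cast (cong (λ x → toVec (record s { uu = x ; rs = ones (m + r) ; u2 = [] })) (ones-mv m)) (mv-run u2# uu# (λ ()) _ (length-ones le)))

      mul-loop : ∀ s m a r → m ≤ B → Loop (nonempty ac#) (addP ⨾ del ac#) a
        (toVec (record s { uu = ones m ; u2 = [] ; ac′ = ones a ; rs = ones r })) (toVec (record s { uu = ones m ; u2 = [] ; ac′ = [] ; rs = ones (a * m + r) }))
      mul-loop s m zero    r le = stop refl
      mul-loop s m (suc a) r le = more refl (via (toVec (record s { uu = ones m ; u2 = [] ; ac′ = ones (suc a) ; rs = ones (m + r) })) (add-run (record s { ac′ = ones (suc a) }) m r le) act)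
        (Loop-cast (cong (λ x → toVec (record s { uu = ones m ; u2 = [] ; ac′ = [] ; rs = ones x })) (trans (sym (+-assoc (a * m) m r)) (cong (_+ r) (+-comm (a * m) m)))) (mul-loop s m a (m + r) le))

      mul-run : ∀ s m a → m ≤ B → a ≤ B → a * m ≤ B → mulP ⊢ toVec (record s { uu = ones m ; u2 = [] ; ac′ = ones a ; rs = [] }) ⇒ toVec (record s { uu = ones m ; u2 = [] ; ac′ = ones (a * m) ; rs = [] })
      mul-run s m a m≤ a≤ le = via (toVec (record s { uu = ones m ; u2 = [] ; ac′ = [] ; rs = ones (a * m) }))
        (cast (cong (λ x → toVec (record s { uu = ones m ; u2 = [] ; ac′ = [] ; rs = ones x })) (+-identityʳ (a * m))) (while a≤ (mul-loop s m a 0 m≤)))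
        (cast (cong (λ x → toVec (record s { uu = ones m ; u2 = [] ; ac′ = x ; rs = [] })) (ones-mv (a * m))) (mv-run rs# ac# (λ ()) _ (length-ones le)))

      pow-run : ∀ s m k a → suc m ≤ B → a * suc m ^ k ≤ B → powP k ⊢ toVec (record s { uu = ones (suc m) ; u2 = [] ; ac′ = ones a ; rs = [] }) ⇒ toVec (record s { uu = ones (suc m) ; u2 = [] ; ac′ = ones (a * suc m ^ k) ; rs = [] })
      pow-run s m zero    a m≤ le = cast (cong (λ x → toVec (record s { uu = ones (suc m) ; u2 = [] ; ac′ = ones x ; rs = [] })) (sym (*-identityʳ a))) act
      pow-run s m (suc k) a m≤ le = via (toVec (record s { uu = ones (suc m) ; u2 = [] ; ac′ = ones (a * suc m) ; rs = [] }))
        (mul-run s (suc m) a m≤ (≤-trans (m≤m*n a (suc m)) le₁) le₁)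
        (cast (cong (λ x → toVec (record s { uu = ones (suc m) ; u2 = [] ; ac′ = ones x ; rs = [] })) e) (pow-run s m k (a * suc m) m≤ le₂))
        where
        e : a * suc m * suc m ^ k ≡ a * suc m ^ suc k
        e = *-assoc a (suc m) (suc m ^ k)
        le₂ : a * suc m * suc m ^ k ≤ B
        le₂ = ≤-trans (≤-reflexive e) le
        -- An intermediate product is at most the final one, as the factors to come are positive.
        le₁ : a * suc m ≤ B
        le₁ = ≤-trans (≤-trans (≤-reflexive (sym (*-identityʳ (a * suc m)))) (*-monoʳ-≤ (a * suc m) (m^n>0 (suc m) k))) le₂

      seed-run : ∀ s c a → seedP c ⊢ toVec (record s { ac′ = ones a }) ⇒ toVec (record s { ac′ = ones (c + a) })
      seed-run s zero    a = act
      seed-run s (suc c) a = via (toVec (record s { ac′ = ones (suc a) })) act (cast (cong (λ x → toVec (record s { ac′ = ones x })) (+-suc c a)) (seed-run s c (suc a)))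

      pad-loop : ∀ s S X r → Loop (nonempty ac#) (put row# (cell void) ⨾ put rs# one ⨾ del ac#) S
        (toVec (record s { ac′ = ones S ; rs = ones r ; rowS = cells X })) (toVec (record s { ac′ = [] ; rs = ones (S + r) ; rowS = cells (replicate S void ++ X) }))
      pad-loop s zero    X r = stop refl
      pad-loop s (suc S) X r = more refl acts
        (Loop-cast (cong₂ (λ x y → toVec (record s { ac′ = [] ; rs = ones x ; rowS = cells y })) (+-suc S r) (replicate-∷ S void X)) (pad-loop s S (void ∷ X) (suc r)))

      pad-run : ∀ s S X → S ≤ B → padP ⊢ toVec (record s { ac′ = ones S ; rs = [] ; rowS = cells X }) ⇒ toVec (record s { ac′ = ones S ; rs = [] ; rowS = cells (replicate S void ++ X) })
      pad-run s S X le = via (toVec (record s { ac′ = [] ; rs = ones S ; rowS = cells (replicate S void ++ X) }))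
        (cast (cong (λ x → toVec (record s { ac′ = [] ; rs = ones x ; rowS = cells (replicate S void ++ X) })) (+-identityʳ S)) (while le (pad-loop s S X 0)))
        (cast (cong (λ x → toVec (record s { ac′ = x ; rs = [] ; rowS = cells (replicate S void ++ X) })) (ones-mv S)) (mv-run rs# ac# (λ ()) _ (length-ones le)))

      bits-loop : ∀ s xs X → Loop (nonempty rw#) (act (λ v → push row# (cell (plain (bitSym M (unbit (sym? (lookup v rw#))))))) ⨾ del rw#) (length xs)
        (toVec (record s { rw = bits′ xs ; rowS = cells X })) (toVec (record s { rw = [] ; rowS = cells (map (plain ∘ bitSym M) xs ʳ++ X) }))
      bits-loop s []       X = stop refl
      bits-loop s (b ∷ xs) X = more refl acts (bits-loop s xs (plain (bitSym M b) ∷ X))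

      bits-run : ∀ s xs X b w → reverse xs ≡ b ∷ w → length xs ≤ B →
        bitsP ⊢ toVec (record s { rw = bits′ xs ; rowS = cells X }) ⇒ toVec (record s { rw = [] ; rowS = cells (plain (bitSym M b) ∷ (map plain (map (bitSym M) w) ++ X)) })
      bits-run s xs X b w e le = cast (cong (λ x → toVec (record s { rw = [] ; rowS = cells x }))
          (trans (ʳ++-defn (map (plain ∘ bitSym M) xs)) (cong (_++ X) (trans (sym (reverse-map (plain ∘ bitSym M) xs)) (trans (cong (map (plain ∘ bitSym M)) e) (cong (plain (bitSym M b) ∷_) (map-∘ w)))))))
        (while le (bits-loop s xs X))

      head-run : ∀ s x X → headP ⊢ toVec (record s { rowS = cells (plain x ∷ X) ; row2 = [] }) ⇒ toVec (record s { rowS = cells (head q₀ x ∷ X) ; row2 = [] })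
      head-run s x X = acts

      build-run : ∀ s w S → length w ≤ B → S ≤ B → buildP ⊢ toVec (record s { rw = bits′ (reverse w) ; ac′ = ones S ; rs = [] ; rowS = [] ; row2 = [] })
        ⇒ toVec (record s { rw = [] ; ac′ = ones S ; rs = [] ; rowS = cells (startRow w S) ; row2 = [] })
      build-run s w S w≤ S≤ = via (toVec (record s { rw = bits′ (reverse w) ; ac′ = ones S ; rs = [] ; rowS = cells (wall ∷ []) ; row2 = [] })) act
        (via (toVec (record s { rw = bits′ (reverse w) ; ac′ = ones S ; rs = [] ; rowS = cells X ; row2 = [] })) (pad-run (record s { rw = bits′ (reverse w) ; row2 = [] }) S (wall ∷ []) S≤)
        (via (toVec (record s { rw = [] ; ac′ = ones S ; rs = [] ; rowS = cells (middle w) ; row2 = [] })) (place w (reverse w) (reverse-involutive w) (≤-trans (≤-reflexive (length-reverse w)) w≤))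
        (cast (cong (λ x → toVec (record s { rw = [] ; ac′ = ones S ; rs = [] ; rowS = cells x ; row2 = [] })) (whole-row w)) (pad-run (record s { rw = [] ; row2 = [] }) S (middle w) S≤))))
        where
        X = replicate S void ++ wall ∷ []
        s′ = record s { ac′ = ones S ; rs = [] }
        middle : List Bool → List Cell
        middle w = head q₀ (Config.hd (initCfg M w)) ∷ (map plain (Config.rgt (initCfg M w)) ++ X)
        whole-row : ∀ w → replicate S void ++ middle w ≡ startRow w S
        whole-row []      = sym (row-padded S q₀ (blank M) [])
        whole-row (b ∷ w) = sym (row-padded S q₀ (bitSym M b) (map (bitSym M) w))
        place : ∀ w xs → reverse xs ≡ w → length xs ≤ B → ifte (nonempty rw#) (bitsP ⨾ headP) (put row# (cell (head q₀ (blank M))))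
          ⊢ toVec (record s′ { rw = bits′ xs ; rowS = cells X ; row2 = [] }) ⇒ toVec (record s′ { rw = [] ; rowS = cells (middle w) ; row2 = [] })
        place []      []       e le = else′ refl act
        place (b ∷ w) (x ∷ xs) e le = then′ refl (via (toVec (record s′ { rw = [] ; rowS = cells (plain (bitSym M b) ∷ (map plain (map (bitSym M) w) ++ X)) ; row2 = [] }))
          (bits-run (record s′ { row2 = [] }) (x ∷ xs) X b w e le) (head-run (record s′ { rw = [] }) (bitSym M b) (map plain (map (bitSym M) w) ++ X)))
        place []      (x ∷ xs) e le = ⊥-elim (1+n≢0 (trans (sym (length-reverse (x ∷ xs))) (cong length e)))
        place (b ∷ w) []       () le

-- Every problem in polynomial space reduces to the theory

module Hardness where

  open import Defs hiding (Language; step)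
  open FiniteTypes
  open StackPrograms
  open Compilation
  open UniversalStructure using (Letter; Label; C; module Histories)
  open Simulation
  open Acceptance
  open RewritingSystem
  open AtomOutput
  open SentenceOutput
  open RowOutput
  open import Data.Nat using (ℕ; zero; suc; _+_; _*_; _∸_; _≤_; z≤n; s≤s)
  open import Data.Nat.Properties
  open import Data.Fin using () renaming (zero to fz; suc to fs)
  open import Data.Bool using (Bool; false)
  open import Data.Maybe using (Maybe)
  open import Data.List using (List; []; _∷_; length; _++_; map; reverse)
  open import Data.List.Properties using (length-map; length-++; length-replicate; length-reverse; map-∘; map-id)
  open import Data.List.Relation.Unary.Any using (there)
  open import Data.Vec using ([]; _∷_)
  open import Data.Vec.Properties using (lookup-replicate)
  open import Data.Product using (∃; _,_; proj₁; proj₂)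
  open import Data.Sum using (inj₁; inj₂)
  open import Function using (_∘_)
  open import Function.Bundles using (_⇔_; mk⇔; Equivalence)
  open import Relation.Binary.PropositionalEquality

  module Reductions (finLetter : Finite (Maybe Letter)) (finLabel : Finite Label) (finC : Finite C) where

    open Histories finLetter finLabel finC using (sentence; sentence-sound; sentence-complete; 𝒜; encSentence-injective)

    module _ (M : TM) (c : ℕ) where

      open Reducer finLetter finLabel finC M
      open Reduction finLetter finLabel finC M
      open Transducer finLetter finLabel finC M
      open TM M using () renaming (start to q₀)
      open Machine M hiding (idle; first; second)
      open Tape M using (row; blanks; rowK; length-rowK; Rep; rep; step-halt)
      open Rewriting M using (free; keysOf; triples; every; module Labels; module Labels′; module Complete)

      -- The first row needs a rule as well. All rules occur again in `triples`, so any choice will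
      -- do.
      τ₀ : Triple
      τ₀ = q₀ , blank M , blank M

      room : List Bool → ℕ
      room w = polyBound c (length w)

      open module Labs (w : List Bool) = Labels τ₀ triples (startRow w (room w)) using (labs₁; labs₂)

      reduction : List Bool → List Bool
      reduction w = encSentence (sentence (labs₁ w) (labs₂ w))

      reductionP : Prog
      reductionP = inputP ⨾ seedP c ⨾ powP c ⨾ buildP ⨾ sentenceP τ₀ triples

      cells-bound bound : ℕ → ℕ
      cells-bound n = polyBound c n + suc (n + polyBound c n + 1)
      bound n = cells-bound n + suc (length triples) * (cells-bound n * width) + polyBound c n + suc n

      bound-poly : Poly bound
      bound-poly = poly-+ (poly-+ (poly-+ cp (poly-* (poly-const (suc (length triples))) (poly-* cp (poly-const width)))) sp) (poly-+ (poly-const 1) poly-id)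
        where
        sp : Poly (polyBound c)
        sp = c , λ _ → ≤-refl
        cp : Poly cells-bound
        cp = poly-+ sp (poly-+ (poly-const 1) (poly-+ (poly-+ poly-id sp) (poly-const 1)))

      length-row : ∀ l q h r → length (row l q h r) ≡ length l + suc (length r + 1)
      length-row l q h r = trans (length-++ (map plain (reverse l))) (cong₂ (λ x y → x + suc y) (trans (length-map plain (reverse l)) (length-reverse l))
        (trans (length-++ (map plain r)) (cong (_+ 1) (length-map plain r))))

      length-padded : ∀ q h r S → length (row (blanks S) q h (r ++ blanks S)) ≡ S + suc (length r + S + 1)
      length-padded q h r S = trans (length-row (blanks S) q h (r ++ blanks S))
        (cong₂ (λ x y → x + suc (y + 1)) (length-replicate S) (trans (length-++ r) (cong (length r +_) (length-replicate S))))

      length-startRow : ∀ w S → length (startRow w S) ≤ S + suc (length w + S + 1)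
      length-startRow []      S = ≤-reflexive (length-padded q₀ (blank M) [] S)
      length-startRow (b ∷ w) S = ≤-trans (≤-reflexive (trans (length-padded q₀ (bitSym M b) (map (bitSym M) w) S) (cong (λ x → S + suc (x + S + 1)) (length-map (bitSym M) w))))
        (+-monoʳ-≤ S (n≤1+n _))

      length-keysOf : ∀ n τs → length (keysOf n τs) ≡ length τs * (n * width)
      length-keysOf n []       = refl
      length-keysOf n (τ ∷ τs) = trans (length-++ (rowK (rule τ) n)) (cong₂ _+_ (length-rowK (rule τ) n) (length-keysOf n τs))

      labels-bound : ∀ w → length (labs₂ w) + (length (labs₁ w) + 0) ≤ suc (length triples) * (cells-bound (length w) * width)
      labels-bound w = ≤-trans (≤-reflexive (trans (cong₂ _+_ (trans (length-map free (keysOf n triples)) (length-keysOf n triples)) (trans (+-identityʳ _) (Labels.length-labs₁ τ₀ triples cs)))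
          (+-comm (length triples * (n * width)) (n * width))))
        (*-monoʳ-≤ (suc (length triples)) (*-monoˡ-≤ width (length-startRow w (room w))))
        where
        cs = startRow w (room w)
        n = length cs

      s₀ : St
      s₀ = record { out = [] ; uu = [] ; u2 = [] ; ac′ = [] ; rs = [] ; rw = [] ; rowS = [] ; row2 = [] ; ct = [] ; c2 = [] }

      module _ (w : List Bool) where

        private
          n = length w
          B = bound n
          S = room w
          cs = startRow w S

        open Language.Loops 9 Sy B

        reduction-run : ∃ λ s → reductionP ⊢ toVec (record s₀ { out = bits′ w }) ⇒ toVec (record s { out = bits′ (reduction w) })
        reduction-run = record s₀ { uu = ones (suc n) ; ac′ = ones S ; rowS = cells cs ; ct = ones (length (labs₂ w) + (length (labs₁ w) + 0)) } , via (toVec (record s₀ { uu = ones (suc n) ; rw = bits′ (reverse w) })) (input-run B s₀ w (≤-trans (n≤1+n n) n<))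
          (via (toVec (record s₀ { uu = ones (suc n) ; rw = bits′ (reverse w) ; ac′ = ones c }))
            (cast (cong (λ x → toVec (record s₀ { uu = ones (suc n) ; rw = bits′ (reverse w) ; ac′ = ones x })) (+-identityʳ c)) (seed-run B (record s₀ { uu = ones (suc n) ; rw = bits′ (reverse w) }) c 0))
          (via (toVec (record s₀ { uu = ones (suc n) ; rw = bits′ (reverse w) ; ac′ = ones S })) (pow-run B (record s₀ { rw = bits′ (reverse w) }) n c c n< S≤)
          (via (toVec (record s₀ { uu = ones (suc n) ; ac′ = ones S ; rowS = cells cs })) (build-run B (record s₀ { uu = ones (suc n) }) w S (≤-trans (n≤1+n n) n<) S≤)
            (sentence-run τ₀ triples cs B (≤-trans (length-startRow w S) cs≤) (≤-trans (labels-bound w) ls≤) (record s₀ { uu = ones (suc n) ; ac′ = ones S })))))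
          where
          n< : suc n ≤ B
          n< = m≤n+m (suc n) _
          S≤ : S ≤ B
          S≤ = ≤-trans (m≤n+m S _) (m≤m+n _ (suc n))
          ls≤ : suc (length triples) * (cells-bound n * width) ≤ B
          ls≤ = ≤-trans (≤-trans (m≤n+m _ (cells-bound n)) (m≤m+n _ S)) (m≤m+n _ (suc n))
          cs≤ : cells-bound n ≤ B
          cs≤ = ≤-trans (≤-trans (m≤m+n _ _) (m≤m+n _ S)) (m≤m+n _ (suc n))

        reduction-exec : ∃ λ s → Exec (Height≤ (n + cost reductionP B)) reductionP (toVec (record s₀ { out = bits′ w })) (toVec (record s { out = bits′ (reduction w) })) (cost reductionP B)
        reduction-exec = proj₁ reduction-run , bounded (timed (proj₂ reduction-run)) (height (λ
          { fz → ≤-reflexive (length-map bit w)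
          ; (fs j) → subst (λ l → length l ≤ n) (sym (lookup-replicate j [])) z≤n })) ≤-refl

      reduction-polytime : PolyTimeComputable reduction
      reduction-polytime = Compiler.Impl.tm machine , proj₁ time-poly , λ w →
        let (s , x) = reduction-exec w
            (T , T≤ , h , _ , _ , o) = Compiler.Sim.simulate 9 finSy bit unbit reductionP (λ _ → false) machine {w = w} x (m≤m+n (length w) _)
        in T , ≤-trans T≤ (proj₂ time-poly (length w)) , h , trans o (unbit-bits (reduction w))
        where
        machine = Compiler.impl 9 finSy bit unbit reductionP (λ _ → false)
        unbit-bits : ∀ w → map unbit (bits′ w) ≡ w
        unbit-bits w = trans (sym (map-∘ w)) (map-id w)
        steps : ℕ → ℕ
        steps n = cost reductionP (bound n)
        steps-poly : Poly steps
        steps-poly = cost-poly reductionP bound-poly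
        time-poly : Poly (λ n → suc (suc (steps n) * (3 + (n + steps n) * 2)))
        time-poly = poly-+ (poly-const 1) (poly-* (poly-+ (poly-const 1) steps-poly) (poly-+ (poly-const 3) (poly-* (poly-+ poly-id steps-poly) (poly-const 2))))

      halted-stays : ∀ w t k → halted M (run M w t) → run M w (k + t) ≡ run M w t
      halted-stays w t zero    h = refl
      halted-stays w t (suc k) h rewrite halted-stays w t k h = step-halt _ _ _ _ h

      -- A history may reach its halting configuration at another time than the one given with the
      -- machine; since a halted machine stays put, the verdict is the same.
      halted-unique : ∀ w t t′ → halted M (run M w t) → halted M (run M w t′) → run M w t ≡ run M w t′
      halted-unique w t t′ h h′ with ≤-total t t′
      ... | inj₁ le = trans (sym (halted-stays w t (t′ ∸ t) h)) (cong (run M w) (m∸n+n≡m le))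
      ... | inj₂ le = trans (cong (run M w) (sym (m∸n+n≡m le))) (halted-stays w t′ (t ∸ t′) h′)

      start-rep : ∀ w S R → R ≤ S + space M (initCfg M w) → Rep R (initCfg M w) (Config.lft (initCfg M w) ++ blanks S) (Config.state (initCfg M w)) (Config.hd (initCfg M w)) (Config.rgt (initCfg M w) ++ blanks S)
      start-rep w S R le = rep S S refl refl refl refl le le

      row-nonempty : ∀ w → length (startRow w (room w)) * width ≢ 0
      row-nonempty w e with m*n≡0⇒m≡0∨n≡0 (length (startRow w (room w))) e
      ... | inj₂ e′ = width≢0 e′
      ... | inj₁ e′ = 1+n≢0 (trans (sym (+-suc _ _)) (trans (sym (length-row (Config.lft (initCfg M w) ++ blanks (room w)) (Config.state (initCfg M w)) (Config.hd (initCfg M w)) (Config.rgt (initCfg M w) ++ blanks (room w)))) e′))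

      module _ (L : Defs.Language) (w : List Bool) (t : ℕ) (h : halted M (run M w t))
               (sp : ∀ t′ → t′ ≤ t → space M (run M w t′) ≤ room w) (iff : accepted M (run M w t) ⇔ L w) where

        reduction-complete : L w → Σ₁Theory 𝒜 (reduction w)
        reduction-complete Lw = sentence (labs₁ w) (labs₂ w) , refl , sentence-complete (labs₁ w) (labs₂ w) (proj₁ sol) (proj₂ sol)
          where
          eq₀ : t + 0 ≡ t
          eq₀ = +-identityʳ t
          rows = Complete.run-rows w (room w) (τ₀ ∷ triples) (there ∘ every) t 0 _ _ _ _
            (λ t′ le → sp t′ (≤-trans le (≤-reflexive eq₀)))
            (subst (λ k → halted M (run M w k)) (sym eq₀) h) (subst (λ k → accepted M (run M w k)) (sym eq₀) (Equivalence.from iff Lw))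
            -- The initial configuration has at least one cell, which together with `room w` blanks
            -- on a side makes the room `suc (room w)`.
            (start-rep w (room w) (suc (room w)) (≤-trans (≤-reflexive (sym (+-comm (room w) 1))) (+-monoʳ-≤ (room w) (≤-trans (s≤s z≤n) (m≤n+m _ (length (Config.lft (initCfg M w))))))))
          sol = Labels′.solution-complete τ₀ triples (startRow w (room w)) {k = t} (proj₂ rows)

        reduction-sound : Σ₁Theory 𝒜 (reduction w) → L w
        reduction-sound (s , e , holds) =
          let (body , sol) = sentence-sound (labs₁ w) (labs₂ w) (subst (Holds 𝒜) (encSentence-injective s (sentence (labs₁ w) (labs₂ w)) e) holds)
              (t′ , h′ , a′) = Labels.solution-sound τ₀ triples (startRow w (room w)) w refl (start-rep w (room w) 0 z≤n) (row-nonempty w) sol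
          in Equivalence.to iff (trans (cong (λ cf → TM.accepting M (Config.state cf)) (halted-unique w t t′ h h′)) a′)

    theory-hard : PSPACEHard (Σ₁Theory 𝒜)
    theory-hard L (M , c , dec) = reduction M c , reduction-polytime M c , λ w →
      let (t , h , sp , iff) = dec w
      in mk⇔ (reduction-complete M c L w t h sp iff) (reduction-sound M c L w t h sp iff)

-- Assembling the theorem

open import Defs
open FiniteTypes
open DeciderTheorem
open Hardness
open UniversalStructure using (Letter; Label; C; module Histories; letterFin; labelFin; scanFin)
open import Data.Maybe using (Maybe)
open import Data.Product using (Σ; _×_; _,_)
open import Relation.Binary.PropositionalEquality using (refl)

module Assembly (finLetter : Finite (Maybe Letter)) (finLabel : Finite Label) (finC : Finite C) where

  open Histories finLetter finLabel finC

  assembled : IsValidPresentation P × BoundedDegree (presented P) × LinearGrowth (presented P) × PSPACEComplete (Σ₁Theory (presented P))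
  assembled = valid , bounded-degree , linear-growth ,
    Membership.theory∈PSPACE γ (size finQ) (size finLabel) q₀ δ final (λ _ → refl) ,
    Reductions.theory-hard finLetter finLabel finC

theorem9 : Σ Signature λ σ → Σ (AutomaticPresentation σ) λ P →
             IsValidPresentation P
           × BoundedDegree (presented P)
           × LinearGrowth (presented P)
           × PSPACEComplete (Σ₁Theory (presented P))
theorem9 = Histories.σ letterFin labelFin scanFin , Histories.P letterFin labelFin scanFin , Assembly.assembled letterFin labelFin scanFin
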